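{- Let $n\ge 1$. Then: (i) the Frobenius character of the $\mathfrak{S}_n$-module $\mathbb{C}[\mathrm{OShPf}(n)]$ (with the action described in the context) is $SH_n$; (ii) $SH_n=\sum_{(p,\overline{\sigma},\tau)} V_{\lambda(p)}$, where the sum runs over all sorted odd shifted parking functions $(p,\overline{\sigma},\tau)$ of size $n$.
   Context: Parking functions. A parking function of size $n$ is an $n$-tuple $p=(p_1,\dots,p_n)$ of positive integers such that for each $i\in[n]=\{1,\dots,n\}$ the $i$-th smallest entry of $p$ (counted with multiplicity) is at most $i$; $\mathrm{Pf}(n)$ is the set of these. $\mathtt{sort}(p)$ denotes the weakly increasing rearrangement of $p$; $p$ is sorted if $p=\mathtt{sort}(p)$. The content of $p$ is $(\alpha_1(p),\dots,\alpha_n(p))$ with $\alpha_k(p)=\#\{j:p_j=k\}$, and the shape $\lambda(p)$ is the partition whose parts are the nonzero $\alpha_k(p)$ in weakly decreasing order. A partition is odd if all its parts are odd. Symmetric functions. $\mathrm{Sym}$ is the ring of symmetric functions with power sums $p_k$, complete homogeneous $h_k$ and elementary $e_k$ ($h_0=e_0=1$). Put $P_0=1$, $P_k=\frac12\sum_{i=0}^k h_ie_{k-i}$ for $k\ge1$, and $V_\lambda=\prod_i P_{\lambda_i}$ for a partition $\lambda$. Shiftification $\mathtt{sh}:\mathrm{Sym}\to\mathrm{Sym}$ is the algebra homomorphism with $\mathtt{sh}(p_{2k-1})=2p_{2k-1}$ and $\mathtt{sh}(p_{2k})=0$ for $k\ge1$. $PF_n=\sum_{p} h_{\lambda(p)}$,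 summed over sorted $p\in\mathrm{Pf}(n)$ (equivalently, the Frobenius character of the permutation module $\mathbb{C}[\mathrm{Pf}(n)]$), and $SH_n=\mathtt{sh}(PF_n)$. The Frobenius character of a finite-dimensional $\mathfrak{S}_n$-module with character $\chi$ is $\sum_{\lambda\vdash n} z_\lambda^{ -1}\chi(\pi_\lambda)p_\lambda$, with $\pi_\lambda$ of cycle type $\lambda$ and $z_\lambda$ the order of its centralizer. Odd shifted parking functions. For $p\in\mathrm{Pf}(n)$ and $\sigma\in\{ -1,1\}^n$ define $\overline{\sigma}\in\{ -1,0,1\}^n$ by $\overline{\sigma}_k=\prod_{i:\,p_i=k}\sigma_i$ if $\alpha_k(p)>0$ and $\overline{\sigma}_k=0$ if $\alpha_k(p)=0$. An odd shifted parking function of size $n$ is a triple $(p,\sigma,\tau)$ where $p\in\mathrm{Pf}(n)$ has odd shape, $\sigma\in\{ -1,1\}^n$, and $\tau$ is a non-crossing partial matching of the set of integers appearing in $p$ (a set of pairs $(a,b)$ with $a<b$, both values of $p$, each value in at most one pair, and no two pairs $(a,c),(b,d)\in\tau$ with $a<b<c<d$), such that: (1) if $(a,b)\in\tau$ then $\overline{\sigma}_a=-\overline{\sigma}_b$; (2) if $(a,c)\in\tau$ and $a<b<c$ then $b$ appears in $p$; (3) if $(a,d),(b,c)\in\tau$ with $a<b<c<d$ then $\overline{\sigma}_a=\overline{\sigma}_b$. $\mathrm{OShPf}(n)$ is the set of these. Its sort is $\mathtt{sort}(p,\sigma,\tau)=(\mathtt{sort}(p),\overline{\sigma},\tau)$,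 and a sorted odd shifted parking function of size $n$ is any triple of the form $\mathtt{sort}(p,\sigma,\tau)$ with $(p,\sigma,\tau)\in\mathrm{OShPf}(n)$. Action. $\mathbb{C}[\mathrm{OShPf}(n)]$ is the vector space with basis $\mathrm{OShPf}(n)$. For $w\in\mathfrak{S}_n$ and an $n$-tuple $a$, let $w\cdot a$ be the tuple whose entry in position $w(i)$ is $a_i$. For $(p,\sigma,\tau)\in\mathrm{OShPf}(n)$ let $i_1<\dots<i_k$ be the positions with $\sigma_i=-1$, and define $w\cdot(p,\sigma,\tau)=\varepsilon\,(w\cdot p,w\cdot\sigma,\tau)$, where $\varepsilon\in\{\pm1\}$ is the sign of the permutation sorting $(w(i_1),\dots,w(i_k))$ into increasing order; equivalently this is the action transported from $\mathbb{C}[\mathrm{Pf}(n)]\otimes\bigwedge(\mathbb{C}^n)$ (with $\mathfrak{S}_n$ permuting the basis $\beta_1,\dots,\beta_n$ of $\mathbb{C}^n$) via $(p,\sigma,\tau)\mapsto p\otimes\beta_{i_1}\wedge\cdots\wedge\beta_{i_k}$ for each fixed $\tau$. -}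

module Defs where

open import Data.Bool using (Bool; true; false; if_then_else_; _∧_; _∨_; not)
open import Data.Nat as ℕ using (ℕ; zero; suc; _≡ᵇ_; _<ᵇ_; _≤ᵇ_; _∸_; _^_; _!)
open import Data.Integer as ℤ using (ℤ; +_; -[1+_])
open import Data.Rational as ℚ using (ℚ; 0ℚ; 1ℚ)
open import Data.List using (List; []; _∷_; _++_; map; foldr; concatMap; filterᵇ; length; deduplicate; upTo; zip)
open import Data.Bool.ListAction using (all; any)
open import Data.Nat.ListAction using (sum)
open import Data.Product using (_×_; _,_; proj₁; proj₂)
import Data.Product.Properties as ×P
import Data.List.Properties as LP
open import Relation.Nullary using (does)
open import Relation.Binary.PropositionalEquality using (_≡_)
open import Relation.Binary.Definitions using (DecidableEquality)

range : ℕ → ℕ → List ℕ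
range a b = map (a ℕ.+_) (upTo (suc b ∸ a))

at : {A : Set} → A → List A → ℕ → A
at d []       _       = d
at d (x ∷ xs) zero    = x
at d (x ∷ xs) (suc i) = at d xs i

tuples : {A : Set} → List A → ℕ → List (List A)
tuples xs zero    = [] ∷ []
tuples xs (suc k) = concatMap (λ x → map (x ∷_) (tuples xs k)) xs

sublists : {A : Set} → List A → List (List A)
sublists []       = [] ∷ []
sublists (x ∷ xs) = let r = sublists xs in map (x ∷_) r ++ r

count : ℕ → List ℕ → ℕ
count k xs = length (filterᵇ (_≡ᵇ_ k) xs)

insertInc : ℕ → List ℕ → List ℕ
insertInc x []       = x ∷ []
insertInc x (y ∷ ys) = if x ℕ.≤ᵇ y then x ∷ y ∷ ys else y ∷ insertInc x ys

sortInc : List ℕ → List ℕ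
sortInc = foldr insertInc []

insertDec : ℕ → List ℕ → List ℕ
insertDec x []       = x ∷ []
insertDec x (y ∷ ys) = if y ℕ.≤ᵇ x then x ∷ y ∷ ys else y ∷ insertDec x ys

sortDec : List ℕ → List ℕ
sortDec = foldr insertDec []

eqListℕ : List ℕ → List ℕ → Bool
eqListℕ []       []       = true
eqListℕ (x ∷ xs) (y ∷ ys) = (x ≡ᵇ y) ∧ eqListℕ xs ys
eqListℕ _        _        = false

odd : ℕ → Bool
odd zero          = false
odd (suc zero)    = true
odd (suc (suc n)) = odd n

-- 1/k for k ≥ 1 (the value at 0 is never used)
inv : ℕ → ℚ
inv zero    = 0ℚ
inv (suc k) = ℤ.+ 1 ℚ./ suc k

ℤtoℚ : ℤ → ℚ
ℤtoℚ z = z ℚ./ 1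

ℕtoℚ : ℕ → ℚ
ℕtoℚ k = ℤtoℚ (ℤ.+ k)

sumℚ : List ℚ → ℚ
sumℚ = foldr ℚ._+_ 0ℚ

sumℤ : List ℤ → ℤ
sumℤ = foldr ℤ._+_ (ℤ.+ 0)

prodℤ : List ℤ → ℤ
prodℤ = foldr ℤ._*_ (ℤ.+ 1)

-- Symmetric functions (over ℚ), modelled in the power-sum basis:
-- Sym ≅ ℚ[p₁,p₂,…]; an element is a finite formal ℚ-linear combination
-- of power-sum products p_μ = p_{μ₁} p_{μ₂} ⋯ (μ a list of positive parts).

Sym : Set
Sym = List (List ℕ × ℚ)

coeff : Sym → List ℕ → ℚ
coeff f λ′ = sumℚ (map proj₂ (filterᵇ (λ t → eqListℕ (sortDec (proj₁ t)) (sortDec λ′)) f))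

_≈S_ : Sym → Sym → Set
f ≈S g = ∀ (λ′ : List ℕ) → coeff f λ′ ≡ coeff g λ′

infix 4 _≈S_

0S : Sym
0S = []

1S : Sym
1S = ([] , 1ℚ) ∷ []

_+S_ : Sym → Sym → Sym
_+S_ = _++_

_*S_ : Sym → Sym → Sym
f *S g = concatMap (λ s → map (λ t → (proj₁ s ++ proj₁ t , proj₂ s ℚ.* proj₂ t)) g) f

scaleS : ℚ → Sym → Sym
scaleS c = map (λ t → (proj₁ t , c ℚ.* proj₂ t))

sumS : List Sym → Sym
sumS = foldr _+S_ 0S

prodS : List Sym → Sym
prodS = foldr _*S_ 1S

pS : ℕ → Sym
pS k = (k ∷ [] , 1ℚ) ∷ []

pλ : List ℕ → Sym
pλ μ = (μ , 1ℚ) ∷ []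

-- Newton's identities: k h_k = Σ_{i=1}^k p_i h_{k-i},
--                      k e_k = Σ_{i=1}^k (-1)^{i-1} p_i e_{k-i}.
-- hList k = [h_k, h_{k-1}, …, h_0]
hList : ℕ → List Sym
hList zero    = 1S ∷ []
hList (suc k) =
  let prev = hList k in
  scaleS (inv (suc k))
    (sumS (map (λ ih → pS (suc (proj₁ ih)) *S proj₂ ih) (zip (upTo (suc k)) prev)))
  ∷ prev

sgnℚ : ℕ → ℚ
sgnℚ i = if odd i then ℚ.- 1ℚ else 1ℚ

eList : ℕ → List Sym
eList zero    = 1S ∷ []
eList (suc k) =
  let prev = eList k in
  scaleS (inv (suc k))
    (sumS (map (λ ie → scaleS (sgnℚ (proj₁ ie)) (pS (suc (proj₁ ie)) *S proj₂ ie))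
               (zip (upTo (suc k)) prev)))
  ∷ prev

headS : List Sym → Sym
headS []      = 0S
headS (x ∷ _) = x

hS : ℕ → Sym
hS k = headS (hList k)

eS : ℕ → Sym
eS k = headS (eList k)

hλ : List ℕ → Sym
hλ λ′ = prodS (map hS λ′)

PS : ℕ → Sym
PS zero    = 1S
PS (suc k) = scaleS (inv 2) (sumS (map (λ i → hS i *S eS (suc k ∸ i)) (range 0 (suc k))))

Vλ : List ℕ → Sym
Vλ λ′ = prodS (map PS λ′)

-- shiftification: the algebra map p_{2k-1} ↦ 2 p_{2k-1}, p_{2k} ↦ 0,
-- hence p_μ ↦ 2^{ℓ(μ)} p_μ if all parts of μ are odd, and 0 otherwise.
sh : Sym → Sym
sh = concatMap (λ t → if all odd (proj₁ t)
                        then (proj₁ t , ℕtoℚ (2 ^ length (proj₁ t)) ℚ.* proj₂ t) ∷ []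
                        else [])

partsF : ℕ → ℕ → ℕ → List (List ℕ)
partsF fuel    zero    m = [] ∷ []
partsF zero    (suc n) m = []
partsF (suc f) (suc n) m =
  concatMap (λ k → map (k ∷_) (partsF f (suc n ∸ k) k))
            (filterᵇ (λ k → k ℕ.≤ᵇ m) (range 1 (suc n)))

partitions : ℕ → List (List ℕ)
partitions n = partsF n n n

zλ : List ℕ → ℕ
zλ λ′ = foldr ℕ._*_ 1 (map (λ i → (i ^ count i λ′) ℕ.* (count i λ′) !) (range 1 (sum λ′)))

-- Parking functions (tuples are lists of length n, positions 0,…,n-1)

isPF : ℕ → List ℕ → Bool
isPF n p = (length p ≡ᵇ n) ∧ go 1 (sortInc p)
  where
  go : ℕ → List ℕ → Bool
  go i []       = true
  go i (x ∷ xs) = (1 ℕ.≤ᵇ x) ∧ (x ℕ.≤ᵇ i) ∧ go (suc i) xs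

-- Pf(n): candidates have entries in [1,n] (forced by the definition)
Pf : ℕ → List (List ℕ)
Pf n = filterᵇ (isPF n) (tuples (range 1 n) n)

α : List ℕ → ℕ → ℕ
α p k = count k p

-- shape λ(p) (values of a parking function of size n lie in [1,n])
shape : ℕ → List ℕ → List ℕ
shape n p = sortDec (filterᵇ (λ a → not (a ≡ᵇ 0)) (map (α p) (range 1 n)))

isSorted : List ℕ → Bool
isSorted p = eqListℕ p (sortInc p)

PFsym : ℕ → Sym
PFsym n = sumS (map (λ p → hλ (shape n p)) (filterᵇ isSorted (Pf n)))

SHsym : ℕ → Sym
SHsym n = sh (PFsym n)

-- Odd shifted parking functions
-- σ ∈ {-1,1}^n as a list of integers; σ̄ ∈ {-1,0,1}^n as a list indexed by
-- k = 1,…,n; τ as a list of pairs (a,b) with a < b.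

eqℤ : ℤ → ℤ → Bool
eqℤ x y = does (x ℤ.≟ y)

σbarAt : List ℕ → List ℤ → ℕ → ℤ
σbarAt p σ k =
  if α p k ≡ᵇ 0 then ℤ.+ 0
  else prodℤ (map proj₂ (filterᵇ (λ t → proj₁ t ≡ᵇ k) (zip p σ)))

σbar : ℕ → List ℕ → List ℤ → List ℤ
σbar n p σ = map (σbarAt p σ) (range 1 n)

Triple : Set
Triple = List ℕ × List ℤ × List (ℕ × ℕ)

appears : List ℕ → ℕ → Bool
appears p k = not (α p k ≡ᵇ 0)

noDup : List ℕ → Bool
noDup []       = true
noDup (x ∷ xs) = not (any (_≡ᵇ_ x) xs) ∧ noDup xs

endpoints : List (ℕ × ℕ) → List ℕ
endpoints = concatMap (λ ab → proj₁ ab ∷ proj₂ ab ∷ [])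

validτ : List ℕ → List ℤ → List (ℕ × ℕ) → Bool
validτ p σ τ =
  all (λ ab → (proj₁ ab <ᵇ proj₂ ab) ∧ appears p (proj₁ ab) ∧ appears p (proj₂ ab)) τ
  ∧ noDup (endpoints τ)
  ∧ all (λ ab → eqℤ (sb (proj₁ ab)) (ℤ.- sb (proj₂ ab))) τ
  ∧ all (λ ac → all (λ b → if (proj₁ ac <ᵇ b) ∧ (b <ᵇ proj₂ ac) then appears p b else true)
                    (range 1 (proj₂ ac))) τ
  ∧ all (λ x → all (λ y → cond x y) τ) τ
  where
  sb : ℕ → ℤ
  sb = σbarAt p σ
  cond : ℕ × ℕ → ℕ × ℕ → Bool
  cond (a , c) (b , d) =
    not ((a <ᵇ b) ∧ (b <ᵇ c) ∧ (c <ᵇ d))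
    ∧ (if (a <ᵇ b) ∧ (b <ᵇ d) ∧ (d <ᵇ c) then eqℤ (sb a) (sb b) else true)

isOShPf : ℕ → Triple → Bool
isOShPf n (p , σ , τ) = isPF n p ∧ all odd (shape n p) ∧ (length σ ≡ᵇ n) ∧ validτ p σ τ

allPairs : ℕ → List (ℕ × ℕ)
allPairs n = concatMap (λ a → map (a ,_) (range (suc a) n)) (range 1 n)

signs : List ℤ
signs = ℤ.+ 1 ∷ ℤ.- (ℤ.+ 1) ∷ []

-- OShPf(n), as a duplicate-free list (each τ is listed in the canonical order
-- of allPairs, so distinct lists are distinct sets)
OShPf : ℕ → List Triple
OShPf n = filterᵇ (isOShPf n)
  (concatMap (λ p → concatMap (λ σ → map (λ τ → (p , σ , τ)) (sublists (allPairs n)))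
                               (tuples signs n))
             (Pf n))

_≟T_ : DecidableEquality Triple
_≟T_ = ×P.≡-dec (LP.≡-dec ℕ._≟_) (×P.≡-dec (LP.≡-dec ℤ._≟_) (LP.≡-dec (×P.≡-dec ℕ._≟_ ℕ._≟_)))

sortTriple : ℕ → Triple → Triple
sortTriple n (p , σ , τ) = (sortInc p , σbar n p σ , τ)

SortedOShPf : ℕ → List Triple
SortedOShPf n = deduplicate _≟T_ (map (sortTriple n) (OShPf n))

-- The action of 𝔖ₙ on ℂ[OShPf(n)]
-- A permutation w of positions {0,…,n-1} is given as a function ℕ → ℕ.

preimage : (ℕ → ℕ) → ℕ → ℕ → ℕ
preimage w n j = go (upTo n)
  where
  go : List ℕ → ℕ
  go []       = 0
  go (i ∷ is) = if w i ≡ᵇ j then i else go is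

-- w·a : the entry in position w(i) is a_i
actTuple : {A : Set} → A → (ℕ → ℕ) → ℕ → List A → List A
actTuple d w n a = map (λ j → at d a (preimage w n j)) (upTo n)

inversions : List ℕ → ℕ
inversions []       = 0
inversions (x ∷ xs) = length (filterᵇ (λ y → y <ᵇ x) xs) ℕ.+ inversions xs

sortSign : List ℕ → ℤ
sortSign xs = if odd (inversions xs) then ℤ.- (ℤ.+ 1) else ℤ.+ 1

negPositions : List ℤ → List ℕ
negPositions σ = map proj₁ (filterᵇ (λ t → eqℤ (proj₂ t) (ℤ.- (ℤ.+ 1))) (zip (upTo (length σ)) σ))

act : ℕ → (ℕ → ℕ) → Triple → ℤ × Triple
act n w (p , σ , τ) =
  ( sortSign (map w (negPositions σ))
  , (actTuple 0 w n p , actTuple (ℤ.+ 0) w n σ , τ) )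

-- character of ℂ[OShPf(n)] at w: trace of the (signed monomial) matrix of w
χOSh : ℕ → (ℕ → ℕ) → ℤ
χOSh n w = sumℤ (map (λ b → let r = act n w b in
                             if does (proj₂ r ≟T b) then proj₁ r else ℤ.+ 0)
                     (OShPf n))

-- a permutation π_λ of cycle type λ: consecutive blocks are cycles
-- (s, s+1, …, s+ℓ-1)
cycPerm : List ℕ → ℕ → ℕ
cycPerm λ′ i = go λ′ 0
  where
  go : List ℕ → ℕ → ℕ
  go []       s = i
  go (l ∷ ls) s = if i <ᵇ s ℕ.+ l
                  then (if suc i <ᵇ s ℕ.+ l then suc i else s)
                  else go ls (s ℕ.+ l)

FrobOSh : ℕ → Sym
FrobOSh n = sumS (map (λ λ′ → scaleS (ℤtoℚ (χOSh n (cycPerm λ′)) ℚ.* inv (zλ λ′)) (pλ λ′))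
                      (partitions n))

VSum : ℕ → Sym
VSum n = sumS (map (λ t → Vλ (shape n (proj₁ t))) (SortedOShPf n))

{-# OPTIONS --safe #-}
-- Pair a symmetric function f ∈ ℚ[p₁,p₂,…] with a list κ of parts by differentiating once with
-- respect to p_k for every k in κ and evaluating at 0.  A product is then paired by splitting κ in
-- all ways, and, up to the factor ∏ 1/k, h_m pairs to [|κ| = m] and q_m = 2 P_m to [|κ| = m] 2^ℓ(κ)
-- if all parts are odd and to 0 otherwise.  Hence SH_n at κ is a sum over Dyck paths in which the
-- parts of κ are distributed to n slots.  A basis element of ℂ[OShPf(n)] fixed by a permutation of
-- cycle type κ is a distribution of its cycles with a sign for each; the two signs of an even cycle
-- cancel, and what remains is the pairing of κ with the sum of the V_λ.
--
-- Reading the slots from left to right, the matchings τ are counted by the number e of open arcs.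
-- In the exponential variable y the slots have weights e^{2y} (for SH_n) and sinh(2y)/2 (for a slot
-- with a prescribed sign), and the count with e open arcs is the SH-count multiplied by tanh^e y:
-- with Z = tanh y and S = sinh(2y)/2 the two recursions agree because
--   e^{2y} = 1 + 2 S (1 + Z)   and   e^{2y} Z = S (1 + Z)².
module Submission where

open import Defs
open import Data.Nat as ℕ using (ℕ; zero; suc; _≤_; _<_; z≤n; s≤s; _∸_; _≡ᵇ_; _<ᵇ_; _≤ᵇ_; _^_; _!)
import Data.Nat.Properties as ℕP
open import Data.Nat.ListAction using (sum)
open import Data.Integer as ℤ using (ℤ)
import Data.Integer.Properties as ℤP
open import Data.Rational as ℚ using (ℚ; 0ℚ; 1ℚ)
import Data.Rational.Properties as ℚP
open import Data.Bool using (Bool; true; false; if_then_else_; _∧_; _∨_; not; T)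
import Data.Bool.Properties as BP
open import Data.Bool.ListAction using (all; any)
open import Data.List using (List; []; _∷_; _++_; map; foldr; concatMap; filterᵇ; length; upTo; zip; replicate; null)
import Data.List.Properties as LP
open import Data.List.Membership.Propositional using (_∈_; _∉_)
import Data.List.Membership.Propositional.Properties as ∈P
open import Data.List.Membership.Propositional.Properties.WithK using (unique∧set⇒bag)
open import Data.List.Relation.Unary.Any using (here; there)
open import Data.List.Relation.Unary.All as All using (All; []; _∷_)
import Data.List.Relation.Unary.All.Properties as AllP
open import Data.List.Relation.Unary.AllPairs using (AllPairs; []; _∷_)
open import Data.List.Relation.Unary.Unique.Propositional using (Unique)
import Data.List.Relation.Unary.Unique.Propositional.Properties as UP
import Data.List.Relation.Unary.Unique.DecPropositional.Properties as UDP
open import Data.List.Relation.Binary.BagAndSetEquality using (∼bag⇒↭)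
open import Data.List.Relation.Binary.Permutation.Propositional using (_↭_; ↭-refl; ↭-sym; ↭-trans; ↭-reflexive; prep; swap) renaming (refl to ↭refl; trans to ↭trans)
import Data.List.Relation.Binary.Permutation.Propositional.Properties as ↭P
open import Data.Product using (Σ; ∃; _×_; _,_; proj₁; proj₂)
open import Data.Sum using (_⊎_; inj₁; inj₂)
open import Data.Empty using (⊥; ⊥-elim)
open import Data.Unit using (tt)
open import Function using (_∘_; flip; mk⇔)
open import Level using (0ℓ)
open import Algebra.Bundles using (CommutativeRing)
open import Algebra.Structures using (IsCommutativeRing)
open import Relation.Nullary using (¬_; Dec; yes; no; does)
open import Relation.Nullary.Decidable using (dec⇒maybe; dec-true)
open import Relation.Binary.Definitions using (tri<; tri≈; tri>)
open import Relation.Binary.PropositionalEquality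
open import Tactic.RingSolver using (solve-∀)
open import Tactic.RingSolver.Core.AlmostCommutativeRing using (AlmostCommutativeRing; fromCommutativeRing)
open import Data.List.Membership.DecPropositional ℕ._≟_ using (_∈?_)
open import Data.Nat.Coprimality using (Coprime; 1-coprimeTo) renaming (sym to coprime-sym)
open import Data.Nat.Tactic.RingSolver using () renaming (solve-∀ to solveℕ-∀)
open import Data.Rational.Unnormalised using (mkℚᵘ; *≡*)
import Data.Rational.Unnormalised.Properties as U
open ≡-Reasoning

-- Simultaneously open arcs are nested because `τ` is non-crossing; condition (3) gives their left
-- endpoints a common sign, condition (2) excludes empty slots below them, and only the innermost
-- one can be closed. A sweep over the slots therefore has to remember just the number `e` of open
-- arcs and one sign. Suppose that `e` open arcs multiply the count by `Z^e`. Reading a slot with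
-- `e ≥ 1` then requires `exp(2y) Z^e = S Z^(e-1) (1 + Z)²`: a slot of either sign may stay
-- unmatched, one sign may close an arc, the other may open one. With `e = 0` the slot may also be
-- empty, and either sign may open an arc; this case alone determines `Z = tanh y`, and the other
-- one then holds.
--
-- A single variable `y` is enough because the weight of a list of odd parts depends only on its
-- length. The totals of the slots, which steer the Dyck path, do not interfere: every identity
-- between weights holds for each list of parts separately, so it may be applied inside a path.

private
  variable
    A B : Set

infixl 6 _+_ _-_
infixl 7 _*_
infix  8 -_

-- The operations of ℚ are made opaque so that unification treats them as rigid.
opaque
  _+_ _*_ : ℚ → ℚ → ℚ
  _+_ = ℚ._+_
  _*_ = ℚ._*_

  -_ : ℚ → ℚ
  -_ = ℚ.-_

  isCommutativeRing : IsCommutativeRing _≡_ _+_ _*_ -_ 0ℚ 1ℚ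
  isCommutativeRing = ℚP.+-*-isCommutativeRing

_-_ : ℚ → ℚ → ℚ
a - b = a + - b

ℚ-commutativeRing : CommutativeRing 0ℓ 0ℓ
ℚ-commutativeRing = record { isCommutativeRing = isCommutativeRing }

module R = CommutativeRing ℚ-commutativeRing

ℚ-ring : AlmostCommutativeRing 0ℓ 0ℓ
ℚ-ring = fromCommutativeRing ℚ-commutativeRing (λ x → dec⇒maybe (0ℚ ℚ.≟ x))

-- Indicators and Boolean reasoning

𝟙 : Bool → ℚ
𝟙 true  = 1ℚ
𝟙 false = 0ℚ

𝟙-∧ : ∀ a b → 𝟙 (a ∧ b) ≡ 𝟙 a * 𝟙 b
𝟙-∧ true  b = sym (R.*-identityˡ (𝟙 b))
𝟙-∧ false b = sym (R.zeroˡ (𝟙 b))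

Bool-ext : ∀ {a b} → (T a → T b) → (T b → T a) → a ≡ b
Bool-ext {true}  {true}  f g = refl
Bool-ext {true}  {false} f g = ⊥-elim (f tt)
Bool-ext {false} {true}  f g = ⊥-elim (g tt)
Bool-ext {false} {false} f g = refl

T⇒≡ : ∀ {b} → T b → b ≡ true
T⇒≡ {true} _ = refl

≡⇒T : ∀ {b} → b ≡ true → T b
≡⇒T refl = tt

¬T⇒≡ : ∀ {b} → ¬ T b → b ≡ false
¬T⇒≡ {true}  p = ⊥-elim (p tt)
¬T⇒≡ {false} p = refl

∧-intro : ∀ {a b} → T a → T b → T (a ∧ b)
∧-intro {true} {true} _ _ = tt

∧-fst : ∀ {a b} → T (a ∧ b) → T a
∧-fst {true} _ = tt

∧-snd : ∀ {a b} → T (a ∧ b) → T b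
∧-snd {true} p = p

T-all : ∀ (P : A → Bool) xs → T (all P xs) → ∀ {x} → x ∈ xs → T (P x)
T-all P (x ∷ xs) t (here refl) = ∧-fst t
T-all P (x ∷ xs) t (there m)   = T-all P xs (∧-snd {P x} t) m

all-T : ∀ (P : A → Bool) xs → (∀ {x} → x ∈ xs → T (P x)) → T (all P xs)
all-T P []       f = tt
all-T P (x ∷ xs) f = ∧-intro {P x} (f (here refl)) (all-T P xs (f ∘ there))

≡ᵇ-refl : ∀ n → (n ≡ᵇ n) ≡ true
≡ᵇ-refl n = T⇒≡ (ℕP.≡⇒≡ᵇ n n refl)

≡ᵇ-false : ∀ {m n} → m ≢ n → (m ≡ᵇ n) ≡ false
≡ᵇ-false {m} {n} m≢n = ¬T⇒≡ (m≢n ∘ ℕP.≡ᵇ⇒≡ m n)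

≡ᵇ-sym : ∀ m n → (m ≡ᵇ n) ≡ (n ≡ᵇ m)
≡ᵇ-sym m n = Bool-ext (λ t → ℕP.≡⇒≡ᵇ n m (sym (ℕP.≡ᵇ⇒≡ m n t))) (λ t → ℕP.≡⇒≡ᵇ m n (sym (ℕP.≡ᵇ⇒≡ n m t)))

-- Finite sums

∑ : List A → (A → ℚ) → ℚ
∑ []       f = 0ℚ
∑ (x ∷ xs) f = f x + ∑ xs f

∑-cong-∈ : ∀ (xs : List A) {f g : A → ℚ} → (∀ {x} → x ∈ xs → f x ≡ g x) → ∑ xs f ≡ ∑ xs g
∑-cong-∈ []       h = refl
∑-cong-∈ (x ∷ xs) h = cong₂ _+_ (h (here refl)) (∑-cong-∈ xs (h ∘ there))

∑-cong : ∀ (xs : List A) {f g : A → ℚ} → (∀ x → f x ≡ g x) → ∑ xs f ≡ ∑ xs g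
∑-cong xs h = ∑-cong-∈ xs (λ {x} _ → h x)

∑-zero : ∀ (xs : List A) → ∑ xs (λ _ → 0ℚ) ≡ 0ℚ
∑-zero []       = refl
∑-zero (x ∷ xs) = trans (R.+-identityˡ _) (∑-zero xs)

∑-zero-∈ : ∀ (xs : List A) {f : A → ℚ} → (∀ {x} → x ∈ xs → f x ≡ 0ℚ) → ∑ xs f ≡ 0ℚ
∑-zero-∈ xs h = trans (∑-cong-∈ xs h) (∑-zero xs)

∑-++ : ∀ (xs ys : List A) {f : A → ℚ} → ∑ (xs ++ ys) f ≡ ∑ xs f + ∑ ys f
∑-++ []       ys {f} = sym (R.+-identityˡ (∑ ys f))
∑-++ (x ∷ xs) ys {f} = trans (cong (_ +_) (∑-++ xs ys)) (sym (R.+-assoc (f x) _ _))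

∑-map : ∀ (g : A → B) (xs : List A) {f : B → ℚ} → ∑ (map g xs) f ≡ ∑ xs (f ∘ g)
∑-map g []       = refl
∑-map g (x ∷ xs) = cong (_ +_) (∑-map g xs)

∑-concatMap : ∀ (g : A → List B) (xs : List A) {f : B → ℚ} →
  ∑ (concatMap g xs) f ≡ ∑ xs (λ x → ∑ (g x) f)
∑-concatMap g []       = refl
∑-concatMap g (x ∷ xs) = trans (∑-++ (g x) (concatMap g xs)) (cong (_ +_) (∑-concatMap g xs))

∑-+ : ∀ (xs : List A) {f g : A → ℚ} → ∑ xs (λ x → f x + g x) ≡ ∑ xs f + ∑ xs g
∑-+ []               = sym (R.+-identityˡ 0ℚ)
∑-+ (x ∷ xs) {f} {g} = trans (cong (_ +_) (∑-+ xs)) (lemma (f x) (g x) (∑ xs f) (∑ xs g))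
  where
  lemma : ∀ a b c d → a + b + (c + d) ≡ a + c + (b + d)
  lemma = solve-∀ ℚ-ring

∑-*ˡ : ∀ c (xs : List A) {f : A → ℚ} → ∑ xs (λ x → c * f x) ≡ c * ∑ xs f
∑-*ˡ c []       = sym (R.zeroʳ c)
∑-*ˡ c (x ∷ xs) = trans (cong (_ +_) (∑-*ˡ c xs)) (sym (R.distribˡ c _ _))

∑-*ʳ : ∀ c (xs : List A) {f : A → ℚ} → ∑ xs (λ x → f x * c) ≡ ∑ xs f * c
∑-*ʳ c xs {f} = trans (∑-cong xs (λ x → R.*-comm (f x) c)) (trans (∑-*ˡ c xs) (R.*-comm c _))

∑-swap : ∀ (xs : List A) (ys : List B) {f : A → B → ℚ} →
  ∑ xs (λ x → ∑ ys (f x)) ≡ ∑ ys (λ y → ∑ xs (λ x → f x y))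
∑-swap []       ys = sym (∑-zero ys)
∑-swap (x ∷ xs) ys = trans (cong (_ +_) (∑-swap xs ys)) (sym (∑-+ ys))

∑-filter : ∀ (P : A → Bool) (xs : List A) {f : A → ℚ} → ∑ (filterᵇ P xs) f ≡ ∑ xs (λ x → 𝟙 (P x) * f x)
∑-filter P []       = refl
∑-filter P (x ∷ xs) {f} with P x
... | true  = cong₂ _+_ (sym (R.*-identityˡ (f x))) (∑-filter P xs)
... | false = trans (∑-filter P xs) (sym (trans (cong (_+ _) (R.zeroˡ (f x))) (R.+-identityˡ _)))

∑-↭ : ∀ {xs ys : List A} → xs ↭ ys → ∀ {f : A → ℚ} → ∑ xs f ≡ ∑ ys f
∑-↭ ↭refl               = refl
∑-↭ (prep x p)          = cong (_ +_) (∑-↭ p)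
∑-↭ (swap x y p) {f}    = trans (cong (λ z → f x + (f y + z)) (∑-↭ p)) (lemma (f x) (f y) _)
  where
  lemma : ∀ a b c → a + (b + c) ≡ b + (a + c)
  lemma = solve-∀ ℚ-ring
∑-↭ (↭trans p q)        = trans (∑-↭ p) (∑-↭ q)

-- Duplicate-free lists with the same members are rearrangements of each other. The re-indexings by
-- sorted tuples, sorted triples and fixed tuples all go through this.
∑-set : ∀ {xs ys : List A} → Unique xs → Unique ys →
  (∀ {x} → x ∈ xs → x ∈ ys) → (∀ {x} → x ∈ ys → x ∈ xs) → ∀ {f : A → ℚ} → ∑ xs f ≡ ∑ ys f
∑-set u v f g = ∑-↭ (∼bag⇒↭ (unique∧set⇒bag u v (mk⇔ f g)))

∑-singleton : ∀ {xs : List A} {a} → Unique xs → a ∈ xs → ∀ {f : A → ℚ} →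
  (∀ {x} → x ∈ xs → x ≢ a → f x ≡ 0ℚ) → ∑ xs f ≡ f a
∑-singleton {xs = x ∷ xs} (x∉ ∷ u) (here refl) {f} h =
  trans (cong (f x +_) (∑-zero-∈ xs (λ m → h (there m) (λ e → All.lookup x∉ m (sym e))))) (R.+-identityʳ (f x))
∑-singleton {xs = x ∷ xs} (x∉ ∷ u) (there a∈) {f} h =
  trans (cong₂ _+_ (h (here refl) (All.lookup x∉ a∈)) (∑-singleton u a∈ (h ∘ there))) (R.+-identityˡ _)

∑-𝟙≡ : ∀ {xs : List ℕ} {a} → Unique xs → a ∈ xs → ∀ (f : ℕ → ℚ) → ∑ xs (λ k → 𝟙 (a ≡ᵇ k) * f k) ≡ f a
∑-𝟙≡ {a = a} u a∈ f = trans
  (∑-singleton u a∈ (λ {x} _ x≢a → trans (cong (λ b → 𝟙 b * f x) (≡ᵇ-false (x≢a ∘ sym))) (R.zeroˡ (f x))))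
  (trans (cong (λ b → 𝟙 b * f a) (≡ᵇ-refl a)) (R.*-identityˡ (f a)))

-- Enumerated lists: membership and absence of repetitions

filterᵇ-∈⁻ : ∀ (P : A → Bool) xs {x} → x ∈ filterᵇ P xs → x ∈ xs × T (P x)
filterᵇ-∈⁻ P xs = ∈P.∈-filter⁻ (BP.T? ∘ P)

filterᵇ-∈⁺ : ∀ (P : A → Bool) {xs x} → x ∈ xs → T (P x) → x ∈ filterᵇ P xs
filterᵇ-∈⁺ P = ∈P.∈-filter⁺ (BP.T? ∘ P)

filterᵇ-! : ∀ (P : A → Bool) {xs} → Unique xs → Unique (filterᵇ P xs)
filterᵇ-! P = UP.filter⁺ (BP.T? ∘ P)

concatMap-∈⁻ : ∀ (f : A → List B) xs {y} → y ∈ concatMap f xs → ∃ λ x → x ∈ xs × y ∈ f x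
concatMap-∈⁻ f (x ∷ xs) m with ∈P.∈-++⁻ (f x) m
... | inj₁ l = x , here refl , l
... | inj₂ r with concatMap-∈⁻ f xs r
...   | x′ , m′ , l = x′ , there m′ , l

concatMap-∈⁺ : ∀ (f : A → List B) {xs x y} → x ∈ xs → y ∈ f x → y ∈ concatMap f xs
concatMap-∈⁺ f {x ∷ xs} (here refl) l = ∈P.∈-++⁺ˡ l
concatMap-∈⁺ f {x ∷ xs} (there m)   l = ∈P.∈-++⁺ʳ (f x) (concatMap-∈⁺ f m l)

concatMap-! : ∀ (f : A → List B) {xs} → Unique xs → (∀ x → Unique (f x)) →
  (∀ {x y z} → z ∈ f x → z ∈ f y → x ≡ y) → Unique (concatMap f xs)
concatMap-! f {[]}     u h k = []
concatMap-! f {x ∷ xs} (x∉ ∷ u) h k = UP.++⁺ (h x) (concatMap-! f u h k) disj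
  where
  disj : ∀ {z} → z ∈ f x × z ∈ concatMap f xs → ⊥
  disj (l , r) with concatMap-∈⁻ f xs r
  ... | x′ , m , l′ = All.lookup x∉ m (k l l′)

tuples-∈⁻ : ∀ (xs : List A) k {t} → t ∈ tuples xs k → length t ≡ k × (∀ {x} → x ∈ t → x ∈ xs)
tuples-∈⁻ xs zero (here refl) = refl , λ ()
tuples-∈⁻ xs (suc k) m with concatMap-∈⁻ _ xs m
... | x , x∈ , l with ∈P.∈-map⁻ (x ∷_) l
...   | t , t∈ , refl with tuples-∈⁻ xs k t∈
...     | e , h = cong suc e , λ { (here refl) → x∈ ; (there m) → h m }

tuples-∈⁺ : ∀ (xs : List A) t → (∀ {x} → x ∈ t → x ∈ xs) → t ∈ tuples xs (length t)
tuples-∈⁺ xs []      h = here refl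
tuples-∈⁺ xs (x ∷ t) h = concatMap-∈⁺ _ (h (here refl)) (∈P.∈-map⁺ (x ∷_) (tuples-∈⁺ xs t (h ∘ there)))

tuples-! : ∀ {xs : List A} → Unique xs → ∀ k → Unique (tuples xs k)
tuples-! u zero    = [] ∷ []
tuples-! u (suc k) = concatMap-! _ u (λ x → UP.map⁺ LP.∷-injectiveʳ (tuples-! u k)) key
  where
  key : ∀ {x y z} → z ∈ map (x ∷_) (tuples _ k) → z ∈ map (y ∷_) (tuples _ k) → x ≡ y
  key p q with ∈P.∈-map⁻ _ p | ∈P.∈-map⁻ _ q
  ... | _ , _ , refl | _ , _ , e = LP.∷-injectiveˡ e

∑-tuples : ∀ (xs : List A) k {f : List A → ℚ} → ∑ (tuples xs (suc k)) f ≡ ∑ xs (λ x → ∑ (tuples xs k) (λ t → f (x ∷ t)))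
∑-tuples xs k = trans (∑-concatMap _ xs) (∑-cong xs (λ x → ∑-map (x ∷_) (tuples xs k)))

range-∈⁻ : ∀ a b {x} → x ∈ range a b → a ≤ x × x ≤ b
range-∈⁻ a b m with ∈P.∈-map⁻ (a ℕ.+_) m
... | i , i∈ , refl = ℕP.m≤m+n a i , ℕP.≤-pred (ℕP.≤-trans (ℕP.≤-reflexive (sym (ℕP.+-suc a i)))
      (ℕP.≤-trans (ℕP.+-monoʳ-≤ a i<) (ℕP.≤-reflexive (ℕP.m+[n∸m]≡n {a} (ℕP.<⇒≤ (ℕP.m∸n≢0⇒n<m (λ e → ℕP.n≮0 (subst (i <_) e i<))))))))
  where
  i< : i < suc b ∸ a
  i< = ∈P.∈-upTo⁻ i∈

range-∈⁺ : ∀ {a b x} → a ≤ x → x ≤ b → x ∈ range a b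
range-∈⁺ {a} {b} {x} a≤x x≤b = subst (_∈ range a b) (ℕP.m+[n∸m]≡n a≤x)
  (∈P.∈-map⁺ (a ℕ.+_) (∈P.∈-upTo⁺ (ℕP.∸-monoˡ-< (s≤s x≤b) a≤x)))

range-! : ∀ a b → Unique (range a b)
range-! a b = UP.map⁺ (ℕP.+-cancelˡ-≡ a _ _) (UP.upTo⁺ _)

range-∷ : ∀ {a b} → a ≤ b → range a b ≡ a ∷ range (suc a) b
range-∷ {a} {b} a≤b rewrite ℕP.+-∸-assoc 1 a≤b = cong₂ _∷_ (ℕP.+-identityʳ a)
  (trans (cong (map (a ℕ.+_)) (sym (LP.map-upTo suc (b ∸ a)))) (trans (sym (LP.map-∘ (upTo (b ∸ a)))) (LP.map-cong (ℕP.+-suc a) _)))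

range-[] : ∀ {a b} → b < a → range a b ≡ []
range-[] {a} {b} b<a rewrite ℕP.m≤n⇒m∸n≡0 b<a = refl

length-range : ∀ a b → length (range a b) ≡ suc b ∸ a
length-range a b = trans (LP.length-map _ (upTo (suc b ∸ a))) (LP.length-upTo _)

-- Sums over all ways to split a list into two complementary sublists

∑⊎ : (List A → List A → ℚ) → List A → ℚ
∑⊎ φ []       = φ [] []
∑⊎ φ (k ∷ xs) = ∑⊎ (λ μ ν → φ (k ∷ μ) ν) xs + ∑⊎ (λ μ ν → φ μ (k ∷ ν)) xs

∑⊎-cong-All : ∀ {P : A → Set} {φ ψ : List A → List A → ℚ} →
  (∀ {μ ν} → All P μ → All P ν → φ μ ν ≡ ψ μ ν) → ∀ {xs} → All P xs → ∑⊎ φ xs ≡ ∑⊎ ψ xs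
∑⊎-cong-All h []       = h [] []
∑⊎-cong-All h (p ∷ ps) = cong₂ _+_ (∑⊎-cong-All (λ m → h (p ∷ m)) ps) (∑⊎-cong-All (λ m n → h m (p ∷ n)) ps)

∑⊎-cong : ∀ {φ ψ : List A → List A → ℚ} → (∀ μ ν → φ μ ν ≡ ψ μ ν) → ∀ xs → ∑⊎ φ xs ≡ ∑⊎ ψ xs
∑⊎-cong h []       = h [] []
∑⊎-cong h (k ∷ xs) = cong₂ _+_ (∑⊎-cong (λ μ → h (k ∷ μ)) xs) (∑⊎-cong (λ μ ν → h μ (k ∷ ν)) xs)

∑⊎-zero : ∀ {φ : List A → List A → ℚ} → (∀ μ ν → φ μ ν ≡ 0ℚ) → ∀ xs → ∑⊎ φ xs ≡ 0ℚ
∑⊎-zero h []       = h [] []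
∑⊎-zero h (k ∷ xs) = trans (cong₂ _+_ (∑⊎-zero (λ μ → h (k ∷ μ)) xs) (∑⊎-zero (λ μ ν → h μ (k ∷ ν)) xs)) (R.+-identityˡ 0ℚ)

∑⊎-+ : ∀ {φ ψ : List A → List A → ℚ} xs → ∑⊎ (λ μ ν → φ μ ν + ψ μ ν) xs ≡ ∑⊎ φ xs + ∑⊎ ψ xs
∑⊎-+ []       = refl
∑⊎-+ (k ∷ xs) = trans (cong₂ _+_ (∑⊎-+ xs) (∑⊎-+ xs)) (lemma _ _ _ _)
  where
  opaque
    unfolding _+_
    lemma : ∀ a b c d → a + b + (c + d) ≡ a + c + (b + d)
    lemma = solve-∀ ℚ-ring

∑⊎-*ˡ : ∀ c {φ : List A → List A → ℚ} xs → ∑⊎ (λ μ ν → c * φ μ ν) xs ≡ c * ∑⊎ φ xs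
∑⊎-*ˡ c []       = refl
∑⊎-*ˡ c (k ∷ xs) = trans (cong₂ _+_ (∑⊎-*ˡ c xs) (∑⊎-*ˡ c xs)) (sym (R.distribˡ c _ _))

∑⊎-*ʳ : ∀ c {φ : List A → List A → ℚ} xs → ∑⊎ (λ μ ν → φ μ ν * c) xs ≡ ∑⊎ φ xs * c
∑⊎-*ʳ c []       = refl
∑⊎-*ʳ c (k ∷ xs) = trans (cong₂ _+_ (∑⊎-*ʳ c xs) (∑⊎-*ʳ c xs)) (sym (R.distribʳ c _ _))

∑⊎-∑ : ∀ (ys : List B) {φ : B → List A → List A → ℚ} xs →
  ∑⊎ (λ μ ν → ∑ ys (λ y → φ y μ ν)) xs ≡ ∑ ys (λ y → ∑⊎ (φ y) xs)
∑⊎-∑ ys []       = refl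
∑⊎-∑ ys (k ∷ xs) = trans (cong₂ _+_ (∑⊎-∑ ys xs) (∑⊎-∑ ys xs)) (sym (∑-+ ys))

∑⊎-comm : ∀ {φ : List A → List A → ℚ} xs → ∑⊎ φ xs ≡ ∑⊎ (flip φ) xs
∑⊎-comm []       = refl
∑⊎-comm (k ∷ xs) = trans (R.+-comm _ _) (cong₂ _+_ (∑⊎-comm xs) (∑⊎-comm xs))

-- Both sides run over all ways to colour the entries with three colours.
∑⊎-assoc : ∀ {φ : List A → List A → List A → ℚ} xs →
  ∑⊎ (λ μ ν → ∑⊎ (λ α β → φ α β ν) μ) xs ≡ ∑⊎ (λ α ν → ∑⊎ (λ β γ → φ α β γ) ν) xs
∑⊎-assoc []       = refl
∑⊎-assoc {φ = φ} (k ∷ xs) = begin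
  ∑⊎ (λ μ ν → ∑⊎ (λ α β → φ (k ∷ α) β ν) μ + ∑⊎ (λ α β → φ α (k ∷ β) ν) μ) xs
    + ∑⊎ (λ μ ν → ∑⊎ (λ α β → φ α β (k ∷ ν)) μ) xs
    ≡⟨ cong₂ _+_ (∑⊎-+ xs) refl ⟩
  ∑⊎ (λ μ ν → ∑⊎ (λ α β → φ (k ∷ α) β ν) μ) xs + ∑⊎ (λ μ ν → ∑⊎ (λ α β → φ α (k ∷ β) ν) μ) xs
    + ∑⊎ (λ μ ν → ∑⊎ (λ α β → φ α β (k ∷ ν)) μ) xs
    ≡⟨ cong₂ _+_ (cong₂ _+_ (∑⊎-assoc xs) (∑⊎-assoc xs)) (∑⊎-assoc xs) ⟩
  ∑⊎ (λ α ν → ∑⊎ (λ β γ → φ (k ∷ α) β γ) ν) xs + ∑⊎ (λ α ν → ∑⊎ (λ β γ → φ α (k ∷ β) γ) ν) xs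
    + ∑⊎ (λ α ν → ∑⊎ (λ β γ → φ α β (k ∷ γ)) ν) xs
    ≡⟨ R.+-assoc _ _ _ ⟩
  ∑⊎ (λ α ν → ∑⊎ (λ β γ → φ (k ∷ α) β γ) ν) xs + (∑⊎ (λ α ν → ∑⊎ (λ β γ → φ α (k ∷ β) γ) ν) xs
    + ∑⊎ (λ α ν → ∑⊎ (λ β γ → φ α β (k ∷ γ)) ν) xs)
    ≡⟨ cong₂ _+_ refl (sym (∑⊎-+ xs)) ⟩
  ∑⊎ (λ α ν → ∑⊎ (λ β γ → φ (k ∷ α) β γ) ν) xs
    + ∑⊎ (λ α ν → ∑⊎ (λ β γ → φ α (k ∷ β) γ) ν + ∑⊎ (λ β γ → φ α β (k ∷ γ)) ν) xs ∎

∑⊎-[] : ∀ {φ : List A → List A → ℚ} → (∀ k μ ν → φ (k ∷ μ) ν ≡ 0ℚ) → ∀ xs → ∑⊎ φ xs ≡ φ [] xs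
∑⊎-[] h []       = refl
∑⊎-[] h (k ∷ xs) = trans (cong₂ _+_ (∑⊎-zero (h k) xs) (∑⊎-[] (λ l μ ν → h l μ (k ∷ ν)) xs)) (R.+-identityˡ _)

𝟙-null-* : ∀ k (μ : List A) x → 𝟙 (null (k ∷ μ)) * x ≡ 0ℚ
𝟙-null-* k μ x = R.zeroˡ x

∑⊎-identityˡ : ∀ {ψ : List A → ℚ} xs → ∑⊎ (λ μ ν → 𝟙 (null μ) * ψ ν) xs ≡ ψ xs
∑⊎-identityˡ {ψ = ψ} xs = trans (∑⊎-[] (λ k μ ν → 𝟙-null-* k μ (ψ ν)) xs) (R.*-identityˡ (ψ xs))

∏ : (A → ℚ) → List A → ℚ
∏ w []       = 1ℚ
∏ w (k ∷ xs) = w k * ∏ w xs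

-- Lets a multiplicative weight of the whole list, such as `ip` or the factors 2 of shiftification,
-- be shared out among the slots.
∑⊎-∏ : ∀ (w : A → ℚ) {φ : List A → List A → ℚ} xs →
  ∏ w xs * ∑⊎ φ xs ≡ ∑⊎ (λ μ ν → ∏ w μ * ∏ w ν * φ μ ν) xs
∑⊎-∏ w {φ} []       = cong (_* φ [] []) (sym (R.*-identityˡ 1ℚ))
∑⊎-∏ w {φ} (k ∷ xs) = begin
  w k * ∏ w xs * (∑⊎ (λ μ → φ (k ∷ μ)) xs + ∑⊎ (λ μ ν → φ μ (k ∷ ν)) xs)
    ≡⟨ dist (w k) (∏ w xs) _ _ ⟩
  w k * (∏ w xs * ∑⊎ (λ μ → φ (k ∷ μ)) xs) + w k * (∏ w xs * ∑⊎ (λ μ ν → φ μ (k ∷ ν)) xs)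
    ≡⟨ cong₂ (λ x y → w k * x + w k * y) (∑⊎-∏ w xs) (∑⊎-∏ w xs) ⟩
  w k * ∑⊎ (λ μ ν → ∏ w μ * ∏ w ν * φ (k ∷ μ) ν) xs + w k * ∑⊎ (λ μ ν → ∏ w μ * ∏ w ν * φ μ (k ∷ ν)) xs
    ≡⟨ cong₂ _+_ (sym (∑⊎-*ˡ (w k) xs)) (sym (∑⊎-*ˡ (w k) xs)) ⟩
  ∑⊎ (λ μ ν → w k * (∏ w μ * ∏ w ν * φ (k ∷ μ) ν)) xs + ∑⊎ (λ μ ν → w k * (∏ w μ * ∏ w ν * φ μ (k ∷ ν))) xs
    ≡⟨ cong₂ _+_ (∑⊎-cong (λ μ ν → left (w k) _ _ _) xs) (∑⊎-cong (λ μ ν → right (w k) _ _ _) xs) ⟩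
  ∑⊎ (λ μ ν → w k * ∏ w μ * ∏ w ν * φ (k ∷ μ) ν) xs + ∑⊎ (λ μ ν → ∏ w μ * (w k * ∏ w ν) * φ μ (k ∷ ν)) xs ∎
  where
  opaque
    unfolding _+_
    dist : ∀ a b c d → a * b * (c + d) ≡ a * (b * c) + a * (b * d)
    dist = solve-∀ ℚ-ring
  opaque
    unfolding _+_
    left : ∀ a b c d → a * (b * c * d) ≡ a * b * c * d
    left = solve-∀ ℚ-ring
  opaque
    unfolding _+_
    right : ∀ a b c d → a * (b * c * d) ≡ b * (a * c) * d
    right = solve-∀ ℚ-ring

-- Integers and their inverses among the rationals

ℤtoℚ-mkℚ : ∀ z → Σ ℚ λ q → ℤtoℚ z ≡ q × ℚ.↥ q ≡ z × ℚ.↧ₙ q ≡ 1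
ℤtoℚ-mkℚ z = ℚ.mkℚ z 0 (Coprime-1 z) , ℚP.↥p/↧p≡p (ℚ.mkℚ z 0 (Coprime-1 z)) , refl , refl
  where
  Coprime-1 : ∀ z → Coprime ℤ.∣ z ∣ 1
  Coprime-1 z = coprime-sym (1-coprimeTo ℤ.∣ z ∣)

opaque
  unfolding _+_

  *-ℚ : ∀ a b → a ℚ.* b ≡ a * b
  *-ℚ a b = refl

  ℤtoℚ-+ : ∀ a b → ℤtoℚ (a ℤ.+ b) ≡ ℤtoℚ a + ℤtoℚ b
  ℤtoℚ-+ a b with ℤtoℚ-mkℚ a | ℤtoℚ-mkℚ b
  ... | ℚ.mkℚ .a 0 _ , p , refl , refl | ℚ.mkℚ .b 0 _ , q , refl , refl =
    trans (cong₂ (λ x y → ℤtoℚ (x ℤ.+ y)) (sym (ℤP.*-identityʳ a)) (sym (ℤP.*-identityʳ b))) (cong₂ ℚ._+_ (sym p) (sym q))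

  ℤtoℚ-* : ∀ a b → ℤtoℚ (a ℤ.* b) ≡ ℤtoℚ a * ℤtoℚ b
  ℤtoℚ-* a b with ℤtoℚ-mkℚ a | ℤtoℚ-mkℚ b
  ... | ℚ.mkℚ .a 0 _ , p , refl , refl | ℚ.mkℚ .b 0 _ , q , refl , refl = cong₂ ℚ._*_ (sym p) (sym q)

  sumℚ-∑ : ∀ (xs : List A) (f : A → ℚ) → sumℚ (map f xs) ≡ ∑ xs f
  sumℚ-∑ []       f = refl
  sumℚ-∑ (x ∷ xs) f = cong (f x ℚ.+_) (sumℚ-∑ xs f)

ℕtoℚ-+ : ∀ a b → ℕtoℚ (a ℕ.+ b) ≡ ℕtoℚ a + ℕtoℚ b
ℕtoℚ-+ a b = ℤtoℚ-+ (ℤ.+ a) (ℤ.+ b)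

ℕtoℚ-* : ∀ a b → ℕtoℚ (a ℕ.* b) ≡ ℕtoℚ a * ℕtoℚ b
ℕtoℚ-* a b = trans (cong ℤtoℚ (ℤP.pos-* a b)) (ℤtoℚ-* (ℤ.+ a) (ℤ.+ b))

ℕtoℚ-suc : ∀ a → ℕtoℚ (suc a) ≡ 1ℚ + ℕtoℚ a
ℕtoℚ-suc = ℕtoℚ-+ 1

ℤtoℚ-sumℤ : ∀ (xs : List A) (f : A → ℤ) → ℤtoℚ (sumℤ (map f xs)) ≡ ∑ xs (ℤtoℚ ∘ f)
ℤtoℚ-sumℤ []       f = refl
ℤtoℚ-sumℤ (x ∷ xs) f = trans (ℤtoℚ-+ (f x) _) (cong (_ +_) (ℤtoℚ-sumℤ xs f))

opaque
  unfolding _+_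

  inv-inverseˡ : ∀ k → inv (suc k) * ℕtoℚ (suc k) ≡ 1ℚ
  inv-inverseˡ k = ℚP.toℚᵘ-injective (U.≃-trans (ℚP.toℚᵘ-homo-* (inv (suc k)) (ℕtoℚ (suc k)))
    (U.≃-trans (U.*-cong (ℚP.toℚᵘ-fromℚᵘ (mkℚᵘ (ℤ.+ 1) k)) (ℚP.toℚᵘ-fromℚᵘ (mkℚᵘ (ℤ.+ suc k) 0)))
      (*≡* (trans (cong (ℤ._* ℤ.+ 1) (ℤP.*-identityˡ (ℤ.+ suc k))) (trans (cong ℤ.+_ (cong (ℕ._* 1) (sym (ℕP.*-identityʳ (suc k))))) (ℤP.*-comm (ℤ.+ (suc k ℕ.* 1)) (ℤ.+ 1)))))))

inv-* : ∀ a {x y} → ℕtoℚ (suc a) * x ≡ y → x ≡ inv (suc a) * y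
inv-* a {x} {y} refl = begin
  x                                   ≡⟨ sym (R.*-identityˡ x) ⟩
  1ℚ * x                              ≡⟨ cong (_* x) (sym (inv-inverseˡ a)) ⟩
  inv (suc a) * ℕtoℚ (suc a) * x      ≡⟨ R.*-assoc _ _ _ ⟩
  inv (suc a) * (ℕtoℚ (suc a) * x)    ∎

ℕtoℚ-cancelˡ : ∀ a {x y} → ℕtoℚ (suc a) * x ≡ ℕtoℚ (suc a) * y → x ≡ y
ℕtoℚ-cancelˡ a e = trans (inv-* a refl) (trans (cong (inv (suc a) *_) e) (sym (inv-* a refl)))

∑-const : ∀ (xs : List A) c → ∑ xs (λ _ → c) ≡ ℕtoℚ (length xs) * c
∑-const []       c = sym (R.zeroˡ c)
∑-const (x ∷ xs) c = trans (cong₂ _+_ (sym (R.*-identityˡ c)) (∑-const xs c))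
  (trans (sym (R.distribʳ c 1ℚ (ℕtoℚ (length xs)))) (cong (_* c) (sym (ℕtoℚ-suc (length xs)))))

-- Sorting and counting

-- Since insertions commute, insertion sort forgets the order of its input, which makes `sortDec` a
-- normal form for multisets.
insertDec-comm : ∀ x y zs → insertDec x (insertDec y zs) ≡ insertDec y (insertDec x zs)
insertDec-comm x y [] with y ≤ᵇ x in p | x ≤ᵇ y in q
... | true  | true  = cong₂ (λ a b → a ∷ b ∷ []) e (sym e)
  where e = ℕP.≤-antisym (ℕP.≤ᵇ⇒≤ x y (≡⇒T q)) (ℕP.≤ᵇ⇒≤ y x (≡⇒T p))
... | true  | false = refl
... | false | true  = refl
... | false | false with ℕP.≤-total x y
...   | inj₁ h = ⊥-elim (subst T q (ℕP.≤⇒≤ᵇ h))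
...   | inj₂ h = ⊥-elim (subst T p (ℕP.≤⇒≤ᵇ h))
insertDec-comm x y (z ∷ zs) with z ≤ᵇ y in p | z ≤ᵇ x in q
... | true  | true with y ≤ᵇ x in r | x ≤ᵇ y in s
...   | true  | true  = cong₂ (λ a b → a ∷ b ∷ z ∷ zs) e (sym e)
  where e = ℕP.≤-antisym (ℕP.≤ᵇ⇒≤ x y (≡⇒T s)) (ℕP.≤ᵇ⇒≤ y x (≡⇒T r))
...   | true  | false rewrite p = refl
...   | false | true  rewrite q = refl
...   | false | false with ℕP.≤-total x y
...     | inj₁ h = ⊥-elim (subst T s (ℕP.≤⇒≤ᵇ h))
...     | inj₂ h = ⊥-elim (subst T r (ℕP.≤⇒≤ᵇ h))
insertDec-comm x y (z ∷ zs) | true | false with y ≤ᵇ x in r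
... | true  = ⊥-elim (subst T q (ℕP.≤⇒≤ᵇ (ℕP.≤-trans (ℕP.≤ᵇ⇒≤ z y (≡⇒T p)) (ℕP.≤ᵇ⇒≤ y x (≡⇒T r)))))
... | false rewrite q | p = refl
insertDec-comm x y (z ∷ zs) | false | true with x ≤ᵇ y in r
... | true  = ⊥-elim (subst T p (ℕP.≤⇒≤ᵇ (ℕP.≤-trans (ℕP.≤ᵇ⇒≤ z x (≡⇒T q)) (ℕP.≤ᵇ⇒≤ x y (≡⇒T r)))))
... | false rewrite q | p = refl
insertDec-comm x y (z ∷ zs) | false | false rewrite q | p = cong (z ∷_) (insertDec-comm x y zs)

sortDec-↭⇒≡ : ∀ {xs ys} → xs ↭ ys → sortDec xs ≡ sortDec ys
sortDec-↭⇒≡ ↭refl        = refl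
sortDec-↭⇒≡ (prep x p)   = cong (insertDec x) (sortDec-↭⇒≡ p)
sortDec-↭⇒≡ (swap {xs} x y p) = trans (insertDec-comm x y (sortDec xs)) (cong (insertDec y ∘ insertDec x) (sortDec-↭⇒≡ p))
sortDec-↭⇒≡ (↭trans p q) = trans (sortDec-↭⇒≡ p) (sortDec-↭⇒≡ q)

insertDec-↭ : ∀ x ys → insertDec x ys ↭ x ∷ ys
insertDec-↭ x []       = ↭-refl
insertDec-↭ x (y ∷ ys) with y ≤ᵇ x
... | true  = ↭-refl
... | false = ↭-trans (prep y (insertDec-↭ x ys)) (swap y x ↭-refl)

sortDec-↭ : ∀ xs → sortDec xs ↭ xs
sortDec-↭ []       = ↭-refl
sortDec-↭ (x ∷ xs) = ↭-trans (insertDec-↭ x (sortDec xs)) (prep x (sortDec-↭ xs))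

sortDec-idem : ∀ xs → sortDec (sortDec xs) ≡ sortDec xs
sortDec-idem xs = sortDec-↭⇒≡ (sortDec-↭ xs)

eqListℕ⇒≡ : ∀ xs ys → T (eqListℕ xs ys) → xs ≡ ys
eqListℕ⇒≡ []       []       t = refl
eqListℕ⇒≡ (x ∷ xs) (y ∷ ys) t = cong₂ _∷_ (ℕP.≡ᵇ⇒≡ x y (∧-fst t)) (eqListℕ⇒≡ xs ys (∧-snd {x ≡ᵇ y} t))

eqListℕ-refl : ∀ xs → eqListℕ xs xs ≡ true
eqListℕ-refl []       = refl
eqListℕ-refl (x ∷ xs) = trans (cong (_∧ eqListℕ xs xs) (≡ᵇ-refl x)) (eqListℕ-refl xs)

count-∷ : ∀ k x xs → count k (x ∷ xs) ≡ (if k ≡ᵇ x then 1 else 0) ℕ.+ count k xs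
count-∷ k x xs with k ≡ᵇ x
... | true  = refl
... | false = refl

count-↭ : ∀ k {xs ys} → xs ↭ ys → count k xs ≡ count k ys
count-↭ k ↭refl = refl
count-↭ k (prep {xs} {ys} x p) = trans (count-∷ k x xs) (trans (cong (_ ℕ.+_) (count-↭ k p)) (sym (count-∷ k x ys)))
count-↭ k (swap {xs} {ys} x y p) = begin
  count k (x ∷ y ∷ xs)         ≡⟨ trans (count-∷ k x _) (cong (c x ℕ.+_) (count-∷ k y xs)) ⟩
  c x ℕ.+ (c y ℕ.+ count k xs) ≡⟨ cong (λ z → c x ℕ.+ (c y ℕ.+ z)) (count-↭ k p) ⟩
  c x ℕ.+ (c y ℕ.+ count k ys) ≡⟨ ℕP.+-assoc (c x) _ _ ⟨
  c x ℕ.+ c y ℕ.+ count k ys   ≡⟨ cong (ℕ._+ count k ys) (ℕP.+-comm (c x) (c y)) ⟩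
  c y ℕ.+ c x ℕ.+ count k ys   ≡⟨ ℕP.+-assoc (c y) _ _ ⟩
  c y ℕ.+ (c x ℕ.+ count k ys) ≡⟨ trans (count-∷ k y _) (cong (c y ℕ.+_) (count-∷ k x ys)) ⟨
  count k (y ∷ x ∷ ys)         ∎
  where
  c : ℕ → ℕ
  c z = if k ≡ᵇ z then 1 else 0
count-↭ k (↭trans p q) = trans (count-↭ k p) (count-↭ k q)

-- The pairing of a symmetric function with a list of parts

-- The derivative of `p_μ` with respect to `p_k`: equal parts are removed at each of their
-- positions, and this repetition produces the exponent.
removals : ℕ → List ℕ → List (List ℕ)
removals k []       = []
removals k (x ∷ xs) = (if k ≡ᵇ x then xs ∷ [] else []) ++ map (x ∷_) (removals k xs)

-- Counts the bijections between the positions of `κ` and of `μ` that preserve parts; the indicator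
-- at the end is the evaluation at 0.
matchings : List ℕ → List ℕ → ℚ
matchings μ []       = 𝟙 (null μ)
matchings μ (k ∷ κ) = ∑ (removals k μ) (λ ν → matchings ν κ)

-- ⟨ f ∣ κ ⟩ is the value at 0 of the derivative ∂f / ∂p_{κ₁} ∂p_{κ₂} ⋯ of f ∈ ℚ[p₁,p₂,…].
⟨_∣_⟩ : Sym → List ℕ → ℚ
⟨ f ∣ κ ⟩ = ∑ f (λ t → proj₂ t * matchings (proj₁ t) κ)

∑-if : ∀ b (x : A) {f : A → ℚ} → ∑ (if b then x ∷ [] else []) f ≡ 𝟙 b * f x
∑-if true  x {f} = trans (R.+-identityʳ (f x)) (sym (R.*-identityˡ (f x)))
∑-if false x {f} = sym (R.zeroˡ (f x))

∑-removals-∷ : ∀ k x μ {f : List ℕ → ℚ} →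
  ∑ (removals k (x ∷ μ)) f ≡ 𝟙 (k ≡ᵇ x) * f μ + ∑ (removals k μ) (λ ν → f (x ∷ ν))
∑-removals-∷ k x μ = trans (∑-++ (if k ≡ᵇ x then μ ∷ [] else []) _) (cong₂ _+_ (∑-if (k ≡ᵇ x) μ) (∑-map (x ∷_) (removals k μ)))

∑-removals-++ : ∀ k μ ν {f : List ℕ → ℚ} →
  ∑ (removals k (μ ++ ν)) f ≡ ∑ (removals k μ) (λ ρ → f (ρ ++ ν)) + ∑ (removals k ν) (λ ρ → f (μ ++ ρ))
∑-removals-++ k []      ν = sym (R.+-identityˡ _)
∑-removals-++ k (x ∷ μ) ν {f} = begin
  ∑ (removals k (x ∷ μ ++ ν)) f
    ≡⟨ ∑-removals-∷ k x (μ ++ ν) ⟩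
  𝟙 (k ≡ᵇ x) * f (μ ++ ν) + ∑ (removals k (μ ++ ν)) (λ ρ → f (x ∷ ρ))
    ≡⟨ cong₂ _+_ refl (∑-removals-++ k μ ν) ⟩
  𝟙 (k ≡ᵇ x) * f (μ ++ ν) + (∑ (removals k μ) (λ ρ → f (x ∷ ρ ++ ν)) + ∑ (removals k ν) (λ ρ → f (x ∷ μ ++ ρ)))
    ≡⟨ R.+-assoc _ _ _ ⟨
  𝟙 (k ≡ᵇ x) * f (μ ++ ν) + ∑ (removals k μ) (λ ρ → f (x ∷ ρ ++ ν)) + ∑ (removals k ν) (λ ρ → f (x ∷ μ ++ ρ))
    ≡⟨ cong₂ _+_ (sym (∑-removals-∷ k x μ)) refl ⟩
  ∑ (removals k (x ∷ μ)) (λ ρ → f (ρ ++ ν)) + ∑ (removals k ν) (λ ρ → f (x ∷ μ ++ ρ)) ∎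

𝟙-null-++ : ∀ (μ ν : List A) → 𝟙 (null (μ ++ ν)) ≡ 𝟙 (null μ) * 𝟙 (null ν)
𝟙-null-++ []      ν = sym (R.*-identityˡ _)
𝟙-null-++ (x ∷ μ) ν = sym (R.zeroˡ _)

-- Leibniz rule: each derivative hits exactly one of the two factors.
matchings-++ : ∀ μ ν κ → matchings (μ ++ ν) κ ≡ ∑⊎ (λ a b → matchings μ a * matchings ν b) κ
matchings-++ μ ν []      = 𝟙-null-++ μ ν
matchings-++ μ ν (k ∷ κ) = begin
  ∑ (removals k (μ ++ ν)) (λ ρ → matchings ρ κ)
    ≡⟨ ∑-removals-++ k μ ν ⟩
  ∑ (removals k μ) (λ ρ → matchings (ρ ++ ν) κ) + ∑ (removals k ν) (λ ρ → matchings (μ ++ ρ) κ)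
    ≡⟨ cong₂ _+_ (∑-cong (removals k μ) (λ ρ → matchings-++ ρ ν κ)) (∑-cong (removals k ν) (λ ρ → matchings-++ μ ρ κ)) ⟩
  ∑ (removals k μ) (λ ρ → ∑⊎ (λ a b → matchings ρ a * matchings ν b) κ)
    + ∑ (removals k ν) (λ ρ → ∑⊎ (λ a b → matchings μ a * matchings ρ b) κ)
    ≡⟨ cong₂ _+_ (sym (∑⊎-∑ (removals k μ) κ)) (sym (∑⊎-∑ (removals k ν) κ)) ⟩
  ∑⊎ (λ a b → ∑ (removals k μ) (λ ρ → matchings ρ a * matchings ν b)) κ
    + ∑⊎ (λ a b → ∑ (removals k ν) (λ ρ → matchings μ a * matchings ρ b)) κ
    ≡⟨ cong₂ _+_ (∑⊎-cong (λ a b → ∑-*ʳ (matchings ν b) (removals k μ)) κ)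
                 (∑⊎-cong (λ a b → ∑-*ˡ (matchings μ a) (removals k ν)) κ) ⟩
  ∑⊎ (λ a b → matchings μ (k ∷ a) * matchings ν b) κ + ∑⊎ (λ a b → matchings μ a * matchings ν (k ∷ b)) κ ∎

⟨+S⟩ : ∀ f g κ → ⟨ f +S g ∣ κ ⟩ ≡ ⟨ f ∣ κ ⟩ + ⟨ g ∣ κ ⟩
⟨+S⟩ f g κ = ∑-++ f g

⟨sumS⟩ : ∀ (xs : List A) (F : A → Sym) κ → ⟨ sumS (map F xs) ∣ κ ⟩ ≡ ∑ xs (λ x → ⟨ F x ∣ κ ⟩)
⟨sumS⟩ []       F κ = refl
⟨sumS⟩ (x ∷ xs) F κ = trans (⟨+S⟩ (F x) (sumS (map F xs)) κ) (cong₂ _+_ refl (⟨sumS⟩ xs F κ))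

⟨scaleS⟩ : ∀ c f κ → ⟨ scaleS c f ∣ κ ⟩ ≡ c * ⟨ f ∣ κ ⟩
⟨scaleS⟩ c f κ = begin
  ⟨ scaleS c f ∣ κ ⟩                                          ≡⟨ ∑-map _ f ⟩
  ∑ f (λ t → (c ℚ.* proj₂ t) * matchings (proj₁ t) κ)         ≡⟨ ∑-cong f (λ t → trans (cong (_* matchings (proj₁ t) κ) (*-ℚ c (proj₂ t))) (R.*-assoc c _ _)) ⟩
  ∑ f (λ t → c * (proj₂ t * matchings (proj₁ t) κ))           ≡⟨ ∑-*ˡ c f ⟩
  c * ⟨ f ∣ κ ⟩                                               ∎

⟨1S⟩ : ∀ κ → ⟨ 1S ∣ κ ⟩ ≡ 𝟙 (null κ)
⟨1S⟩ []      = trans (R.+-identityʳ _) (R.*-identityˡ 1ℚ)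
⟨1S⟩ (k ∷ κ) = trans (R.+-identityʳ _) (R.*-identityˡ 0ℚ)

⟨*S⟩ : ∀ f g κ → ⟨ f *S g ∣ κ ⟩ ≡ ∑⊎ (λ μ ν → ⟨ f ∣ μ ⟩ * ⟨ g ∣ ν ⟩) κ
⟨*S⟩ f g κ = begin
  ⟨ f *S g ∣ κ ⟩
    ≡⟨ ∑-concatMap _ f ⟩
  ∑ f (λ s → ∑ (map (λ t → (proj₁ s ++ proj₁ t , proj₂ s ℚ.* proj₂ t)) g) (λ t → proj₂ t * matchings (proj₁ t) κ))
    ≡⟨ ∑-cong f (λ s → ∑-map _ g) ⟩
  ∑ f (λ s → ∑ g (λ t → (proj₂ s ℚ.* proj₂ t) * matchings (proj₁ s ++ proj₁ t) κ))
    ≡⟨ ∑-cong f (λ s → ∑-cong g (λ t → trans (cong₂ _*_ (*-ℚ (proj₂ s) (proj₂ t)) (matchings-++ (proj₁ s) (proj₁ t) κ)) (sym (∑⊎-*ˡ _ κ)))) ⟩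
  ∑ f (λ s → ∑ g (λ t → ∑⊎ (λ μ ν → proj₂ s * proj₂ t * (matchings (proj₁ s) μ * matchings (proj₁ t) ν)) κ))
    ≡⟨ ∑-cong f (λ s → sym (∑⊎-∑ g κ)) ⟩
  ∑ f (λ s → ∑⊎ (λ μ ν → ∑ g (λ t → proj₂ s * proj₂ t * (matchings (proj₁ s) μ * matchings (proj₁ t) ν))) κ)
    ≡⟨ sym (∑⊎-∑ f κ) ⟩
  ∑⊎ (λ μ ν → ∑ f (λ s → ∑ g (λ t → proj₂ s * proj₂ t * (matchings (proj₁ s) μ * matchings (proj₁ t) ν)))) κ
    ≡⟨ ∑⊎-cong (λ μ ν → ∑-cong f (λ s → trans (∑-cong g (λ t → lemma (proj₂ s) (proj₂ t) (matchings (proj₁ s) μ) (matchings (proj₁ t) ν))) (∑-*ˡ _ g))) κ ⟩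
  ∑⊎ (λ μ ν → ∑ f (λ s → proj₂ s * matchings (proj₁ s) μ * ⟨ g ∣ ν ⟩)) κ
    ≡⟨ ∑⊎-cong (λ μ ν → ∑-*ʳ ⟨ g ∣ ν ⟩ f) κ ⟩
  ∑⊎ (λ μ ν → ⟨ f ∣ μ ⟩ * ⟨ g ∣ ν ⟩) κ ∎
  where
  opaque
    unfolding _+_
    lemma : ∀ a b c d → a * b * (c * d) ≡ a * c * (b * d)
    lemma = solve-∀ ℚ-ring

-- From pairings to coefficients

fac : List ℕ → ℕ
fac []      = 1
fac (k ∷ κ) = suc (count k κ) ℕ.* fac κ

fac-suc : ∀ κ → ∃ λ m → fac κ ≡ suc m
fac-suc []      = 0 , refl
fac-suc (k ∷ κ) with fac κ | fac-suc κ
... | _ | m , refl = _ , refl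

removals-∈ : ∀ k μ {ν} → ν ∈ removals k μ → μ ↭ k ∷ ν
removals-∈ k (x ∷ μ) m with k ≡ᵇ x in e
removals-∈ k (x ∷ μ) (here refl) | true = ↭-reflexive (cong (_∷ μ) (sym (ℕP.≡ᵇ⇒≡ k x (≡⇒T e))))
removals-∈ k (x ∷ μ) (there m)   | true with ∈P.∈-map⁻ (x ∷_) m
... | ν , m′ , refl = ↭-trans (prep x (removals-∈ k μ m′)) (swap x k ↭-refl)
removals-∈ k (x ∷ μ) m | false with ∈P.∈-map⁻ (x ∷_) m
... | ν , m′ , refl = ↭-trans (prep x (removals-∈ k μ m′)) (swap x k ↭-refl)

length-removals : ∀ k μ → length (removals k μ) ≡ count k μ
length-removals k []      = refl
length-removals k (x ∷ μ) with k ≡ᵇ x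
... | true  = cong suc (trans (LP.length-map _ (removals k μ)) (length-removals k μ))
... | false = trans (LP.length-map _ (removals k μ)) (length-removals k μ)

matchings-↭ : ∀ {μ} κ → μ ↭ κ → matchings μ κ ≡ ℕtoℚ (fac κ)
matchings-↭ [] p rewrite ↭P.↭-empty-inv p = refl
matchings-↭ {μ} (k ∷ κ) p = begin
  ∑ (removals k μ) (λ ν → matchings ν κ)         ≡⟨ ∑-cong-∈ (removals k μ) (λ m → matchings-↭ κ (↭P.drop-∷ (↭-trans (↭-sym (removals-∈ k μ m)) p))) ⟩
  ∑ (removals k μ) (λ _ → ℕtoℚ (fac κ))          ≡⟨ ∑-const (removals k μ) _ ⟩
  ℕtoℚ (length (removals k μ)) * ℕtoℚ (fac κ)    ≡⟨ cong (λ z → ℕtoℚ z * ℕtoℚ (fac κ)) eq ⟩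
  ℕtoℚ (suc (count k κ)) * ℕtoℚ (fac κ)          ≡⟨ ℕtoℚ-* (suc (count k κ)) (fac κ) ⟨
  ℕtoℚ (fac (k ∷ κ))                             ∎
  where
  eq : length (removals k μ) ≡ suc (count k κ)
  eq = trans (length-removals k μ) (trans (count-↭ k p) (trans (count-∷ k k κ) (cong (λ b → (if b then 1 else 0) ℕ.+ count k κ) (≡ᵇ-refl k))))

matchings-¬↭ : ∀ {μ} κ → ¬ (μ ↭ κ) → matchings μ κ ≡ 0ℚ
matchings-¬↭ {[]}    [] p = ⊥-elim (p ↭-refl)
matchings-¬↭ {_ ∷ _} [] p = refl
matchings-¬↭ {μ} (k ∷ κ) p = ∑-zero-∈ (removals k μ) (λ m → matchings-¬↭ κ (λ q → p (↭-trans (removals-∈ k μ m) (prep k q))))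

matchings-fac : ∀ μ κ → matchings μ κ ≡ ℕtoℚ (fac κ) * 𝟙 (eqListℕ (sortDec μ) (sortDec κ))
matchings-fac μ κ with eqListℕ (sortDec μ) (sortDec κ) in e
... | true  = trans (matchings-↭ κ (↭-trans (↭-sym (sortDec-↭ μ)) (↭-trans (↭-reflexive (eqListℕ⇒≡ _ _ (≡⇒T e))) (sortDec-↭ κ)))) (sym (R.*-identityʳ (ℕtoℚ (fac κ))))
... | false = trans (matchings-¬↭ κ (λ p → subst T e (≡⇒T (trans (cong (λ z → eqListℕ z (sortDec κ)) (sortDec-↭⇒≡ p)) (eqListℕ-refl (sortDec κ))))))
                    (sym (R.zeroʳ (ℕtoℚ (fac κ))))

⟨⟩-coeff : ∀ f κ → ⟨ f ∣ κ ⟩ ≡ ℕtoℚ (fac κ) * coeff f κ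
⟨⟩-coeff f κ = begin
  ∑ f (λ t → proj₂ t * matchings (proj₁ t) κ)
    ≡⟨ ∑-cong f (λ t → trans (cong (proj₂ t *_) (matchings-fac (proj₁ t) κ)) (lemma (proj₂ t) (ℕtoℚ (fac κ)) (𝟙 (eqListℕ (sortDec (proj₁ t)) (sortDec κ))))) ⟩
  ∑ f (λ t → ℕtoℚ (fac κ) * (𝟙 (eqListℕ (sortDec (proj₁ t)) (sortDec κ)) * proj₂ t))
    ≡⟨ ∑-*ˡ (ℕtoℚ (fac κ)) f ⟩
  ℕtoℚ (fac κ) * ∑ f (λ t → 𝟙 (eqListℕ (sortDec (proj₁ t)) (sortDec κ)) * proj₂ t)
    ≡⟨ cong (ℕtoℚ (fac κ) *_) (sym (trans (sumℚ-∑ (filterᵇ (λ t → eqListℕ (sortDec (proj₁ t)) (sortDec κ)) f) proj₂) (∑-filter _ f))) ⟩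
  ℕtoℚ (fac κ) * coeff f κ ∎
  where
  opaque
    unfolding _+_
    lemma : ∀ a b c → a * (b * c) ≡ b * (c * a)
    lemma = solve-∀ ℚ-ring

coeff-sortDec : ∀ f κ → coeff f (sortDec κ) ≡ coeff f κ
coeff-sortDec f κ rewrite sortDec-idem κ = refl

-- A pairing is a coefficient times `fac κ`, the product of the factorials of the multiplicities,
-- which can be cancelled. Sorted lists suffice because `coeff` sorts its argument; the Frobenius
-- character is later paired with decreasing lists only.
⟨⟩⇒≈S : ∀ {f g} → (∀ κ → ⟨ f ∣ sortDec κ ⟩ ≡ ⟨ g ∣ sortDec κ ⟩) → f ≈S g
⟨⟩⇒≈S {f} {g} h κ = trans (sym (coeff-sortDec f κ)) (trans (cancel (fac-suc (sortDec κ))) (coeff-sortDec g κ))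
  where
  cancel : (∃ λ m → fac (sortDec κ) ≡ suc m) → coeff f (sortDec κ) ≡ coeff g (sortDec κ)
  cancel (m , e) = ℕtoℚ-cancelˡ m (subst (λ z → ℕtoℚ z * coeff f (sortDec κ) ≡ ℕtoℚ z * coeff g (sortDec κ)) e
    (trans (sym (⟨⟩-coeff f (sortDec κ))) (trans (h κ) (⟨⟩-coeff g (sortDec κ)))))

-- Newton's identities

pick : (ℕ → List ℕ → ℚ) → List ℕ → ℚ
pick φ []      = 0ℚ
pick φ (k ∷ κ) = φ k κ + pick (λ x ν → φ x (k ∷ ν)) κ

pick-cong : ∀ {φ ψ} → (∀ x ν → φ x ν ≡ ψ x ν) → ∀ κ → pick φ κ ≡ pick ψ κ
pick-cong h []      = refl
pick-cong h (k ∷ κ) = cong₂ _+_ (h k κ) (pick-cong (λ x ν → h x (k ∷ ν)) κ)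

pick-∑ : ∀ (ys : List B) {φ : B → ℕ → List ℕ → ℚ} κ → pick (λ x ν → ∑ ys (λ y → φ y x ν)) κ ≡ ∑ ys (λ y → pick (φ y) κ)
pick-∑ ys []      = sym (∑-zero ys)
pick-∑ ys (k ∷ κ) = trans (cong₂ _+_ refl (pick-∑ ys κ)) (sym (∑-+ ys))

pick-*ˡ : ∀ c {φ} κ → pick (λ x ν → c * φ x ν) κ ≡ c * pick φ κ
pick-*ˡ c []      = sym (R.zeroʳ c)
pick-*ˡ c (k ∷ κ) = trans (cong₂ _+_ refl (pick-*ˡ c κ)) (sym (R.distribˡ c _ _))

opaque
  unfolding _+_

  x∙yz≈y∙xz : ∀ x y z → x * (y * z) ≡ y * (x * z)
  x∙yz≈y∙xz = solve-∀ ℚ-ring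

matchings-∷ : ∀ i μ κ → matchings (i ∷ μ) κ ≡ pick (λ x ν → 𝟙 (x ≡ᵇ i) * matchings μ ν) κ
matchings-∷ i μ []      = refl
matchings-∷ i μ (k ∷ κ) = begin
  ∑ (removals k (i ∷ μ)) (λ ν → matchings ν κ)
    ≡⟨ ∑-removals-∷ k i μ ⟩
  𝟙 (k ≡ᵇ i) * matchings μ κ + ∑ (removals k μ) (λ ν → matchings (i ∷ ν) κ)
    ≡⟨ cong₂ _+_ refl (∑-cong (removals k μ) (λ ν → matchings-∷ i ν κ)) ⟩
  𝟙 (k ≡ᵇ i) * matchings μ κ + ∑ (removals k μ) (λ ν → pick (λ x ρ → 𝟙 (x ≡ᵇ i) * matchings ν ρ) κ)
    ≡⟨ cong₂ _+_ refl (sym (pick-∑ (removals k μ) κ)) ⟩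
  𝟙 (k ≡ᵇ i) * matchings μ κ + pick (λ x ρ → ∑ (removals k μ) (λ ν → 𝟙 (x ≡ᵇ i) * matchings ν ρ)) κ
    ≡⟨ cong₂ _+_ refl (pick-cong (λ x ρ → ∑-*ˡ (𝟙 (x ≡ᵇ i)) (removals k μ)) κ) ⟩
  𝟙 (k ≡ᵇ i) * matchings μ κ + pick (λ x ρ → 𝟙 (x ≡ᵇ i) * matchings μ (k ∷ ρ)) κ ∎

-- Exactly one derivative must hit the linear factor `p_i`, so splitting `κ` reduces to choosing one
-- part.
⟨pS*⟩ : ∀ i f κ → ⟨ pS i *S f ∣ κ ⟩ ≡ pick (λ x ν → 𝟙 (x ≡ᵇ i) * ⟨ f ∣ ν ⟩) κ
⟨pS*⟩ i f κ = begin
  ⟨ pS i *S f ∣ κ ⟩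
    ≡⟨ trans (∑-++ (map _ f) []) (R.+-identityʳ _) ⟩
  ∑ (map (λ t → (i ∷ proj₁ t , 1ℚ ℚ.* proj₂ t)) f) (λ t → proj₂ t * matchings (proj₁ t) κ)
    ≡⟨ ∑-map _ f ⟩
  ∑ f (λ t → (1ℚ ℚ.* proj₂ t) * matchings (i ∷ proj₁ t) κ)
    ≡⟨ ∑-cong f (λ t → trans (cong₂ _*_ (ℚP.*-identityˡ (proj₂ t)) (matchings-∷ i (proj₁ t) κ)) (sym (pick-*ˡ (proj₂ t) κ))) ⟩
  ∑ f (λ t → pick (λ x ν → proj₂ t * (𝟙 (x ≡ᵇ i) * matchings (proj₁ t) ν)) κ)
    ≡⟨ sym (pick-∑ f κ) ⟩
  pick (λ x ν → ∑ f (λ t → proj₂ t * (𝟙 (x ≡ᵇ i) * matchings (proj₁ t) ν))) κ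
    ≡⟨ pick-cong (λ x ν → trans (∑-cong f (λ t → x∙yz≈y∙xz (proj₂ t) (𝟙 (x ≡ᵇ i)) (matchings (proj₁ t) ν))) (∑-*ˡ (𝟙 (x ≡ᵇ i)) f)) κ ⟩
  pick (λ x ν → 𝟙 (x ≡ᵇ i) * ⟨ f ∣ ν ⟩) κ ∎

-- Euler's identity for a homogeneous function.
pick-sum : ∀ (G : ℕ → ℚ) (w : ℕ → ℚ) κ →
  pick (λ x ν → ℕtoℚ x * (G (x ℕ.+ sum ν) * (w x * ∏ w ν))) κ ≡ ℕtoℚ (sum κ) * (G (sum κ) * ∏ w κ)
pick-sum G w []      = sym (R.zeroˡ _)
pick-sum G w (k ∷ κ) = begin
  ℕtoℚ k * (G (k ℕ.+ sum κ) * (w k * ∏ w κ)) + pick (λ x ν → ℕtoℚ x * (G (x ℕ.+ (k ℕ.+ sum ν)) * (w x * (w k * ∏ w ν)))) κ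
    ≡⟨ cong₂ _+_ refl (pick-cong (λ x ν → trans (cong (λ z → ℕtoℚ x * (G z * (w x * (w k * ∏ w ν)))) (shift x (sum ν))) (pull (ℕtoℚ x) (G (k ℕ.+ (x ℕ.+ sum ν))) (w x) (w k) (∏ w ν))) κ) ⟩
  ℕtoℚ k * (G (k ℕ.+ sum κ) * (w k * ∏ w κ)) + pick (λ x ν → w k * (ℕtoℚ x * (G (k ℕ.+ (x ℕ.+ sum ν)) * (w x * ∏ w ν)))) κ
    ≡⟨ cong₂ _+_ refl (trans (pick-*ˡ (w k) κ) (cong (w k *_) (pick-sum (λ z → G (k ℕ.+ z)) w κ))) ⟩
  ℕtoℚ k * (G (k ℕ.+ sum κ) * (w k * ∏ w κ)) + w k * (ℕtoℚ (sum κ) * (G (k ℕ.+ sum κ) * ∏ w κ))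
    ≡⟨ collect (ℕtoℚ k) (G (k ℕ.+ sum κ)) (w k) (∏ w κ) (ℕtoℚ (sum κ)) ⟩
  (ℕtoℚ k + ℕtoℚ (sum κ)) * (G (k ℕ.+ sum κ) * (w k * ∏ w κ))
    ≡⟨ cong (_* (G (k ℕ.+ sum κ) * (w k * ∏ w κ))) (sym (ℕtoℚ-+ k (sum κ))) ⟩
  ℕtoℚ (k ℕ.+ sum κ) * (G (k ℕ.+ sum κ) * (w k * ∏ w κ)) ∎
  where
  shift : ∀ x s → x ℕ.+ (k ℕ.+ s) ≡ k ℕ.+ (x ℕ.+ s)
  shift x s = trans (sym (ℕP.+-assoc x k s)) (trans (cong (ℕ._+ s) (ℕP.+-comm x k)) (ℕP.+-assoc k x s))
  opaque
    unfolding _+_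
    pull : ∀ a b c d e → a * (b * (c * (d * e))) ≡ d * (a * (b * (c * e)))
    pull = solve-∀ ℚ-ring
    collect : ∀ a b c d e → a * (b * (c * d)) + c * (e * (b * d)) ≡ (a + e) * (b * (c * d))
    collect = solve-∀ ℚ-ring

newton-weight : (ℕ → ℚ) → ℕ → ℚ
newton-weight s x = s (x ∸ 1) * inv x

-- The recursion characterises the series `exp (Σ s_(k-1) p_k t^k / k)`. Its derivative along `κ` at
-- 0 is the product of the numbers `s_(x-1) / x`, in degree `sum κ`. Constant `s = 1` gives h,
-- alternating signs give e.
module Newton (X : ℕ → Sym) (s : ℕ → ℚ)
  (X-zero : ∀ κ → ⟨ X 0 ∣ κ ⟩ ≡ 𝟙 (null κ))
  (X-suc : ∀ k κ → ⟨ X (suc k) ∣ κ ⟩ ≡ inv (suc k) * ∑ (upTo (suc k)) (λ i → s i * ⟨ pS (suc i) *S X (k ∸ i) ∣ κ ⟩)) where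

  w : ℕ → ℚ
  w = newton-weight s

  -- Only the index `i = x - 1` survives. Its weight `s (x - 1)` is rewritten as `x` times `w x`,
  -- the form in which Euler's identity can sum over the chosen part.
  coefficient : ∀ k → (∀ j → j ≤ k → ∀ ν → ⟨ X j ∣ ν ⟩ ≡ 𝟙 (sum ν ≡ᵇ j) * ∏ w ν) → ∀ x ν →
    ∑ (upTo (suc k)) (λ i → s i * (𝟙 (x ≡ᵇ suc i) * ⟨ X (k ∸ i) ∣ ν ⟩)) ≡ ℕtoℚ x * (𝟙 (x ℕ.+ sum ν ≡ᵇ suc k) * (w x * ∏ w ν))
  coefficient k ih zero ν = trans (∑-zero-∈ (upTo (suc k)) (λ {i} _ → trans (cong (s i *_) (R.zeroˡ _)) (R.zeroʳ (s i)))) (sym (R.zeroˡ _))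
  coefficient k ih (suc y) ν with y ℕP.≤? k
  ... | yes y≤k = begin
    ∑ (upTo (suc k)) (λ i → s i * (𝟙 (y ≡ᵇ i) * ⟨ X (k ∸ i) ∣ ν ⟩))
      ≡⟨ ∑-cong (upTo (suc k)) (λ i → x∙yz≈y∙xz (s i) (𝟙 (y ≡ᵇ i)) _) ⟩
    ∑ (upTo (suc k)) (λ i → 𝟙 (y ≡ᵇ i) * (s i * ⟨ X (k ∸ i) ∣ ν ⟩))
      ≡⟨ ∑-𝟙≡ (UP.upTo⁺ (suc k)) (∈P.∈-upTo⁺ (s≤s y≤k)) (λ i → s i * ⟨ X (k ∸ i) ∣ ν ⟩) ⟩
    s y * ⟨ X (k ∸ y) ∣ ν ⟩
      ≡⟨ cong (s y *_) (ih (k ∸ y) (ℕP.m∸n≤m k y) ν) ⟩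
    s y * (𝟙 (sum ν ≡ᵇ k ∸ y) * ∏ w ν)
      ≡⟨ cong (λ b → s y * (𝟙 b * ∏ w ν)) (Bool-ext (λ t → ℕP.≡⇒≡ᵇ _ _ (trans (cong (y ℕ.+_) (ℕP.≡ᵇ⇒≡ (sum ν) _ t)) (ℕP.m+[n∸m]≡n y≤k)))
                                                    (λ t → ℕP.≡⇒≡ᵇ _ _ (trans (sym (ℕP.m+n∸m≡n y (sum ν))) (cong (_∸ y) (ℕP.≡ᵇ⇒≡ (y ℕ.+ sum ν) k t))))) ⟩
    s y * (𝟙 (y ℕ.+ sum ν ≡ᵇ k) * ∏ w ν)
      ≡⟨ sym (R.*-identityˡ _) ⟩
    1ℚ * (s y * (𝟙 (y ℕ.+ sum ν ≡ᵇ k) * ∏ w ν))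
      ≡⟨ cong (_* (s y * (𝟙 (y ℕ.+ sum ν ≡ᵇ k) * ∏ w ν))) (sym (inv-inverseˡ y)) ⟩
    inv (suc y) * ℕtoℚ (suc y) * (s y * (𝟙 (y ℕ.+ sum ν ≡ᵇ k) * ∏ w ν))
      ≡⟨ rearrange (inv (suc y)) (ℕtoℚ (suc y)) (s y) (𝟙 (y ℕ.+ sum ν ≡ᵇ k)) (∏ w ν) ⟩
    ℕtoℚ (suc y) * (𝟙 (y ℕ.+ sum ν ≡ᵇ k) * (s y * inv (suc y) * ∏ w ν)) ∎
    where
    opaque
      unfolding _+_
      rearrange : ∀ a b c d e → a * b * (c * (d * e)) ≡ b * (d * (c * a * e))
      rearrange = solve-∀ ℚ-ring
  ... | no y≰k = trans
    (∑-zero-∈ (upTo (suc k)) (λ {i} m → trans (cong (λ b → s i * (𝟙 b * ⟨ X (k ∸ i) ∣ ν ⟩)) (≡ᵇ-false {y} {i} (λ { refl → y≰k (ℕP.≤-pred (∈P.∈-upTo⁻ m)) })))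
                                             (trans (cong (s i *_) (R.zeroˡ _)) (R.zeroʳ (s i)))))
    (sym (trans (cong (λ b → ℕtoℚ (suc y) * (𝟙 b * (w (suc y) * ∏ w ν))) (≡ᵇ-false {y ℕ.+ sum ν} {k} (λ { refl → y≰k (ℕP.m≤m+n y (sum ν)) })))
                (trans (cong (ℕtoℚ (suc y) *_) (R.zeroˡ _)) (R.zeroʳ (ℕtoℚ (suc y))))))

  -- Newton's recursion reaches all smaller degrees at once; the bound `k` makes the induction
  -- structural.
  pairing-≤ : ∀ k j → j ≤ k → ∀ κ → ⟨ X j ∣ κ ⟩ ≡ 𝟙 (sum κ ≡ᵇ j) * ∏ w κ
  pairing-≤ k       zero    z≤n []           = trans (X-zero []) (sym (R.*-identityˡ 1ℚ))
  -- Parts 0 do not change the degree; the right side vanishes because `inv 0 = 0`.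
  pairing-≤ k       zero    z≤n (zero ∷ κ)   = trans (X-zero (0 ∷ κ)) (sym (trans (cong (𝟙 (sum κ ≡ᵇ 0) *_) (trans (cong (_* ∏ w κ) (R.zeroʳ (s 0))) (R.zeroˡ _))) (R.zeroʳ _)))
  pairing-≤ k       zero    z≤n (suc x ∷ κ)  = trans (X-zero (suc x ∷ κ)) (sym (R.zeroˡ _))
  pairing-≤ (suc k) (suc j) (s≤s j≤k) κ = begin
    ⟨ X (suc j) ∣ κ ⟩
      ≡⟨ X-suc j κ ⟩
    inv (suc j) * ∑ (upTo (suc j)) (λ i → s i * ⟨ pS (suc i) *S X (j ∸ i) ∣ κ ⟩)
      ≡⟨ cong (inv (suc j) *_) (∑-cong (upTo (suc j)) (λ i → trans (cong (s i *_) (⟨pS*⟩ (suc i) (X (j ∸ i)) κ)) (sym (pick-*ˡ (s i) κ)))) ⟩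
    inv (suc j) * ∑ (upTo (suc j)) (λ i → pick (λ x ν → s i * (𝟙 (x ≡ᵇ suc i) * ⟨ X (j ∸ i) ∣ ν ⟩)) κ)
      ≡⟨ cong (inv (suc j) *_) (sym (pick-∑ (upTo (suc j)) κ)) ⟩
    inv (suc j) * pick (λ x ν → ∑ (upTo (suc j)) (λ i → s i * (𝟙 (x ≡ᵇ suc i) * ⟨ X (j ∸ i) ∣ ν ⟩))) κ
      ≡⟨ cong (inv (suc j) *_) (pick-cong (coefficient j (λ i i≤j → pairing-≤ k i (ℕP.≤-trans i≤j j≤k))) κ) ⟩
    inv (suc j) * pick (λ x ν → ℕtoℚ x * (𝟙 (x ℕ.+ sum ν ≡ᵇ suc j) * (w x * ∏ w ν))) κ
      ≡⟨ cong (inv (suc j) *_) (pick-sum (λ z → 𝟙 (z ≡ᵇ suc j)) w κ) ⟩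
    inv (suc j) * (ℕtoℚ (sum κ) * (𝟙 (sum κ ≡ᵇ suc j) * ∏ w κ))
      ≡⟨ final (sum κ) ⟩
    𝟙 (sum κ ≡ᵇ suc j) * ∏ w κ ∎
    where
    final : ∀ m → inv (suc j) * (ℕtoℚ m * (𝟙 (m ≡ᵇ suc j) * ∏ w κ)) ≡ 𝟙 (m ≡ᵇ suc j) * ∏ w κ
    final m with m ≡ᵇ suc j in e
    ... | true rewrite ℕP.≡ᵇ⇒≡ m (suc j) (≡⇒T e) =
      trans (sym (R.*-assoc (inv (suc j)) (ℕtoℚ (suc j)) _)) (trans (cong (_* (1ℚ * ∏ w κ)) (inv-inverseˡ j)) (R.*-identityˡ _))
    ... | false = trans (cong (λ z → inv (suc j) * (ℕtoℚ m * z)) (R.zeroˡ (∏ w κ)))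
                        (trans (cong (inv (suc j) *_) (R.zeroʳ (ℕtoℚ m))) (trans (R.zeroʳ (inv (suc j))) (sym (R.zeroˡ (∏ w κ)))))

  pairing : ∀ k κ → ⟨ X k ∣ κ ⟩ ≡ 𝟙 (sum κ ≡ᵇ k) * ∏ w κ
  pairing k = pairing-≤ k k ℕP.≤-refl

zip-map : ∀ (f : A → B) xs → zip xs (map f xs) ≡ map (λ x → (x , f x)) xs
zip-map f []       = refl
zip-map f (x ∷ xs) = cong ((x , f x) ∷_) (zip-map f xs)

hList-map : ∀ k → hList k ≡ map (λ i → hS (k ∸ i)) (upTo (suc k))
hList-map zero    = refl
hList-map (suc k) = cong (hS (suc k) ∷_) (trans (hList-map k) (trans (LP.map-∘ (upTo (suc k))) (cong (map (λ i → hS (suc k ∸ i))) (LP.map-upTo suc (suc k)))))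

eList-map : ∀ k → eList k ≡ map (λ i → eS (k ∸ i)) (upTo (suc k))
eList-map zero    = refl
eList-map (suc k) = cong (eS (suc k) ∷_) (trans (eList-map k) (trans (LP.map-∘ (upTo (suc k))) (cong (map (λ i → eS (suc k ∸ i))) (LP.map-upTo suc (suc k)))))

hS-suc : ∀ k κ → ⟨ hS (suc k) ∣ κ ⟩ ≡ inv (suc k) * ∑ (upTo (suc k)) (λ i → 1ℚ * ⟨ pS (suc i) *S hS (k ∸ i) ∣ κ ⟩)
hS-suc k κ = begin
  ⟨ hS (suc k) ∣ κ ⟩
    ≡⟨ ⟨scaleS⟩ (inv (suc k)) (sumS (map F (zip (upTo (suc k)) (hList k)))) κ ⟩
  inv (suc k) * ⟨ sumS (map F (zip (upTo (suc k)) (hList k))) ∣ κ ⟩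
    ≡⟨ cong (inv (suc k) *_) (⟨sumS⟩ (zip (upTo (suc k)) (hList k)) F κ) ⟩
  inv (suc k) * ∑ (zip (upTo (suc k)) (hList k)) (λ z → ⟨ F z ∣ κ ⟩)
    ≡⟨ cong (λ l → inv (suc k) * ∑ l (λ z → ⟨ F z ∣ κ ⟩)) (trans (cong (zip (upTo (suc k))) (hList-map k)) (zip-map _ (upTo (suc k)))) ⟩
  inv (suc k) * ∑ (map (λ i → (i , hS (k ∸ i))) (upTo (suc k))) (λ z → ⟨ F z ∣ κ ⟩)
    ≡⟨ cong (inv (suc k) *_) (trans (∑-map _ (upTo (suc k))) (∑-cong (upTo (suc k)) (λ i → sym (R.*-identityˡ ⟨ F (i , hS (k ∸ i)) ∣ κ ⟩)))) ⟩
  inv (suc k) * ∑ (upTo (suc k)) (λ i → 1ℚ * ⟨ pS (suc i) *S hS (k ∸ i) ∣ κ ⟩) ∎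
  where
  F : ℕ × Sym → Sym
  F ih = pS (suc (proj₁ ih)) *S proj₂ ih

eS-suc : ∀ k κ → ⟨ eS (suc k) ∣ κ ⟩ ≡ inv (suc k) * ∑ (upTo (suc k)) (λ i → sgnℚ i * ⟨ pS (suc i) *S eS (k ∸ i) ∣ κ ⟩)
eS-suc k κ = begin
  ⟨ eS (suc k) ∣ κ ⟩
    ≡⟨ ⟨scaleS⟩ (inv (suc k)) (sumS (map F (zip (upTo (suc k)) (eList k)))) κ ⟩
  inv (suc k) * ⟨ sumS (map F (zip (upTo (suc k)) (eList k))) ∣ κ ⟩
    ≡⟨ cong (inv (suc k) *_) (⟨sumS⟩ (zip (upTo (suc k)) (eList k)) F κ) ⟩
  inv (suc k) * ∑ (zip (upTo (suc k)) (eList k)) (λ z → ⟨ F z ∣ κ ⟩)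
    ≡⟨ cong (λ l → inv (suc k) * ∑ l (λ z → ⟨ F z ∣ κ ⟩)) (trans (cong (zip (upTo (suc k))) (eList-map k)) (zip-map _ (upTo (suc k)))) ⟩
  inv (suc k) * ∑ (map (λ i → (i , eS (k ∸ i))) (upTo (suc k))) (λ z → ⟨ F z ∣ κ ⟩)
    ≡⟨ cong (inv (suc k) *_) (trans (∑-map _ (upTo (suc k))) (∑-cong (upTo (suc k)) (λ i → ⟨scaleS⟩ (sgnℚ i) (pS (suc i) *S eS (k ∸ i)) κ))) ⟩
  inv (suc k) * ∑ (upTo (suc k)) (λ i → sgnℚ i * ⟨ pS (suc i) *S eS (k ∸ i) ∣ κ ⟩) ∎
  where
  F : ℕ × Sym → Sym
  F ie = scaleS (sgnℚ (proj₁ ie)) (pS (suc (proj₁ ie)) *S proj₂ ie)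

module NewtonH = Newton hS (λ _ → 1ℚ) ⟨1S⟩ hS-suc
module NewtonE = Newton eS sgnℚ ⟨1S⟩ eS-suc

∏-cong : ∀ {v w : A → ℚ} → (∀ x → v x ≡ w x) → ∀ κ → ∏ v κ ≡ ∏ w κ
∏-cong h []      = refl
∏-cong h (x ∷ κ) = cong₂ _*_ (h x) (∏-cong h κ)

∏-* : ∀ (v w : A → ℚ) κ → ∏ (λ x → v x * w x) κ ≡ ∏ v κ * ∏ w κ
∏-* v w []      = sym (R.*-identityˡ 1ℚ)
∏-* v w (x ∷ κ) = trans (cong (v x * w x *_) (∏-* v w κ)) (lemma (v x) (w x) (∏ v κ) (∏ w κ))
  where
  opaque
    unfolding _+_
    lemma : ∀ a b c d → a * b * (c * d) ≡ a * c * (b * d)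
    lemma = solve-∀ ℚ-ring

-- Expanding the product on the right means choosing `v` or `w` at each entry, that is, splitting
-- the list.
∑⊎-∏∏ : ∀ (v w : A → ℚ) κ → ∑⊎ (λ μ ν → ∏ v μ * ∏ w ν) κ ≡ ∏ (λ x → v x + w x) κ
∑⊎-∏∏ v w []      = R.*-identityˡ 1ℚ
∑⊎-∏∏ v w (x ∷ κ) = begin
  ∑⊎ (λ μ ν → v x * ∏ v μ * ∏ w ν) κ + ∑⊎ (λ μ ν → ∏ v μ * (w x * ∏ w ν)) κ
    ≡⟨ cong₂ _+_ (trans (∑⊎-cong (λ μ ν → R.*-assoc (v x) _ _) κ) (∑⊎-*ˡ (v x) κ))
                 (trans (∑⊎-cong (λ μ ν → x∙yz≈y∙xz _ (w x) _) κ) (∑⊎-*ˡ (w x) κ)) ⟩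
  v x * ∑⊎ (λ μ ν → ∏ v μ * ∏ w ν) κ + w x * ∑⊎ (λ μ ν → ∏ v μ * ∏ w ν) κ
    ≡⟨ sym (R.distribʳ _ (v x) (w x)) ⟩
  (v x + w x) * ∑⊎ (λ μ ν → ∏ v μ * ∏ w ν) κ
    ≡⟨ cong ((v x + w x) *_) (∑⊎-∏∏ v w κ) ⟩
  (v x + w x) * ∏ (λ x → v x + w x) κ ∎

∑⊎-sum : ∀ (F : ℕ → ℚ) {φ : List ℕ → List ℕ → ℚ} κ → ∑⊎ (λ μ ν → F (sum μ ℕ.+ sum ν) * φ μ ν) κ ≡ F (sum κ) * ∑⊎ φ κ
∑⊎-sum F []      = refl
∑⊎-sum F {φ} (x ∷ κ) = begin
  ∑⊎ (λ μ ν → F (x ℕ.+ sum μ ℕ.+ sum ν) * φ (x ∷ μ) ν) κ + ∑⊎ (λ μ ν → F (sum μ ℕ.+ (x ℕ.+ sum ν)) * φ μ (x ∷ ν)) κ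
    ≡⟨ cong₂ _+_ (∑⊎-cong (λ μ ν → cong (λ z → F z * φ (x ∷ μ) ν) (ℕP.+-assoc x (sum μ) (sum ν))) κ)
                 (∑⊎-cong (λ μ ν → cong (λ z → F z * φ μ (x ∷ ν)) (shift (sum μ) (sum ν))) κ) ⟩
  ∑⊎ (λ μ ν → F (x ℕ.+ (sum μ ℕ.+ sum ν)) * φ (x ∷ μ) ν) κ + ∑⊎ (λ μ ν → F (x ℕ.+ (sum μ ℕ.+ sum ν)) * φ μ (x ∷ ν)) κ
    ≡⟨ cong₂ _+_ (∑⊎-sum (λ z → F (x ℕ.+ z)) κ) (∑⊎-sum (λ z → F (x ℕ.+ z)) κ) ⟩
  F (x ℕ.+ sum κ) * ∑⊎ (λ μ → φ (x ∷ μ)) κ + F (x ℕ.+ sum κ) * ∑⊎ (λ μ ν → φ μ (x ∷ ν)) κ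
    ≡⟨ sym (R.distribˡ _ _ _) ⟩
  F (x ℕ.+ sum κ) * (∑⊎ (λ μ → φ (x ∷ μ)) κ + ∑⊎ (λ μ ν → φ μ (x ∷ ν)) κ) ∎
  where
  shift : ∀ a b → a ℕ.+ (x ℕ.+ b) ≡ x ℕ.+ (a ℕ.+ b)
  shift a b = trans (sym (ℕP.+-assoc a x b)) (trans (cong (ℕ._+ b) (ℕP.+-comm a x)) (ℕP.+-assoc x a b))

-- Weights of the factors h_k, q_k = 2 P_k and P_k

ip : List ℕ → ℚ
ip = ∏ inv

2ℚ : ℚ
2ℚ = 1ℚ + 1ℚ

oddWeight : ℚ → List ℕ → ℚ
oddWeight c = ∏ (λ x → 𝟙 (odd x) * c)

-- `P_k` has a factor 1/2 for `k ≥ 1`, while `P_0 = 1` has none. So one factor 2 is missing exactly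
-- for nonempty lists; it is dropped at the head.
halfWeight : List ℕ → ℚ
halfWeight []      = 1ℚ
halfWeight (x ∷ κ) = 𝟙 (odd x) * oddWeight 2ℚ κ

odd-suc : ∀ n → odd (suc n) ≡ not (odd n)
odd-suc zero          = refl
odd-suc (suc zero)    = refl
odd-suc (suc (suc n)) = odd-suc n

opaque
  unfolding _+_

  -- The sum of `1/x` and `(-1)^(x-1)/x` is `2/x` for odd `x` and 0 for even `x`: multiplying the
  -- series of h and e leaves only the odd power sums, doubled.
  inv-+-sgnℚ : ∀ x → 1ℚ * inv x + newton-weight sgnℚ x ≡ inv x * (𝟙 (odd x) * 2ℚ)
  inv-+-sgnℚ zero = refl
  inv-+-sgnℚ (suc y) rewrite odd-suc y with odd y
  ... | true  = lemma (inv (suc y))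
    where
    lemma : ∀ a → 1ℚ * a + - 1ℚ * a ≡ a * (0ℚ * (1ℚ + 1ℚ))
    lemma = solve-∀ ℚ-ring
  ... | false = lemma (inv (suc y))
    where
    lemma : ∀ a → 1ℚ * a + 1ℚ * a ≡ a * (1ℚ * (1ℚ + 1ℚ))
    lemma = solve-∀ ℚ-ring

  inv2-2ℚ : ∀ b → inv 2 * (b * 2ℚ) ≡ b
  inv2-2ℚ b = trans (lemma (inv 2) b) (trans (cong (_* b) (inv-inverseˡ 1)) (R.*-identityˡ b))
    where
    lemma : ∀ a b → a * (b * (1ℚ + 1ℚ)) ≡ a * (1ℚ + 1ℚ) * b
    lemma = solve-∀ ℚ-ring

-- The trailing factor 1 is the slot weight, which brings h into the same shape as `⟨PS⟩`.
⟨hS⟩ : ∀ k κ → ⟨ hS k ∣ κ ⟩ ≡ ip κ * (𝟙 (sum κ ≡ᵇ k) * 1ℚ)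
⟨hS⟩ k κ = begin
  ⟨ hS k ∣ κ ⟩                                    ≡⟨ NewtonH.pairing k κ ⟩
  𝟙 (sum κ ≡ᵇ k) * ∏ (λ x → 1ℚ * inv x) κ         ≡⟨ cong (𝟙 (sum κ ≡ᵇ k) *_) (∏-cong (λ x → R.*-identityˡ (inv x)) κ) ⟩
  𝟙 (sum κ ≡ᵇ k) * ip κ                           ≡⟨ R.*-comm _ (ip κ) ⟩
  ip κ * 𝟙 (sum κ ≡ᵇ k)                           ≡⟨ cong (ip κ *_) (sym (R.*-identityʳ _)) ⟩
  ip κ * (𝟙 (sum κ ≡ᵇ k) * 1ℚ)                    ∎

∑-convolution : ∀ k a b → a ℕ.+ b ≡ k ⊎ a ℕ.+ b ≢ k → ∑ (range 0 k) (λ i → 𝟙 (a ≡ᵇ i) * 𝟙 (b ≡ᵇ k ∸ i)) ≡ 𝟙 (a ℕ.+ b ≡ᵇ k)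
∑-convolution k a b (inj₁ refl) = trans (∑-𝟙≡ (range-! 0 k) (range-∈⁺ z≤n (ℕP.m≤m+n a b)) (λ i → 𝟙 (b ≡ᵇ k ∸ i)))
  (cong 𝟙 (trans (trans (cong (b ≡ᵇ_) (ℕP.m+n∸m≡n a b)) (≡ᵇ-refl b)) (sym (≡ᵇ-refl (a ℕ.+ b)))))
∑-convolution k a b (inj₂ ne) = trans (∑-zero-∈ (range 0 k) zeros) (cong 𝟙 (sym (≡ᵇ-false ne)))
  where
  zeros : ∀ {i} → i ∈ range 0 k → 𝟙 (a ≡ᵇ i) * 𝟙 (b ≡ᵇ k ∸ i) ≡ 0ℚ
  zeros {i} m with a ≡ᵇ i in p
  ... | false = R.zeroˡ _
  ... | true rewrite sym (ℕP.≡ᵇ⇒≡ a i (≡⇒T p)) =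
    trans (R.*-identityˡ _) (cong 𝟙 (≡ᵇ-false {b} {k ∸ a} (λ { refl → ne (ℕP.m+[n∸m]≡n (proj₂ (range-∈⁻ 0 k m))) })))

⟨PS-suc⟩ : ∀ k κ → ⟨ PS (suc k) ∣ κ ⟩ ≡ 𝟙 (sum κ ≡ᵇ suc k) * (ip κ * (inv 2 * oddWeight 2ℚ κ))
⟨PS-suc⟩ k κ = begin
  ⟨ PS (suc k) ∣ κ ⟩
    ≡⟨ ⟨scaleS⟩ (inv 2) (sumS (map F (range 0 (suc k)))) κ ⟩
  inv 2 * ⟨ sumS (map F (range 0 (suc k))) ∣ κ ⟩
    ≡⟨ cong (inv 2 *_) (trans (⟨sumS⟩ (range 0 (suc k)) F κ) (∑-cong (range 0 (suc k)) (λ i → ⟨*S⟩ (hS i) (eS (suc k ∸ i)) κ))) ⟩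
  inv 2 * ∑ (range 0 (suc k)) (λ i → ∑⊎ (λ μ ν → ⟨ hS i ∣ μ ⟩ * ⟨ eS (suc k ∸ i) ∣ ν ⟩) κ)
    ≡⟨ cong (inv 2 *_) (sym (∑⊎-∑ (range 0 (suc k)) κ)) ⟩
  inv 2 * ∑⊎ (λ μ ν → ∑ (range 0 (suc k)) (λ i → ⟨ hS i ∣ μ ⟩ * ⟨ eS (suc k ∸ i) ∣ ν ⟩)) κ
    ≡⟨ cong (inv 2 *_) (∑⊎-cong inner κ) ⟩
  inv 2 * ∑⊎ (λ μ ν → 𝟙 (sum μ ℕ.+ sum ν ≡ᵇ suc k) * (∏ NewtonH.w μ * ∏ NewtonE.w ν)) κ
    ≡⟨ cong (inv 2 *_) (trans (∑⊎-sum (λ z → 𝟙 (z ≡ᵇ suc k)) κ) (cong (𝟙 (sum κ ≡ᵇ suc k) *_) (∑⊎-∏∏ NewtonH.w NewtonE.w κ))) ⟩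
  inv 2 * (𝟙 (sum κ ≡ᵇ suc k) * ∏ (λ x → NewtonH.w x + NewtonE.w x) κ)
    ≡⟨ cong (λ z → inv 2 * (𝟙 (sum κ ≡ᵇ suc k) * z)) (trans (∏-cong inv-+-sgnℚ κ) (∏-* inv (λ x → 𝟙 (odd x) * 2ℚ) κ)) ⟩
  inv 2 * (𝟙 (sum κ ≡ᵇ suc k) * (ip κ * oddWeight 2ℚ κ))
    ≡⟨ trans (x∙yz≈y∙xz (inv 2) _ _) (cong (𝟙 (sum κ ≡ᵇ suc k) *_) (x∙yz≈y∙xz (inv 2) (ip κ) _)) ⟩
  𝟙 (sum κ ≡ᵇ suc k) * (ip κ * (inv 2 * oddWeight 2ℚ κ)) ∎
  where
  opaque
    unfolding _+_
    regroup : ∀ a b c d → a * b * (c * d) ≡ a * c * (b * d)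
    regroup = solve-∀ ℚ-ring
  F : ℕ → Sym
  F i = hS i *S eS (suc k ∸ i)
  dec : ∀ a → a ≡ suc k ⊎ a ≢ suc k
  dec a with a ℕ.≟ suc k
  ... | yes p = inj₁ p
  ... | no  p = inj₂ p
  inner : ∀ μ ν → ∑ (range 0 (suc k)) (λ i → ⟨ hS i ∣ μ ⟩ * ⟨ eS (suc k ∸ i) ∣ ν ⟩) ≡ 𝟙 (sum μ ℕ.+ sum ν ≡ᵇ suc k) * (∏ NewtonH.w μ * ∏ NewtonE.w ν)
  inner μ ν = trans (∑-cong (range 0 (suc k)) (λ i → trans (cong₂ _*_ (NewtonH.pairing i μ) (NewtonE.pairing (suc k ∸ i) ν))
      (regroup (𝟙 (sum μ ≡ᵇ i)) (∏ NewtonH.w μ) (𝟙 (sum ν ≡ᵇ suc k ∸ i)) (∏ NewtonE.w ν))))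
    (trans (∑-*ʳ _ (range 0 (suc k))) (cong (_* (∏ NewtonH.w μ * ∏ NewtonE.w ν)) (∑-convolution (suc k) (sum μ) (sum ν) (dec (sum μ ℕ.+ sum ν)))))

⟨PS⟩ : ∀ k κ → ⟨ PS k ∣ κ ⟩ ≡ ip κ * (𝟙 (sum κ ≡ᵇ k) * halfWeight κ)
⟨PS⟩ zero    []          = trans (⟨1S⟩ []) (sym (trans (R.*-identityˡ _) (R.*-identityˡ 1ℚ)))
⟨PS⟩ zero    (zero ∷ κ)  = trans (⟨1S⟩ (0 ∷ κ)) (sym (trans (cong (_* (𝟙 (sum κ ≡ᵇ 0) * halfWeight (0 ∷ κ))) (R.zeroˡ (ip κ))) (R.zeroˡ _)))
⟨PS⟩ zero    (suc x ∷ κ) = trans (⟨1S⟩ (suc x ∷ κ)) (sym (trans (cong (ip (suc x ∷ κ) *_) (R.zeroˡ _)) (R.zeroʳ _)))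
⟨PS⟩ (suc k) []          = trans (⟨PS-suc⟩ k []) (trans (R.zeroˡ _) (sym (trans (cong (ip [] *_) (R.zeroˡ 1ℚ)) (R.zeroʳ (ip [])))))
⟨PS⟩ (suc k) (x ∷ κ)     = begin
  ⟨ PS (suc k) ∣ x ∷ κ ⟩
    ≡⟨ ⟨PS-suc⟩ k (x ∷ κ) ⟩
  𝟙 (sum (x ∷ κ) ≡ᵇ suc k) * (ip (x ∷ κ) * (inv 2 * (𝟙 (odd x) * 2ℚ * oddWeight 2ℚ κ)))
    ≡⟨ x∙yz≈y∙xz (𝟙 (sum (x ∷ κ) ≡ᵇ suc k)) (ip (x ∷ κ)) _ ⟩
  ip (x ∷ κ) * (𝟙 (sum (x ∷ κ) ≡ᵇ suc k) * (inv 2 * (𝟙 (odd x) * 2ℚ * oddWeight 2ℚ κ)))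
    ≡⟨ cong (λ z → ip (x ∷ κ) * (𝟙 (sum (x ∷ κ) ≡ᵇ suc k) * z)) (trans (sym (R.*-assoc (inv 2) _ _)) (cong (_* oddWeight 2ℚ κ) (inv2-2ℚ (𝟙 (odd x))))) ⟩
  ip (x ∷ κ) * (𝟙 (sum (x ∷ κ) ≡ᵇ suc k) * (𝟙 (odd x) * oddWeight 2ℚ κ)) ∎

-- Shiftification in the power-sum basis

∏-↭ : ∀ (w : A → ℚ) {xs ys} → xs ↭ ys → ∏ w xs ≡ ∏ w ys
∏-↭ w ↭refl        = refl
∏-↭ w (prep x p)   = cong (w x *_) (∏-↭ w p)
∏-↭ w (swap x y p) = trans (cong (λ z → w x * (w y * z)) (∏-↭ w p)) (x∙yz≈y∙xz (w x) (w y) _)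
∏-↭ w (↭trans p q) = trans (∏-↭ w p) (∏-↭ w q)

oddWeight-2 : ∀ μ → 𝟙 (all odd μ) * ℕtoℚ (2 ^ length μ) ≡ oddWeight 2ℚ μ
oddWeight-2 []      = R.*-identityˡ 1ℚ
oddWeight-2 (x ∷ μ) = begin
  𝟙 (odd x ∧ all odd μ) * ℕtoℚ (2 ℕ.* 2 ^ length μ)            ≡⟨ cong₂ _*_ (𝟙-∧ (odd x) (all odd μ)) (trans (ℕtoℚ-* 2 (2 ^ length μ)) (cong (_* ℕtoℚ (2 ^ length μ)) (ℕtoℚ-+ 1 1))) ⟩
  𝟙 (odd x) * 𝟙 (all odd μ) * (2ℚ * ℕtoℚ (2 ^ length μ))       ≡⟨ lemma (𝟙 (odd x)) (𝟙 (all odd μ)) 2ℚ (ℕtoℚ (2 ^ length μ)) ⟩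
  𝟙 (odd x) * 2ℚ * (𝟙 (all odd μ) * ℕtoℚ (2 ^ length μ))       ≡⟨ cong (𝟙 (odd x) * 2ℚ *_) (oddWeight-2 μ) ⟩
  𝟙 (odd x) * 2ℚ * oddWeight 2ℚ μ                              ∎
  where
  opaque
    unfolding _+_
    lemma : ∀ a b c d → a * b * (c * d) ≡ a * c * (b * d)
    lemma = solve-∀ ℚ-ring

-- Both sides vanish unless `μ` is a rearrangement of `κ`. This moves a weight from the monomials to
-- the list they are paired with.
∏-matchings : ∀ (w : ℕ → ℚ) μ κ → ∏ w μ * matchings μ κ ≡ ∏ w κ * matchings μ κ
∏-matchings w μ κ with eqListℕ (sortDec μ) (sortDec κ) in e
... | true  = cong (_* matchings μ κ) (∏-↭ w (↭-trans (↭-sym (sortDec-↭ μ)) (↭-trans (↭-reflexive (eqListℕ⇒≡ _ _ (≡⇒T e))) (sortDec-↭ κ))))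
... | false = trans (cong (∏ w μ *_) z) (trans (R.zeroʳ _) (sym (trans (cong (∏ w κ *_) z) (R.zeroʳ _))))
  where
  z : matchings μ κ ≡ 0ℚ
  z = trans (matchings-fac μ κ) (trans (cong (λ b → ℕtoℚ (fac κ) * 𝟙 b) e) (R.zeroʳ (ℕtoℚ (fac κ))))

-- Shiftification is diagonal in the power-sum basis, so it only rescales each pairing.
⟨sh⟩ : ∀ f κ → ⟨ sh f ∣ κ ⟩ ≡ oddWeight 2ℚ κ * ⟨ f ∣ κ ⟩
⟨sh⟩ f κ = begin
  ⟨ sh f ∣ κ ⟩
    ≡⟨ ∑-concatMap _ f ⟩
  ∑ f (λ t → ∑ (if all odd (proj₁ t) then (proj₁ t , ℕtoℚ (2 ^ length (proj₁ t)) ℚ.* proj₂ t) ∷ [] else []) (λ t → proj₂ t * matchings (proj₁ t) κ))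
    ≡⟨ ∑-cong f (λ t → ∑-if (all odd (proj₁ t)) (proj₁ t , ℕtoℚ (2 ^ length (proj₁ t)) ℚ.* proj₂ t)) ⟩
  ∑ f (λ t → 𝟙 (all odd (proj₁ t)) * ((ℕtoℚ (2 ^ length (proj₁ t)) ℚ.* proj₂ t) * matchings (proj₁ t) κ))
    ≡⟨ ∑-cong f term ⟩
  ∑ f (λ t → oddWeight 2ℚ κ * (proj₂ t * matchings (proj₁ t) κ))
    ≡⟨ ∑-*ˡ (oddWeight 2ℚ κ) f ⟩
  oddWeight 2ℚ κ * ⟨ f ∣ κ ⟩ ∎
  where
  opaque
    unfolding _+_
    lemma : ∀ a b c d → a * (b * c * d) ≡ c * (a * b * d)
    lemma = solve-∀ ℚ-ring
  term : ∀ t → 𝟙 (all odd (proj₁ t)) * ((ℕtoℚ (2 ^ length (proj₁ t)) ℚ.* proj₂ t) * matchings (proj₁ t) κ) ≡ oddWeight 2ℚ κ * (proj₂ t * matchings (proj₁ t) κ)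
  term (μ , c) = begin
    𝟙 (all odd μ) * ((ℕtoℚ (2 ^ length μ) ℚ.* c) * matchings μ κ)   ≡⟨ cong (λ z → 𝟙 (all odd μ) * (z * matchings μ κ)) (*-ℚ (ℕtoℚ (2 ^ length μ)) c) ⟩
    𝟙 (all odd μ) * (ℕtoℚ (2 ^ length μ) * c * matchings μ κ)       ≡⟨ lemma (𝟙 (all odd μ)) (ℕtoℚ (2 ^ length μ)) c (matchings μ κ) ⟩
    c * (𝟙 (all odd μ) * ℕtoℚ (2 ^ length μ) * matchings μ κ)       ≡⟨ cong (λ z → c * (z * matchings μ κ)) (oddWeight-2 μ) ⟩
    c * (oddWeight 2ℚ μ * matchings μ κ)                            ≡⟨ cong (c *_) (∏-matchings _ μ κ) ⟩
    c * (oddWeight 2ℚ κ * matchings μ κ)                            ≡⟨ x∙yz≈y∙xz c (oddWeight 2ℚ κ) _ ⟩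
    oddWeight 2ℚ κ * (c * matchings μ κ)                            ∎

-- Products indexed by a content vector

-- Products are built by concatenation and do not commute as lists. After pairing they do, since
-- splittings can be reassociated and swapped.
⟨prodS⟩-↭ : ∀ (X : ℕ → Sym) {as bs} → as ↭ bs → ∀ κ → ⟨ prodS (map X as) ∣ κ ⟩ ≡ ⟨ prodS (map X bs) ∣ κ ⟩
⟨prodS⟩-↭ X ↭refl κ = refl
⟨prodS⟩-↭ X (prep {as} {bs} a p) κ = trans (⟨*S⟩ (X a) (prodS (map X as)) κ)
  (trans (∑⊎-cong (λ μ ν → cong (⟨ X a ∣ μ ⟩ *_) (⟨prodS⟩-↭ X p ν)) κ) (sym (⟨*S⟩ (X a) (prodS (map X bs)) κ)))
⟨prodS⟩-↭ X (swap {as} {bs} a b p) κ = begin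
  ⟨ X a *S (X b *S prodS (map X as)) ∣ κ ⟩
    ≡⟨ ⟨*S⟩ (X a) (X b *S prodS (map X as)) κ ⟩
  ∑⊎ (λ μ ν → ⟨ X a ∣ μ ⟩ * ⟨ X b *S prodS (map X as) ∣ ν ⟩) κ
    ≡⟨ ∑⊎-cong (λ μ ν → trans (cong (⟨ X a ∣ μ ⟩ *_) (⟨*S⟩ (X b) (prodS (map X as)) ν)) (sym (∑⊎-*ˡ ⟨ X a ∣ μ ⟩ ν))) κ ⟩
  ∑⊎ (λ μ ν → ∑⊎ (λ β γ → ⟨ X a ∣ μ ⟩ * (⟨ X b ∣ β ⟩ * ⟨ prodS (map X as) ∣ γ ⟩)) ν) κ
    ≡⟨ sym (∑⊎-assoc κ) ⟩
  ∑⊎ (λ μ ν → ∑⊎ (λ β γ → ⟨ X a ∣ β ⟩ * (⟨ X b ∣ γ ⟩ * ⟨ prodS (map X as) ∣ ν ⟩)) μ) κ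
    ≡⟨ ∑⊎-cong (λ μ ν → ∑⊎-comm μ) κ ⟩
  ∑⊎ (λ μ ν → ∑⊎ (λ β γ → ⟨ X a ∣ γ ⟩ * (⟨ X b ∣ β ⟩ * ⟨ prodS (map X as) ∣ ν ⟩)) μ) κ
    ≡⟨ ∑⊎-assoc κ ⟩
  ∑⊎ (λ μ ν → ∑⊎ (λ β γ → ⟨ X a ∣ β ⟩ * (⟨ X b ∣ μ ⟩ * ⟨ prodS (map X as) ∣ γ ⟩)) ν) κ
    ≡⟨ ∑⊎-cong (λ μ ν → trans (∑⊎-cong (λ β γ → trans (x∙yz≈y∙xz ⟨ X a ∣ β ⟩ ⟨ X b ∣ μ ⟩ _) (cong (λ z → ⟨ X b ∣ μ ⟩ * (⟨ X a ∣ β ⟩ * z)) (⟨prodS⟩-↭ X p γ))) ν)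
        (trans (∑⊎-*ˡ ⟨ X b ∣ μ ⟩ ν) (cong (⟨ X b ∣ μ ⟩ *_) (sym (⟨*S⟩ (X a) (prodS (map X bs)) ν))))) κ ⟩
  ∑⊎ (λ μ ν → ⟨ X b ∣ μ ⟩ * ⟨ X a *S prodS (map X bs) ∣ ν ⟩) κ
    ≡⟨ ⟨*S⟩ (X b) (X a *S prodS (map X bs)) κ ⟨
  ⟨ X b *S (X a *S prodS (map X bs)) ∣ κ ⟩ ∎
⟨prodS⟩-↭ X (↭trans p q) κ = trans (⟨prodS⟩-↭ X p κ) (⟨prodS⟩-↭ X q κ)

⟨prodS⟩-filter : ∀ (X : ℕ → Sym) → X 0 ≡ 1S → ∀ as κ →
  ⟨ prodS (map X (filterᵇ (λ a → not (a ≡ᵇ 0)) as)) ∣ κ ⟩ ≡ ⟨ prodS (map X as) ∣ κ ⟩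
⟨prodS⟩-filter X X0 []           κ = refl
⟨prodS⟩-filter X X0 (zero ∷ as)  κ = sym (begin
  ⟨ X 0 *S prodS (map X as) ∣ κ ⟩                             ≡⟨ ⟨*S⟩ (X 0) (prodS (map X as)) κ ⟩
  ∑⊎ (λ μ ν → ⟨ X 0 ∣ μ ⟩ * ⟨ prodS (map X as) ∣ ν ⟩) κ       ≡⟨ ∑⊎-cong (λ μ ν → cong (_* ⟨ prodS (map X as) ∣ ν ⟩) (trans (cong (⟨_∣ μ ⟩) X0) (⟨1S⟩ μ))) κ ⟩
  ∑⊎ (λ μ ν → 𝟙 (null μ) * ⟨ prodS (map X as) ∣ ν ⟩) κ        ≡⟨ ∑⊎-identityˡ κ ⟩
  ⟨ prodS (map X as) ∣ κ ⟩                                    ≡⟨ ⟨prodS⟩-filter X X0 as κ ⟨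
  ⟨ prodS (map X (filterᵇ (λ a → not (a ≡ᵇ 0)) as)) ∣ κ ⟩     ∎)
⟨prodS⟩-filter X X0 (suc a ∷ as) κ = trans (⟨*S⟩ (X (suc a)) _ κ)
  (trans (∑⊎-cong (λ μ ν → cong (⟨ X (suc a) ∣ μ ⟩ *_) (⟨prodS⟩-filter X X0 as ν)) κ) (sym (⟨*S⟩ (X (suc a)) (prodS (map X as)) κ)))

-- What remains of the pairing of a product with one factor per slot once the common factor `ip κ`
-- has been taken out.
contentWeight : (List ℕ → ℚ) → List ℕ → List ℕ → ℚ
contentWeight G []       κ = 𝟙 (null κ)
contentWeight G (a ∷ as) κ = ∑⊎ (λ μ ν → 𝟙 (sum μ ≡ᵇ a) * G μ * contentWeight G as ν) κ

⟨prodS⟩-contentWeight : ∀ (X : ℕ → Sym) G → (∀ a κ → ⟨ X a ∣ κ ⟩ ≡ ip κ * (𝟙 (sum κ ≡ᵇ a) * G κ)) →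
  ∀ as κ → ⟨ prodS (map X as) ∣ κ ⟩ ≡ ip κ * contentWeight G as κ
⟨prodS⟩-contentWeight X G h [] []      = trans (⟨1S⟩ []) (sym (R.*-identityˡ 1ℚ))
⟨prodS⟩-contentWeight X G h [] (k ∷ κ) = trans (⟨1S⟩ (k ∷ κ)) (sym (R.zeroʳ (ip (k ∷ κ))))
⟨prodS⟩-contentWeight X G h (a ∷ as) κ = begin
  ⟨ X a *S prodS (map X as) ∣ κ ⟩
    ≡⟨ ⟨*S⟩ (X a) (prodS (map X as)) κ ⟩
  ∑⊎ (λ μ ν → ⟨ X a ∣ μ ⟩ * ⟨ prodS (map X as) ∣ ν ⟩) κ
    ≡⟨ ∑⊎-cong (λ μ ν → trans (cong₂ _*_ (h a μ) (⟨prodS⟩-contentWeight X G h as ν)) (lemma (ip μ) _ (ip ν) _)) κ ⟩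
  ∑⊎ (λ μ ν → ip μ * ip ν * (𝟙 (sum μ ≡ᵇ a) * G μ * contentWeight G as ν)) κ
    ≡⟨ ∑⊎-∏ inv κ ⟨
  ip κ * contentWeight G (a ∷ as) κ ∎
  where
  opaque
    unfolding _+_
    lemma : ∀ a b c d → a * b * (c * d) ≡ a * c * (b * d)
    lemma = solve-∀ ℚ-ring

content : ℕ → List ℕ → List ℕ
content n p = map (α p) (range 1 n)

-- The shape may be replaced by the full content: sorting only permutes the factors, and empty slots
-- contribute `X 0 = 1`.
⟨prodS⟩-shape : ∀ (X : ℕ → Sym) G → X 0 ≡ 1S → (∀ a κ → ⟨ X a ∣ κ ⟩ ≡ ip κ * (𝟙 (sum κ ≡ᵇ a) * G κ)) →
  ∀ n p κ → ⟨ prodS (map X (shape n p)) ∣ κ ⟩ ≡ ip κ * contentWeight G (content n p) κ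
⟨prodS⟩-shape X G X0 h n p κ = trans (⟨prodS⟩-↭ X (sortDec-↭ (filterᵇ (λ a → not (a ≡ᵇ 0)) (content n p))) κ)
  (trans (⟨prodS⟩-filter X X0 (content n p) κ) (⟨prodS⟩-contentWeight X G h (content n p) κ))

-- Powers of tanh

-- The derivative of `tanh^e` is `e (tanh^(e-1) - tanh^(e+1))`; here this is a rule for the whole
-- sequence of powers.
D : (ℕ → ℚ) → ℕ → ℚ
D X zero    = 0ℚ
D X (suc e) = ℕtoℚ (suc e) * (X e - X (suc (suc e)))

-- Z e is the exponential generating function tanh^e y, where all variables of odd index are
-- identified with y: Z e κ is the derivative of order length κ at 0 if κ has odd parts.
Z : ℕ → List ℕ → ℚ
Z e       (k ∷ κ) = 𝟙 (odd k) * D (λ i → Z i κ) e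
Z zero    []      = 1ℚ
Z (suc e) []      = 0ℚ

infixr 7 _⊛_

-- The product of exponential generating functions, in terms of their derivatives at 0.
_⊛_ : (List ℕ → ℚ) → (List ℕ → ℚ) → List ℕ → ℚ
(F ⊛ G) κ = ∑⊎ (λ μ ν → F μ * G ν) κ

-- The generating function `exp (c y) tanh^e y`; `E-∷` is its product rule.
E : ℚ → ℕ → List ℕ → ℚ
E c e = oddWeight c ⊛ Z e

opaque
  unfolding _+_

  D-* : ∀ c X e → D (λ i → c * X i) e ≡ c * D X e
  D-* c X zero    = sym (R.zeroʳ c)
  D-* c X (suc e) = lemma c (ℕtoℚ (suc e)) (X e) (X (suc (suc e)))
    where
    lemma : ∀ c n x y → n * (c * x - c * y) ≡ c * (n * (x - y))
    lemma = solve-∀ ℚ-ring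

∑⊎-D : ∀ (φ : ℕ → List ℕ → List ℕ → ℚ) e κ → ∑⊎ (λ μ ν → D (λ i → φ i μ ν) e) κ ≡ D (λ i → ∑⊎ (φ i) κ) e
∑⊎-D φ zero    κ = ∑⊎-zero (λ _ _ → refl) κ
∑⊎-D φ (suc e) κ = trans (∑⊎-*ˡ (ℕtoℚ (suc e)) κ) (cong (ℕtoℚ (suc e) *_) (trans (∑⊎-+ κ) (cong₂ _+_ refl (neg κ))))
  where
  opaque
    unfolding _+_
    neg-* : ∀ a → - a ≡ - 1ℚ * a
    neg-* = solve-∀ ℚ-ring
  neg : ∀ {ψ : List ℕ → List ℕ → ℚ} κ → ∑⊎ (λ μ ν → - ψ μ ν) κ ≡ - ∑⊎ ψ κ
  neg {ψ} κ = trans (∑⊎-cong (λ μ ν → neg-* (ψ μ ν)) κ) (trans (∑⊎-*ˡ (- 1ℚ) κ) (sym (neg-* _)))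

E-[] : ∀ c e → E c e [] ≡ Z e []
E-[] c e = R.*-identityˡ (Z e [])

E-∷ : ∀ c e k κ → E c e (k ∷ κ) ≡ 𝟙 (odd k) * (c * E c e κ + D (λ i → E c i κ) e)
E-∷ c e k κ = begin
  ∑⊎ (λ μ ν → 𝟙 (odd k) * c * oddWeight c μ * Z e ν) κ + ∑⊎ (λ μ ν → oddWeight c μ * (𝟙 (odd k) * D (λ i → Z i ν) e)) κ
    ≡⟨ cong₂ _+_ (trans (∑⊎-cong (λ μ ν → left (𝟙 (odd k)) c (oddWeight c μ) (Z e ν)) κ) (trans (∑⊎-*ˡ (𝟙 (odd k)) κ) (cong (𝟙 (odd k) *_) (∑⊎-*ˡ c κ))))
                 (trans (∑⊎-cong (λ μ ν → trans (x∙yz≈y∙xz (oddWeight c μ) (𝟙 (odd k)) _) (cong (𝟙 (odd k) *_) (sym (D-* (oddWeight c μ) (λ i → Z i ν) e)))) κ)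
                        (trans (∑⊎-*ˡ (𝟙 (odd k)) κ) (cong (𝟙 (odd k) *_) (∑⊎-D (λ i μ ν → oddWeight c μ * Z i ν) e κ)))) ⟩
  𝟙 (odd k) * (c * E c e κ) + 𝟙 (odd k) * D (λ i → E c i κ) e
    ≡⟨ sym (R.distribˡ (𝟙 (odd k)) _ _) ⟩
  𝟙 (odd k) * (c * E c e κ + D (λ i → E c i κ) e) ∎
  where
  opaque
    unfolding _+_
    left : ∀ a c x y → a * c * x * y ≡ a * (c * (x * y))
    left = solve-∀ ℚ-ring

-- e^{2y} (1 - tanh y) = 1 + tanh y, multiplied by tanh^e y.  Both sides satisfy the same
-- differential recursion in e.
opaque
  unfolding _+_

  exp-tanh⁺ : ∀ κ e → E 2ℚ e κ - E 2ℚ (suc e) κ ≡ Z e κ + Z (suc e) κ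
  exp-tanh⁺ [] e = trans (cong₂ _-_ (E-[] 2ℚ e) (E-[] 2ℚ (suc e))) (lemma (Z e []))
    where
    lemma : ∀ a → a - 0ℚ ≡ a + 0ℚ
    lemma = solve-∀ ℚ-ring
  exp-tanh⁺ (k ∷ κ) zero = trans (cong₂ _-_ (E-∷ 2ℚ 0 k κ) (E-∷ 2ℚ 1 k κ))
    (trans (left (𝟙 (odd k)) (E 2ℚ 0 κ) (E 2ℚ 1 κ) (E 2ℚ 2 κ))
    (trans (cong₂ (λ x y → 𝟙 (odd k) * (x - y)) (exp-tanh⁺ κ 0) (exp-tanh⁺ κ 1))
           (right (𝟙 (odd k)) (Z 0 κ) (Z 1 κ) (Z 2 κ))))
    where
    left : ∀ o a b c → o * ((1ℚ + 1ℚ) * a + 0ℚ) - o * ((1ℚ + 1ℚ) * b + 1ℚ * (a - c)) ≡ o * ((a - b) - (b - c))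
    left = solve-∀ ℚ-ring
    right : ∀ o a b c → o * ((a + b) - (b + c)) ≡ o * 0ℚ + o * (1ℚ * (a - c))
    right = solve-∀ ℚ-ring
  exp-tanh⁺ (k ∷ κ) (suc e) = trans (cong₂ _-_ (E-∷ 2ℚ (suc e) k κ) (E-∷ 2ℚ (suc (suc e)) k κ))
    (trans (cong (λ n → 𝟙 (odd k) * (2ℚ * E 2ℚ (suc e) κ + ℕtoℚ (suc e) * (E 2ℚ e κ - E 2ℚ (2 ℕ.+ e) κ)) - 𝟙 (odd k) * (2ℚ * E 2ℚ (2 ℕ.+ e) κ + n * (E 2ℚ (suc e) κ - E 2ℚ (3 ℕ.+ e) κ))) (ℕtoℚ-suc (suc e)))
    (trans (left (𝟙 (odd k)) (ℕtoℚ (suc e)) (E 2ℚ e κ) (E 2ℚ (suc e) κ) (E 2ℚ (2 ℕ.+ e) κ) (E 2ℚ (3 ℕ.+ e) κ))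
    (trans (cong₂ (λ x y → 𝟙 (odd k) * (x + y)) (cong₂ (λ x y → ℕtoℚ (suc e) * x + y) (exp-tanh⁺ κ e) (exp-tanh⁺ κ (suc e))) (cong (λ y → - ((1ℚ + ℕtoℚ (suc e)) * y)) (exp-tanh⁺ κ (suc (suc e)))))
    (trans (right (𝟙 (odd k)) (ℕtoℚ (suc e)) (Z e κ) (Z (suc e) κ) (Z (2 ℕ.+ e) κ) (Z (3 ℕ.+ e) κ))
           (cong (λ n → 𝟙 (odd k) * (ℕtoℚ (suc e) * (Z e κ - Z (2 ℕ.+ e) κ)) + 𝟙 (odd k) * (n * (Z (suc e) κ - Z (3 ℕ.+ e) κ))) (sym (ℕtoℚ-suc (suc e))))))))
    where
    left : ∀ o n a b c d → o * ((1ℚ + 1ℚ) * b + n * (a - c)) - o * ((1ℚ + 1ℚ) * c + (1ℚ + n) * (b - d)) ≡ o * ((n * (a - b) + (b - c)) + - ((1ℚ + n) * (c - d)))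
    left = solve-∀ ℚ-ring
    right : ∀ o n a b c d → o * ((n * (a + b) + (b + c)) + - ((1ℚ + n) * (c + d))) ≡ o * (n * (a - c)) + o * ((1ℚ + n) * (b - d))
    right = solve-∀ ℚ-ring

  -- The mirror image `exp(-2y) (1 + tanh y) = 1 - tanh y`, again multiplied by `tanh^e y`.
  exp-tanh⁻ : ∀ κ e → E (- 2ℚ) e κ + E (- 2ℚ) (suc e) κ ≡ Z e κ - Z (suc e) κ
  exp-tanh⁻ [] e = trans (cong₂ _+_ (E-[] (- 2ℚ) e) (E-[] (- 2ℚ) (suc e))) (lemma (Z e []))
    where
    lemma : ∀ a → a + 0ℚ ≡ a - 0ℚ
    lemma = solve-∀ ℚ-ring
  exp-tanh⁻ (k ∷ κ) zero = trans (cong₂ _+_ (E-∷ (- 2ℚ) 0 k κ) (E-∷ (- 2ℚ) 1 k κ))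
    (trans (left (𝟙 (odd k)) (E (- 2ℚ) 0 κ) (E (- 2ℚ) 1 κ) (E (- 2ℚ) 2 κ))
    (trans (cong₂ (λ x y → 𝟙 (odd k) * (- x - y)) (exp-tanh⁻ κ 0) (exp-tanh⁻ κ 1))
           (right (𝟙 (odd k)) (Z 0 κ) (Z 1 κ) (Z 2 κ))))
    where
    left : ∀ o a b c → o * (- (1ℚ + 1ℚ) * a + 0ℚ) + o * (- (1ℚ + 1ℚ) * b + 1ℚ * (a - c)) ≡ o * (- (a + b) - (b + c))
    left = solve-∀ ℚ-ring
    right : ∀ o a b c → o * (- (a - b) - (b - c)) ≡ o * 0ℚ - o * (1ℚ * (a - c))
    right = solve-∀ ℚ-ring
  exp-tanh⁻ (k ∷ κ) (suc e) = trans (cong₂ _+_ (E-∷ (- 2ℚ) (suc e) k κ) (E-∷ (- 2ℚ) (suc (suc e)) k κ))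
    (trans (cong (λ n → 𝟙 (odd k) * (- 2ℚ * E (- 2ℚ) (suc e) κ + ℕtoℚ (suc e) * (E (- 2ℚ) e κ - E (- 2ℚ) (2 ℕ.+ e) κ)) + 𝟙 (odd k) * (- 2ℚ * E (- 2ℚ) (2 ℕ.+ e) κ + n * (E (- 2ℚ) (suc e) κ - E (- 2ℚ) (3 ℕ.+ e) κ))) (ℕtoℚ-suc (suc e)))
    (trans (left (𝟙 (odd k)) (ℕtoℚ (suc e)) (E (- 2ℚ) e κ) (E (- 2ℚ) (suc e) κ) (E (- 2ℚ) (2 ℕ.+ e) κ) (E (- 2ℚ) (3 ℕ.+ e) κ))
    (trans (cong₂ (λ x y → 𝟙 (odd k) * (x + y)) (cong₂ (λ x y → ℕtoℚ (suc e) * x - y) (exp-tanh⁻ κ e) (exp-tanh⁻ κ (suc e))) (cong (λ y → - ((1ℚ + ℕtoℚ (suc e)) * y)) (exp-tanh⁻ κ (suc (suc e)))))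
    (trans (right (𝟙 (odd k)) (ℕtoℚ (suc e)) (Z e κ) (Z (suc e) κ) (Z (2 ℕ.+ e) κ) (Z (3 ℕ.+ e) κ))
           (cong (λ n → 𝟙 (odd k) * (ℕtoℚ (suc e) * (Z e κ - Z (2 ℕ.+ e) κ)) - 𝟙 (odd k) * (n * (Z (suc e) κ - Z (3 ℕ.+ e) κ))) (sym (ℕtoℚ-suc (suc e))))))))
    where
    left : ∀ o n a b c d → o * (- (1ℚ + 1ℚ) * b + n * (a - c)) + o * (- (1ℚ + 1ℚ) * c + (1ℚ + n) * (b - d)) ≡ o * ((n * (a + b) - (b + c)) + - ((1ℚ + n) * (c + d)))
    left = solve-∀ ℚ-ring
    right : ∀ o n a b c d → o * ((n * (a - b) - (b - c)) + - ((1ℚ + n) * (c - d))) ≡ o * (n * (a - c)) - o * ((1ℚ + n) * (b - d))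
    right = solve-∀ ℚ-ring

-- This is sinh(2y)/2 in the notation above.
oddSlot : List ℕ → ℚ
oddSlot μ = 𝟙 (odd (sum μ)) * halfWeight μ

odd-+ : ∀ a b → odd (a ℕ.+ b) ≡ (if odd a then not (odd b) else odd b)
odd-+ zero          b = refl
odd-+ (suc zero)    b = odd-suc b
odd-+ (suc (suc a)) b = odd-+ a b

opaque
  unfolding _+_

  -- For odd parts the number of parts has the parity of their sum, so negating every factor 2 gives
  -- the sign `(-1)^(sum μ)`.
  oddWeight-neg : ∀ μ → oddWeight (- 2ℚ) μ ≡ (1ℚ - 2ℚ * 𝟙 (odd (sum μ))) * oddWeight 2ℚ μ
  oddWeight-neg []      = refl
  oddWeight-neg (x ∷ μ) rewrite odd-+ x (sum μ) with odd x
  ... | false = lemma (oddWeight (- 2ℚ) μ) (𝟙 (odd (sum μ))) (oddWeight 2ℚ μ)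
    where
    lemma : ∀ a b c → 0ℚ * - 2ℚ * a ≡ (1ℚ - 2ℚ * b) * (0ℚ * 2ℚ * c)
    lemma a b c = trans (cong (_* a) (R.zeroˡ (- 2ℚ))) (trans (R.zeroˡ a) (sym (trans (cong (λ z → (1ℚ - 2ℚ * b) * (z * c)) (R.zeroˡ 2ℚ)) (trans (cong ((1ℚ - 2ℚ * b) *_) (R.zeroˡ c)) (R.zeroʳ (1ℚ - 2ℚ * b))))))
  ... | true with odd (sum μ) | oddWeight-neg μ
  ...   | true  | ih = trans (cong (1ℚ * - 2ℚ *_) ih) (lemma (oddWeight 2ℚ μ))
    where
    lemma : ∀ a → 1ℚ * - (1ℚ + 1ℚ) * ((1ℚ - (1ℚ + 1ℚ) * 1ℚ) * a) ≡ (1ℚ - (1ℚ + 1ℚ) * 0ℚ) * (1ℚ * (1ℚ + 1ℚ) * a)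
    lemma = solve-∀ ℚ-ring
  ...   | false | ih = trans (cong (1ℚ * - 2ℚ *_) ih) (lemma (oddWeight 2ℚ μ))
    where
    lemma : ∀ a → 1ℚ * - (1ℚ + 1ℚ) * ((1ℚ - (1ℚ + 1ℚ) * 0ℚ) * a) ≡ (1ℚ - (1ℚ + 1ℚ) * 1ℚ) * (1ℚ * (1ℚ + 1ℚ) * a)
    lemma = solve-∀ ℚ-ring

  oddSlot-sinh : ∀ μ → 2ℚ * (2ℚ * oddSlot μ) ≡ oddWeight 2ℚ μ - oddWeight (- 2ℚ) μ
  oddSlot-sinh []      = refl
  oddSlot-sinh (x ∷ μ) = trans (lemma (𝟙 (odd (sum (x ∷ μ)))) (𝟙 (odd x)) (oddWeight 2ℚ μ)) (cong (λ z → oddWeight 2ℚ (x ∷ μ) - z) (sym (oddWeight-neg (x ∷ μ))))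
    where
    lemma : ∀ s o w → (1ℚ + 1ℚ) * ((1ℚ + 1ℚ) * (s * (o * w))) ≡ o * (1ℚ + 1ℚ) * w - (1ℚ - (1ℚ + 1ℚ) * s) * (o * (1ℚ + 1ℚ) * w)
    lemma = solve-∀ ℚ-ring

  2ℚ-cancel : ∀ {x y} → 2ℚ * x ≡ 2ℚ * y → x ≡ y
  2ℚ-cancel = ℕtoℚ-cancelˡ 1

oddSlot-Z : ∀ e κ → 2ℚ * (2ℚ * (oddSlot ⊛ Z e) κ) ≡ E 2ℚ e κ - E (- 2ℚ) e κ
oddSlot-Z e κ = begin
  2ℚ * (2ℚ * (oddSlot ⊛ Z e) κ)                                         ≡⟨ trans (cong (2ℚ *_) (sym (∑⊎-*ˡ 2ℚ κ))) (sym (∑⊎-*ˡ 2ℚ κ)) ⟩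
  ∑⊎ (λ μ ν → 2ℚ * (2ℚ * (oddSlot μ * Z e ν))) κ                        ≡⟨ ∑⊎-cong (λ μ ν → lemma (oddSlot μ) (Z e ν)) κ ⟩
  ∑⊎ (λ μ ν → 2ℚ * (2ℚ * oddSlot μ) * Z e ν) κ                          ≡⟨ ∑⊎-cong (λ μ ν → trans (cong (_* Z e ν) (oddSlot-sinh μ)) (dist (oddWeight 2ℚ μ) (oddWeight (- 2ℚ) μ) (Z e ν))) κ ⟩
  ∑⊎ (λ μ ν → oddWeight 2ℚ μ * Z e ν + - 1ℚ * (oddWeight (- 2ℚ) μ * Z e ν)) κ ≡⟨ trans (∑⊎-+ κ) (cong₂ _+_ refl (∑⊎-*ˡ (- 1ℚ) κ)) ⟩
  E 2ℚ e κ + - 1ℚ * E (- 2ℚ) e κ                                        ≡⟨ neg (E 2ℚ e κ) (E (- 2ℚ) e κ) ⟩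
  E 2ℚ e κ - E (- 2ℚ) e κ                                               ∎
  where
  opaque
    unfolding _+_
    lemma : ∀ a b → 2ℚ * (2ℚ * (a * b)) ≡ 2ℚ * (2ℚ * a) * b
    lemma a b = trans (cong (2ℚ *_) (sym (R.*-assoc 2ℚ a b))) (sym (R.*-assoc 2ℚ (2ℚ * a) b))
    dist : ∀ a b c → (a - b) * c ≡ a * c + - 1ℚ * (b * c)
    dist = solve-∀ ℚ-ring
    neg : ∀ a b → a + - 1ℚ * b ≡ a - b
    neg = solve-∀ ℚ-ring

Z-zero : ∀ κ → Z 0 κ ≡ 𝟙 (null κ)
Z-zero []      = refl
Z-zero (k ∷ κ) = R.zeroʳ (𝟙 (odd k))

opaque
  unfolding _+_

  -- Twice `exp(2y)` is `exp(2y) (1 - Z) + exp(2y) (1 + Z)`. The first summand equals `1 + Z`, which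
  -- is `2 - exp(-2y) (1 + Z)` by the mirrored identity, and the difference of the two exponentials
  -- is `4 S`.
  transfer-zero : ∀ κ → E 2ℚ 0 κ ≡ Z 0 κ + 2ℚ * ((oddSlot ⊛ Z 0) κ + (oddSlot ⊛ Z 1) κ)
  transfer-zero κ = 2ℚ-cancel (trans
    (alg (E 2ℚ 0 κ) (E 2ℚ 1 κ) (E (- 2ℚ) 0 κ) (E (- 2ℚ) 1 κ) (Z 0 κ) (Z 1 κ) (exp-tanh⁺ κ 0) (exp-tanh⁻ κ 0))
    (trans (cong₂ (λ x y → 2ℚ * Z 0 κ + (x + y)) (sym (oddSlot-Z 0 κ)) (sym (oddSlot-Z 1 κ))) (fold (Z 0 κ) ((oddSlot ⊛ Z 0) κ) ((oddSlot ⊛ Z 1) κ))))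
    where
    ring₁ : ∀ a b → (1ℚ + 1ℚ) * a ≡ (a - b) + (a + b)
    ring₁ = solve-∀ ℚ-ring
    ring₂ : ∀ a b z w → (z + w) + (a + b) ≡ (1ℚ + 1ℚ) * z + (a + b - (z - w))
    ring₂ = solve-∀ ℚ-ring
    ring₃ : ∀ a b c d → a + b - (c + d) ≡ (a - c) + (b - d)
    ring₃ = solve-∀ ℚ-ring
    alg : ∀ a b c d z w → a - b ≡ z + w → c + d ≡ z - w → 2ℚ * a ≡ 2ℚ * z + ((a - c) + (b - d))
    alg a b c d z w p q = trans (ring₁ a b) (trans (cong (_+ (a + b)) p) (trans (ring₂ a b z w) (cong (2ℚ * z +_) (trans (cong (λ z → a + b - z) (sym q)) (ring₃ a b c d)))))
    fold : ∀ z a b → (1ℚ + 1ℚ) * z + ((1ℚ + 1ℚ) * ((1ℚ + 1ℚ) * a) + (1ℚ + 1ℚ) * ((1ℚ + 1ℚ) * b)) ≡ (1ℚ + 1ℚ) * (z + (1ℚ + 1ℚ) * (a + b))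
    fold = solve-∀ ℚ-ring

  -- Both `exp(2y) (1 - Z)²` and `exp(-2y) (1 + Z)²` equal `1 - Z²`. Their difference, times `Z^e`,
  -- is the vanishing term in `ring₁`; added to `4 exp(2y) Z^(e+1)` it leaves only multiples of
  -- `exp(2y) - exp(-2y) = 4 S`.
  transfer-suc : ∀ e κ → E 2ℚ (suc e) κ ≡ 2ℚ * (oddSlot ⊛ Z (suc e)) κ + ((oddSlot ⊛ Z e) κ + (oddSlot ⊛ Z (2 ℕ.+ e)) κ)
  transfer-suc e κ = 2ℚ-cancel (2ℚ-cancel (trans
    (alg (E 2ℚ e κ) (E 2ℚ (suc e) κ) (E 2ℚ (2 ℕ.+ e) κ) (E (- 2ℚ) e κ) (E (- 2ℚ) (suc e) κ) (E (- 2ℚ) (2 ℕ.+ e) κ) (Z e κ) (Z (suc e) κ) (Z (2 ℕ.+ e) κ)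
         (exp-tanh⁺ κ e) (exp-tanh⁺ κ (suc e)) (exp-tanh⁻ κ e) (exp-tanh⁻ κ (suc e)))
    (trans (cong₂ (λ x y → 2ℚ * x + y) (sym (oddSlot-Z (suc e) κ)) (cong₂ _+_ (sym (oddSlot-Z e κ)) (sym (oddSlot-Z (2 ℕ.+ e) κ))))
           (fold ((oddSlot ⊛ Z (suc e)) κ) ((oddSlot ⊛ Z e) κ) ((oddSlot ⊛ Z (2 ℕ.+ e)) κ)))))
    where
    ring₁ : ∀ b z w v → (1ℚ + 1ℚ) * ((1ℚ + 1ℚ) * b) + (((z + w) - (w + v)) - ((z - w) + (w - v))) ≡ (1ℚ + 1ℚ) * ((1ℚ + 1ℚ) * b)
    ring₁ = solve-∀ ℚ-ring
    ring₂ : ∀ a b c a′ b′ c′ → (1ℚ + 1ℚ) * ((1ℚ + 1ℚ) * b) + (((a - b) - (b - c)) - ((a′ + b′) + (b′ + c′))) ≡ (1ℚ + 1ℚ) * (b - b′) + ((a - a′) + (c - c′))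
    ring₂ = solve-∀ ℚ-ring
    alg : ∀ a b c a′ b′ c′ z w v → a - b ≡ z + w → b - c ≡ w + v → a′ + b′ ≡ z - w → b′ + c′ ≡ w - v →
      2ℚ * (2ℚ * b) ≡ 2ℚ * (b - b′) + ((a - a′) + (c - c′))
    alg a b c a′ b′ c′ z w v p q r s = trans (sym (ring₁ b z w v))
      (trans (cong₂ (λ x y → 2ℚ * (2ℚ * b) + (x - y)) (cong₂ _-_ (sym p) (sym q)) (cong₂ _+_ (sym r) (sym s))) (ring₂ a b c a′ b′ c′))
    fold : ∀ x y z → (1ℚ + 1ℚ) * ((1ℚ + 1ℚ) * ((1ℚ + 1ℚ) * x)) + ((1ℚ + 1ℚ) * ((1ℚ + 1ℚ) * y) + (1ℚ + 1ℚ) * ((1ℚ + 1ℚ) * z)) ≡ (1ℚ + 1ℚ) * ((1ℚ + 1ℚ) * ((1ℚ + 1ℚ) * x + (y + z)))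
    fold = solve-∀ ℚ-ring

-- Weighted Dyck paths

∑⊎-[]-All : ∀ {P : A → Set} {φ : List A → List A → ℚ} →
  (∀ k μ ν → P k → φ (k ∷ μ) ν ≡ 0ℚ) → ∀ {xs} → All P xs → ∑⊎ φ xs ≡ φ [] xs
∑⊎-[]-All h []                = refl
∑⊎-[]-All {φ = φ} h (_∷_ {k} {xs} p ps) =
  trans (cong₂ _+_ (∑⊎-zero (λ μ ν → h k μ ν p) xs) (∑⊎-[]-All (λ l μ ν → h l μ (k ∷ ν)) ps)) (R.+-identityˡ (φ [] (k ∷ xs)))

infixr 6 _⋆_

-- Puts the parts `μ` into the current slot and raises the height by their total. The step down is
-- kept apart in `↓`, so that a weight without a slot of its own, such as `tanh^e y`, can be put in
-- front as well.
_⋆_ : (List ℕ → ℚ) → (ℕ → List ℕ → ℚ) → ℕ → List ℕ → ℚ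
(F ⋆ t) j κ = ∑⊎ (λ μ ν → F μ * t (j ℕ.+ sum μ) ν) κ

-- The step down at the end of a slot; from height 0 it would leave the Dyck region.
↓ : (ℕ → List ℕ → ℚ) → ℕ → List ℕ → ℚ
↓ t zero    κ = 0ℚ
↓ t (suc m) κ = t m κ

dyckEnd : ℕ → List ℕ → ℚ
dyckEnd zero    κ = 𝟙 (null κ)
dyckEnd (suc j) κ = 0ℚ

-- T[ Q ] s j κ is the Q-weighted number of ways to distribute the parts of κ to s slots so that, starting
-- at height j and changing it by (total of the slot) - 1 at each slot, the height stays
-- nonnegative and ends at 0.
T[_] : (List ℕ → ℚ) → ℕ → ℕ → List ℕ → ℚ
T[ Q ] zero    = dyckEnd
T[ Q ] (suc s) = Q ⋆ ↓ (T[ Q ] s)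

↓-cong : ∀ {t u : ℕ → List ℕ → ℚ} → (∀ m κ → t m κ ≡ u m κ) → ∀ m κ → ↓ t m κ ≡ ↓ u m κ
↓-cong h zero    κ = refl
↓-cong h (suc m) κ = h m κ

-- Heights are additive, so two weights with no step down between them merge into one.
⋆-assoc : ∀ F G t j κ → (F ⋆ (G ⋆ t)) j κ ≡ ((F ⊛ G) ⋆ t) j κ
⋆-assoc F G t j κ = begin
  ∑⊎ (λ μ ν → F μ * ∑⊎ (λ ρ π → G ρ * t (j ℕ.+ sum μ ℕ.+ sum ρ) π) ν) κ
    ≡⟨ ∑⊎-cong (λ μ ν → sym (∑⊎-*ˡ (F μ) ν)) κ ⟩
  ∑⊎ (λ μ ν → ∑⊎ (λ ρ π → F μ * (G ρ * t (j ℕ.+ sum μ ℕ.+ sum ρ) π)) ν) κ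
    ≡⟨ ∑⊎-assoc κ ⟨
  ∑⊎ (λ τ π → ∑⊎ (λ μ ρ → F μ * (G ρ * t (j ℕ.+ sum μ ℕ.+ sum ρ) π)) τ) κ
    ≡⟨ ∑⊎-cong (λ τ π → ∑⊎-cong (λ μ ρ → trans (cong (λ m → F μ * (G ρ * t m π)) (ℕP.+-assoc j (sum μ) (sum ρ))) (rotate (F μ) (G ρ) _)) τ) κ ⟩
  ∑⊎ (λ τ π → ∑⊎ (λ μ ρ → t (j ℕ.+ (sum μ ℕ.+ sum ρ)) π * (F μ * G ρ)) τ) κ
    ≡⟨ ∑⊎-cong (λ τ π → trans (∑⊎-sum (λ z → t (j ℕ.+ z) π) τ) (R.*-comm _ _)) κ ⟩
  ∑⊎ (λ τ π → (F ⊛ G) τ * t (j ℕ.+ sum τ) π) κ ∎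
  where
  opaque
    unfolding _+_
    rotate : ∀ a b c → a * (b * c) ≡ c * (a * b)
    rotate = solve-∀ ℚ-ring

⋆-identity : ∀ t j κ → ((λ μ → 𝟙 (null μ)) ⋆ t) j κ ≡ t j κ
⋆-identity t j κ = trans (∑⊎-[] (λ k μ ν → R.zeroˡ _) κ) (trans (R.*-identityˡ _) (cong (λ m → t m κ) (ℕP.+-identityʳ j)))

⋆-congˡ : ∀ {F G : List ℕ → ℚ} → (∀ μ → F μ ≡ G μ) → ∀ t j κ → (F ⋆ t) j κ ≡ (G ⋆ t) j κ
⋆-congˡ h t j κ = ∑⊎-cong (λ μ ν → cong (_* t (j ℕ.+ sum μ) ν) (h μ)) κ

⋆-congʳ : ∀ F {t u : ℕ → List ℕ → ℚ} → (∀ m κ → t m κ ≡ u m κ) → ∀ j κ → (F ⋆ t) j κ ≡ (F ⋆ u) j κ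
⋆-congʳ F h j κ = ∑⊎-cong (λ μ ν → cong (F μ *_) (h (j ℕ.+ sum μ) ν)) κ

⋆-+ : ∀ F G t j κ → ((λ μ → F μ + G μ) ⋆ t) j κ ≡ (F ⋆ t) j κ + (G ⋆ t) j κ
⋆-+ F G t j κ = trans (∑⊎-cong (λ μ ν → R.distribʳ _ (F μ) (G μ)) κ) (∑⊎-+ κ)

⋆-*ˡ : ∀ c F t j κ → ((λ μ → c * F μ) ⋆ t) j κ ≡ c * (F ⋆ t) j κ
⋆-*ˡ c F t j κ = trans (∑⊎-cong (λ μ ν → R.*-assoc c (F μ) _) κ) (∑⊎-*ˡ c κ)

-- Every slot steps down by 1 and the path ends at height 0, so the parts have to make up for the
-- `s` steps.
T-homogeneous : ∀ Q s j κ → T[ Q ] s j κ ≡ 𝟙 (j ℕ.+ sum κ ≡ᵇ s) * T[ Q ] s j κ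
T-homogeneous Q zero    zero    []      = sym (R.*-identityˡ 1ℚ)
T-homogeneous Q zero    zero    (k ∷ κ) = sym (R.zeroʳ _)
T-homogeneous Q zero    (suc j) κ       = sym (R.zeroʳ _)
T-homogeneous Q (suc s) j       κ       = begin
  ∑⊎ (λ μ ν → Q μ * ↓ (T[ Q ] s) (j ℕ.+ sum μ) ν) κ
    ≡⟨ ∑⊎-cong (λ μ ν → trans (cong (Q μ *_) (step (j ℕ.+ sum μ) ν)) (trans (x∙yz≈y∙xz (Q μ) _ _) (cong (λ z → 𝟙 (z ≡ᵇ suc s) * (Q μ * ↓ (T[ Q ] s) (j ℕ.+ sum μ) ν)) (ℕP.+-assoc j (sum μ) (sum ν))))) κ ⟩
  ∑⊎ (λ μ ν → 𝟙 (j ℕ.+ (sum μ ℕ.+ sum ν) ≡ᵇ suc s) * (Q μ * ↓ (T[ Q ] s) (j ℕ.+ sum μ) ν)) κ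
    ≡⟨ ∑⊎-sum (λ z → 𝟙 (j ℕ.+ z ≡ᵇ suc s)) κ ⟩
  𝟙 (j ℕ.+ sum κ ≡ᵇ suc s) * T[ Q ] (suc s) j κ ∎
  where
  step : ∀ m ν → ↓ (T[ Q ] s) m ν ≡ 𝟙 (m ℕ.+ sum ν ≡ᵇ suc s) * ↓ (T[ Q ] s) m ν
  step zero    ν = sym (R.zeroʳ _)
  step (suc m) ν = T-homogeneous Q s m ν

T-weight : ∀ w s j κ → ∏ w κ * T[ (λ _ → 1ℚ) ] s j κ ≡ T[ ∏ w ] s j κ
T-weight w zero    zero    []      = R.*-identityˡ 1ℚ
T-weight w zero    zero    (k ∷ κ) = R.zeroʳ _
T-weight w zero    (suc j) κ       = R.zeroʳ _
T-weight w (suc s) j       κ       = trans (∑⊎-∏ w κ) (∑⊎-cong (λ μ ν → trans (lemma (∏ w μ) (∏ w ν) _) (cong (∏ w μ *_) (step (j ℕ.+ sum μ) ν))) κ)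
  where
  opaque
    unfolding _+_
    lemma : ∀ a b c → a * b * (1ℚ * c) ≡ a * (b * c)
    lemma = solve-∀ ℚ-ring
  step : ∀ m ν → ∏ w ν * ↓ (T[ (λ _ → 1ℚ) ] s) m ν ≡ ↓ (T[ ∏ w ] s) m ν
  step zero    ν = R.zeroʳ _
  step (suc m) ν = T-weight w s m ν

-- Signed slots with open arcs

isZero : ℤ → Bool
isZero x = eqℤ x (ℤ.+ 0)

trits : List ℤ
trits = ℤ.+ 0 ∷ ℤ.+ 1 ∷ ℤ.- (ℤ.+ 1) ∷ []

slot : ℤ → List ℕ → ℚ
slot x μ = if isZero x then 𝟙 (null μ) else oddSlot μ

-- Here the slot signs `σ̄` are prescribed: 0 forces an empty slot, a sign forces an odd total.
Ω : ℕ → List ℤ → List ℕ → ℚ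
Ω j []       = dyckEnd j
Ω j (x ∷ xs) = (slot x ⋆ ↓ (λ m → Ω m xs)) j

-- arcs g xs e counts the ways to complete e nested open arcs, whose left endpoints all have
-- sign g, to a matching of the remaining slots xs.
arcs : ℤ → List ℤ → ℕ → ℚ
arcs g []       zero    = 1ℚ
arcs g []       (suc e) = 0ℚ
arcs g (x ∷ xs) zero    = arcs g xs 0 + 𝟙 (not (isZero x)) * arcs x xs 1
arcs g (x ∷ xs) (suc e) = 𝟙 (eqℤ x (ℤ.- g)) * arcs g xs e
  + (𝟙 (not (isZero x)) * arcs g xs (suc e) + 𝟙 (eqℤ x g) * arcs g xs (suc (suc e)))

data IsSign : ℤ → Set where
  pos : IsSign (ℤ.+ 1)
  neg : IsSign (ℤ.- (ℤ.+ 1))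

Positive : List ℕ → Set
Positive = All (1 ≤_)

∑-⋆ : ∀ (L : List A) (a : A → ℚ) F (t : A → ℕ → List ℕ → ℚ) j κ →
  ∑ L (λ x → a x * (F ⋆ ↓ (t x)) j κ) ≡ (F ⋆ ↓ (λ m ν → ∑ L (λ x → a x * t x m ν))) j κ
∑-⋆ L a F t j κ = begin
  ∑ L (λ x → a x * ∑⊎ (λ μ ν → F μ * ↓ (t x) (j ℕ.+ sum μ) ν) κ)     ≡⟨ ∑-cong L (λ x → sym (∑⊎-*ˡ (a x) κ)) ⟩
  ∑ L (λ x → ∑⊎ (λ μ ν → a x * (F μ * ↓ (t x) (j ℕ.+ sum μ) ν)) κ)   ≡⟨ ∑⊎-∑ L κ ⟨
  ∑⊎ (λ μ ν → ∑ L (λ x → a x * (F μ * ↓ (t x) (j ℕ.+ sum μ) ν))) κ   ≡⟨ ∑⊎-cong (λ μ ν → trans (∑-cong L (λ x → x∙yz≈y∙xz (a x) (F μ) _)) (trans (∑-*ˡ (F μ) L) (cong (F μ *_) (step (j ℕ.+ sum μ) ν)))) κ ⟩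
  ∑⊎ (λ μ ν → F μ * ↓ (λ m ν → ∑ L (λ x → a x * t x m ν)) (j ℕ.+ sum μ) ν) κ ∎
  where
  step : ∀ m ν → ∑ L (λ x → a x * ↓ (t x) m ν) ≡ ↓ (λ m ν → ∑ L (λ x → a x * t x m ν)) m ν
  step zero    ν = ∑-zero-∈ L (λ {x} _ → R.zeroʳ (a x))
  step (suc m) ν = refl

-- Stepping down before or after `F` makes a difference only at height 0, where `↓` stops the path
-- before `F` can raise it. A slot of odd total has already left height 0.
oddSlot-↓ : ∀ F t j κ → (oddSlot ⋆ ↓ (F ⋆ t)) j κ ≡ (oddSlot ⋆ (F ⋆ ↓ t)) j κ
oddSlot-↓ F t j κ = ∑⊎-cong (λ μ ν → step μ ν (sum μ) refl) κ
  where
  step : ∀ μ ν m → sum μ ≡ m → oddSlot μ * ↓ (F ⋆ t) (j ℕ.+ sum μ) ν ≡ oddSlot μ * (F ⋆ ↓ t) (j ℕ.+ sum μ) ν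
  step μ ν zero    e = trans (cong (_* ↓ (F ⋆ t) (j ℕ.+ sum μ) ν) z) (trans (R.zeroˡ _) (sym (trans (cong (_* (F ⋆ ↓ t) (j ℕ.+ sum μ) ν) z) (R.zeroˡ _))))
    where
    z : oddSlot μ ≡ 0ℚ
    z = trans (cong (λ n → 𝟙 (odd n) * halfWeight μ) e) (R.zeroˡ _)
  step μ ν (suc m) e = cong (oddSlot μ *_) (trans (cong (λ n → ↓ (F ⋆ t) n ν) e′) (sym (cong (λ n → (F ⋆ ↓ t) n ν) e′)))
    where
    e′ : j ℕ.+ sum μ ≡ suc (j ℕ.+ m)
    e′ = trans (cong (j ℕ.+_) e) (ℕP.+-suc j m)

arcSum : ℤ → ℕ → ℕ → ℕ → List ℕ → ℚ
arcSum g s e j κ = ∑ (tuples trits s) (λ xs → arcs g xs e * Ω j xs κ)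

Q₂ : List ℕ → ℚ
Q₂ = oddWeight 2ℚ

⋆-cong-Positive : ∀ F {t u : ℕ → List ℕ → ℚ} → (∀ m {κ} → Positive κ → t m κ ≡ u m κ) → ∀ j {κ} → Positive κ → (F ⋆ ↓ t) j κ ≡ (F ⋆ ↓ u) j κ
⋆-cong-Positive F {t} {u} h j = ∑⊎-cong-All (λ {μ} {ν} _ p → cong (F μ *_) (step (j ℕ.+ sum μ) p))
  where
  step : ∀ m {ν} → Positive ν → ↓ t m ν ≡ ↓ u m ν
  step zero    p = refl
  step (suc m) p = h m p

-- No step down separates `tanh^e y` from the first slot, so it multiplies the weight `exp(2y)` of
-- that slot.
T-transfer : ∀ e s j κ → (Z e ⋆ T[ Q₂ ] (suc s)) j κ ≡ (E 2ℚ e ⋆ ↓ (T[ Q₂ ] s)) j κ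
T-transfer e s j κ = trans (⋆-assoc (Z e) Q₂ (↓ (T[ Q₂ ] s)) j κ)
  (⋆-congˡ (λ μ → trans (∑⊎-comm μ) (∑⊎-cong (λ a b → R.*-comm (Z e b) (Q₂ a)) μ)) (↓ (T[ Q₂ ] s)) j κ)

opaque
  unfolding _+_

  ∑-trits-ring : ∀ z p n → z + (p + (n + 0ℚ)) ≡ z + (p + n)
  ∑-trits-ring = solve-∀ ℚ-ring
  zero-ring : ∀ a b c → (a + 0ℚ * b) * c ≡ a * c
  zero-ring = solve-∀ ℚ-ring
  sign-ring : ∀ a b c → (a + 1ℚ * b) * c ≡ a * c + b * c
  sign-ring = solve-∀ ℚ-ring
  double : ∀ z a b → z + ((a + b) + (a + b)) ≡ z + 2ℚ * (a + b)
  double z a b = trans (lemma z a b) refl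
    where
    lemma : ∀ z a b → z + ((a + b) + (a + b)) ≡ z + (1ℚ + 1ℚ) * (a + b)
    lemma = solve-∀ ℚ-ring
  dead-ring : ∀ a b c d → (0ℚ * a + (0ℚ * b + 0ℚ * c)) * d ≡ 0ℚ
  dead-ring = solve-∀ ℚ-ring
  close-ring : ∀ a b c d → (1ℚ * a + (1ℚ * b + 0ℚ * c)) * d ≡ a * d + b * d
  close-ring = solve-∀ ℚ-ring
  open-ring : ∀ a b c d → (0ℚ * a + (1ℚ * b + 1ℚ * c)) * d ≡ b * d + c * d
  open-ring = solve-∀ ℚ-ring
  gather⁺ : ∀ a b c → 0ℚ + ((b + c) + (a + b)) ≡ (1ℚ + 1ℚ) * b + (a + c)
  gather⁺ = solve-∀ ℚ-ring
  gather⁻ : ∀ a b c → 0ℚ + ((a + b) + (b + c)) ≡ (1ℚ + 1ℚ) * b + (a + c)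
  gather⁻ = solve-∀ ℚ-ring

-- Induction on the number of slots: the open arcs act as a factor `tanh^e y` in front of the first
-- slot, and their sign `g` drops out. Under open arcs a slot of sign `-g` closes one or stays
-- unmatched, a slot of sign `g` opens one or stays unmatched, and no slot is empty; this is
-- `transfer-suc`. With no open arc the slot is empty, unmatched, or opens an arc of its own sign;
-- this is `transfer-zero`.
arcSum-tanh : ∀ s e {g} → IsSign g → ∀ j {κ} → Positive κ → arcSum g s e j κ ≡ (Z e ⋆ T[ Q₂ ] s) j κ

oddSlot-arcSum : ∀ s e {g} → IsSign g → ∀ j {κ} → Positive κ →
  ∑ (tuples trits s) (λ xs → arcs g xs e * (oddSlot ⋆ ↓ (λ m → Ω m xs)) j κ) ≡ ((oddSlot ⊛ Z e) ⋆ ↓ (T[ Q₂ ] s)) j κ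
oddSlot-arcSum s e {g} sg j {κ} p = begin
  ∑ (tuples trits s) (λ xs → arcs g xs e * (oddSlot ⋆ ↓ (λ m → Ω m xs)) j κ)  ≡⟨ ∑-⋆ (tuples trits s) (λ xs → arcs g xs e) oddSlot (λ xs m → Ω m xs) j κ ⟩
  (oddSlot ⋆ ↓ (arcSum g s e)) j κ                                          ≡⟨ ⋆-cong-Positive oddSlot (λ m → arcSum-tanh s e sg m) j p ⟩
  (oddSlot ⋆ ↓ (Z e ⋆ T[ Q₂ ] s)) j κ                                       ≡⟨ oddSlot-↓ (Z e) (T[ Q₂ ] s) j κ ⟩
  (oddSlot ⋆ (Z e ⋆ ↓ (T[ Q₂ ] s))) j κ                                     ≡⟨ ⋆-assoc oddSlot (Z e) (↓ (T[ Q₂ ] s)) j κ ⟩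
  ((oddSlot ⊛ Z e) ⋆ ↓ (T[ Q₂ ] s)) j κ                                     ∎

arcSum-tanh zero e {g} sg j {κ} p = begin
  arcs g [] e * dyckEnd j κ + 0ℚ                   ≡⟨ R.+-identityʳ _ ⟩
  arcs g [] e * dyckEnd j κ                        ≡⟨ cong₂ (λ x m → x * dyckEnd m κ) (base e) (sym (ℕP.+-identityʳ j)) ⟩
  Z e [] * dyckEnd (j ℕ.+ 0) κ                     ≡⟨ ∑⊎-[]-All dead p ⟨
  (Z e ⋆ dyckEnd) j κ                              ∎
  where
  base : ∀ e → arcs g [] e ≡ Z e []
  base zero    = refl
  base (suc e) = refl
  -- A positive part in the leading factor leaves the path above height 0 with no slot left to come
  -- down.
  dead : ∀ k μ ν → 1 ≤ k → Z e (k ∷ μ) * dyckEnd (j ℕ.+ sum (k ∷ μ)) ν ≡ 0ℚ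
  dead (suc k) μ ν _ = trans (cong (λ m → Z e (suc k ∷ μ) * dyckEnd m ν) (ℕP.+-suc j (k ℕ.+ sum μ))) (R.zeroʳ _)
arcSum-tanh (suc s) zero {g} sg j {κ} p = begin
  arcSum g (suc s) 0 j κ
    ≡⟨ trans (∑-tuples trits s) (∑-trits-ring _ _ _) ⟩
  ∑ X (λ xs → (arcs g xs 0 + 0ℚ * arcs (ℤ.+ 0) xs 1) * Ω j (ℤ.+ 0 ∷ xs) κ)
    + (∑ X (λ xs → (arcs g xs 0 + 1ℚ * arcs (ℤ.+ 1) xs 1) * (oddSlot ⋆ ↓ (λ m → Ω m xs)) j κ)
      + ∑ X (λ xs → (arcs g xs 0 + 1ℚ * arcs (ℤ.- (ℤ.+ 1)) xs 1) * (oddSlot ⋆ ↓ (λ m → Ω m xs)) j κ))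
    ≡⟨ cong₂ _+_ empty (cong₂ _+_ (signed pos) (signed neg)) ⟩
  (Z 0 ⋆ ↓ t) j κ + ((a₀ + a₁) + (a₀ + a₁))
    ≡⟨ double _ a₀ a₁ ⟩
  (Z 0 ⋆ ↓ t) j κ + 2ℚ * (a₀ + a₁)
    ≡⟨ cong₂ _+_ refl (cong (2ℚ *_) (sym (⋆-+ (oddSlot ⊛ Z 0) (oddSlot ⊛ Z 1) (↓ t) j κ))) ⟩
  (Z 0 ⋆ ↓ t) j κ + 2ℚ * ((λ μ → (oddSlot ⊛ Z 0) μ + (oddSlot ⊛ Z 1) μ) ⋆ ↓ t) j κ
    ≡⟨ cong₂ _+_ refl (sym (⋆-*ˡ 2ℚ (λ μ → (oddSlot ⊛ Z 0) μ + (oddSlot ⊛ Z 1) μ) (↓ t) j κ)) ⟩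
  (Z 0 ⋆ ↓ t) j κ + ((λ μ → 2ℚ * ((oddSlot ⊛ Z 0) μ + (oddSlot ⊛ Z 1) μ)) ⋆ ↓ t) j κ
    ≡⟨ ⋆-+ (Z 0) _ (↓ t) j κ ⟨
  ((λ μ → Z 0 μ + 2ℚ * ((oddSlot ⊛ Z 0) μ + (oddSlot ⊛ Z 1) μ)) ⋆ ↓ t) j κ
    ≡⟨ ⋆-congˡ transfer-zero (↓ t) j κ ⟨
  (E 2ℚ 0 ⋆ ↓ t) j κ
    ≡⟨ T-transfer 0 s j κ ⟨
  (Z 0 ⋆ T[ Q₂ ] (suc s)) j κ ∎
  where
  X : List (List ℤ)
  X = tuples trits s
  t : ℕ → List ℕ → ℚ
  t = T[ Q₂ ] s
  a₀ a₁ : ℚ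
  a₀ = ((oddSlot ⊛ Z 0) ⋆ ↓ t) j κ
  a₁ = ((oddSlot ⊛ Z 1) ⋆ ↓ t) j κ
  empty : ∑ X (λ xs → (arcs g xs 0 + 0ℚ * arcs (ℤ.+ 0) xs 1) * Ω j (ℤ.+ 0 ∷ xs) κ) ≡ (Z 0 ⋆ ↓ t) j κ
  empty = begin
    ∑ X (λ xs → (arcs g xs 0 + 0ℚ * arcs (ℤ.+ 0) xs 1) * Ω j (ℤ.+ 0 ∷ xs) κ)
      ≡⟨ ∑-cong X (λ xs → zero-ring (arcs g xs 0) _ _) ⟩
    ∑ X (λ xs → arcs g xs 0 * ((λ μ → 𝟙 (null μ)) ⋆ ↓ (λ m → Ω m xs)) j κ)
      ≡⟨ ∑-⋆ X (λ xs → arcs g xs 0) (λ μ → 𝟙 (null μ)) (λ xs m → Ω m xs) j κ ⟩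
    ((λ μ → 𝟙 (null μ)) ⋆ ↓ (arcSum g s 0)) j κ
      ≡⟨ ⋆-cong-Positive (λ μ → 𝟙 (null μ)) (λ m {ν} q → trans (arcSum-tanh s 0 sg m q) (trans (⋆-congˡ Z-zero t m ν) (⋆-identity t m ν))) j p ⟩
    ((λ μ → 𝟙 (null μ)) ⋆ ↓ t) j κ
      ≡⟨ ⋆-congˡ Z-zero (↓ t) j κ ⟨
    (Z 0 ⋆ ↓ t) j κ ∎
  signed : ∀ {x} → IsSign x → ∑ X (λ xs → (arcs g xs 0 + 1ℚ * arcs x xs 1) * (oddSlot ⋆ ↓ (λ m → Ω m xs)) j κ) ≡ a₀ + a₁
  signed {x} sx = trans (∑-cong X (λ xs → sign-ring (arcs g xs 0) (arcs x xs 1) _))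
    (trans (∑-+ X) (cong₂ _+_ (oddSlot-arcSum s 0 sg j p) (oddSlot-arcSum s 1 sx j p)))
arcSum-tanh (suc s) (suc e) {g} sg j {κ} p = begin
  arcSum g (suc s) (suc e) j κ
    ≡⟨ trans (∑-tuples trits s) (∑-trits-ring _ _ _) ⟩
  ∑ X (λ xs → arcs g (ℤ.+ 0 ∷ xs) (suc e) * Ω j (ℤ.+ 0 ∷ xs) κ)
    + (∑ X (λ xs → arcs g (ℤ.+ 1 ∷ xs) (suc e) * (oddSlot ⋆ ↓ (λ m → Ω m xs)) j κ)
      + ∑ X (λ xs → arcs g (ℤ.- (ℤ.+ 1) ∷ xs) (suc e) * (oddSlot ⋆ ↓ (λ m → Ω m xs)) j κ))
    ≡⟨ three sg ⟩
  2ℚ * ((oddSlot ⊛ Z (suc e)) ⋆ ↓ t) j κ + (((oddSlot ⊛ Z e) ⋆ ↓ t) j κ + ((oddSlot ⊛ Z (2 ℕ.+ e)) ⋆ ↓ t) j κ)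
    ≡⟨ cong₂ _+_ (sym (⋆-*ˡ 2ℚ (oddSlot ⊛ Z (suc e)) (↓ t) j κ)) (sym (⋆-+ (oddSlot ⊛ Z e) (oddSlot ⊛ Z (2 ℕ.+ e)) (↓ t) j κ)) ⟩
  ((λ μ → 2ℚ * (oddSlot ⊛ Z (suc e)) μ) ⋆ ↓ t) j κ + ((λ μ → (oddSlot ⊛ Z e) μ + (oddSlot ⊛ Z (2 ℕ.+ e)) μ) ⋆ ↓ t) j κ
    ≡⟨ ⋆-+ (λ μ → 2ℚ * (oddSlot ⊛ Z (suc e)) μ) _ (↓ t) j κ ⟨
  ((λ μ → 2ℚ * (oddSlot ⊛ Z (suc e)) μ + ((oddSlot ⊛ Z e) μ + (oddSlot ⊛ Z (2 ℕ.+ e)) μ)) ⋆ ↓ t) j κ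
    ≡⟨ ⋆-congˡ (transfer-suc e) (↓ t) j κ ⟨
  (E 2ℚ (suc e) ⋆ ↓ t) j κ
    ≡⟨ T-transfer (suc e) s j κ ⟨
  (Z (suc e) ⋆ T[ Q₂ ] (suc s)) j κ ∎
  where
  X : List (List ℤ)
  X = tuples trits s
  t : ℕ → List ℕ → ℚ
  t = T[ Q₂ ] s
  W : ℕ → ℚ
  W i = ((oddSlot ⊛ Z i) ⋆ ↓ t) j κ
  O : List ℤ → ℚ
  O xs = (oddSlot ⋆ ↓ (λ m → Ω m xs)) j κ
  two : ∀ {h} → IsSign h → ∀ i i′ → ∑ X (λ xs → arcs h xs i * O xs + arcs h xs i′ * O xs) ≡ W i + W i′
  two sh i i′ = trans (∑-+ X) (cong₂ _+_ (oddSlot-arcSum s i sh j p) (oddSlot-arcSum s i′ sh j p))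
  opaque
    unfolding _+_
    three : ∀ {h} → IsSign h →
      ∑ X (λ xs → arcs h (ℤ.+ 0 ∷ xs) (suc e) * Ω j (ℤ.+ 0 ∷ xs) κ)
        + (∑ X (λ xs → arcs h (ℤ.+ 1 ∷ xs) (suc e) * O xs) + ∑ X (λ xs → arcs h (ℤ.- (ℤ.+ 1) ∷ xs) (suc e) * O xs))
      ≡ 2ℚ * W (suc e) + (W e + W (2 ℕ.+ e))
    three pos = trans (cong₂ _+_ (∑-zero-∈ X (λ {xs} _ → dead-ring (arcs (ℤ.+ 1) xs e) (arcs (ℤ.+ 1) xs (suc e)) (arcs (ℤ.+ 1) xs (2 ℕ.+ e)) _))
      (cong₂ _+_ (trans (∑-cong X (λ xs → open-ring (arcs (ℤ.+ 1) xs e) (arcs (ℤ.+ 1) xs (suc e)) (arcs (ℤ.+ 1) xs (2 ℕ.+ e)) (O xs))) (two pos (suc e) (2 ℕ.+ e)))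
                 (trans (∑-cong X (λ xs → close-ring (arcs (ℤ.+ 1) xs e) (arcs (ℤ.+ 1) xs (suc e)) (arcs (ℤ.+ 1) xs (2 ℕ.+ e)) (O xs))) (two pos e (suc e)))))
      (gather⁺ (W e) (W (suc e)) (W (2 ℕ.+ e)))
    three neg = trans (cong₂ _+_ (∑-zero-∈ X (λ {xs} _ → dead-ring (arcs -1ℤ xs e) (arcs -1ℤ xs (suc e)) (arcs -1ℤ xs (2 ℕ.+ e)) _))
      (cong₂ _+_ (trans (∑-cong X (λ xs → close-ring (arcs -1ℤ xs e) (arcs -1ℤ xs (suc e)) (arcs -1ℤ xs (2 ℕ.+ e)) (O xs))) (two neg e (suc e)))
                 (trans (∑-cong X (λ xs → open-ring (arcs -1ℤ xs e) (arcs -1ℤ xs (suc e)) (arcs -1ℤ xs (2 ℕ.+ e)) (O xs))) (two neg (suc e) (2 ℕ.+ e)))))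
      (gather⁻ (W e) (W (suc e)) (W (2 ℕ.+ e)))
      where
      -1ℤ : ℤ
      -1ℤ = ℤ.- (ℤ.+ 1)

arcSum-T : ∀ n {κ} → Positive κ → arcSum (ℤ.+ 1) n 0 0 κ ≡ T[ Q₂ ] n 0 κ
arcSum-T n {κ} p = trans (arcSum-tanh n 0 pos 0 p) (trans (⋆-congˡ Z-zero (T[ Q₂ ] n) 0 κ) (⋆-identity (T[ Q₂ ] n) 0 κ))

-- Sorted parking functions and their contents

mutual
  isDyck : ℕ → List ℕ → Bool
  isDyck zero    []       = true
  isDyck (suc j) []       = false
  isDyck j       (k ∷ as) = isDyck↓ (j ℕ.+ k) as

  isDyck↓ : ℕ → List ℕ → Bool
  isDyck↓ zero    as = false
  isDyck↓ (suc m) as = isDyck m as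

isDyck-∷ : ∀ j k as → isDyck j (k ∷ as) ≡ isDyck↓ (j ℕ.+ k) as
isDyck-∷ zero    k as = refl
isDyck-∷ (suc j) k as = refl

-- The inverse of taking contents, on sorted tuples with values from `i` on.
expand : ℕ → List ℕ → List ℕ
expand i []       = []
expand i (k ∷ as) = replicate k i ++ expand (suc i) as

insertInc-comm : ∀ x y zs → insertInc x (insertInc y zs) ≡ insertInc y (insertInc x zs)
insertInc-comm x y [] with x ≤ᵇ y in p | y ≤ᵇ x in q
... | true  | true  = cong₂ (λ a b → a ∷ b ∷ []) e (sym e)
  where e = ℕP.≤-antisym (ℕP.≤ᵇ⇒≤ x y (≡⇒T p)) (ℕP.≤ᵇ⇒≤ y x (≡⇒T q))
... | true  | false = refl
... | false | true  = refl
... | false | false with ℕP.≤-total x y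
...   | inj₁ h = ⊥-elim (subst T p (ℕP.≤⇒≤ᵇ h))
...   | inj₂ h = ⊥-elim (subst T q (ℕP.≤⇒≤ᵇ h))
insertInc-comm x y (z ∷ zs) with y ≤ᵇ z in p | x ≤ᵇ z in q
... | true  | true with x ≤ᵇ y in r | y ≤ᵇ x in s
...   | true  | true  = cong₂ (λ a b → a ∷ b ∷ z ∷ zs) e (sym e)
  where e = ℕP.≤-antisym (ℕP.≤ᵇ⇒≤ x y (≡⇒T r)) (ℕP.≤ᵇ⇒≤ y x (≡⇒T s))
...   | true  | false rewrite p = refl
...   | false | true  rewrite q = refl
...   | false | false with ℕP.≤-total x y
...     | inj₁ h = ⊥-elim (subst T r (ℕP.≤⇒≤ᵇ h))
...     | inj₂ h = ⊥-elim (subst T s (ℕP.≤⇒≤ᵇ h))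
insertInc-comm x y (z ∷ zs) | true | false with x ≤ᵇ y in r
... | true  = ⊥-elim (subst T q (ℕP.≤⇒≤ᵇ (ℕP.≤-trans (ℕP.≤ᵇ⇒≤ x y (≡⇒T r)) (ℕP.≤ᵇ⇒≤ y z (≡⇒T p)))))
... | false rewrite q | p = refl
insertInc-comm x y (z ∷ zs) | false | true with y ≤ᵇ x in r
... | true  = ⊥-elim (subst T p (ℕP.≤⇒≤ᵇ (ℕP.≤-trans (ℕP.≤ᵇ⇒≤ y x (≡⇒T r)) (ℕP.≤ᵇ⇒≤ x z (≡⇒T q)))))
... | false rewrite q | p = refl
insertInc-comm x y (z ∷ zs) | false | false rewrite q | p = cong (z ∷_) (insertInc-comm x y zs)

sortInc-↭⇒≡ : ∀ {xs ys} → xs ↭ ys → sortInc xs ≡ sortInc ys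
sortInc-↭⇒≡ ↭refl        = refl
sortInc-↭⇒≡ (prep x p)   = cong (insertInc x) (sortInc-↭⇒≡ p)
sortInc-↭⇒≡ (swap {xs} x y p) = trans (insertInc-comm x y (sortInc xs)) (cong (insertInc y ∘ insertInc x) (sortInc-↭⇒≡ p))
sortInc-↭⇒≡ (↭trans p q) = trans (sortInc-↭⇒≡ p) (sortInc-↭⇒≡ q)

insertInc-≤ : ∀ x {ys} → All (x ≤_) ys → insertInc x ys ≡ x ∷ ys
insertInc-≤ x []      = refl
insertInc-≤ x (_∷_ {y} p ps) rewrite T⇒≡ (ℕP.≤⇒≤ᵇ p) = refl

replicate-All : ∀ {P : A → Set} k {x} → P x → All P (replicate k x)
replicate-All zero    p = []
replicate-All (suc k) p = p ∷ replicate-All k p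

expand-≥ : ∀ i as → All (i ≤_) (expand i as)
expand-≥ i []       = []
expand-≥ i (k ∷ as) = AllP.++⁺ (replicate-All k ℕP.≤-refl) (All.map (ℕP.≤-trans (ℕP.n≤1+n i)) (expand-≥ (suc i) as))

sortInc-expand : ∀ i as → sortInc (expand i as) ≡ expand i as
sortInc-expand i []       = refl
sortInc-expand i (k ∷ as) = go k
  where
  go : ∀ k → sortInc (replicate k i ++ expand (suc i) as) ≡ replicate k i ++ expand (suc i) as
  go zero    = sortInc-expand (suc i) as
  go (suc k) = trans (cong (insertInc i) (go k)) (insertInc-≤ i (expand-≥ i (k ∷ as)))

expand-< : ∀ i as → All (_< i ℕ.+ length as) (expand i as)
expand-< i []       = []
expand-< i (k ∷ as) = AllP.++⁺ (replicate-All k (ℕP.m<m+n i (s≤s z≤n)))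
  (All.map (λ p → ℕP.≤-trans p (ℕP.≤-reflexive (sym (ℕP.+-suc i (length as))))) (expand-< (suc i) as))

length-expand : ∀ i as → length (expand i as) ≡ sum as
length-expand i []       = refl
length-expand i (k ∷ as) = trans (LP.length-++ (replicate k i)) (cong₂ ℕ._+_ (LP.length-replicate k) (length-expand (suc i) as))

count-++ : ∀ k xs ys → count k (xs ++ ys) ≡ count k xs ℕ.+ count k ys
count-++ k []       ys = refl
count-++ k (x ∷ xs) ys = trans (count-∷ k x (xs ++ ys)) (trans (cong (_ ℕ.+_) (count-++ k xs ys))
  (trans (sym (ℕP.+-assoc _ (count k xs) (count k ys))) (cong (ℕ._+ count k ys) (sym (count-∷ k x xs)))))

count-∉ : ∀ k xs → k ∉ xs → count k xs ≡ 0
count-∉ k []       n = refl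
count-∉ k (x ∷ xs) n = trans (count-∷ k x xs)
  (cong₂ ℕ._+_ (cong (λ b → if b then 1 else 0) (≡ᵇ-false {k} {x} (n ∘ here))) (count-∉ k xs (n ∘ there)))

count-≢0 : ∀ k xs → count k xs ≢ 0 → k ∈ xs
count-≢0 k []       n = ⊥-elim (n refl)
count-≢0 k (x ∷ xs) n with k ℕ.≟ x
... | yes refl = here refl
... | no ne    = there (count-≢0 k xs (λ e → n (trans (count-∷ k x xs) (cong₂ ℕ._+_ (cong (λ b → if b then 1 else 0) (≡ᵇ-false ne)) e))))

count-self : ∀ k xs → count k (k ∷ xs) ≡ suc (count k xs)
count-self k xs = trans (count-∷ k k xs) (cong (λ b → (if b then 1 else 0) ℕ.+ count k xs) (≡ᵇ-refl k))

count-replicate : ∀ m i → count i (replicate m i) ≡ m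
count-replicate zero    i = refl
count-replicate (suc m) i = trans (count-self i (replicate m i)) (cong suc (count-replicate m i))

count⇒↭ : ∀ xs ys → (∀ k → count k xs ≡ count k ys) → xs ↭ ys
count⇒↭ []       []       h = ↭-refl
count⇒↭ []       (y ∷ ys) h = ⊥-elim (ℕP.0≢1+n (trans (h y) (count-self y ys)))
count⇒↭ (x ∷ xs) ys h with ∈P.∈-∃++ (count-≢0 x ys (λ e → ℕP.0≢1+n (trans (sym e) (trans (sym (h x)) (count-self x xs)))))
... | as , bs , refl = ↭-trans (prep x (count⇒↭ xs (as ++ bs) h′)) (↭-sym (↭P.shift x as bs))
  where
  h′ : ∀ k → count k xs ≡ count k (as ++ bs)
  h′ k = ℕP.+-cancelˡ-≡ (if k ≡ᵇ x then 1 else 0) _ _ (trans (sym (count-∷ k x xs)) (trans (h k) (trans (count-↭ k (↭P.shift x as bs)) (count-∷ k x (as ++ bs)))))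

content-upTo : ∀ n p → content n p ≡ map (λ k → count (suc k) p) (upTo n)
content-upTo n p = sym (LP.map-∘ (upTo n))

length-content : ∀ n p → length (content n p) ≡ n
length-content n p = trans (LP.length-map (α p) (range 1 n)) (length-range 1 n)

map-upTo-suc : ∀ (f : ℕ → A) n → map f (upTo (suc n)) ≡ f 0 ∷ map (f ∘ suc) (upTo n)
map-upTo-suc f n = cong (f 0 ∷_) (trans (cong (map f) (sym (LP.map-upTo suc n))) (sym (LP.map-∘ (upTo n))))

count-expand-< : ∀ {k} i as → k < i → count k (expand i as) ≡ 0
count-expand-< {k} i as k<i = count-∉ k (expand i as) (λ m → ℕP.<⇒≱ k<i (All.lookup (expand-≥ i as) m))

counts-expand : ∀ i as → map (λ k → count (i ℕ.+ k) (expand i as)) (upTo (length as)) ≡ as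
counts-expand i []       = refl
counts-expand i (a ∷ as) = trans (map-upTo-suc _ (length as)) (cong₂ _∷_ hd (trans (LP.map-cong tl (upTo (length as))) (counts-expand (suc i) as)))
  where
  hd : count (i ℕ.+ 0) (replicate a i ++ expand (suc i) as) ≡ a
  hd rewrite ℕP.+-identityʳ i = trans (count-++ i (replicate a i) _)
    (trans (cong₂ ℕ._+_ (count-replicate a i) (count-expand-< (suc i) as ℕP.≤-refl)) (ℕP.+-identityʳ a))
  tl : ∀ k → count (i ℕ.+ suc k) (replicate a i ++ expand (suc i) as) ≡ count (suc i ℕ.+ k) (expand (suc i) as)
  tl k rewrite ℕP.+-suc i k = trans (count-++ (suc (i ℕ.+ k)) (replicate a i) _)
    (cong (ℕ._+ count (suc (i ℕ.+ k)) (expand (suc i) as)) (count-∉ (suc (i ℕ.+ k)) (replicate a i) (λ m → ℕP.<⇒≢ (ℕP.m<m+n i {suc k} (s≤s z≤n)) (sym (trans (ℕP.+-suc i k) (All.lookup (replicate-All {P = _≡ i} a refl) m))))))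

content-expand : ∀ n as → length as ≡ n → content n (expand 1 as) ≡ as
content-expand n as refl = trans (content-upTo n (expand 1 as)) (counts-expand 1 as)

map-≡⇒ : ∀ {f g : A → B} xs → map f xs ≡ map g xs → ∀ {x} → x ∈ xs → f x ≡ g x
map-≡⇒ (x ∷ xs) e (here refl) = LP.∷-injectiveˡ e
map-≡⇒ (x ∷ xs) e (there m)   = map-≡⇒ xs (LP.∷-injectiveʳ e) m

InRange : ℕ → List ℕ → Set
InRange n p = ∀ {x} → x ∈ p → x ∈ range 1 n

expand-InRange : ∀ n as → length as ≡ n → InRange n (expand 1 as)
expand-InRange n as refl m = range-∈⁺ (All.lookup (expand-≥ 1 as) m) (ℕP.≤-pred (All.lookup (expand-< 1 as) m))

↭-expand-content : ∀ n p → InRange n p → p ↭ expand 1 (content n p)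
↭-expand-content n p r = count⇒↭ p _ cnt
  where
  ex = expand 1 (content n p)
  cnt : ∀ k → count k p ≡ count k ex
  cnt k with k ∈? range 1 n
  ... | yes m = map-≡⇒ (range 1 n) (sym (content-expand n (content n p) (length-content n p))) m
  ... | no nm = trans (count-∉ k p (nm ∘ r)) (sym (count-∉ k ex (nm ∘ expand-InRange n (content n p) (length-content n p))))

sortInc-content : ∀ n p → InRange n p → sortInc p ≡ expand 1 (content n p)
sortInc-content n p r = trans (sortInc-↭⇒≡ (↭-expand-content n p r)) (sortInc-expand 1 (content n p))

sum-content : ∀ n p → InRange n p → sum (content n p) ≡ length p
sum-content n p r = trans (sym (length-expand 1 (content n p))) (sym (↭P.↭-length (↭-expand-content n p r)))

-- The local function in the definition of isPF has no name outside it; unification supplies one.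
mutual
  pfGo : ℕ → List ℕ → ℕ → List ℕ → Bool
  pfGo = _

  isPF≡pfGo : ∀ n p → isPF n p ≡ (length p ≡ᵇ n) ∧ pfGo n p 1 (sortInc p)
  isPF≡pfGo n p with 1 | sortInc p
  ... | i | xs = refl

pfGo-replicate : ∀ n p k i t xs → 1 ≤ i → i ≤ t → pfGo n p t (replicate k i ++ xs) ≡ pfGo n p (t ℕ.+ k) xs
pfGo-replicate n p zero    i t xs 1≤i i≤t rewrite ℕP.+-identityʳ t = refl
pfGo-replicate n p (suc k) i t xs 1≤i i≤t
  rewrite T⇒≡ (ℕP.≤⇒≤ᵇ 1≤i) | T⇒≡ (ℕP.≤⇒≤ᵇ i≤t) | ℕP.+-suc t k = pfGo-replicate n p k i (suc t) xs 1≤i (ℕP.m≤n⇒m≤1+n i≤t)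

pfGo-above : ∀ n p t x xs → All (suc t ≤_) (x ∷ xs) → pfGo n p t (x ∷ xs) ≡ false
pfGo-above n p t x xs (t<x ∷ _) rewrite ¬T⇒≡ {x ≤ᵇ t} (λ b → ℕP.<⇒≱ t<x (ℕP.≤ᵇ⇒≤ x t b)) = BP.∧-zeroʳ (1 ≤ᵇ x)

-- When the copies of `i` are reached, the position counter is `i + j`, ahead of the value by the
-- height `j`. All copies pass the test, and the height left after them is the lead over the next
-- value, plus 1.
pfGo-expand : ∀ n p i j as → 1 ≤ i → j ℕ.+ sum as ≡ length as → pfGo n p (i ℕ.+ j) (expand i as) ≡ isDyck j as
pfGo-expand n p i zero    []       1≤i e = refl
pfGo-expand n p i j       (k ∷ as) 1≤i e = trans (pfGo-replicate n p k i (i ℕ.+ j) (expand (suc i) as) 1≤i (ℕP.m≤m+n i j))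
  (trans (cong (λ t → pfGo n p t (expand (suc i) as)) (ℕP.+-assoc i j k))
  (trans (step (j ℕ.+ k) (trans (ℕP.+-assoc j k (sum as)) e)) (sym (isDyck-∷ j k as))))
  where
  step : ∀ m → m ℕ.+ sum as ≡ suc (length as) → pfGo n p (i ℕ.+ m) (expand (suc i) as) ≡ isDyck↓ m as
  step (suc m) e′ rewrite ℕP.+-suc i m = pfGo-expand n p (suc i) m as (s≤s z≤n) (ℕP.suc-injective e′)
  -- The path cannot step down. By `e′` some entry still follows; it is at least `i + 1` but stands
  -- at position `i`.
  step zero    e′ rewrite ℕP.+-identityʳ i with expand (suc i) as in eq | expand-≥ (suc i) as
  ... | []     | _ = ⊥-elim (ℕP.0≢1+n (trans (sym (trans (sym (length-expand (suc i) as)) (cong length eq))) e′))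
  ... | x ∷ xs | h = pfGo-above n p i x xs h

isPF-isDyck : ∀ n p → InRange n p → length p ≡ n → isPF n p ≡ isDyck 0 (content n p)
isPF-isDyck n p r e = begin
  isPF n p                                      ≡⟨ isPF≡pfGo n p ⟩
  (length p ≡ᵇ n) ∧ pfGo n p 1 (sortInc p)      ≡⟨ cong (_∧ pfGo n p 1 (sortInc p)) (T⇒≡ (ℕP.≡⇒≡ᵇ _ _ e)) ⟩
  pfGo n p 1 (sortInc p)                        ≡⟨ cong (pfGo n p 1) (sortInc-content n p r) ⟩
  pfGo n p 1 (expand 1 (content n p))           ≡⟨ pfGo-expand n p 1 0 (content n p) (s≤s z≤n) (trans (sum-content n p r) (trans e (sym (length-content n p)))) ⟩
  isDyck 0 (content n p)                        ∎

isDyck-sum : ∀ j as → T (isDyck j as) → j ℕ.+ sum as ≡ length as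
isDyck-sum zero    []       t = refl
isDyck-sum j       (k ∷ as) t = trans (sym (ℕP.+-assoc j k (sum as))) (step (j ℕ.+ k) (subst T (isDyck-∷ j k as) t))
  where
  step : ∀ m → T (isDyck↓ m as) → m ℕ.+ sum as ≡ suc (length as)
  step (suc m) t′ = cong suc (isDyck-sum m as t′)

Pf-∈⁻ : ∀ n {p} → p ∈ Pf n → InRange n p × length p ≡ n × T (isDyck 0 (content n p))
Pf-∈⁻ n m with filterᵇ-∈⁻ (isPF n) (tuples (range 1 n) n) m
... | m′ , t with tuples-∈⁻ (range 1 n) n m′
...   | l , r = r , l , subst T (isPF-isDyck n _ r l) t

Pf-∈⁺ : ∀ n {p} → InRange n p → length p ≡ n → T (isDyck 0 (content n p)) → p ∈ Pf n
Pf-∈⁺ n {p} r l t = filterᵇ-∈⁺ (isPF n) (subst (λ k → p ∈ tuples (range 1 n) k) l (tuples-∈⁺ (range 1 n) p r)) (subst T (sym (isPF-isDyck n p r l)) t)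

map-! : ∀ (f : A → B) {xs} → (∀ {x y} → x ∈ xs → y ∈ xs → f x ≡ f y → x ≡ y) → Unique xs → Unique (map f xs)
map-! f h []       = []
map-! f h (x∉ ∷ u) = AllP.map⁺ (All.tabulate (λ m e → All.lookup x∉ m (h (here refl) (there m) e))) ∷ map-! f (λ p q → h (there p) (there q)) u

sortedPf : ℕ → List (List ℕ)
sortedPf n = filterᵇ isSorted (Pf n)

dyckContents : ℕ → List (List ℕ)
dyckContents n = filterᵇ (isDyck 0) (tuples (upTo (suc n)) n)

sum-∈ : ∀ {x} as → x ∈ as → x ≤ sum as
sum-∈ (a ∷ as) (here refl) = ℕP.m≤m+n a (sum as)
sum-∈ (a ∷ as) (there m)   = ℕP.≤-trans (sum-∈ as m) (ℕP.m≤n+m (sum as) a)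

-- A sorted parking function is determined by its content, and the contents that occur are the Dyck
-- vectors. Their entries add up to `n`, so listing entries up to `n` loses nothing.
∑-sortedPf : ∀ n (F : List ℕ → ℚ) → ∑ (sortedPf n) (λ p → F (content n p)) ≡ ∑ (tuples (upTo (suc n)) n) (λ as → 𝟙 (isDyck 0 as) * F as)
∑-sortedPf n F = begin
  ∑ (sortedPf n) (λ p → F (content n p))
    ≡⟨ ∑-set (filterᵇ-! isSorted (filterᵇ-! (isPF n) (tuples-! (range-! 1 n) n))) unique to from ⟩
  ∑ (map (expand 1) (dyckContents n)) (λ p → F (content n p))
    ≡⟨ ∑-map (expand 1) (dyckContents n) ⟩
  ∑ (dyckContents n) (λ as → F (content n (expand 1 as)))
    ≡⟨ ∑-cong-∈ (dyckContents n) (λ m → cong F (content-expand n _ (proj₁ (dyck m)))) ⟩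
  ∑ (dyckContents n) F
    ≡⟨ ∑-filter (isDyck 0) (tuples (upTo (suc n)) n) ⟩
  ∑ (tuples (upTo (suc n)) n) (λ as → 𝟙 (isDyck 0 as) * F as) ∎
  where
  dyck : ∀ {as} → as ∈ dyckContents n → length as ≡ n × T (isDyck 0 as)
  dyck m with filterᵇ-∈⁻ (isDyck 0) (tuples (upTo (suc n)) n) m
  ... | m′ , t = proj₁ (tuples-∈⁻ (upTo (suc n)) n m′) , t
  unique : Unique (map (expand 1) (dyckContents n))
  unique = map-! (expand 1) (λ {as} {bs} p q e → trans (sym (content-expand n as (proj₁ (dyck p)))) (trans (cong (content n) e) (content-expand n bs (proj₁ (dyck q)))))
    (filterᵇ-! (isDyck 0) (tuples-! (UP.upTo⁺ (suc n)) n))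
  to : ∀ {p} → p ∈ sortedPf n → p ∈ map (expand 1) (dyckContents n)
  to {p} m with filterᵇ-∈⁻ isSorted (Pf n) m
  ... | m′ , s with Pf-∈⁻ n m′
  ...   | r , l , d = subst (_∈ map (expand 1) (dyckContents n)) (sym (trans (eqListℕ⇒≡ p (sortInc p) s) (sortInc-content n p r)))
    (∈P.∈-map⁺ (expand 1) (filterᵇ-∈⁺ (isDyck 0) (subst (λ k → content n p ∈ tuples (upTo (suc n)) k) (length-content n p)
      (tuples-∈⁺ (upTo (suc n)) (content n p) (λ m → ∈P.∈-upTo⁺ (s≤s (ℕP.≤-trans (sum-∈ (content n p) m) (ℕP.≤-reflexive (trans (sum-content n p r) l))))))) d))
  from : ∀ {p} → p ∈ map (expand 1) (dyckContents n) → p ∈ sortedPf n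
  from m with ∈P.∈-map⁻ (expand 1) m
  ... | as , m′ , refl with dyck m′
  ...   | l , d = filterᵇ-∈⁺ isSorted (Pf-∈⁺ n (expand-InRange n as l) (trans (length-expand 1 as) (trans (isDyck-sum 0 as d) l)) (subst (T ∘ isDyck 0) (sym (content-expand n as l)) d))
      (≡⇒T (trans (cong (eqListℕ (expand 1 as)) (sortInc-expand 1 as)) (eqListℕ-refl (expand 1 as))))

-- From sums over contents to weighted paths

SlotWeight : Set
SlotWeight = ℕ → List ℕ → ℚ

pathWeight : List SlotWeight → List ℕ → List ℕ → ℚ
pathWeight (g ∷ gs) (a ∷ as) κ = ∑⊎ (λ μ ν → 𝟙 (sum μ ≡ᵇ a) * g a μ * pathWeight gs as ν) κ
pathWeight []       []       κ = 𝟙 (null κ)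
pathWeight _        _        κ = 0ℚ

pathSum : List SlotWeight → ℕ → List ℕ → ℚ
pathSum []       = dyckEnd
pathSum (g ∷ gs) = (λ μ → g (sum μ) μ) ⋆ ↓ (pathSum gs)

-- Each remaining slot lowers the height by at most 1, so height 0 is out of reach.
pathSum-high : ∀ gs j κ → length gs < j → pathSum gs j κ ≡ 0ℚ
pathSum-high []       (suc j) κ h = refl
pathSum-high (g ∷ gs) (suc j) κ (s≤s h) = ∑⊎-zero (λ μ ν → trans (cong (g (sum μ) μ *_) (pathSum-high gs (j ℕ.+ sum μ) ν (ℕP.≤-trans h (ℕP.m≤m+n j (sum μ))))) (R.zeroʳ _)) κ

-- Summing over the content releases the constraint on the total of each slot. Contents are listed
-- up to `N` only; a slot with a larger total lifts the path too high to return, by `pathSum-high`.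
∑-pathWeight : ∀ N gs → length gs ≤ N → ∀ j κ →
  ∑ (tuples (upTo (suc N)) (length gs)) (λ as → 𝟙 (isDyck j as) * pathWeight gs as κ) ≡ pathSum gs j κ
∑-pathWeight N []       h zero    κ = trans (R.+-identityʳ _) (R.*-identityˡ _)
∑-pathWeight N []       h (suc j) κ = trans (R.+-identityʳ _) (R.zeroˡ _)
∑-pathWeight N (g ∷ gs) h j       κ = begin
  ∑ (tuples (upTo (suc N)) (suc (length gs))) (λ as → 𝟙 (isDyck j as) * pathWeight (g ∷ gs) as κ)
    ≡⟨ ∑-tuples (upTo (suc N)) (length gs) ⟩
  ∑ (upTo (suc N)) (λ a → ∑ X (λ as → 𝟙 (isDyck j (a ∷ as)) * ∑⊎ (λ μ ν → 𝟙 (sum μ ≡ᵇ a) * g a μ * pathWeight gs as ν) κ))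
    ≡⟨ ∑-cong (upTo (suc N)) (λ a → inner a) ⟩
  ∑ (upTo (suc N)) (λ a → ∑⊎ (λ μ ν → 𝟙 (sum μ ≡ᵇ a) * (g a μ * ↓ (pathSum gs) (j ℕ.+ a) ν)) κ)
    ≡⟨ ∑⊎-∑ (upTo (suc N)) κ ⟨
  ∑⊎ (λ μ ν → ∑ (upTo (suc N)) (λ a → 𝟙 (sum μ ≡ᵇ a) * (g a μ * ↓ (pathSum gs) (j ℕ.+ a) ν))) κ
    ≡⟨ ∑⊎-cong collapse κ ⟩
  pathSum (g ∷ gs) j κ ∎
  where
  X : List (List ℕ)
  X = tuples (upTo (suc N)) (length gs)
  opaque
    unfolding _+_
    rearrange : ∀ a b c d → a * (b * c * d) ≡ b * c * (a * d)
    rearrange = solve-∀ ℚ-ring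
  step : ∀ m ν → ∑ X (λ as → 𝟙 (isDyck↓ m as) * pathWeight gs as ν) ≡ ↓ (pathSum gs) m ν
  step zero    ν = ∑-zero-∈ X (λ _ → R.zeroˡ _)
  step (suc m) ν = ∑-pathWeight N gs (ℕP.≤-trans (ℕP.n≤1+n _) h) m ν
  inner : ∀ a → ∑ X (λ as → 𝟙 (isDyck j (a ∷ as)) * ∑⊎ (λ μ ν → 𝟙 (sum μ ≡ᵇ a) * g a μ * pathWeight gs as ν) κ)
    ≡ ∑⊎ (λ μ ν → 𝟙 (sum μ ≡ᵇ a) * (g a μ * ↓ (pathSum gs) (j ℕ.+ a) ν)) κ
  inner a = begin
    ∑ X (λ as → 𝟙 (isDyck j (a ∷ as)) * ∑⊎ (λ μ ν → 𝟙 (sum μ ≡ᵇ a) * g a μ * pathWeight gs as ν) κ)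
      ≡⟨ ∑-cong X (λ as → trans (cong (λ b → 𝟙 b * _) (isDyck-∷ j a as)) (sym (∑⊎-*ˡ (𝟙 (isDyck↓ (j ℕ.+ a) as)) κ))) ⟩
    ∑ X (λ as → ∑⊎ (λ μ ν → 𝟙 (isDyck↓ (j ℕ.+ a) as) * (𝟙 (sum μ ≡ᵇ a) * g a μ * pathWeight gs as ν)) κ)
      ≡⟨ ∑⊎-∑ X κ ⟨
    ∑⊎ (λ μ ν → ∑ X (λ as → 𝟙 (isDyck↓ (j ℕ.+ a) as) * (𝟙 (sum μ ≡ᵇ a) * g a μ * pathWeight gs as ν))) κ
      ≡⟨ ∑⊎-cong (λ μ ν → trans (∑-cong X (λ as → rearrange (𝟙 (isDyck↓ (j ℕ.+ a) as)) (𝟙 (sum μ ≡ᵇ a)) (g a μ) (pathWeight gs as ν)))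
          (trans (∑-*ˡ (𝟙 (sum μ ≡ᵇ a) * g a μ) X) (trans (cong (𝟙 (sum μ ≡ᵇ a) * g a μ *_) (step (j ℕ.+ a) ν)) (R.*-assoc _ _ _)))) κ ⟩
    ∑⊎ (λ μ ν → 𝟙 (sum μ ≡ᵇ a) * (g a μ * ↓ (pathSum gs) (j ℕ.+ a) ν)) κ ∎
  collapse : ∀ μ ν → ∑ (upTo (suc N)) (λ a → 𝟙 (sum μ ≡ᵇ a) * (g a μ * ↓ (pathSum gs) (j ℕ.+ a) ν)) ≡ g (sum μ) μ * ↓ (pathSum gs) (j ℕ.+ sum μ) ν
  collapse μ ν with sum μ ℕP.≤? N
  ... | yes p = ∑-𝟙≡ (UP.upTo⁺ (suc N)) (∈P.∈-upTo⁺ (s≤s p)) (λ a → g a μ * ↓ (pathSum gs) (j ℕ.+ a) ν)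
  ... | no np = trans (∑-zero-∈ (upTo (suc N)) (λ {a} m → trans (cong (λ b → 𝟙 b * (g a μ * ↓ (pathSum gs) (j ℕ.+ a) ν)) (≡ᵇ-false {sum μ} {a} (λ { refl → np (ℕP.≤-pred (∈P.∈-upTo⁻ m)) }))) (R.zeroˡ _)))
      (sym (trans (cong (g (sum μ) μ *_) (high (j ℕ.+ sum μ) (ℕP.≤-trans (ℕP.≤-trans (s≤s h) (ℕP.≰⇒> np)) (ℕP.m≤n+m (sum μ) j)))) (R.zeroʳ _)))
    where
    high : ∀ m → suc (length (g ∷ gs)) ≤ m → ↓ (pathSum gs) m ν ≡ 0ℚ
    high (suc m) (s≤s q) = pathSum-high gs m ν q

pathSum-T : ∀ Q n j κ → pathSum (replicate n (λ _ → Q)) j κ ≡ T[ Q ] n j κ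
pathSum-T Q zero    j κ = refl
pathSum-T Q (suc n) j κ = ⋆-congʳ Q (↓-cong (pathSum-T Q n)) j κ

pathWeight-content : ∀ G n as κ → length as ≡ n → pathWeight (replicate n (λ _ → G)) as κ ≡ contentWeight G as κ
pathWeight-content G zero    []       κ e = refl
pathWeight-content G (suc n) (a ∷ as) κ e = ∑⊎-cong (λ μ ν → cong (𝟙 (sum μ ≡ᵇ a) * G μ *_) (pathWeight-content G n as ν (ℕP.suc-injective e))) κ

⟨PFsym⟩ : ∀ n κ → ⟨ PFsym n ∣ κ ⟩ ≡ ip κ * T[ (λ _ → 1ℚ) ] n 0 κ
⟨PFsym⟩ n κ = begin
  ⟨ PFsym n ∣ κ ⟩
    ≡⟨ ⟨sumS⟩ (sortedPf n) (λ p → hλ (shape n p)) κ ⟩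
  ∑ (sortedPf n) (λ p → ⟨ hλ (shape n p) ∣ κ ⟩)
    ≡⟨ ∑-cong (sortedPf n) (λ p → ⟨prodS⟩-shape hS (λ _ → 1ℚ) refl ⟨hS⟩ n p κ) ⟩
  ∑ (sortedPf n) (λ p → ip κ * contentWeight (λ _ → 1ℚ) (content n p) κ)
    ≡⟨ ∑-*ˡ (ip κ) (sortedPf n) ⟩
  ip κ * ∑ (sortedPf n) (λ p → contentWeight (λ _ → 1ℚ) (content n p) κ)
    ≡⟨ cong (ip κ *_) (∑-sortedPf n (λ as → contentWeight (λ _ → 1ℚ) as κ)) ⟩
  ip κ * ∑ (tuples (upTo (suc n)) n) (λ as → 𝟙 (isDyck 0 as) * contentWeight (λ _ → 1ℚ) as κ)
    ≡⟨ cong (ip κ *_) (∑-cong-∈ (tuples (upTo (suc n)) n) (λ {as} m → cong (𝟙 (isDyck 0 as) *_) (sym (pathWeight-content (λ _ → 1ℚ) n as κ (proj₁ (tuples-∈⁻ (upTo (suc n)) n m)))))) ⟩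
  ip κ * ∑ (tuples (upTo (suc n)) n) (λ as → 𝟙 (isDyck 0 as) * pathWeight ones as κ)
    ≡⟨ cong (ip κ *_) (subst (λ l → ∑ (tuples (upTo (suc n)) l) (λ as → 𝟙 (isDyck 0 as) * pathWeight ones as κ) ≡ pathSum ones 0 κ) (LP.length-replicate n) (∑-pathWeight n ones (ℕP.≤-reflexive (LP.length-replicate n)) 0 κ)) ⟩
  ip κ * pathSum ones 0 κ
    ≡⟨ cong (ip κ *_) (pathSum-T (λ _ → 1ℚ) n 0 κ) ⟩
  ip κ * T[ (λ _ → 1ℚ) ] n 0 κ ∎
  where
  ones : List SlotWeight
  ones = replicate n (λ _ _ → 1ℚ)

⟨SHsym⟩ : ∀ n κ → ⟨ SHsym n ∣ κ ⟩ ≡ ip κ * T[ Q₂ ] n 0 κ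
⟨SHsym⟩ n κ = begin
  ⟨ SHsym n ∣ κ ⟩                                     ≡⟨ ⟨sh⟩ (PFsym n) κ ⟩
  Q₂ κ * ⟨ PFsym n ∣ κ ⟩                              ≡⟨ cong (Q₂ κ *_) (⟨PFsym⟩ n κ) ⟩
  Q₂ κ * (ip κ * T[ (λ _ → 1ℚ) ] n 0 κ)               ≡⟨ x∙yz≈y∙xz (Q₂ κ) (ip κ) _ ⟩
  ip κ * (Q₂ κ * T[ (λ _ → 1ℚ) ] n 0 κ)               ≡⟨ cong (ip κ *_) (T-weight _ n 0 κ) ⟩
  ip κ * T[ Q₂ ] n 0 κ                                ∎

-- Valid matchings as cliques

¬T-intro : ∀ {b} → ¬ T b → T (not b)
¬T-intro {true}  n = n tt
¬T-intro {false} n = tt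

¬T-elim : ∀ {b} → T (not b) → ¬ T b
¬T-elim {false} _ ()

⇒-intro : ∀ {b c} → (T b → T c) → T (if b then c else true)
⇒-intro {true}  f = f tt
⇒-intro {false} f = tt

⇒-elim : ∀ {b c} → T (if b then c else true) → T b → T c
⇒-elim {true} t _ = t

eqℤ⇒≡ : ∀ {x y} → T (eqℤ x y) → x ≡ y
eqℤ⇒≡ {x} {y} t with x ℤ.≟ y
... | yes p = p

≡⇒eqℤ : ∀ {x y} → x ≡ y → T (eqℤ x y)
≡⇒eqℤ {x} {y} e with x ℤ.≟ y
... | yes _ = tt
... | no n  = n e

≢⇒not≡ᵇ : ∀ {x y} → x ≢ y → T (not (x ≡ᵇ y))
≢⇒not≡ᵇ {x} {y} n = ¬T-intro (n ∘ ℕP.≡ᵇ⇒≡ x y)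

not≡ᵇ⇒≢ : ∀ {x y} → T (not (x ≡ᵇ y)) → x ≢ y
not≡ᵇ⇒≢ {x} {y} t e = ¬T-elim t (ℕP.≡⇒≡ᵇ x y e)

all-cong : ∀ {P Q : A → Bool} → (∀ x → P x ≡ Q x) → ∀ xs → all P xs ≡ all Q xs
all-cong h []       = refl
all-cong h (x ∷ xs) = cong₂ _∧_ (h x) (all-cong h xs)

Pair : Set
Pair = ℕ × ℕ

-- `validτ` with the appearing values and the slot signs as parameters: `validτ p σ τ` unfolds to an
-- instance, and instances that agree on both can be exchanged.
module Matching (ap : ℕ → Bool) (sb : ℕ → ℤ) where

  proper : Pair → Bool
  proper (a , b) = (a <ᵇ b) ∧ ap a ∧ ap b

  opposite : Pair → Bool
  opposite (a , b) = eqℤ (sb a) (ℤ.- sb b)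

  covers : Pair → Bool
  covers (a , c) = all (λ b → if (a <ᵇ b) ∧ (b <ᵇ c) then ap b else true) (range 1 c)

  cond : Pair → Pair → Bool
  cond (a , c) (b , d) =
    not ((a <ᵇ b) ∧ (b <ᵇ c) ∧ (c <ᵇ d))
    ∧ (if (a <ᵇ b) ∧ (b <ᵇ d) ∧ (d <ᵇ c) then eqℤ (sb a) (sb b) else true)

  valid : List Pair → Bool
  valid τ = all proper τ ∧ noDup (endpoints τ) ∧ all opposite τ ∧ all covers τ ∧ all (λ x → all (cond x) τ) τ

  arc : Pair → Bool
  arc x = proper x ∧ opposite x ∧ covers x

  disjoint : Pair → Pair → Bool
  disjoint (a , b) (c , d) = (not (a ≡ᵇ c) ∧ not (a ≡ᵇ d)) ∧ (not (b ≡ᵇ c) ∧ not (b ≡ᵇ d))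

  compat : Pair → Pair → Bool
  compat x y = disjoint x y ∧ cond x y ∧ cond y x

  -- Each condition involves one arc or two, so validity is a pairwise compatibility and a matching
  -- can be built arc by arc.
  clique : List Pair → Bool
  clique []      = true
  clique (x ∷ τ) = arc x ∧ all (compat x) τ ∧ clique τ

  -- `valid` tests each arc against itself as well, which `clique` does not.
  cond-refl : ∀ x → T (cond x x)
  cond-refl (a , c) = ∧-intro (¬T-intro (λ t → irr (∧-fst t))) (⇒-intro (λ t → ⊥-elim (irr (∧-fst t))))
    where
    irr : ¬ T (a <ᵇ a)
    irr t = ℕP.<-irrefl refl (ℕP.<ᵇ⇒< a a t)

  not-any⁺ : ∀ x ys → (∀ {y} → y ∈ ys → x ≢ y) → T (not (any (x ≡ᵇ_) ys))
  not-any⁺ x []       h = tt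
  not-any⁺ x (y ∷ ys) h rewrite ≡ᵇ-false (h (here refl)) = not-any⁺ x ys (h ∘ there)

  not-any⁻ : ∀ x ys → T (not (any (x ≡ᵇ_) ys)) → ∀ {y} → y ∈ ys → x ≢ y
  not-any⁻ x (y ∷ ys) t m with x ≡ᵇ y in e
  not-any⁻ x (y ∷ ys) t (here refl) | false = λ e′ → subst T e (ℕP.≡⇒≡ᵇ _ _ e′)
  not-any⁻ x (y ∷ ys) t (there m)   | false = not-any⁻ x ys t m

  endpoints-∈⁻ : ∀ τ {z} → z ∈ endpoints τ → ∃ λ y → y ∈ τ × (z ≡ proj₁ y ⊎ z ≡ proj₂ y)
  endpoints-∈⁻ (y ∷ τ) (here e)         = y , here refl , inj₁ e
  endpoints-∈⁻ (y ∷ τ) (there (here e)) = y , here refl , inj₂ e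
  endpoints-∈⁻ (y ∷ τ) (there (there m)) with endpoints-∈⁻ τ m
  ... | y′ , m′ , e = y′ , there m′ , e

  endpoints-∈⁺ : ∀ τ {y} → y ∈ τ → proj₁ y ∈ endpoints τ × proj₂ y ∈ endpoints τ
  endpoints-∈⁺ (y ∷ τ) (here refl) = here refl , there (here refl)
  endpoints-∈⁺ (y ∷ τ) (there m) with endpoints-∈⁺ τ m
  ... | p , q = there (there p) , there (there q)

  valid⇒clique : ∀ τ → T (valid τ) → T (clique τ)
  valid⇒clique []            t = tt
  valid⇒clique (x@(a , b) ∷ τ) t = ∧-intro {arc x} (∧-intro {proper x} (∧-fst t₁) (∧-intro {opposite x} (∧-fst t₃) (∧-fst t₄)))
    (∧-intro {all (compat x) τ} (all-T (compat x) τ comp) (valid⇒clique τ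
      (∧-intro {all proper τ} (∧-snd {proper x} t₁) (∧-intro {noDup (endpoints τ)} nd (∧-intro {all opposite τ} (∧-snd {opposite x} t₃)
        (∧-intro {all covers τ} (∧-snd {covers x} t₄) (all-T _ τ (λ m → all-T _ τ (λ m′ → cc (there m) (there m′))))))))))
    where
    t₁ = ∧-fst {all proper (x ∷ τ)} t
    r₁ = ∧-snd {all proper (x ∷ τ)} t
    t₂ = ∧-fst {noDup (endpoints (x ∷ τ))} r₁
    r₂ = ∧-snd {noDup (endpoints (x ∷ τ))} r₁
    t₃ = ∧-fst {all opposite (x ∷ τ)} r₂
    r₃ = ∧-snd {all opposite (x ∷ τ)} r₂
    t₄ = ∧-fst {all covers (x ∷ τ)} r₃
    t₅ = ∧-snd {all covers (x ∷ τ)} r₃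
    cc : ∀ {y z} → y ∈ x ∷ τ → z ∈ x ∷ τ → T (cond y z)
    cc m m′ = T-all _ (x ∷ τ) (T-all (λ y → all (cond y) (x ∷ τ)) (x ∷ τ) t₅ m) m′
    n₁ = not-any⁻ a (b ∷ endpoints τ) (∧-fst t₂)
    s₂ = ∧-snd {not (any (a ≡ᵇ_) (b ∷ endpoints τ))} t₂
    n₂ = not-any⁻ b (endpoints τ) (∧-fst s₂)
    nd = ∧-snd {not (any (b ≡ᵇ_) (endpoints τ))} s₂
    comp : ∀ {y} → y ∈ τ → T (compat x y)
    comp {c , d} m with endpoints-∈⁺ τ m
    ... | p , q = ∧-intro {disjoint x (c , d)}
      (∧-intro {not (a ≡ᵇ c) ∧ not (a ≡ᵇ d)} (∧-intro {not (a ≡ᵇ c)} (≢⇒not≡ᵇ (n₁ (there p))) (≢⇒not≡ᵇ (n₁ (there q)))) (∧-intro {not (b ≡ᵇ c)} (≢⇒not≡ᵇ (n₂ p)) (≢⇒not≡ᵇ (n₂ q))))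
      (∧-intro {cond x (c , d)} (cc (here refl) (there m)) (cc (there m) (here refl)))

  clique⇒valid : ∀ τ → T (clique τ) → T (valid τ)
  clique⇒valid []            t = tt
  clique⇒valid (x@(a , b) ∷ τ) t = ∧-intro {all proper (x ∷ τ)} (∧-intro {proper x} u₁ t₁)
    (∧-intro {noDup (endpoints (x ∷ τ))} (∧-intro {not (any (a ≡ᵇ_) (b ∷ endpoints τ))} (not-any⁺ a (b ∷ endpoints τ) na) (∧-intro {not (any (b ≡ᵇ_) (endpoints τ))} (not-any⁺ b (endpoints τ) nb) t₂))
    (∧-intro {all opposite (x ∷ τ)} (∧-intro {opposite x} (∧-fst u₂) t₃)
    (∧-intro {all covers (x ∷ τ)} (∧-intro {covers x} (∧-snd {opposite x} u₂) t₄)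
      (all-T _ (x ∷ τ) (λ m → all-T _ (x ∷ τ) (λ m′ → cc m m′))))))
    where
    u = ∧-fst {arc x} t
    u₁ = ∧-fst {proper x} u
    u₂ = ∧-snd {proper x} u
    s = ∧-snd {arc x} t
    comp : ∀ {y} → y ∈ τ → T (compat x y)
    comp = T-all (compat x) τ (∧-fst {all (compat x) τ} s)
    v = clique⇒valid τ (∧-snd {all (compat x) τ} s)
    t₁ = ∧-fst {all proper τ} v
    r₁ = ∧-snd {all proper τ} v
    t₂ = ∧-fst {noDup (endpoints τ)} r₁
    r₂ = ∧-snd {noDup (endpoints τ)} r₁
    t₃ = ∧-fst {all opposite τ} r₂
    r₃ = ∧-snd {all opposite τ} r₂
    t₄ = ∧-fst {all covers τ} r₃
    t₅ = ∧-snd {all covers τ} r₃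
    dj : ∀ {y} → y ∈ τ → T (disjoint x y)
    dj m = ∧-fst (comp m)
    na : ∀ {z} → z ∈ b ∷ endpoints τ → a ≢ z
    na (here refl) refl = ℕP.<-irrefl refl (ℕP.<ᵇ⇒< a b (∧-fst u₁))
    na (there m) with endpoints-∈⁻ τ m
    ... | (c , d) , m′ , inj₁ refl = not≡ᵇ⇒≢ (∧-fst {not (a ≡ᵇ c)} (∧-fst {not (a ≡ᵇ c) ∧ not (a ≡ᵇ d)} (dj m′)))
    ... | (c , d) , m′ , inj₂ refl = not≡ᵇ⇒≢ (∧-snd {not (a ≡ᵇ c)} (∧-fst {not (a ≡ᵇ c) ∧ not (a ≡ᵇ d)} (dj m′)))
    nb : ∀ {z} → z ∈ endpoints τ → b ≢ z
    nb m with endpoints-∈⁻ τ m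
    ... | (c , d) , m′ , inj₁ refl = not≡ᵇ⇒≢ (∧-fst {not (b ≡ᵇ c)} (∧-snd {not (a ≡ᵇ c) ∧ not (a ≡ᵇ d)} (dj m′)))
    ... | (c , d) , m′ , inj₂ refl = not≡ᵇ⇒≢ (∧-snd {not (b ≡ᵇ c)} (∧-snd {not (a ≡ᵇ c) ∧ not (a ≡ᵇ d)} (dj m′)))
    cc : ∀ {y z} → y ∈ x ∷ τ → z ∈ x ∷ τ → T (cond y z)
    cc (here refl) (here refl) = cond-refl x
    cc {_} {z} (here refl) (there m) = ∧-fst {cond x z} (∧-snd {disjoint x z} (comp m))
    cc {y} (there m) (here refl) = ∧-snd {cond x y} (∧-snd {disjoint x y} (comp m))
    cc (there m) (there m′) = T-all _ τ (T-all (λ y → all (cond y) τ) τ t₅ m) m′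

  valid-clique : ∀ τ → valid τ ≡ clique τ
  valid-clique τ = Bool-ext (valid⇒clique τ) (clique⇒valid τ)

  -- Counts the cliques among the sublists of `L`; `P` accumulates compatibility with the arcs
  -- chosen so far.
  cliques : (Pair → Bool) → List Pair → ℚ
  cliques P []      = 1ℚ
  cliques P (x ∷ L) = 𝟙 (P x ∧ arc x) * cliques (λ y → P y ∧ compat x y) L + cliques P L

  all-∧ : ∀ (P Q : Pair → Bool) τ → all (λ y → P y ∧ Q y) τ ≡ all P τ ∧ all Q τ
  all-∧ P Q []      = refl
  all-∧ P Q (y ∷ τ) rewrite all-∧ P Q τ with P y | Q y
  ... | true  | true  = refl
  ... | true  | false = sym (BP.∧-zeroʳ (all P τ))
  ... | false | _     = refl

  ∑-sublists-cliques : ∀ P L → ∑ (sublists L) (λ τ → 𝟙 (all P τ) * 𝟙 (clique τ)) ≡ cliques P L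
  ∑-sublists-cliques P []      = trans (R.+-identityʳ _) (R.*-identityˡ 1ℚ)
  ∑-sublists-cliques P (x ∷ L) = begin
    ∑ (map (x ∷_) (sublists L) ++ sublists L) (λ τ → 𝟙 (all P τ) * 𝟙 (clique τ))
      ≡⟨ trans (∑-++ (map (x ∷_) (sublists L)) (sublists L)) (cong₂ _+_ (∑-map (x ∷_) (sublists L)) (∑-sublists-cliques P L)) ⟩
    ∑ (sublists L) (λ τ → 𝟙 (P x ∧ all P τ) * 𝟙 (arc x ∧ all (compat x) τ ∧ clique τ)) + cliques P L
      ≡⟨ cong₂ _+_ (trans (∑-cong (sublists L) step) (∑-*ˡ (𝟙 (P x ∧ arc x)) (sublists L))) refl ⟩
    𝟙 (P x ∧ arc x) * ∑ (sublists L) (λ τ → 𝟙 (all (λ y → P y ∧ compat x y) τ) * 𝟙 (clique τ)) + cliques P L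
      ≡⟨ cong₂ _+_ (cong (𝟙 (P x ∧ arc x) *_) (∑-sublists-cliques (λ y → P y ∧ compat x y) L)) refl ⟩
    cliques P (x ∷ L) ∎
    where
    opaque
      unfolding _+_
      regroup : ∀ a b c d e → a * b * (c * (d * e)) ≡ a * c * (b * d * e)
      regroup = solve-∀ ℚ-ring
    step : ∀ τ → 𝟙 (P x ∧ all P τ) * 𝟙 (arc x ∧ all (compat x) τ ∧ clique τ) ≡ 𝟙 (P x ∧ arc x) * (𝟙 (all (λ y → P y ∧ compat x y) τ) * 𝟙 (clique τ))
    step τ = trans (cong₂ _*_ (𝟙-∧ (P x) (all P τ)) (trans (𝟙-∧ (arc x) _) (cong (𝟙 (arc x) *_) (𝟙-∧ (all (compat x) τ) (clique τ)))))
      (trans (regroup (𝟙 (P x)) (𝟙 (all P τ)) (𝟙 (arc x)) (𝟙 (all (compat x) τ)) (𝟙 (clique τ)))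
        (cong₂ (λ a b → a * (b * 𝟙 (clique τ))) (sym (𝟙-∧ (P x) (arc x))) (trans (sym (𝟙-∧ (all P τ) (all (compat x) τ))) (cong 𝟙 (sym (all-∧ P (compat x) τ))))))

  cliques-cong : ∀ {P Q : Pair → Bool} L → (∀ {y} → y ∈ L → P y ≡ Q y) → cliques P L ≡ cliques Q L
  cliques-cong []      h = refl
  cliques-cong (x ∷ L) h = cong₂ _+_ (cong₂ (λ a b → 𝟙 (a ∧ arc x) * b) (h (here refl)) (cliques-cong L (λ m → cong (_∧ compat x _) (h (there m))))) (cliques-cong L (h ∘ there))

  cliques-skip : ∀ {P : Pair → Bool} a bs M → (∀ b → P (a , b) ≡ false) → cliques P (map (a ,_) bs ++ M) ≡ cliques P M
  cliques-skip a []       M h = refl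
  cliques-skip {P} a (b ∷ bs) M h rewrite h b = trans (cong₂ _+_ (R.zeroˡ _) (cliques-skip a bs M h)) (R.+-identityˡ _)

  compat-same : ∀ a b c → compat (a , b) (a , c) ≡ false
  compat-same a b c rewrite ≡ᵇ-refl a = refl

  -- Arcs with a common left endpoint exclude each other, so at most one is chosen from the block.
  cliques-block : ∀ P a bs M → cliques P (map (a ,_) bs ++ M) ≡ cliques P M + ∑ bs (λ b → 𝟙 (P (a , b) ∧ arc (a , b)) * cliques (λ y → P y ∧ compat (a , b) y) M)
  cliques-block P a []       M = sym (R.+-identityʳ _)
  cliques-block P a (b ∷ bs) M = trans
    (cong₂ _+_ (cong (𝟙 (P (a , b) ∧ arc (a , b)) *_) (cliques-skip a bs M (λ c → trans (cong (P (a , c) ∧_) (compat-same a b c)) (BP.∧-zeroʳ (P (a , c)))))) (cliques-block P a bs M))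
    (rotate _ (cliques P M) _)
    where
    rotate : ∀ a b c → a + (b + c) ≡ b + (a + c)
    rotate = solve-∀ ℚ-ring

-- Pairs and selections from an interval

pairs : List ℕ → List Pair
pairs []       = []
pairs (a ∷ as) = map (a ,_) as ++ pairs as

allPairs-pairs : ∀ n → allPairs n ≡ pairs (range 1 n)
allPairs-pairs n = go n 1 refl
  where
  go : ∀ d i → i ℕ.+ d ≡ suc n → concatMap (λ a → map (a ,_) (range (suc a) n)) (range i n) ≡ pairs (range i n)
  go zero    i e rewrite range-[] {i} {n} (ℕP.≤-reflexive (trans (sym e) (ℕP.+-identityʳ i))) = refl
  go (suc d) i e rewrite range-∷ {i} {n} (ℕP.≤-trans (ℕP.m≤m+n i d) (ℕP.≤-reflexive (ℕP.suc-injective (trans (sym (ℕP.+-suc i d)) e)))) =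
    cong (map (i ,_) (range (suc i) n) ++_) (go d (suc i) (trans (sym (ℕP.+-suc i d)) e))

pairs-∈ : ∀ {P : ℕ → Set} as {y} → AllPairs _<_ as → All P as → y ∈ pairs as → P (proj₁ y) × P (proj₂ y) × proj₁ y < proj₂ y
pairs-∈ (a ∷ as) (a< ∷ s) (p ∷ ps) m with ∈P.∈-++⁻ (map (a ,_) as) m
... | inj₂ r = pairs-∈ as s ps r
... | inj₁ l with ∈P.∈-map⁻ (a ,_) l
...   | b , b∈ , refl = p , All.lookup ps b∈ , All.lookup a< b∈

choose : ℕ → List ℕ → List (List ℕ)
choose zero    as       = [] ∷ []
choose (suc e) []       = []
choose (suc e) (a ∷ as) = map (a ∷_) (choose e as) ++ choose (suc e) as

choose-∈ : ∀ e as {cs} → cs ∈ choose e as → ∀ {c} → c ∈ cs → c ∈ as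
choose-∈ zero    as (here refl) ()
choose-∈ (suc e) (a ∷ as) m with ∈P.∈-++⁻ (map (a ∷_) (choose e as)) m
... | inj₂ r = there ∘ choose-∈ (suc e) as r
... | inj₁ l with ∈P.∈-map⁻ (a ∷_) l
...   | cs , m′ , refl = λ { (here refl) → here refl ; (there c) → there (choose-∈ e as m′ c) }

choose-sorted : ∀ e {as} → AllPairs _<_ as → ∀ {cs} → cs ∈ choose e as → AllPairs _<_ cs
choose-sorted zero    s (here refl) = []
choose-sorted (suc e) {a ∷ as} (a< ∷ s) m with ∈P.∈-++⁻ (map (a ∷_) (choose e as)) m
... | inj₂ r = choose-sorted (suc e) s r
... | inj₁ l with ∈P.∈-map⁻ (a ∷_) l
...   | cs , m′ , refl = All.tabulate (λ c → All.lookup a< (choose-∈ e as m′ c)) ∷ choose-sorted e s m′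

choose-nonempty : ∀ e as {cs} → cs ∈ choose (suc e) as → ∃ λ c → ∃ λ ds → cs ≡ c ∷ ds
choose-nonempty e (a ∷ as) m with ∈P.∈-++⁻ (map (a ∷_) (choose e as)) m
... | inj₂ r = choose-nonempty e as r
... | inj₁ l with ∈P.∈-map⁻ (a ∷_) l
...   | cs , m′ , e′ = a , cs , e′

hd : List ℕ → ℕ
hd []      = 0
hd (c ∷ _) = c

∑-choose-one : ∀ as {F : List ℕ → ℚ} → ∑ (choose 1 as) F ≡ ∑ as (λ b → F (b ∷ []))
∑-choose-one []       = refl
∑-choose-one (a ∷ as) = cong₂ _+_ refl (∑-choose-one as)

-- Splits off the least element of the longer selection; `hd cs` is the least element of the rest
-- because the list increases.
∑-choose-suc : ∀ e as → AllPairs _<_ as → ∀ {F : List ℕ → ℚ} →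
  ∑ (choose (suc e) as) (λ cs → ∑ as (λ b → 𝟙 (b <ᵇ hd cs) * F (b ∷ cs))) ≡ ∑ (choose (suc (suc e)) as) F
∑-choose-suc e []       s       = refl
∑-choose-suc e (a ∷ as) (a< ∷ s) {F} = begin
  ∑ (map (a ∷_) (choose e as) ++ choose (suc e) as) G
    ≡⟨ trans (∑-++ (map (a ∷_) (choose e as)) (choose (suc e) as)) (cong₂ _+_ (trans (∑-map (a ∷_) (choose e as)) (∑-zero-∈ (choose e as) (λ _ → none))) refl) ⟩
  0ℚ + ∑ (choose (suc e) as) G
    ≡⟨ trans (R.+-identityˡ _) (∑-+ (choose (suc e) as)) ⟩
  ∑ (choose (suc e) as) (λ cs → 𝟙 (a <ᵇ hd cs) * F (a ∷ cs)) + ∑ (choose (suc e) as) (λ cs → ∑ as (λ b → 𝟙 (b <ᵇ hd cs) * F (b ∷ cs)))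
    ≡⟨ cong₂ _+_ (∑-cong-∈ (choose (suc e) as) first) (∑-choose-suc e as s) ⟩
  ∑ (choose (suc e) as) (λ cs → F (a ∷ cs)) + ∑ (choose (suc (suc e)) as) F
    ≡⟨ sym (trans (∑-++ (map (a ∷_) (choose (suc e) as)) (choose (suc (suc e)) as)) (cong₂ _+_ (∑-map (a ∷_) (choose (suc e) as)) refl)) ⟩
  ∑ (choose (suc (suc e)) (a ∷ as)) F ∎
  where
  G : List ℕ → ℚ
  G cs = ∑ (a ∷ as) (λ b → 𝟙 (b <ᵇ hd cs) * F (b ∷ cs))
  none : ∀ {cs} → G (a ∷ cs) ≡ 0ℚ
  none {cs} = ∑-zero-∈ (a ∷ as) (λ {b} m → trans (cong (λ t → 𝟙 t * F (b ∷ a ∷ cs)) (¬T⇒≡ (λ t → ℕP.<⇒≱ (ℕP.<ᵇ⇒< b a t) (ge m)))) (R.zeroˡ _))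
    where
    ge : ∀ {b} → b ∈ a ∷ as → a ≤ b
    ge (here refl) = ℕP.≤-refl
    ge (there m)   = ℕP.<⇒≤ (All.lookup a< m)
  first : ∀ {cs} → cs ∈ choose (suc e) as → 𝟙 (a <ᵇ hd cs) * F (a ∷ cs) ≡ F (a ∷ cs)
  first {cs} m with choose-nonempty e as m
  ... | c , ds , refl = trans (cong (λ t → 𝟙 t * F (a ∷ cs)) (T⇒≡ (ℕP.<⇒<ᵇ (All.lookup a< (choose-∈ (suc e) as m (here refl)))))) (R.*-identityˡ _)

𝟙-*-cong : ∀ b {x y} → (T b → x ≡ y) → 𝟙 b * x ≡ 𝟙 b * y
𝟙-*-cong true  h = cong (1ℚ *_) (h tt)
𝟙-*-cong false h = trans (R.zeroˡ _) (sym (R.zeroˡ _))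

range-sorted : ∀ a n → AllPairs _<_ (range a n)
range-sorted a n = go (suc n ∸ a) a refl
  where
  go : ∀ d a → suc n ∸ a ≡ d → AllPairs _<_ (range a n)
  go zero    a e rewrite range-[] {a} {n} (ℕP.m∸n≡0⇒m≤n e) = []
  go (suc d) a e = subst (AllPairs _<_) (sym (range-∷ a≤n)) (All.tabulate (λ m → proj₁ (range-∈⁻ (suc a) n m)) ∷ go d (suc a) e′)
    where
    a≤n : a ≤ n
    a≤n = ℕP.≤-pred (ℕP.m∸n≢0⇒n<m (λ z → ℕP.0≢1+n (trans (sym z) e)))
    e′ : suc n ∸ suc a ≡ d
    e′ = ℕP.suc-injective (trans (sym (ℕP.+-∸-assoc 1 a≤n)) e)

sign-≢0 : ∀ {g} → IsSign g → g ≢ ℤ.+ 0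
sign-≢0 pos ()
sign-≢0 neg ()

sign-neg-≢0 : ∀ {g} → IsSign g → ℤ.- g ≢ ℤ.+ 0
sign-neg-≢0 pos ()
sign-neg-≢0 neg ()

-- The sweep over the positions from the left. When an arc opens, its right endpoint is chosen in
-- advance and reserved; the reserved endpoints and the common sign are all that the later positions
-- see of the open arcs.
module OpenArcs (sb : ℕ → ℤ) (sign : ∀ a → T (not (isZero (sb a))) → IsSign (sb a)) (n : ℕ) where

  ap : ℕ → Bool
  ap x = not (isZero (sb x))

  open Matching ap sb

  ap-intro : ∀ {x} → sb x ≢ ℤ.+ 0 → T (ap x)
  ap-intro h = ¬T-intro (h ∘ eqℤ⇒≡)

  ap-elim : ∀ {x} → T (ap x) → sb x ≢ ℤ.+ 0
  ap-elim t e = ¬T-elim t (≡⇒eqℤ e)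

  clause : ℤ → ℕ → Pair → Bool
  clause g c (x , y) = not (x ≡ᵇ c) ∧ not (y ≡ᵇ c) ∧ (if x <ᵇ c then (y <ᵇ c) ∧ eqℤ (sb x) g else true)

  inside : ℤ → List ℕ → Pair → Bool
  inside g cs y = all (λ c → clause g c y) cs

  -- The second conjunct is what condition (2) still demands of the positions that have not been
  -- read.
  closes : ℤ → List ℕ → ℕ → Bool
  closes g as c = eqℤ (sb c) (ℤ.- g) ∧ all (λ x → if x <ᵇ c then ap x else true) as

  good : ℤ → List ℕ → List ℕ → Bool
  good g as cs = all (closes g as) cs

  -- The number of matchings of the positions as in which the positions cs are already taken as
  -- the right endpoints of nested arcs starting to the left of as.
  completions : ℤ → List ℕ → List ℕ → ℚ
  completions g as cs = 𝟙 (good g as cs) * cliques (inside g cs) (pairs as)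

  -- For arcs to the right of `a`, compatibility with `(a , b)` depends on `a` only through its
  -- sign. This is why left endpoints can be forgotten.
  compat-clause : ∀ a b {x y} → a < x → x < y → compat (a , b) (x , y) ≡ clause (sb a) b (x , y)
  compat-clause a b {x} {y} a<x x<y = Bool-ext to from
    where
    to : T (compat (a , b) (x , y)) → T (clause (sb a) b (x , y))
    to t = ∧-intro {not (x ≡ᵇ b)} (≢⇒not≡ᵇ (b≢x ∘ sym)) (∧-intro {not (y ≡ᵇ b)} (≢⇒not≡ᵇ (b≢y ∘ sym)) (⇒-intro {x <ᵇ b} nested))
      where
      d = ∧-fst {disjoint (a , b) (x , y)} t
      b≢x : b ≢ x
      b≢x = not≡ᵇ⇒≢ (∧-fst {not (b ≡ᵇ x)} (∧-snd {not (a ≡ᵇ x) ∧ not (a ≡ᵇ y)} d))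
      b≢y : b ≢ y
      b≢y = not≡ᵇ⇒≢ (∧-snd {not (b ≡ᵇ x)} (∧-snd {not (a ≡ᵇ x) ∧ not (a ≡ᵇ y)} d))
      k = ∧-fst {cond (a , b) (x , y)} (∧-snd {disjoint (a , b) (x , y)} t)
      nocross = ¬T-elim (∧-fst {not ((a <ᵇ x) ∧ (x <ᵇ b) ∧ (b <ᵇ y))} k)
      same = ∧-snd {not ((a <ᵇ x) ∧ (x <ᵇ b) ∧ (b <ᵇ y))} k
      nested : T (x <ᵇ b) → T ((y <ᵇ b) ∧ eqℤ (sb x) (sb a))
      nested x<b with ℕP.<-cmp y b
      ... | tri< y<b _ _ = ∧-intro (ℕP.<⇒<ᵇ y<b) (≡⇒eqℤ {sb x} {sb a} (sym (eqℤ⇒≡ {sb a} {sb x} (⇒-elim {(a <ᵇ x) ∧ (x <ᵇ y) ∧ (y <ᵇ b)} same (∧-intro (ℕP.<⇒<ᵇ a<x) (∧-intro (ℕP.<⇒<ᵇ x<y) (ℕP.<⇒<ᵇ y<b)))))))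
      ... | tri≈ _ y≡b _ = ⊥-elim (b≢y (sym y≡b))
      ... | tri> _ _ y>b = ⊥-elim (nocross (∧-intro (ℕP.<⇒<ᵇ a<x) (∧-intro x<b (ℕP.<⇒<ᵇ y>b))))
    from : T (clause (sb a) b (x , y)) → T (compat (a , b) (x , y))
    from t = ∧-intro {disjoint (a , b) (x , y)}
      (∧-intro {not (a ≡ᵇ x) ∧ not (a ≡ᵇ y)} (∧-intro {not (a ≡ᵇ x)} (≢⇒not≡ᵇ (ℕP.<⇒≢ a<x)) (≢⇒not≡ᵇ (ℕP.<⇒≢ (ℕP.<-trans a<x x<y))))
        (∧-intro {not (b ≡ᵇ x)} (≢⇒not≡ᵇ (x≢b ∘ sym)) (≢⇒not≡ᵇ (y≢b ∘ sym))))
      (∧-intro {cond (a , b) (x , y)}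
        (∧-intro {not ((a <ᵇ x) ∧ (x <ᵇ b) ∧ (b <ᵇ y))}
          (¬T-intro (λ c → ℕP.<-asym (ℕP.<ᵇ⇒< b y (∧-snd {x <ᵇ b} (∧-snd {a <ᵇ x} c))) (ℕP.<ᵇ⇒< y b (∧-fst {y <ᵇ b} (imp (∧-fst {x <ᵇ b} (∧-snd {a <ᵇ x} c)))))))
          (⇒-intro {(a <ᵇ x) ∧ (x <ᵇ y) ∧ (y <ᵇ b)} (λ c → ≡⇒eqℤ {sb a} {sb x} (sym (eqℤ⇒≡ {sb x} {sb a} (∧-snd {y <ᵇ b} (imp (ℕP.<⇒<ᵇ (ℕP.<-trans x<y (ℕP.<ᵇ⇒< y b (∧-snd {x <ᵇ y} (∧-snd {a <ᵇ x} c))))))))))))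
        (∧-intro {not ((x <ᵇ a) ∧ (a <ᵇ y) ∧ (y <ᵇ b))} (¬T-intro (λ c → x≮a (∧-fst {x <ᵇ a} c))) (⇒-intro {(x <ᵇ a) ∧ (a <ᵇ b) ∧ (b <ᵇ y)} (λ c → ⊥-elim (x≮a (∧-fst {x <ᵇ a} c))))))
      where
      x≢b : x ≢ b
      x≢b = not≡ᵇ⇒≢ (∧-fst {not (x ≡ᵇ b)} t)
      r = ∧-snd {not (x ≡ᵇ b)} t
      y≢b : y ≢ b
      y≢b = not≡ᵇ⇒≢ (∧-fst {not (y ≡ᵇ b)} r)
      imp : T (x <ᵇ b) → T ((y <ᵇ b) ∧ eqℤ (sb x) (sb a))
      imp = ⇒-elim (∧-snd {not (y ≡ᵇ b)} r)
      x≮a : ¬ T (x <ᵇ a)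
      x≮a c = ℕP.<-asym a<x (ℕP.<ᵇ⇒< x a c)

  module Step (a : ℕ) where

    as : List ℕ
    as = range (suc a) n

    as-> : All (a <_) as
    as-> = All.tabulate (λ m → proj₁ (range-∈⁻ (suc a) n m))

    pairs-as : ∀ {y} → y ∈ pairs as → a < proj₁ y × proj₁ y < proj₂ y
    pairs-as m with pairs-∈ as (range-sorted (suc a) n) as-> m
    ... | p , _ , q = p , q

    -- The positions strictly between `a` and `b` are the members of `as` below `b`, so apart from
    -- the appearance of `a` everything is a condition on the right endpoint.
    arc-closes : ∀ {b} → b ∈ as → arc (a , b) ≡ ap a ∧ closes (sb a) as b
    arc-closes {b} b∈ = Bool-ext to from
      where
      a<b : a < b
      a<b = All.lookup as-> b∈
      to : T (arc (a , b)) → T (ap a ∧ closes (sb a) as b)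
      to t = ∧-intro {ap a} (∧-fst {ap a} (∧-snd {a <ᵇ b} (∧-fst {proper (a , b)} t)))
        (∧-intro {eqℤ (sb b) (ℤ.- sb a)} (≡⇒eqℤ (trans (sym (ℤP.neg-involutive (sb b))) (cong ℤ.-_ (sym (eqℤ⇒≡ (∧-fst {opposite (a , b)} r))))))
          (all-T _ as (λ {x} x∈ → ⇒-intro {x <ᵇ b} (λ x<b → ⇒-elim {(a <ᵇ x) ∧ (x <ᵇ b)} (T-all _ (range 1 b) (∧-snd {opposite (a , b)} r)
            (range-∈⁺ (ℕP.≤-trans (s≤s z≤n) (All.lookup as-> x∈)) (ℕP.<⇒≤ (ℕP.<ᵇ⇒< x b x<b)))) (∧-intro (ℕP.<⇒<ᵇ (All.lookup as-> x∈)) x<b)))))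
        where r = ∧-snd {proper (a , b)} t
      from : T (ap a ∧ closes (sb a) as b) → T (arc (a , b))
      from t = ∧-intro {proper (a , b)} (∧-intro {a <ᵇ b} (ℕP.<⇒<ᵇ a<b) (∧-intro {ap a} apa (ap-intro (λ z → ap-elim {a} apa (trans opp (cong ℤ.-_ z))))))
        (∧-intro {opposite (a , b)} (≡⇒eqℤ opp) (all-T _ (range 1 b) (λ {x} x∈ → ⇒-intro {(a <ᵇ x) ∧ (x <ᵇ b)} (λ c →
          ⇒-elim {x <ᵇ b} (T-all _ as (∧-snd {eqℤ (sb b) (ℤ.- sb a)} r) (range-∈⁺ (ℕP.<ᵇ⇒< a x (∧-fst c)) (ℕP.≤-trans (proj₂ (range-∈⁻ 1 b x∈)) (proj₂ (range-∈⁻ (suc a) n b∈))))) (∧-snd {a <ᵇ x} c)))))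
        where
        apa = ∧-fst {ap a} t
        r = ∧-snd {ap a} t
        opp : sb a ≡ ℤ.- sb b
        opp = trans (sym (ℤP.neg-involutive (sb a))) (cong ℤ.-_ (sym (eqℤ⇒≡ (∧-fst {eqℤ (sb b) (ℤ.- sb a)} r))))

    none-before : all (λ x → if x <ᵇ a then ap x else true) (a ∷ as) ≡ true
    none-before = T⇒≡ (all-T _ (a ∷ as) (λ {x} m → ⇒-intro {x <ᵇ a} (λ x<a → ⊥-elim (ℕP.<⇒≱ (ℕP.<ᵇ⇒< x a x<a) (ge m)))))
      where
      ge : ∀ {x} → x ∈ a ∷ as → a ≤ x
      ge (here refl) = ℕP.≤-refl
      ge (there m)   = ℕP.<⇒≤ (All.lookup as-> m)

    good-∷ : ∀ g cs → All (a <_) cs → ap a ≡ true → good g (a ∷ as) cs ≡ good g as cs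
    good-∷ g []       []       e = refl
    good-∷ g (c ∷ cs) (a<c ∷ h) e rewrite T⇒≡ (ℕP.<⇒<ᵇ a<c) | e = cong (closes g as c ∧_) (trans (all-cong (λ x → cong (λ b → eqℤ (sb x) (ℤ.- g) ∧ (if a <ᵇ x then b else true) ∧ all (λ y → if y <ᵇ x then ap y else true) as) (sym e)) cs) (good-∷ g cs h e))

    good-∷-false : ∀ g c cs → a < c → ap a ≡ false → good g (a ∷ as) (c ∷ cs) ≡ false
    good-∷-false g c cs a<c e rewrite T⇒≡ (ℕP.<⇒<ᵇ a<c) | e | BP.∧-zeroʳ (eqℤ (sb c) (ℤ.- g)) = refl

    -- The current position is itself reserved: it ends the innermost arc, starts no other one, and
    -- imposes nothing on arcs that start beyond it.
    completions-close : ∀ {g} → IsSign g → ∀ cs → All (a <_) cs →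
      completions g (a ∷ as) (a ∷ cs) ≡ 𝟙 (eqℤ (sb a) (ℤ.- g)) * completions g as cs
    completions-close {g} sg cs h = begin
      𝟙 (closes g (a ∷ as) a ∧ good g (a ∷ as) cs) * cliques (inside g (a ∷ cs)) (map (a ,_) as ++ pairs as)
        ≡⟨ cong₂ (λ b x → 𝟙 (b ∧ good g (a ∷ as) cs) * x) closes-a (trans (cliques-skip a as (pairs as) (λ b → cong (λ t → (not t ∧ not (b ≡ᵇ a) ∧ (if a <ᵇ a then (b <ᵇ a) ∧ eqℤ (sb a) g else true)) ∧ inside g cs (a , b)) (≡ᵇ-refl a)))
            (cliques-cong (pairs as) (λ {y} m → cong (_∧ inside g cs y) (clause-true m)))) ⟩
      𝟙 (eqℤ (sb a) (ℤ.- g) ∧ good g (a ∷ as) cs) * cliques (inside g cs) (pairs as)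
        ≡⟨ cong (_* cliques (inside g cs) (pairs as)) (trans (𝟙-∧ (eqℤ (sb a) (ℤ.- g)) _) (𝟙-*-cong (eqℤ (sb a) (ℤ.- g)) (λ t → cong 𝟙 (good-∷ g cs h (T⇒≡ (ap-intro {a} (λ z → sign-neg-≢0 sg (trans (sym (eqℤ⇒≡ t)) z)))))))) ⟩
      𝟙 (eqℤ (sb a) (ℤ.- g)) * 𝟙 (good g as cs) * cliques (inside g cs) (pairs as)
        ≡⟨ R.*-assoc _ _ _ ⟩
      𝟙 (eqℤ (sb a) (ℤ.- g)) * completions g as cs ∎
      where
      closes-a : closes g (a ∷ as) a ≡ eqℤ (sb a) (ℤ.- g)
      closes-a = trans (cong (eqℤ (sb a) (ℤ.- g) ∧_) none-before) (BP.∧-identityʳ _)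
      clause-true : ∀ {y} → y ∈ pairs as → clause g a y ≡ true
      clause-true {x , y} m = T⇒≡ (∧-intro {not (x ≡ᵇ a)} (≢⇒not≡ᵇ (ℕP.<⇒≢ a<x ∘ sym)) (∧-intro {not (y ≡ᵇ a)} (≢⇒not≡ᵇ (ℕP.<⇒≢ (ℕP.<-trans a<x (proj₂ (pairs-as m))) ∘ sym))
        (⇒-intro {x <ᵇ a} (λ t → ⊥-elim (ℕP.<-asym a<x (ℕP.<ᵇ⇒< x a t))))))
        where
        a<x : a < x
        a<x = proj₁ (pairs-as m)

    -- With no open arc, `a` stays unmatched or starts an arc; in the latter case its sign becomes
    -- the common sign.
    completions-none : ∀ g → completions g (a ∷ as) [] ≡ completions g as [] + 𝟙 (ap a) * ∑ as (λ b → completions (sb a) as (b ∷ []))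
    completions-none g = begin
      1ℚ * cliques (inside g []) (map (a ,_) as ++ pairs as)
        ≡⟨ cong (1ℚ *_) (cliques-block (inside g []) a as (pairs as)) ⟩
      1ℚ * (cliques (inside g []) (pairs as) + ∑ as (λ b → 𝟙 (arc (a , b)) * cliques (compat (a , b)) (pairs as)))
        ≡⟨ R.distribˡ 1ℚ _ _ ⟩
      completions g as [] + 1ℚ * ∑ as (λ b → 𝟙 (arc (a , b)) * cliques (compat (a , b)) (pairs as))
        ≡⟨ cong₂ _+_ refl (trans (R.*-identityˡ _) (trans (∑-cong-∈ as term) (∑-*ˡ (𝟙 (ap a)) as))) ⟩
      completions g as [] + 𝟙 (ap a) * ∑ as (λ b → completions (sb a) as (b ∷ [])) ∎
      where
      term : ∀ {b} → b ∈ as → 𝟙 (arc (a , b)) * cliques (compat (a , b)) (pairs as) ≡ 𝟙 (ap a) * completions (sb a) as (b ∷ [])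
      term {b} b∈ = trans (cong₂ _*_ (trans (cong 𝟙 (trans (arc-closes b∈) (cong (ap a ∧_) (sym (BP.∧-identityʳ _))))) (𝟙-∧ (ap a) (good (sb a) as (b ∷ []))))
          (cliques-cong (pairs as) (λ { {x , y} m → trans (compat-clause a b (proj₁ (pairs-as m)) (proj₂ (pairs-as m))) (sym (BP.∧-identityʳ _)) })))
        (R.*-assoc _ _ _)

    -- Under open arcs `a` has to appear. An arc that starts at `a` needs the sign `g` and, by
    -- non-crossing, ends before the least reserved endpoint `c`; its end becomes the new least
    -- reserved endpoint.
    completions-some : ∀ {g} → IsSign g → ∀ c cs → AllPairs _<_ (c ∷ cs) → All (a <_) (c ∷ cs) →
      completions g (a ∷ as) (c ∷ cs) ≡ 𝟙 (ap a) * completions g as (c ∷ cs) + 𝟙 (eqℤ (sb a) g) * ∑ as (λ b → 𝟙 (b <ᵇ c) * completions g as (b ∷ c ∷ cs))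
    completions-some {g} sg c cs (c< ∷ s) h@(a<c ∷ _) = byCases (ap a) refl
      where
      G : Bool
      G = good g as (c ∷ cs)
      F : ℕ → ℚ
      F b = 𝟙 (inside g (c ∷ cs) (a , b) ∧ arc (a , b)) * cliques (λ y → inside g (c ∷ cs) y ∧ compat (a , b) y) (pairs as)
      above : ∀ {d} → d ∈ c ∷ cs → c ≤ d
      above (here refl) = ℕP.≤-refl
      above (there m)   = ℕP.<⇒≤ (All.lookup c< m)
      condition : ap a ≡ true → ∀ {b} → b ∈ as → G ∧ (inside g (c ∷ cs) (a , b) ∧ arc (a , b)) ≡ eqℤ (sb a) g ∧ ((b <ᵇ c) ∧ good g as (b ∷ c ∷ cs))
      condition e {b} b∈ = Bool-ext to from
        where
        to : T (G ∧ (inside g (c ∷ cs) (a , b) ∧ arc (a , b))) → T (eqℤ (sb a) g ∧ ((b <ᵇ c) ∧ good g as (b ∷ c ∷ cs)))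
        to t = ∧-intro {eqℤ (sb a) g} sa (∧-intro {b <ᵇ c} (∧-fst {b <ᵇ c} imp)
          (∧-intro {closes g as b} (subst (λ z → T (closes z as b)) (eqℤ⇒≡ sa) (∧-snd {ap a} (subst T (arc-closes b∈) (∧-snd {inside g (c ∷ cs) (a , b)} r)))) (∧-fst {G} t)))
          where
          r = ∧-snd {G} t
          cl = ∧-fst {clause g c (a , b)} (∧-fst {inside g (c ∷ cs) (a , b)} r)
          imp = ⇒-elim {a <ᵇ c} (∧-snd {not (b ≡ᵇ c)} (∧-snd {not (a ≡ᵇ c)} cl)) (ℕP.<⇒<ᵇ a<c)
          sa = ∧-snd {b <ᵇ c} imp
        from : T (eqℤ (sb a) g ∧ ((b <ᵇ c) ∧ good g as (b ∷ c ∷ cs))) → T (G ∧ (inside g (c ∷ cs) (a , b) ∧ arc (a , b)))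
        from t = ∧-intro {G} (∧-snd {closes g as b} gd) (∧-intro {inside g (c ∷ cs) (a , b)} (all-T _ (c ∷ cs) ins)
          (subst T (sym (arc-closes b∈)) (∧-intro {ap a} (≡⇒T e) (subst (λ z → T (closes z as b)) (sym (eqℤ⇒≡ sa)) (∧-fst {closes g as b} gd)))))
          where
          sa = ∧-fst {eqℤ (sb a) g} t
          r = ∧-snd {eqℤ (sb a) g} t
          b<c = ℕP.<ᵇ⇒< b c (∧-fst {b <ᵇ c} r)
          gd = ∧-snd {b <ᵇ c} r
          ins : ∀ {d} → d ∈ c ∷ cs → T (clause g d (a , b))
          ins {d} m = ∧-intro {not (a ≡ᵇ d)} (≢⇒not≡ᵇ (ℕP.<⇒≢ (All.lookup h m))) (∧-intro {not (b ≡ᵇ d)} (≢⇒not≡ᵇ (ℕP.<⇒≢ b<d)) (⇒-intro {a <ᵇ d} (λ _ → ∧-intro {b <ᵇ d} (ℕP.<⇒<ᵇ b<d) sa)))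
            where
            b<d : b < d
            b<d = ℕP.<-≤-trans b<c (above m)
      term : ap a ≡ true → ∀ {b} → b ∈ as → 𝟙 G * F b ≡ 𝟙 (eqℤ (sb a) g) * (𝟙 (b <ᵇ c) * completions g as (b ∷ c ∷ cs))
      term e {b} b∈ = begin
        𝟙 G * (𝟙 (inside g (c ∷ cs) (a , b) ∧ arc (a , b)) * X)
          ≡⟨ trans (sym (R.*-assoc _ _ _)) (cong (_* X) (trans (sym (𝟙-∧ G _)) (cong 𝟙 (condition e b∈)))) ⟩
        𝟙 (eqℤ (sb a) g ∧ ((b <ᵇ c) ∧ good g as (b ∷ c ∷ cs))) * X
          ≡⟨ 𝟙-*-cong (eqℤ (sb a) g ∧ ((b <ᵇ c) ∧ good g as (b ∷ c ∷ cs))) (λ t → same (eqℤ⇒≡ (∧-fst {eqℤ (sb a) g} t))) ⟩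
        𝟙 (eqℤ (sb a) g ∧ ((b <ᵇ c) ∧ good g as (b ∷ c ∷ cs))) * Y
          ≡⟨ cong (_* Y) (trans (𝟙-∧ (eqℤ (sb a) g) _) (cong (𝟙 (eqℤ (sb a) g) *_) (𝟙-∧ (b <ᵇ c) (good g as (b ∷ c ∷ cs))))) ⟩
        𝟙 (eqℤ (sb a) g) * (𝟙 (b <ᵇ c) * 𝟙 (good g as (b ∷ c ∷ cs))) * Y
          ≡⟨ trans (R.*-assoc _ _ _) (cong (𝟙 (eqℤ (sb a) g) *_) (R.*-assoc _ _ _)) ⟩
        𝟙 (eqℤ (sb a) g) * (𝟙 (b <ᵇ c) * completions g as (b ∷ c ∷ cs)) ∎
        where
        X Y : ℚ
        X = cliques (λ y → inside g (c ∷ cs) y ∧ compat (a , b) y) (pairs as)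
        Y = cliques (inside g (b ∷ c ∷ cs)) (pairs as)
        same : sb a ≡ g → X ≡ Y
        same refl = cliques-cong (pairs as) (λ { {x , y} m → trans (cong (inside g (c ∷ cs) (x , y) ∧_) (compat-clause a b (proj₁ (pairs-as m)) (proj₂ (pairs-as m)))) (BP.∧-comm (inside g (c ∷ cs) (x , y)) (clause g b (x , y))) })
      byCases : ∀ b → ap a ≡ b → completions g (a ∷ as) (c ∷ cs) ≡ 𝟙 (ap a) * completions g as (c ∷ cs) + 𝟙 (eqℤ (sb a) g) * ∑ as (λ b → 𝟙 (b <ᵇ c) * completions g as (b ∷ c ∷ cs))
      byCases false e = trans (cong (λ b → 𝟙 b * cliques (inside g (c ∷ cs)) (pairs (a ∷ as))) (good-∷-false g c cs a<c e))
        (trans (R.zeroˡ _) (sym (trans (cong₂ _+_ (trans (cong (λ b → 𝟙 b * completions g as (c ∷ cs)) e) (R.zeroˡ _))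
          (trans (cong (λ b → 𝟙 b * ∑ as (λ b → 𝟙 (b <ᵇ c) * completions g as (b ∷ c ∷ cs))) (¬T⇒≡ {eqℤ (sb a) g} (λ t → subst T e (ap-intro {a} (λ z → sign-≢0 sg (trans (sym (eqℤ⇒≡ t)) z)))))) (R.zeroˡ _))) (R.+-identityˡ 0ℚ))))
      byCases true e = begin
        𝟙 (good g (a ∷ as) (c ∷ cs)) * cliques (inside g (c ∷ cs)) (map (a ,_) as ++ pairs as)
          ≡⟨ cong₂ (λ b x → 𝟙 b * x) (good-∷ g (c ∷ cs) h e) (cliques-block (inside g (c ∷ cs)) a as (pairs as)) ⟩
        𝟙 G * (cliques (inside g (c ∷ cs)) (pairs as) + ∑ as F)
          ≡⟨ trans (R.distribˡ (𝟙 G) _ _) (cong₂ _+_ (sym (R.*-identityˡ _)) (sym (∑-*ˡ (𝟙 G) as))) ⟩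
        1ℚ * completions g as (c ∷ cs) + ∑ as (λ b → 𝟙 G * F b)
          ≡⟨ cong₂ _+_ (cong (λ b → 𝟙 b * completions g as (c ∷ cs)) (sym e)) (trans (∑-cong-∈ as (term e)) (∑-*ˡ (𝟙 (eqℤ (sb a) g)) as)) ⟩
        𝟙 (ap a) * completions g as (c ∷ cs) + 𝟙 (eqℤ (sb a) g) * ∑ as (λ b → 𝟙 (b <ᵇ c) * completions g as (b ∷ c ∷ cs)) ∎

  -- Summation over the reserved endpoints turns the three cases into the recursion of `arcs`. A
  -- selection from `a ∷ as` that contains `a` closes an arc; the endpoint of a newly opened arc
  -- enlarges the selection by one.
  ∑-completions : ∀ d a → a ℕ.+ d ≡ suc n → ∀ {g} → IsSign g → ∀ e →
    ∑ (choose e (range a n)) (completions g (range a n)) ≡ arcs g (map sb (range a n)) e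
  ∑-completions zero a eq {g} sg e rewrite range-[] {a} {n} (ℕP.≤-reflexive (trans (sym eq) (ℕP.+-identityʳ a))) with e
  ... | zero  = trans (R.+-identityʳ _) (R.*-identityˡ 1ℚ)
  ... | suc _ = refl
  ∑-completions (suc d) a eq {g} sg e rewrite range-∷ {a} {n} (ℕP.≤-trans (ℕP.m≤m+n a d) (ℕP.≤-reflexive (ℕP.suc-injective (trans (sym (ℕP.+-suc a d)) eq)))) = step e
    where
    open Step a
    ih : ∀ {h} → IsSign h → ∀ e → ∑ (choose e as) (completions h as) ≡ arcs h (map sb as) e
    ih = ∑-completions d (suc a) (trans (sym (ℕP.+-suc a d)) eq)
    above : ∀ e {cs} → cs ∈ choose e as → All (a <_) cs
    above e m = All.tabulate (λ c → All.lookup as-> (choose-∈ e as m c))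
    step : ∀ e → ∑ (choose e (a ∷ as)) (completions g (a ∷ as)) ≡ arcs g (sb a ∷ map sb as) e
    step zero = begin
      completions g (a ∷ as) [] + 0ℚ
        ≡⟨ trans (R.+-identityʳ _) (completions-none g) ⟩
      completions g as [] + 𝟙 (ap a) * ∑ as (λ b → completions (sb a) as (b ∷ []))
        ≡⟨ cong₂ _+_ (trans (sym (R.+-identityʳ _)) (ih sg 0)) (𝟙-*-cong (ap a) (λ t → trans (sym (∑-choose-one as)) (ih (sign a t) 1))) ⟩
      arcs g (map sb as) 0 + 𝟙 (ap a) * arcs (sb a) (map sb as) 1 ∎
    step (suc e) = begin
      ∑ (map (a ∷_) (choose e as) ++ choose (suc e) as) (completions g (a ∷ as))
        ≡⟨ trans (∑-++ (map (a ∷_) (choose e as)) (choose (suc e) as)) (cong₂ _+_ (∑-map (a ∷_) (choose e as)) refl) ⟩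
      ∑ (choose e as) (λ cs → completions g (a ∷ as) (a ∷ cs)) + ∑ (choose (suc e) as) (completions g (a ∷ as))
        ≡⟨ cong₂ _+_ (trans (∑-cong-∈ (choose e as) (λ m → completions-close sg _ (above e m))) (trans (∑-*ˡ _ (choose e as)) (cong (𝟙 (eqℤ (sb a) (ℤ.- g)) *_) (ih sg e))))
                     (∑-cong-∈ (choose (suc e) as) some) ⟩
      𝟙 (eqℤ (sb a) (ℤ.- g)) * arcs g (map sb as) e + ∑ (choose (suc e) as) (λ cs → 𝟙 (ap a) * completions g as cs + 𝟙 (eqℤ (sb a) g) * ∑ as (λ b → 𝟙 (b <ᵇ hd cs) * completions g as (b ∷ cs)))
        ≡⟨ cong₂ _+_ refl (trans (∑-+ (choose (suc e) as)) (cong₂ _+_ (trans (∑-*ˡ (𝟙 (ap a)) (choose (suc e) as)) (cong (𝟙 (ap a) *_) (ih sg (suc e))))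
            (trans (∑-*ˡ (𝟙 (eqℤ (sb a) g)) (choose (suc e) as)) (cong (𝟙 (eqℤ (sb a) g) *_) (trans (∑-choose-suc e as (range-sorted (suc a) n)) (ih sg (suc (suc e)))))))) ⟩
      arcs g (sb a ∷ map sb as) (suc e) ∎
      where
      some : ∀ {cs} → cs ∈ choose (suc e) as → completions g (a ∷ as) cs ≡ 𝟙 (ap a) * completions g as cs + 𝟙 (eqℤ (sb a) g) * ∑ as (λ b → 𝟙 (b <ᵇ hd cs) * completions g as (b ∷ cs))
      some m with choose-nonempty e as m
      ... | c , cs , refl = completions-some sg c cs (choose-sorted (suc e) (range-sorted (suc a) n) m) (above (suc e) m)

  ∑-valid : ∑ (sublists (allPairs n)) (λ τ → 𝟙 (valid τ)) ≡ arcs (ℤ.+ 1) (map sb (range 1 n)) 0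
  ∑-valid = begin
    ∑ (sublists (allPairs n)) (λ τ → 𝟙 (valid τ))
      ≡⟨ ∑-cong (sublists (allPairs n)) (λ τ → trans (cong 𝟙 (valid-clique τ)) (trans (sym (R.*-identityˡ _)) (cong (λ b → 𝟙 b * 𝟙 (clique τ)) (sym (all-true τ))))) ⟩
    ∑ (sublists (allPairs n)) (λ τ → 𝟙 (all (inside (ℤ.+ 1) []) τ) * 𝟙 (clique τ))
      ≡⟨ trans (∑-sublists-cliques (inside (ℤ.+ 1) []) (allPairs n)) (cong (cliques (inside (ℤ.+ 1) [])) (allPairs-pairs n)) ⟩
    cliques (inside (ℤ.+ 1) []) (pairs (range 1 n))
      ≡⟨ trans (sym (R.*-identityˡ _)) (sym (R.+-identityʳ _)) ⟩
    ∑ (choose 0 (range 1 n)) (completions (ℤ.+ 1) (range 1 n))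
      ≡⟨ ∑-completions n 1 refl pos 0 ⟩
    arcs (ℤ.+ 1) (map sb (range 1 n)) 0 ∎
    where
    all-true : ∀ τ → all (inside (ℤ.+ 1) []) τ ≡ true
    all-true []      = refl
    all-true (x ∷ τ) = all-true τ

-- Slot signs of a concrete pair of tuples

valid-cong : ∀ {ap ap′ : ℕ → Bool} {sb sb′ : ℕ → ℤ} → (∀ k → ap k ≡ ap′ k) → (∀ k → sb k ≡ sb′ k) →
  ∀ τ → Matching.valid ap sb τ ≡ Matching.valid ap′ sb′ τ
valid-cong {ap} {ap′} {sb} {sb′} h k τ =
  cong₂ _∧_ (all-cong (λ { (a , b) → cong ((a <ᵇ b) ∧_) (cong₂ _∧_ (h a) (h b)) }) τ)
  (cong (noDup (endpoints τ) ∧_)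
  (cong₂ _∧_ (all-cong (λ { (a , b) → cong₂ (λ x y → eqℤ x (ℤ.- y)) (k a) (k b) }) τ)
  (cong₂ _∧_ (all-cong (λ { (a , c) → all-cong (λ b → cong (λ t → if (a <ᵇ b) ∧ (b <ᵇ c) then t else true) (h b)) (range 1 c) }) τ)
    (all-cong (λ { (a , c) → all-cong (λ { (b , d) → cong₂ (λ x y → not ((a <ᵇ b) ∧ (b <ᵇ c) ∧ (c <ᵇ d)) ∧ (if (a <ᵇ b) ∧ (b <ᵇ d) ∧ (d <ᵇ c) then eqℤ x y else true)) (k a) (k b) }) τ }) τ))))

sign-* : ∀ {g h} → IsSign g → IsSign h → IsSign (g ℤ.* h)
sign-* pos pos = pos
sign-* pos neg = neg
sign-* neg pos = neg
sign-* neg neg = pos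

sign-prodℤ : ∀ {gs} → All IsSign gs → IsSign (prodℤ gs)
sign-prodℤ []       = pos
sign-prodℤ (s ∷ ss) = sign-* s (sign-prodℤ ss)

signs-IsSign : ∀ {g} → g ∈ signs → IsSign g
signs-IsSign (here refl)         = pos
signs-IsSign (there (here refl)) = neg

IsSign-signs : ∀ {g} → IsSign g → g ∈ signs
IsSign-signs pos = here refl
IsSign-signs neg = there (here refl)

zip-proj₂ : ∀ {P : B → Set} (xs : List A) {ys : List B} → All P ys → All (P ∘ proj₂) (zip xs ys)
zip-proj₂ []       _        = []
zip-proj₂ (x ∷ xs) []       = []
zip-proj₂ (x ∷ xs) (p ∷ ps) = p ∷ zip-proj₂ xs ps

σbarAt-zero : ∀ p σ k → α p k ≡ 0 → σbarAt p σ k ≡ ℤ.+ 0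
σbarAt-zero p σ k e rewrite e = refl

if-false : ∀ {b} {x y : A} → b ≡ false → (if b then x else y) ≡ y
if-false refl = refl

σbarAt-prod : ∀ p σ k → α p k ≢ 0 → σbarAt p σ k ≡ prodℤ (map proj₂ (filterᵇ (λ t → proj₁ t ≡ᵇ k) (zip p σ)))
σbarAt-prod p σ k n = if-false (≡ᵇ-false n)

σbarAt-sign : ∀ p {σ} → All IsSign σ → ∀ k → α p k ≢ 0 → IsSign (σbarAt p σ k)
σbarAt-sign p {σ} s k n = subst IsSign (sym (σbarAt-prod p σ k n)) (sign-prodℤ (AllP.map⁺ (AllP.filter⁺ (BP.T? ∘ (λ t → proj₁ t ≡ᵇ k)) (zip-proj₂ p s))))

-- A product of signs is never 0, so `σ̄` alone knows which values appear.
appears-σbarAt : ∀ p {σ} → All IsSign σ → ∀ k → appears p k ≡ not (isZero (σbarAt p σ k))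
appears-σbarAt p {σ} s k = byCases (α p k ℕ.≟ 0)
  where
  byCases : Dec (α p k ≡ 0) → appears p k ≡ not (isZero (σbarAt p σ k))
  byCases (yes e) = trans (cong (λ a → not (a ≡ᵇ 0)) e) (cong (not ∘ isZero) (sym (σbarAt-zero p σ k e)))
  byCases (no n)  = trans (cong not (≡ᵇ-false n)) (sym (T⇒≡ (¬T-intro (sign-≢0 (σbarAt-sign p s k n) ∘ eqℤ⇒≡))))

σbarAt-sign′ : ∀ p {σ} → All IsSign σ → ∀ k → T (not (isZero (σbarAt p σ k))) → IsSign (σbarAt p σ k)
σbarAt-sign′ p s k t = σbarAt-sign p s k (λ e → not≡ᵇ⇒≢ (subst T (sym (appears-σbarAt p s k)) t) e)

∑-validτ : ∀ n p {σ} → All IsSign σ → ∑ (sublists (allPairs n)) (λ τ → 𝟙 (validτ p σ τ)) ≡ arcs (ℤ.+ 1) (σbar n p σ) 0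
∑-validτ n p {σ} s = trans (∑-cong (sublists (allPairs n)) (λ τ → cong 𝟙 (valid-cong {sb = σbarAt p σ} {sb′ = σbarAt p σ} (appears-σbarAt p s) (λ _ → refl) τ)))
  (OpenArcs.∑-valid (σbarAt p σ) (σbarAt-sign′ p s) n)

-- Sorted odd shifted parking functions

slotOK : ℕ → ℤ → Bool
slotOK a x = if isZero x then a ≡ᵇ 0 else odd a

matches : List ℕ → List ℤ → Bool
matches (a ∷ as) (x ∷ xs) = slotOK a x ∧ matches as xs
matches []       []       = true
matches _        _        = false

-- Slots are numbered from 1, list entries from 0.
sAt : List ℤ → ℕ → ℤ
sAt s k = at (ℤ.+ 0) s (k ∸ 1)

map-at : ∀ {d : A} s → map (at d s) (upTo (length s)) ≡ s
map-at []      = refl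
map-at {d = d} (x ∷ s) = trans (map-upTo-suc (at d (x ∷ s)) (length s)) (cong (x ∷_) (map-at s))

map-sAt : ∀ n s → length s ≡ n → map (sAt s) (range 1 n) ≡ s
map-sAt n s refl = trans (sym (LP.map-∘ (upTo n))) (map-at s)

matches-map : ∀ {f : ℕ → ℕ} {g : ℕ → ℤ} (ks : List ℕ) → T (matches (map f ks) (map g ks)) → ∀ {k} → k ∈ ks → T (slotOK (f k) (g k))
matches-map {f} {g} (k ∷ ks) t (here refl) = ∧-fst t
matches-map {f} {g} (k ∷ ks) t (there m)   = matches-map ks (∧-snd {slotOK (f k) (g k)} t) m

map-matches : ∀ {f : ℕ → ℕ} {g : ℕ → ℤ} (ks : List ℕ) → (∀ {k} → k ∈ ks → T (slotOK (f k) (g k))) → T (matches (map f ks) (map g ks))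
map-matches []       h = tt
map-matches {f} {g} (k ∷ ks) h = ∧-intro {slotOK (f k) (g k)} (h (here refl)) (map-matches ks (h ∘ there))

matches-content : ∀ n p s → length s ≡ n → T (matches (content n p) s) → ∀ {k} → k ∈ range 1 n → T (slotOK (α p k) (sAt s k))
matches-content n p s l t = matches-map (range 1 n) (subst (T ∘ matches (content n p)) (sym (map-sAt n s l)) t)

oddContent : ∀ n p → T (all odd (shape n p)) → ∀ {k} → k ∈ range 1 n → α p k ≢ 0 → T (odd (α p k))
oddContent n p t {k} m ne = T-all odd (shape n p) t
  (↭P.∈-resp-↭ (↭-sym (sortDec-↭ (filterᵇ (λ a → not (a ≡ᵇ 0)) (content n p)))) (filterᵇ-∈⁺ (λ a → not (a ≡ᵇ 0)) (∈P.∈-map⁺ (α p) m) (≢⇒not≡ᵇ ne)))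

oddContent⁻ : ∀ n p → (∀ {k} → k ∈ range 1 n → α p k ≢ 0 → T (odd (α p k))) → T (all odd (shape n p))
oddContent⁻ n p h = all-T odd (shape n p) (λ m → step (filterᵇ-∈⁻ (λ a → not (a ≡ᵇ 0)) (content n p) (↭P.∈-resp-↭ (sortDec-↭ (filterᵇ (λ a → not (a ≡ᵇ 0)) (content n p))) m)))
  where
  step : ∀ {a} → a ∈ content n p × T (not (a ≡ᵇ 0)) → T (odd a)
  step (m , t) with ∈P.∈-map⁻ (α p) m
  ... | k , k∈ , refl = h k∈ (not≡ᵇ⇒≢ t)

slotOK-odd : ∀ a {x} → T (slotOK a x) → a ≢ 0 → T (odd a) × x ≢ ℤ.+ 0
slotOK-odd a {x} t n with isZero x in e
... | true  = ⊥-elim (n (ℕP.≡ᵇ⇒≡ a 0 t))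
... | false = t , λ z → subst T e (≡⇒eqℤ z)

slotOK-zero : ∀ {a x} → T (slotOK a x) → a ≡ 0 → x ≡ ℤ.+ 0
slotOK-zero {a} {x} t refl with isZero x in e
... | true  = eqℤ⇒≡ (≡⇒T e)

slotOK-intro : ∀ {a x} → (a ≡ 0 → x ≡ ℤ.+ 0) → (a ≢ 0 → T (odd a) × x ≢ ℤ.+ 0) → T (slotOK a x)
slotOK-intro {zero}  {x} f g rewrite f refl = tt
slotOK-intro {suc a} {x} f g with g (λ ())
... | o , ne rewrite ¬T⇒≡ (ne ∘ eqℤ⇒≡ {x}) = o

prodℤ-replicate : ∀ {g} → IsSign g → ∀ m → T (odd m) → prodℤ (replicate m g) ≡ g
prodℤ-replicate {g} s (suc zero)    t = ℤP.*-identityʳ g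
prodℤ-replicate pos (suc (suc m)) t rewrite prodℤ-replicate pos m t = refl
prodℤ-replicate neg (suc (suc m)) t rewrite prodℤ-replicate neg m t = refl

filter-zip-map : ∀ (f : ℕ → ℤ) k p → map proj₂ (filterᵇ (λ t → proj₁ t ≡ᵇ k) (zip p (map f p))) ≡ replicate (count k p) (f k)
filter-zip-map f k []      = refl
filter-zip-map f k (x ∷ p) rewrite ≡ᵇ-sym x k with k ≡ᵇ x in e
... | true rewrite ℕP.≡ᵇ⇒≡ k x (≡⇒T e) = cong (f x ∷_) (filter-zip-map f x p)
... | false = filter-zip-map f k p

-- A standard preimage of `s` under `σ̄`: every occurrence of `k` gets the sign of slot `k`. The
-- number of occurrences is odd, so their product is that sign again.
signsOf : List ℕ → List ℤ → List ℤ
signsOf p s = map (sAt s) p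

trits-sign : ∀ {x} → x ∈ trits → x ≢ ℤ.+ 0 → IsSign x
trits-sign (here refl)                 n = ⊥-elim (n refl)
trits-sign (there (here refl))         n = pos
trits-sign (there (there (here refl))) n = neg

sAt-trits : ∀ n {s} → s ∈ tuples trits n → ∀ {k} → k ∈ range 1 n → sAt s k ∈ trits
sAt-trits n {s} s∈ {k} m with tuples-∈⁻ trits n s∈
... | l , h = h (subst (sAt s k ∈_) (map-sAt n s l) (∈P.∈-map⁺ (sAt s) m))

module _ (n : ℕ) (p : List ℕ) (r : InRange n p) {s : List ℤ} (s∈ : s ∈ tuples trits n) (t : T (matches (content n p) s)) where

  private
    len : length s ≡ n
    len = proj₁ (tuples-∈⁻ trits n s∈)
    ok : ∀ {k} → k ∈ range 1 n → T (slotOK (α p k) (sAt s k))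
    ok = matches-content n p s len t

  count-∈ : ∀ {k} → k ∈ p → α p k ≢ 0
  count-∈ {k} m e with ∈P.∈-∃++ m
  ... | as , bs , refl = ℕP.0≢1+n (trans (sym e) (trans (count-↭ k (↭P.shift k as bs)) (count-self k (as ++ bs))))

  sAt-sign : ∀ {k} → k ∈ range 1 n → α p k ≢ 0 → IsSign (sAt s k)
  sAt-sign {k} m ne = trits-sign (sAt-trits n s∈ m) (proj₂ (slotOK-odd (α p k) {sAt s k} (ok m) ne))

  signsOf-signs : All IsSign (signsOf p s)
  signsOf-signs = AllP.map⁺ (All.tabulate (λ m → sAt-sign (r m) (count-∈ m)))

  matches⇒odd : T (all odd (shape n p))
  matches⇒odd = oddContent⁻ n p (λ {k} m ne → proj₁ (slotOK-odd (α p k) {sAt s k} (ok m) ne))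

  σbar-signsOf : σbar n p (signsOf p s) ≡ s
  σbar-signsOf = trans (LP.map-cong-local (All.tabulate (λ {k} m → eq k m (α p k ℕ.≟ 0)))) (map-sAt n s len)
    where
    eq : ∀ k → k ∈ range 1 n → Dec (α p k ≡ 0) → σbarAt p (signsOf p s) k ≡ sAt s k
    eq k m (yes e) = trans (σbarAt-zero p (signsOf p s) k e) (sym (slotOK-zero {α p k} {sAt s k} (ok m) e))
    eq k m (no ne) = trans (σbarAt-prod p (signsOf p s) k ne)
      (trans (cong prodℤ (filter-zip-map (sAt s) k p)) (prodℤ-replicate (sAt-sign m ne) (count k p) (proj₁ (slotOK-odd (α p k) {sAt s k} (ok m) ne))))

σbarAt-≡ : ∀ n {p σ p′ σ′} → InRange n p → InRange n p′ → σbar n p σ ≡ σbar n p′ σ′ → ∀ k → σbarAt p σ k ≡ σbarAt p′ σ′ k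
σbarAt-≡ n {p} {σ} {p′} {σ′} r r′ e k with k ∈? range 1 n
... | yes m = map-≡⇒ (range 1 n) e m
... | no nm = trans (σbarAt-zero p σ k (count-∉ k p (nm ∘ r))) (sym (σbarAt-zero p′ σ′ k (count-∉ k p′ (nm ∘ r′))))

sublists-⊆ : ∀ (L : List A) {τ} → τ ∈ sublists L → ∀ {x} → x ∈ τ → x ∈ L
sublists-⊆ []      (here refl) ()
sublists-⊆ (y ∷ L) m with ∈P.∈-++⁻ (map (y ∷_) (sublists L)) m
... | inj₂ r = there ∘ sublists-⊆ L r
... | inj₁ l with ∈P.∈-map⁻ (y ∷_) l
...   | τ , m′ , refl = λ { (here refl) → here refl ; (there q) → there (sublists-⊆ L m′ q) }

sublists-! : ∀ {L : List A} → Unique L → Unique (sublists L)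
sublists-! []       = [] ∷ []
sublists-! {L = y ∷ L} (y∉ ∷ u) = UP.++⁺ (UP.map⁺ LP.∷-injectiveʳ (sublists-! u)) (sublists-! u) disj
  where
  disj : ∀ {τ} → τ ∈ map (y ∷_) (sublists L) × τ ∈ sublists L → ⊥
  disj (l , r) with ∈P.∈-map⁻ (y ∷_) l
  ... | τ , _ , refl = All.lookup y∉ (sublists-⊆ L r (here refl)) refl

allPairs-! : ∀ n → Unique (allPairs n)
allPairs-! n = concatMap-! _ (range-! 1 n) (λ a → UP.map⁺ (cong proj₂) (range-! (suc a) n)) key
  where
  key : ∀ {a b : ℕ} {z : Pair} → z ∈ map (a ,_) (range (suc a) n) → z ∈ map (b ,_) (range (suc b) n) → a ≡ b
  key p q with ∈P.∈-map⁻ _ p | ∈P.∈-map⁻ _ q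
  ... | _ , _ , refl | _ , _ , e = cong proj₁ e

triples : List (List ℕ) → List (List ℤ) → List (List Pair) → List Triple
triples ps ss τs = concatMap (λ p → concatMap (λ s → map (λ τ → (p , s , τ)) τs) ss) ps

triples-! : ∀ {ps ss τs} → Unique ps → Unique ss → Unique τs → Unique (triples ps ss τs)
triples-! {ps} {ss} {τs} u v w = concatMap-! _ u (λ p → concatMap-! _ v (λ s → UP.map⁺ (cong (proj₂ ∘ proj₂)) w) key₂) key₁
  where
  key₂ : ∀ {p : List ℕ} {s s′ : List ℤ} {z : Triple} → z ∈ map (λ τ → (p , s , τ)) τs → z ∈ map (λ τ → (p , s′ , τ)) τs → s ≡ s′
  key₂ a b with ∈P.∈-map⁻ _ a | ∈P.∈-map⁻ _ b
  ... | _ , _ , refl | _ , _ , e = cong (proj₁ ∘ proj₂) e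
  fst : ∀ {p z} → z ∈ concatMap (λ s → map (λ τ → (p , s , τ)) τs) ss → proj₁ z ≡ p
  fst m with concatMap-∈⁻ _ ss m
  ... | s , _ , l with ∈P.∈-map⁻ _ l
  ...   | _ , _ , refl = refl
  key₁ : ∀ {p p′ : List ℕ} {z : Triple} → z ∈ concatMap (λ s → map (λ τ → (p , s , τ)) τs) ss → z ∈ concatMap (λ s → map (λ τ → (p′ , s , τ)) τs) ss → p ≡ p′
  key₁ a b = trans (sym (fst a)) (fst b)

triples-∈⁻ : ∀ ps ss τs {p s τ} → (p , s , τ) ∈ triples ps ss τs → p ∈ ps × s ∈ ss × τ ∈ τs
triples-∈⁻ ps ss τs m with concatMap-∈⁻ _ ps m
... | p , p∈ , l with concatMap-∈⁻ _ ss l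
...   | s , s∈ , l′ with ∈P.∈-map⁻ _ l′
...     | τ , τ∈ , refl = p∈ , s∈ , τ∈

triples-∈⁺ : ∀ {ps ss τs p s τ} → p ∈ ps → s ∈ ss → τ ∈ τs → (p , s , τ) ∈ triples ps ss τs
triples-∈⁺ p s t = concatMap-∈⁺ _ p (concatMap-∈⁺ _ s (∈P.∈-map⁺ _ t))

∑-triples : ∀ ps ss τs {F : Triple → ℚ} → ∑ (triples ps ss τs) F ≡ ∑ ps (λ p → ∑ ss (λ s → ∑ τs (λ τ → F (p , s , τ))))
∑-triples ps ss τs = trans (∑-concatMap _ ps) (∑-cong ps (λ p → trans (∑-concatMap _ ss) (∑-cong ss (λ s → ∑-map _ τs))))

-- A direct test for sorted objects; the only preimage it refers to is the standard one.
isSortedOShPf : ℕ → Triple → Bool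
isSortedOShPf n (p , s , τ) = matches (content n p) s ∧ validτ p (signsOf p s) τ

sortedTriples : ℕ → List Triple
sortedTriples n = filterᵇ (isSortedOShPf n) (triples (sortedPf n) (tuples trits n) (sublists (allPairs n)))

-- Validity depends only on the content and on `σ̄`, so every preimage of a sorted triple can be
-- replaced by the standard one. This exchanges a deduplicated image for a filtered product of
-- lists.
∑-SortedOShPf : ∀ n {F : Triple → ℚ} → ∑ (SortedOShPf n) F ≡ ∑ (sortedTriples n) F
∑-SortedOShPf n = ∑-set (UDP.deduplicate-! _≟T_ (map (sortTriple n) (OShPf n)))
  (filterᵇ-! (isSortedOShPf n) (triples-! (filterᵇ-! isSorted (filterᵇ-! (isPF n) (tuples-! (range-! 1 n) n))) (tuples-! trits-! n) (sublists-! (allPairs-! n))))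
  to from
  where
  trits-! : Unique trits
  trits-! = ((λ ()) ∷ (λ ()) ∷ []) ∷ ((λ ()) ∷ []) ∷ [] ∷ []
  to : ∀ {t} → t ∈ SortedOShPf n → t ∈ sortedTriples n
  to m with ∈P.∈-map⁻ (sortTriple n) (∈P.∈-deduplicate⁻ _≟T_ (map (sortTriple n) (OShPf n)) m)
  ... | (p , σ , τ) , m₁ , refl with filterᵇ-∈⁻ (isOShPf n) (triples (Pf n) (tuples signs n) (sublists (allPairs n))) m₁
  ...   | m₂ , ok with triples-∈⁻ (Pf n) (tuples signs n) (sublists (allPairs n)) m₂
  ...     | p∈ , σ∈ , τ∈ with Pf-∈⁻ n p∈
  ...       | r , l , d = filterᵇ-∈⁺ (isSortedOShPf n)
      (triples-∈⁺ (filterᵇ-∈⁺ isSorted (Pf-∈⁺ n r′ (trans (↭P.↭-length p′↭p) l) (subst (T ∘ isDyck 0) (sym c) d)) (≡⇒T (trans (cong (eqListℕ p′) (sortInc-↭⇒≡ p′↭p)) (eqListℕ-refl p′)))) s∈ τ∈)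
      (∧-intro {matches (content n p′) s} mt (subst T (valid-cong {sb = σbarAt p σ} {sb′ = σbarAt p′ (signsOf p′ s)} (λ k → cong (λ a → not (a ≡ᵇ 0)) (count-↭ k (↭-sym p′↭p))) (σbarAt-≡ n r r′ (sym (σbar-signsOf n p′ r′ s∈ mt))) τ) vt))
    where
    p′ = sortInc p
    s = σbar n p σ
    p′↭p : p′ ↭ p
    p′↭p = ↭-trans (↭-reflexive (sortInc-content n p r)) (↭-sym (↭-expand-content n p r))
    r′ : InRange n p′
    r′ m = r (↭P.∈-resp-↭ p′↭p m)
    c : content n p′ ≡ content n p
    c = LP.map-cong (λ k → count-↭ k p′↭p) (range 1 n)
    σs : All IsSign σ
    σs = All.tabulate (λ m → signs-IsSign (proj₂ (tuples-∈⁻ signs n σ∈) m))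
    ok₂ = ∧-snd {isPF n p} ok
    vt = ∧-snd {length σ ≡ᵇ n} (∧-snd {all odd (shape n p)} ok₂)
    σbarAt-trit : ∀ k → σbarAt p σ k ∈ trits
    σbarAt-trit k with α p k ℕ.≟ 0
    ... | yes e = subst (_∈ trits) (sym (σbarAt-zero p σ k e)) (here refl)
    ... | no ne with σbarAt p σ k | σbarAt-sign p σs k ne
    ...   | _ | pos = there (here refl)
    ...   | _ | neg = there (there (here refl))
    s∈ : s ∈ tuples trits n
    s∈ = subst (λ z → s ∈ tuples trits z) (trans (LP.length-map _ (range 1 n)) (length-range 1 n)) (tuples-∈⁺ trits s (λ m → trit (∈P.∈-map⁻ (σbarAt p σ) m)))
      where
      trit : ∀ {x} → ∃ (λ k → k ∈ range 1 n × x ≡ σbarAt p σ k) → x ∈ trits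
      trit (k , _ , refl) = σbarAt-trit k
    mt : T (matches (content n p′) s)
    mt = subst (λ z → T (matches z s)) (sym c) (map-matches (range 1 n) (λ {k} m → slotOK-intro (σbarAt-zero p σ k)
      (λ ne → oddContent n p (∧-fst {all odd (shape n p)} ok₂) m ne , sign-≢0 (σbarAt-sign p σs k ne))))
  from : ∀ {t} → t ∈ sortedTriples n → t ∈ SortedOShPf n
  from {p , s , τ} m with filterᵇ-∈⁻ (isSortedOShPf n) (triples (sortedPf n) (tuples trits n) (sublists (allPairs n))) m
  ... | m₂ , ok with triples-∈⁻ (sortedPf n) (tuples trits n) (sublists (allPairs n)) m₂
  ...   | p∈ , s∈ , τ∈ with filterᵇ-∈⁻ isSorted (Pf n) p∈
  ...     | p∈′ , st with Pf-∈⁻ n p∈′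
  ...       | r , l , d = ∈P.∈-deduplicate⁺ _≟T_ (subst (_∈ map (sortTriple n) (OShPf n))
      (cong₂ (λ a b → (a , b , τ)) (sym (eqListℕ⇒≡ p (sortInc p) st)) (σbar-signsOf n p r s∈ mt))
      (∈P.∈-map⁺ (sortTriple n) (filterᵇ-∈⁺ (isOShPf n) (triples-∈⁺ p∈′ σ∈ τ∈)
        (∧-intro {isPF n p} (proj₂ (filterᵇ-∈⁻ (isPF n) (tuples (range 1 n) n) p∈′)) (∧-intro {all odd (shape n p)} (matches⇒odd n p r s∈ mt)
          (∧-intro {length σ ≡ᵇ n} (ℕP.≡⇒≡ᵇ _ _ lσ) (∧-snd {matches (content n p) s} ok)))))))
    where
    mt : T (matches (content n p) s)
    mt = ∧-fst ok
    σ = signsOf p s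
    lσ : length σ ≡ n
    lσ = trans (LP.length-map (sAt s) p) l
    σ∈ : σ ∈ tuples signs n
    σ∈ = subst (λ z → σ ∈ tuples signs z) lσ (tuples-∈⁺ signs σ (λ m → IsSign-signs (All.lookup (signsOf-signs n p r s∈ mt) m)))

-- The V-expansion

signedSlot : ℤ → SlotWeight
signedSlot x a μ = 𝟙 (slotOK a x) * halfWeight μ

pathWeight-matches : ∀ s as κ → pathWeight (map signedSlot s) as κ ≡ 𝟙 (matches as s) * contentWeight halfWeight as κ
pathWeight-matches []      []       κ = sym (R.*-identityˡ _)
pathWeight-matches []      (a ∷ as) κ = sym (R.zeroˡ _)
pathWeight-matches (x ∷ s) []       κ = sym (R.zeroˡ _)
pathWeight-matches (x ∷ s) (a ∷ as) κ = begin
  ∑⊎ (λ μ ν → 𝟙 (sum μ ≡ᵇ a) * (𝟙 (slotOK a x) * halfWeight μ) * pathWeight (map signedSlot s) as ν) κ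
    ≡⟨ ∑⊎-cong (λ μ ν → trans (cong (𝟙 (sum μ ≡ᵇ a) * (𝟙 (slotOK a x) * halfWeight μ) *_) (pathWeight-matches s as ν)) (regroup (𝟙 (sum μ ≡ᵇ a)) (𝟙 (slotOK a x)) (halfWeight μ) (𝟙 (matches as s)) (contentWeight halfWeight as ν))) κ ⟩
  ∑⊎ (λ μ ν → 𝟙 (slotOK a x) * 𝟙 (matches as s) * (𝟙 (sum μ ≡ᵇ a) * halfWeight μ * contentWeight halfWeight as ν)) κ
    ≡⟨ trans (∑⊎-*ˡ _ κ) (cong (_* contentWeight halfWeight (a ∷ as) κ) (sym (𝟙-∧ (slotOK a x) (matches as s)))) ⟩
  𝟙 (slotOK a x ∧ matches as s) * contentWeight halfWeight (a ∷ as) κ ∎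
  where
  opaque
    unfolding _+_
    regroup : ∀ a b c d e → a * (b * c) * (d * e) ≡ b * d * (a * c * e)
    regroup = solve-∀ ℚ-ring

-- A slot of sign 0 must have total 0, which for positive parts means that it is empty.
pathSum-Ω : ∀ s j {κ} → Positive κ → pathSum (map signedSlot s) j κ ≡ Ω j s κ
pathSum-Ω []      j p = refl
pathSum-Ω (x ∷ s) j p = ∑⊎-cong-All (λ {μ} {ν} pμ pν → cong₂ _*_ (eq pμ) (step (j ℕ.+ sum μ) pν)) p
  where
  step : ∀ m {ν} → Positive ν → ↓ (pathSum (map signedSlot s)) m ν ≡ ↓ (λ m → Ω m s) m ν
  step zero    q = refl
  step (suc m) q = pathSum-Ω s m q
  eq : ∀ {μ} → Positive μ → signedSlot x (sum μ) μ ≡ slot x μ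
  eq {μ} q with isZero x
  eq {[]}        q       | true = R.*-identityˡ 1ℚ
  eq {suc k ∷ μ} q       | true = R.zeroˡ _
  eq {zero ∷ μ}  (() ∷ _) | true
  eq {μ}         q       | false = refl

-- `V` sees only the content of `p`. Summing over `τ` first gives the factor `arcs`, which depends
-- on `s` alone; then for each `s` the contents can be summed.
⟨VSum⟩ : ∀ n κ → ⟨ VSum n ∣ κ ⟩ ≡ ip κ * ∑ (tuples trits n) (λ s → arcs (ℤ.+ 1) s 0 * pathSum (map signedSlot s) 0 κ)
⟨VSum⟩ n κ = begin
  ⟨ VSum n ∣ κ ⟩
    ≡⟨ ⟨sumS⟩ (SortedOShPf n) (λ t → Vλ (shape n (proj₁ t))) κ ⟩
  ∑ (SortedOShPf n) (λ t → ⟨ Vλ (shape n (proj₁ t)) ∣ κ ⟩)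
    ≡⟨ ∑-SortedOShPf n ⟩
  ∑ (sortedTriples n) (λ t → ⟨ Vλ (shape n (proj₁ t)) ∣ κ ⟩)
    ≡⟨ trans (∑-cong (sortedTriples n) (λ t → ⟨prodS⟩-shape PS halfWeight refl ⟨PS⟩ n (proj₁ t) κ)) (∑-*ˡ (ip κ) (sortedTriples n)) ⟩
  ip κ * ∑ (sortedTriples n) (λ t → W (proj₁ t))
    ≡⟨ cong (ip κ *_) (trans (∑-filter (isSortedOShPf n) (triples (sortedPf n) (tuples trits n) (sublists (allPairs n)))) (∑-triples (sortedPf n) (tuples trits n) (sublists (allPairs n)))) ⟩
  ip κ * ∑ (sortedPf n) (λ p → ∑ (tuples trits n) (λ s → ∑ (sublists (allPairs n)) (λ τ → 𝟙 (matches (content n p) s ∧ validτ p (signsOf p s) τ) * W p)))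
    ≡⟨ cong (ip κ *_) (∑-cong-∈ (sortedPf n) (λ p∈ → ∑-cong-∈ (tuples trits n) (λ s∈ → inner p∈ s∈))) ⟩
  ip κ * ∑ (sortedPf n) (λ p → ∑ (tuples trits n) (λ s → arcs (ℤ.+ 1) s 0 * (𝟙 (matches (content n p) s) * W p)))
    ≡⟨ cong (ip κ *_) (trans (∑-swap (sortedPf n) (tuples trits n)) (∑-cong-∈ (tuples trits n) (λ {s} s∈ → trans (∑-*ˡ (arcs (ℤ.+ 1) s 0) (sortedPf n)) (cong (arcs (ℤ.+ 1) s 0 *_) (outer s (proj₁ (tuples-∈⁻ trits n s∈))))))) ⟩
  ip κ * ∑ (tuples trits n) (λ s → arcs (ℤ.+ 1) s 0 * pathSum (map signedSlot s) 0 κ) ∎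
  where
  W : List ℕ → ℚ
  W p = contentWeight halfWeight (content n p) κ
  opaque
    unfolding _+_
    regroup : ∀ a b c → a * (b * c) ≡ b * (a * c)
    regroup = solve-∀ ℚ-ring
  inner : ∀ {p s} → p ∈ sortedPf n → s ∈ tuples trits n →
    ∑ (sublists (allPairs n)) (λ τ → 𝟙 (matches (content n p) s ∧ validτ p (signsOf p s) τ) * W p) ≡ arcs (ℤ.+ 1) s 0 * (𝟙 (matches (content n p) s) * W p)
  inner {p} {s} p∈ s∈ = begin
    ∑ (sublists (allPairs n)) (λ τ → 𝟙 (matches (content n p) s ∧ validτ p (signsOf p s) τ) * W p)
      ≡⟨ trans (∑-*ʳ (W p) (sublists (allPairs n))) (cong (_* W p) (trans (∑-cong (sublists (allPairs n)) (λ τ → 𝟙-∧ (matches (content n p) s) _)) (∑-*ˡ (𝟙 (matches (content n p) s)) (sublists (allPairs n))))) ⟩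
    𝟙 (matches (content n p) s) * ∑ (sublists (allPairs n)) (λ τ → 𝟙 (validτ p (signsOf p s) τ)) * W p
      ≡⟨ cong (_* W p) (𝟙-*-cong (matches (content n p) s) (λ t → trans (∑-validτ n p (signsOf-signs n p r s∈ t)) (cong (λ z → arcs (ℤ.+ 1) z 0) (σbar-signsOf n p r s∈ t)))) ⟩
    𝟙 (matches (content n p) s) * arcs (ℤ.+ 1) s 0 * W p
      ≡⟨ trans (R.*-assoc _ _ _) (regroup (𝟙 (matches (content n p) s)) (arcs (ℤ.+ 1) s 0) (W p)) ⟩
    arcs (ℤ.+ 1) s 0 * (𝟙 (matches (content n p) s) * W p) ∎
    where
    r : InRange n p
    r = proj₁ (Pf-∈⁻ n (proj₁ (filterᵇ-∈⁻ isSorted (Pf n) p∈)))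
  outer : ∀ s → length s ≡ n → ∑ (sortedPf n) (λ p → 𝟙 (matches (content n p) s) * W p) ≡ pathSum (map signedSlot s) 0 κ
  outer s l = trans (∑-sortedPf n (λ as → 𝟙 (matches as s) * contentWeight halfWeight as κ))
    (trans (∑-cong (tuples (upTo (suc n)) n) (λ as → cong (𝟙 (isDyck 0 as) *_) (sym (pathWeight-matches s as κ))))
      (subst (λ m → ∑ (tuples (upTo (suc n)) m) (λ as → 𝟙 (isDyck 0 as) * pathWeight (map signedSlot s) as κ) ≡ pathSum (map signedSlot s) 0 κ) l′
        (∑-pathWeight n (map signedSlot s) (ℕP.≤-reflexive l′) 0 κ)))
    where
    l′ : length (map signedSlot s) ≡ n
    l′ = trans (LP.length-map signedSlot s) l

∑-arcs-Ω : ∀ n {κ} → Positive κ → ∑ (tuples trits n) (λ s → arcs (ℤ.+ 1) s 0 * pathSum (map signedSlot s) 0 κ) ≡ T[ Q₂ ] n 0 κ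
∑-arcs-Ω n p = trans (∑-cong (tuples trits n) (λ s → cong (arcs (ℤ.+ 1) s 0 *_) (pathSum-Ω s 0 p))) (arcSum-T n p)

-- Since `inv 0 = 0`, the factor `ip` vanishes on every list with a part 0, and slot sums have to be
-- compared for positive parts only.
ip-*-cong : ∀ κ {x y} → (Positive κ → x ≡ y) → ip κ * x ≡ ip κ * y
ip-*-cong κ {x} {y} h with All.all? (1 ℕP.≤?_) κ
... | yes p = cong (ip κ *_) (h p)
... | no np = trans (cong (_* x) (vanish κ np)) (trans (R.zeroˡ x) (sym (trans (cong (_* y) (vanish κ np)) (R.zeroˡ y))))
  where
  vanish : ∀ κ → ¬ Positive κ → ip κ ≡ 0ℚ
  vanish []          n = ⊥-elim (n [])
  vanish (zero ∷ κ)  n = R.zeroˡ (ip κ)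
  vanish (suc k ∷ κ) n = trans (cong (inv (suc k) *_) (vanish κ (λ p → n (s≤s z≤n ∷ p)))) (R.zeroʳ (inv (suc k)))

SHsym≈VSum : ∀ n → SHsym n ≈S VSum n
SHsym≈VSum n = ⟨⟩⇒≈S {SHsym n} {VSum n} (λ κ → trans (⟨SHsym⟩ n (sortDec κ)) (trans (ip-*-cong (sortDec κ) (λ p → sym (∑-arcs-Ω n p))) (sym (⟨VSum⟩ n (sortDec κ)))))

-- The permutation of cycle type κ

mutual
  cycGo : ℕ → List ℕ → ℕ → ℕ
  cycGo = _

  cycPerm≡cycGo : ∀ κ i → cycPerm κ i ≡ cycGo i κ 0
  cycPerm≡cycGo κ i with 0
  ... | s = refl

<ᵇ-+ : ∀ t a b → (t ℕ.+ a <ᵇ t ℕ.+ b) ≡ (a <ᵇ b)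
<ᵇ-+ zero    a b = refl
<ᵇ-+ (suc t) a b = <ᵇ-+ t a b

cycGo-shift : ∀ t i κ s → cycGo (t ℕ.+ i) κ (t ℕ.+ s) ≡ t ℕ.+ cycGo i κ s
cycGo-shift t i []      s = refl
cycGo-shift t i (l ∷ κ) s rewrite ℕP.+-assoc t s l | <ᵇ-+ t i (s ℕ.+ l) | sym (ℕP.+-suc t i) | <ᵇ-+ t (suc i) (s ℕ.+ l) with i <ᵇ s ℕ.+ l
... | false = cycGo-shift t i κ (s ℕ.+ l)
... | true with suc i <ᵇ s ℕ.+ l
...   | true  = refl
...   | false = refl

cycPerm-in : ∀ l κ {i} → i < l → cycPerm (l ∷ κ) i ≡ (if suc i <ᵇ l then suc i else 0)
cycPerm-in l κ {i} i<l rewrite cycPerm≡cycGo (l ∷ κ) i | T⇒≡ (ℕP.<⇒<ᵇ i<l) = refl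

cycPerm-out : ∀ l κ i → cycPerm (l ∷ κ) (l ℕ.+ i) ≡ l ℕ.+ cycPerm κ i
cycPerm-out l κ i rewrite ¬T⇒≡ {l ℕ.+ i <ᵇ l} (λ t → ℕP.m+n≮m l i (ℕP.<ᵇ⇒< _ _ t)) =
  trans (cong (cycGo (l ℕ.+ i) κ) (sym (ℕP.+-identityʳ l))) (trans (cycGo-shift l i κ 0) (cong (l ℕ.+_) (sym (cycPerm≡cycGo κ i))))

data Split (l m : ℕ) : ℕ → Set where
  inner : ∀ {i} → i < l → Split l m i
  outer : ∀ i → i < m → Split l m (l ℕ.+ i)

split : ∀ l m {i} → i < l ℕ.+ m → Split l m i
split l m {i} h with i ℕP.<? l
... | yes p = inner p
... | no np = subst (Split l m) (ℕP.m+[n∸m]≡n (ℕP.≮⇒≥ np)) (outer (i ∸ l) (ℕP.+-cancelˡ-< l _ _ (subst (_< l ℕ.+ m) (sym (ℕP.m+[n∸m]≡n (ℕP.≮⇒≥ np))) h)))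

cycPerm-in-< : ∀ l κ {i} → i < l → cycPerm (l ∷ κ) i < l
cycPerm-in-< l κ {i} i<l rewrite cycPerm-in l κ i<l with suc i <ᵇ l in e
... | true  = ℕP.<ᵇ⇒< (suc i) l (≡⇒T e)
... | false = ℕP.≤-trans (s≤s z≤n) i<l

cycPerm-< : ∀ κ {i} → i < sum κ → cycPerm κ i < sum κ
cycPerm-< (l ∷ κ) h with split l (sum κ) h
... | inner p   = ℕP.<-≤-trans (cycPerm-in-< l κ p) (ℕP.m≤m+n l (sum κ))
... | outer i p rewrite cycPerm-out l κ i = ℕP.+-monoʳ-< l (cycPerm-< κ p)

cycPerm-injective : ∀ κ {i j} → i < sum κ → j < sum κ → cycPerm κ i ≡ cycPerm κ j → i ≡ j
cycPerm-injective (l ∷ κ) hi hj e with split l (sum κ) hi | split l (sum κ) hj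
... | inner {i} p | inner {j} q = rot i j p q (trans (sym (cycPerm-in l κ p)) (trans e (cycPerm-in l κ q)))
  where
  rot : ∀ i j → i < l → j < l → (if suc i <ᵇ l then suc i else 0) ≡ (if suc j <ᵇ l then suc j else 0) → i ≡ j
  rot i j p q e with suc i <ᵇ l in a | suc j <ᵇ l in b
  ... | true  | true  = ℕP.suc-injective e
  ... | false | false = trans (last i p a) (sym (last j q b))
    where
    last : ∀ i → i < l → (suc i <ᵇ l) ≡ false → i ≡ l ∸ 1
    last i p a = trans (sym (ℕP.m+n∸m≡n 1 i)) (cong (_∸ 1) (ℕP.≤-antisym p (ℕP.≮⇒≥ (λ h → subst T a (ℕP.<⇒<ᵇ h)))))
... | inner p | outer j q = ⊥-elim (ℕP.<⇒≱ (cycPerm-in-< l κ p) (ℕP.≤-trans (ℕP.m≤m+n l _) (ℕP.≤-reflexive (trans (sym (cycPerm-out l κ j)) (sym e)))))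
... | outer i p | inner q = ⊥-elim (ℕP.<⇒≱ (cycPerm-in-< l κ q) (ℕP.≤-trans (ℕP.m≤m+n l _) (ℕP.≤-reflexive (trans (sym (cycPerm-out l κ i)) e))))
... | outer i p | outer j q = cong (l ℕ.+_) (cycPerm-injective κ p q (ℕP.+-cancelˡ-≡ l _ _ (trans (sym (cycPerm-out l κ i)) (trans e (cycPerm-out l κ j)))))

cycPerm-surjective : ∀ κ {j} → j < sum κ → ∃ λ i → i < sum κ × cycPerm κ i ≡ j
cycPerm-surjective (l ∷ κ) h with split l (sum κ) h
... | outer j q with cycPerm-surjective κ q
...   | i , p , e = l ℕ.+ i , ℕP.+-monoʳ-< l p , trans (cycPerm-out l κ i) (cong (l ℕ.+_) e)
cycPerm-surjective (suc l ∷ κ) h | inner {zero} q = l , s≤s (ℕP.m≤m+n l (sum κ)) ,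
  trans (cycPerm-in (suc l) κ ℕP.≤-refl) (cong (λ b → if b then suc l else 0) (¬T⇒≡ {suc l <ᵇ suc l} (λ t → ℕP.<-irrefl refl (ℕP.<ᵇ⇒< l l t))))
cycPerm-surjective (l ∷ κ) h | inner {suc j} q = j , ℕP.<-trans (ℕP.n<1+n j) h ,
  trans (cycPerm-in l κ (ℕP.<-trans (ℕP.n<1+n j) q)) (cong (λ b → if b then suc j else 0) (T⇒≡ (ℕP.<⇒<ᵇ q)))

mutual
  preGo : (ℕ → ℕ) → ℕ → ℕ → List ℕ → ℕ
  preGo = _

  preimage≡preGo : ∀ w n j → preimage w n j ≡ preGo w n j (upTo n)
  preimage≡preGo w n j with upTo n
  ... | is = refl

preGo-unique : ∀ w n i is → i ∈ is → (∀ {k} → k ∈ is → w k ≡ w i → k ≡ i) → preGo w n (w i) is ≡ i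
preGo-unique w n i (k ∷ is) m u with w k ≡ᵇ w i in e
... | true  = u (here refl) (ℕP.≡ᵇ⇒≡ (w k) (w i) (≡⇒T e))
... | false with m
...   | here refl = ⊥-elim (subst T e (ℕP.≡⇒≡ᵇ (w i) (w i) refl))
...   | there m′  = preGo-unique w n i is m′ (u ∘ there)

preimage-cycPerm : ∀ κ {i} → i < sum κ → preimage (cycPerm κ) (sum κ) (cycPerm κ i) ≡ i
preimage-cycPerm κ {i} h = trans (preimage≡preGo (cycPerm κ) (sum κ) (cycPerm κ i))
  (preGo-unique (cycPerm κ) (sum κ) i (upTo (sum κ)) (∈P.∈-upTo⁺ h) (λ m e → cycPerm-injective κ (∈P.∈-upTo⁻ m) h e))

-- Invariance under the action, stated with the permutation itself instead of the preimages that
-- occur in `actTuple`.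
Fixed : A → List ℕ → List A → Set
Fixed d κ p = ∀ {i} → i < sum κ → at d p (cycPerm κ i) ≡ at d p i

actTuple-Fixed : ∀ {d : A} κ p → length p ≡ sum κ → actTuple d (cycPerm κ) (sum κ) p ≡ p → Fixed d κ p
actTuple-Fixed {d = d} κ p l e {i} h = sym (trans (cong (at d p) (sym (preimage-cycPerm κ h))) (pointwise (∈P.∈-upTo⁺ (cycPerm-< κ h))))
  where
  pointwise : ∀ {j} → j ∈ upTo (sum κ) → at d p (preimage (cycPerm κ) (sum κ) j) ≡ at d p j
  pointwise = map-≡⇒ (upTo (sum κ)) (trans e (sym (trans (cong (map (at d p) ∘ upTo) (sym l)) (map-at p))))

Fixed-actTuple : ∀ {d : A} κ p → length p ≡ sum κ → Fixed d κ p → actTuple d (cycPerm κ) (sum κ) p ≡ p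
Fixed-actTuple {d = d} κ p l f = trans (LP.map-cong-local (All.tabulate (λ m → eq (∈P.∈-upTo⁻ m)))) (trans (cong (map (at d p) ∘ upTo) (sym l)) (map-at p))
  where
  eq : ∀ {j} → j < sum κ → at d p (preimage (cycPerm κ) (sum κ) j) ≡ at d p j
  eq h with cycPerm-surjective κ h
  ... | i , p′ , refl = trans (cong (at d p) (preimage-cycPerm κ p′)) (sym (f p′))

-- Tuples that are constant on the cycles

blocks : List ℕ → List A → List A
blocks (l ∷ κ) (c ∷ cs) = replicate l c ++ blocks κ cs
blocks _       _        = []

length-blocks : ∀ κ (cs : List A) → length cs ≡ length κ → length (blocks κ cs) ≡ sum κ
length-blocks []      []       e = refl
length-blocks (l ∷ κ) (c ∷ cs) e = trans (LP.length-++ (replicate l c)) (cong₂ ℕ._+_ (LP.length-replicate l) (length-blocks κ cs (ℕP.suc-injective e)))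

at-replicate : ∀ (d : A) l c v {i} → i < l → at d (replicate l c ++ v) i ≡ c
at-replicate d (suc l) c v {zero}  h       = refl
at-replicate d (suc l) c v {suc i} (s≤s h) = at-replicate d l c v h

at-++ʳ : ∀ (d : A) u v i → at d (u ++ v) (length u ℕ.+ i) ≡ at d v i
at-++ʳ d []      v i = refl
at-++ʳ d (x ∷ u) v i = at-++ʳ d u v i

at-replicateʳ : ∀ (d : A) l c v i → at d (replicate l c ++ v) (l ℕ.+ i) ≡ at d v i
at-replicateʳ d l c v i = trans (cong (λ m → at d (replicate l c ++ v) (m ℕ.+ i)) (sym (LP.length-replicate l))) (at-++ʳ d (replicate l c) v i)

blocks-Fixed : ∀ (d : A) κ cs → length cs ≡ length κ → Fixed d κ (blocks κ cs)
blocks-Fixed d (l ∷ κ) (c ∷ cs) e h with split l (sum κ) h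
... | inner p   = trans (at-replicate d l c (blocks κ cs) (cycPerm-in-< l κ p)) (sym (at-replicate d l c (blocks κ cs) p))
... | outer i p = trans (cong (at d (blocks (l ∷ κ) (c ∷ cs))) (cycPerm-out l κ i))
  (trans (at-replicateʳ d l c (blocks κ cs) (cycPerm κ i)) (trans (blocks-Fixed d κ cs (ℕP.suc-injective e) p) (sym (at-replicateʳ d l c (blocks κ cs) i))))

constant-prefix : ∀ (d : A) l p c → l ≤ length p → (∀ {i} → i < l → at d p i ≡ c) → ∃ λ v → p ≡ replicate l c ++ v
constant-prefix d zero    p       c h f = p , refl
constant-prefix d (suc l) (x ∷ p) c (s≤s h) f with constant-prefix d l p c h (λ q → f (s≤s q))
... | v , e = v , cong₂ _∷_ (f (s≤s z≤n)) e

Fixed-blocks : ∀ (d : A) κ p → Positive κ → length p ≡ sum κ → Fixed d κ p → ∃ λ cs → length cs ≡ length κ × p ≡ blocks κ cs × (∀ {x} → x ∈ cs → x ∈ p)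
Fixed-blocks d []          []      _ e f = [] , refl , refl , λ ()
Fixed-blocks d (suc l ∷ κ) (c ∷ p) (_ ∷ pz) e f with constant-prefix d (suc l) (c ∷ p) c (ℕP.≤-trans (ℕP.m≤m+n (suc l) (sum κ)) (ℕP.≤-reflexive (sym e))) const
  where
  const : ∀ {i} → i < suc l → at d (c ∷ p) i ≡ c
  const {zero}  h = refl
  -- Position `i + 1` is the image of position `i` in the same cycle, so invariance carries the
  -- first entry through the block.
  const {suc i} h = trans (cong (at d (c ∷ p)) (sym (trans (cycPerm-in (suc l) κ (ℕP.<-trans (ℕP.n<1+n i) h)) (cong (λ b → if b then suc i else 0) (T⇒≡ (ℕP.<⇒<ᵇ h))))))
    (trans (f (ℕP.<-≤-trans (ℕP.<-trans (ℕP.n<1+n i) h) (ℕP.m≤m+n (suc l) (sum κ)))) (const (ℕP.<-trans (ℕP.n<1+n i) h)))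
... | v , eq with Fixed-blocks d κ v pz lv fv
  where
  lv : length v ≡ sum κ
  lv = ℕP.+-cancelˡ-≡ (suc l) _ _ (trans (sym (trans (cong length eq) (trans (LP.length-++ (replicate (suc l) c)) (cong (ℕ._+ length v) (LP.length-replicate (suc l)))))) e)
  fv : Fixed d κ v
  fv {i} h = begin
    at d v (cycPerm κ i)                                 ≡⟨ at-replicateʳ d (suc l) c v (cycPerm κ i) ⟨
    at d (replicate (suc l) c ++ v) (suc l ℕ.+ cycPerm κ i) ≡⟨ cong₂ (at d) (sym eq) (sym (cycPerm-out (suc l) κ i)) ⟩
    at d (c ∷ p) (cycPerm (suc l ∷ κ) (suc l ℕ.+ i))     ≡⟨ f (ℕP.+-monoʳ-< (suc l) h) ⟩
    at d (c ∷ p) (suc l ℕ.+ i)                           ≡⟨ cong (λ z → at d z (suc l ℕ.+ i)) eq ⟩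
    at d (replicate (suc l) c ++ v) (suc l ℕ.+ i)        ≡⟨ at-replicateʳ d (suc l) c v i ⟩
    at d v i                                             ∎
...   | cs , lc , ev , mem = c ∷ cs , cong suc lc , trans eq (cong (replicate (suc l) c ++_) ev) ,
  λ { (here refl) → here refl ; {x} (there m) → subst (x ∈_) (sym eq) (∈P.∈-++⁺ʳ (replicate (suc l) c) (mem m)) }

replicate-∈ : ∀ l {c x : A} → x ∈ replicate l c → x ≡ c
replicate-∈ (suc l) (here e)  = e
replicate-∈ (suc l) (there m) = replicate-∈ l m

blocks-∈ : ∀ κ (cs : List A) {x} → x ∈ blocks κ cs → x ∈ cs
blocks-∈ (l ∷ κ) (c ∷ cs) m with ∈P.∈-++⁻ (replicate l c) m
... | inj₁ a = here (replicate-∈ l a)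
... | inj₂ b = there (blocks-∈ κ cs b)

blocks-injective : ∀ κ (cs ds : List A) → Positive κ → length cs ≡ length κ → length ds ≡ length κ → blocks κ cs ≡ blocks κ ds → cs ≡ ds
blocks-injective []          []       []       _ _ _ _ = refl
blocks-injective (suc l ∷ κ) (c ∷ cs) (d ∷ ds) (_ ∷ p) a b e with LP.∷-injectiveˡ e
... | refl = cong (c ∷_) (blocks-injective κ cs ds p (ℕP.suc-injective a) (ℕP.suc-injective b) (LP.++-cancelˡ (replicate (suc l) c) _ _ e))

-- An invariant tuple is a choice of one entry per cycle; this applies to `p` and to `σ` alike.
∑-fixed : ∀ (d : A) (_≟_ : ∀ (p q : List A) → Dec (p ≡ q)) κ → Positive κ → ∀ {X} → Unique X → ∀ {F : List A → ℚ} →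
  ∑ (tuples X (sum κ)) (λ p → 𝟙 (does (actTuple d (cycPerm κ) (sum κ) p ≟ p)) * F p) ≡ ∑ (tuples X (length κ)) (λ cs → F (blocks κ cs))
∑-fixed d _≟_ κ pz {X} u {F} = begin
  ∑ (tuples X (sum κ)) (λ p → 𝟙 (fixed p) * F p)      ≡⟨ ∑-filter fixed (tuples X (sum κ)) ⟨
  ∑ (filterᵇ fixed (tuples X (sum κ))) F              ≡⟨ ∑-set (filterᵇ-! fixed (tuples-! u (sum κ))) (map-! (blocks κ) (λ p q → blocks-injective κ _ _ pz (proj₁ (tuples-∈⁻ X _ p)) (proj₁ (tuples-∈⁻ X _ q))) (tuples-! u (length κ))) to from ⟩
  ∑ (map (blocks κ) (tuples X (length κ))) F          ≡⟨ ∑-map (blocks κ) (tuples X (length κ)) ⟩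
  ∑ (tuples X (length κ)) (λ cs → F (blocks κ cs))    ∎
  where
  fixed : List _ → Bool
  fixed p = does (actTuple d (cycPerm κ) (sum κ) p ≟ p)
  fixed⁻ : ∀ {p} → T (fixed p) → actTuple d (cycPerm κ) (sum κ) p ≡ p
  fixed⁻ {p} t with actTuple d (cycPerm κ) (sum κ) p ≟ p
  ... | yes e = e
  to : ∀ {p} → p ∈ filterᵇ fixed (tuples X (sum κ)) → p ∈ map (blocks κ) (tuples X (length κ))
  to {p} m with filterᵇ-∈⁻ fixed (tuples X (sum κ)) m
  ... | m′ , t with tuples-∈⁻ X (sum κ) m′
  ...   | l , h with Fixed-blocks d κ p pz l (actTuple-Fixed κ p l (fixed⁻ t))
  ...     | cs , lc , refl , mem = ∈P.∈-map⁺ (blocks κ) (subst (λ k → cs ∈ tuples X k) lc (tuples-∈⁺ X cs (h ∘ mem)))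
  from : ∀ {p} → p ∈ map (blocks κ) (tuples X (length κ)) → p ∈ filterᵇ fixed (tuples X (sum κ))
  from m with ∈P.∈-map⁻ (blocks κ) m
  ... | cs , m′ , refl with tuples-∈⁻ X (length κ) m′
  ...   | l , h = filterᵇ-∈⁺ fixed (subst (λ k → blocks κ cs ∈ tuples X k) (length-blocks κ cs l) (tuples-∈⁺ X (blocks κ cs) (h ∘ blocks-∈ κ cs)))
    (≡⇒T (dec-true (actTuple d (cycPerm κ) (sum κ) (blocks κ cs) ≟ blocks κ cs) (Fixed-actTuple κ (blocks κ cs) (length-blocks κ cs l) (blocks-Fixed d κ cs l))))

-- The sign of the permutation on the negative positions

negFrom : ℕ → List ℤ → List ℕ
negFrom s []      = []
negFrom s (x ∷ σ) = (if eqℤ x (ℤ.- (ℤ.+ 1)) then s ∷ [] else []) ++ negFrom (suc s) σ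

shifted-upTo : ∀ s m → map (s ℕ.+_) (upTo (suc m)) ≡ s ∷ map (suc s ℕ.+_) (upTo m)
shifted-upTo s m = trans (map-upTo-suc (s ℕ.+_) m) (cong₂ _∷_ (ℕP.+-identityʳ s) (LP.map-cong (ℕP.+-suc s) (upTo m)))

negPositions-negFrom : ∀ σ → negPositions σ ≡ negFrom 0 σ
negPositions-negFrom σ = trans (cong (λ L → map proj₁ (filterᵇ P (zip L σ))) (sym (LP.map-id (upTo (length σ))))) (go 0 σ)
  where
  P : ℕ × ℤ → Bool
  P t = eqℤ (proj₂ t) (ℤ.- (ℤ.+ 1))
  go : ∀ s σ → map proj₁ (filterᵇ P (zip (map (s ℕ.+_) (upTo (length σ))) σ)) ≡ negFrom s σ
  go s []      = refl
  go s (x ∷ σ) = trans (cong (λ L → map proj₁ (filterᵇ P (zip L (x ∷ σ)))) (shifted-upTo s (length σ))) step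
    where
    step : map proj₁ (filterᵇ P ((s , x) ∷ zip (map (suc s ℕ.+_) (upTo (length σ))) σ)) ≡ negFrom s (x ∷ σ)
    step with eqℤ x (ℤ.- (ℤ.+ 1))
    ... | true  = cong (s ∷_) (go (suc s) σ)
    ... | false = go (suc s) σ

negFrom-shift : ∀ t s σ → negFrom (t ℕ.+ s) σ ≡ map (t ℕ.+_) (negFrom s σ)
negFrom-shift t s []      = refl
negFrom-shift t s (x ∷ σ) with eqℤ x (ℤ.- (ℤ.+ 1))
... | true  = cong (t ℕ.+ s ∷_) (trans (cong (λ z → negFrom z σ) (sym (ℕP.+-suc t s))) (negFrom-shift t (suc s) σ))
... | false = trans (cong (λ z → negFrom z σ) (sym (ℕP.+-suc t s))) (negFrom-shift t (suc s) σ)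

negFrom-replicate : ∀ s l x σ → negFrom s (replicate l x ++ σ) ≡ (if eqℤ x (ℤ.- (ℤ.+ 1)) then map (s ℕ.+_) (upTo l) else []) ++ negFrom (s ℕ.+ l) σ
negFrom-replicate s zero    x σ with eqℤ x (ℤ.- (ℤ.+ 1))
... | true  = cong (λ z → negFrom z σ) (sym (ℕP.+-identityʳ s))
... | false = cong (λ z → negFrom z σ) (sym (ℕP.+-identityʳ s))
negFrom-replicate s (suc l) x σ with eqℤ x (ℤ.- (ℤ.+ 1)) | negFrom-replicate (suc s) l x σ
... | true  | ih = trans (cong (s ∷_) (trans ih (cong (λ z → map (suc s ℕ.+_) (upTo l) ++ negFrom z σ) (sym (ℕP.+-suc s l)))))
  (cong (_++ negFrom (s ℕ.+ suc l) σ) (sym (shifted-upTo s l)))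
... | false | ih = trans ih (cong (λ z → negFrom z σ) (sym (ℕP.+-suc s l)))

below : ℕ → List ℕ → ℕ
below x ys = length (filterᵇ (λ y → y <ᵇ x) ys)

below-++ : ∀ x ys zs → below x (ys ++ zs) ≡ below x ys ℕ.+ below x zs
below-++ x ys zs = trans (cong length (LP.filter-++ (BP.T? ∘ (λ y → y <ᵇ x)) ys zs)) (LP.length-++ (filterᵇ (λ y → y <ᵇ x) ys))

below-none : ∀ x ys → All (x ≤_) ys → below x ys ≡ 0
below-none x []       []       = refl
below-none x (y ∷ ys) (p ∷ ps) rewrite ¬T⇒≡ {y <ᵇ x} (λ t → ℕP.<⇒≱ (ℕP.<ᵇ⇒< y x t) p) = below-none x ys ps

inversions-++ : ∀ l xs ys → All (_< l) xs → All (l ≤_) ys → inversions (xs ++ ys) ≡ inversions xs ℕ.+ inversions ys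
inversions-++ l []       ys p q = refl
inversions-++ l (x ∷ xs) ys (a ∷ p) q = trans (cong₂ ℕ._+_ (trans (below-++ x xs ys) (trans (cong (below x xs ℕ.+_) (below-none x ys (All.map (ℕP.≤-trans (ℕP.<⇒≤ a)) q))) (ℕP.+-identityʳ _))) (inversions-++ l xs ys p q))
  (sym (ℕP.+-assoc (below x xs) (inversions xs) (inversions ys)))

inversions-shift : ∀ t xs → inversions (map (t ℕ.+_) xs) ≡ inversions xs
inversions-shift t []       = refl
inversions-shift t (x ∷ xs) = cong₂ ℕ._+_ (go xs) (inversions-shift t xs)
  where
  go : ∀ ys → below (t ℕ.+ x) (map (t ℕ.+_) ys) ≡ below x ys
  go []       = refl
  go (y ∷ ys) rewrite <ᵇ-+ t y x with y <ᵇ x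
  ... | true  = cong suc (go ys)
  ... | false = go ys

-- The images of the positions of a cycle on a block read `1, ..., m, 0`: only the final 0 is out of
-- order, and it is inverted with all the others.
inversions-rotation : ∀ xs → AllPairs _<_ xs → All (1 ≤_) xs → inversions (xs ++ 0 ∷ []) ≡ length xs
inversions-rotation []       s       p = refl
inversions-rotation (x ∷ xs) (a ∷ s) (q ∷ p) = cong₂ ℕ._+_ one (inversions-rotation xs s p)
  where
  one : below x (xs ++ 0 ∷ []) ≡ 1
  one rewrite below-++ x xs (0 ∷ []) | below-none x xs (All.map ℕP.<⇒≤ a) | T⇒≡ (ℕP.<⇒<ᵇ q) = refl

rotation : ∀ m κ → map (cycPerm (suc m ∷ κ)) (upTo (suc m)) ≡ range 1 m ++ 0 ∷ []
rotation m κ = begin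
  map (cycPerm (suc m ∷ κ)) (upTo (suc m))                          ≡⟨ cong (map (cycPerm (suc m ∷ κ))) (sym (LP.upTo-∷ʳ m)) ⟩
  map (cycPerm (suc m ∷ κ)) (upTo m ++ m ∷ [])                      ≡⟨ LP.map-++ (cycPerm (suc m ∷ κ)) (upTo m) (m ∷ []) ⟩
  map (cycPerm (suc m ∷ κ)) (upTo m) ++ cycPerm (suc m ∷ κ) m ∷ []  ≡⟨ cong₂ (λ a b → a ++ b ∷ []) (LP.map-cong-local (All.tabulate (λ {i} q → inside (∈P.∈-upTo⁻ q)))) last ⟩
  range 1 m ++ 0 ∷ []                                               ∎
  where
  inside : ∀ {i} → i < m → cycPerm (suc m ∷ κ) i ≡ suc i
  inside {i} h = trans (cycPerm-in (suc m) κ (ℕP.m<n⇒m<1+n h)) (cong (λ b → if b then suc i else 0) (T⇒≡ {suc i <ᵇ suc m} (ℕP.<⇒<ᵇ h)))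
  last : cycPerm (suc m ∷ κ) m ≡ 0
  last = trans (cycPerm-in (suc m) κ ℕP.≤-refl) (cong (λ b → if b then suc m else 0) (¬T⇒≡ {suc m <ᵇ suc m} (λ t → ℕP.<-irrefl refl (ℕP.<ᵇ⇒< m m t))))

Item : Set
Item = ℕ × ℤ

sgn : ℕ → ℚ
sgn a = if odd a then - 1ℚ else 1ℚ

opaque
  unfolding _+_

  sgn-+ : ∀ a b → sgn (a ℕ.+ b) ≡ sgn a * sgn b
  sgn-+ a b rewrite odd-+ a b with odd a | odd b
  ... | true  | true  = refl
  ... | true  | false = refl
  ... | false | true  = refl
  ... | false | false = refl

  ℤtoℚ-sortSign : ∀ xs → ℤtoℚ (sortSign xs) ≡ sgn (inversions xs)
  ℤtoℚ-sortSign xs with odd (inversions xs)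
  ... | true  = refl
  ... | false = refl

-- The sign `(-1)^(l-1)` of an `l`-cycle, with the exponent written as `l + 1`; it enters when the
-- positions of the cycle are negative.
cycleSign : Item → ℚ
cycleSign (l , x) = if eqℤ x (ℤ.- (ℤ.+ 1)) then sgn (suc l) else 1ℚ

-- An invariant `σ` is constant on cycles, so the negative positions form a union of blocks. Each
-- block is mapped to itself, hence there are no inversions between different blocks.
sortSign-blocks : ∀ κ ς → Positive κ → length ς ≡ length κ → ℤtoℚ (sortSign (map (cycPerm κ) (negPositions (blocks κ ς)))) ≡ ∏ cycleSign (zip κ ς)
sortSign-blocks κ ς p e = trans (ℤtoℚ-sortSign (map (cycPerm κ) (negPositions (blocks κ ς)))) (trans (cong (λ L → sgn (inversions (map (cycPerm κ) L))) (negPositions-negFrom (blocks κ ς))) (go κ ς p e))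
  where
  go : ∀ κ ς → Positive κ → length ς ≡ length κ → sgn (inversions (map (cycPerm κ) (negFrom 0 (blocks κ ς)))) ≡ ∏ cycleSign (zip κ ς)
  go []          []      _       e = refl
  go (suc m ∷ κ) (x ∷ ς) (_ ∷ p) e = begin
    sgn (inversions (map W (negFrom 0 (replicate (suc m) x ++ blocks κ ς))))
      ≡⟨ cong (λ L → sgn (inversions (map W L))) (negFrom-replicate 0 (suc m) x (blocks κ ς)) ⟩
    sgn (inversions (map W (X ++ negFrom (suc m) (blocks κ ς))))
      ≡⟨ cong (λ L → sgn (inversions L)) (trans (LP.map-++ W X _) (cong (map W X ++_) tail)) ⟩
    sgn (inversions (map W X ++ map (suc m ℕ.+_) V))
      ≡⟨ cong sgn (inversions-++ (suc m) (map W X) (map (suc m ℕ.+_) V) X< (AllP.map⁺ (All.tabulate (λ _ → ℕP.m≤m+n (suc m) _)))) ⟩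
    sgn (inversions (map W X) ℕ.+ inversions (map (suc m ℕ.+_) V))
      ≡⟨ sgn-+ (inversions (map W X)) _ ⟩
    sgn (inversions (map W X)) * sgn (inversions (map (suc m ℕ.+_) V))
      ≡⟨ cong₂ _*_ headSign (trans (cong sgn (inversions-shift (suc m) V)) (go κ ς p (ℕP.suc-injective e))) ⟩
    cycleSign (suc m , x) * ∏ cycleSign (zip κ ς) ∎
    where
    W : ℕ → ℕ
    W = cycPerm (suc m ∷ κ)
    X V : List ℕ
    X = if eqℤ x (ℤ.- (ℤ.+ 1)) then map (0 ℕ.+_) (upTo (suc m)) else []
    V = map (cycPerm κ) (negFrom 0 (blocks κ ς))
    tail : map W (negFrom (suc m) (blocks κ ς)) ≡ map (suc m ℕ.+_) V
    tail = begin
      map W (negFrom (suc m) (blocks κ ς))                     ≡⟨ cong (λ z → map W (negFrom z (blocks κ ς))) (sym (ℕP.+-identityʳ (suc m))) ⟩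
      map W (negFrom (suc m ℕ.+ 0) (blocks κ ς))               ≡⟨ cong (map W) (negFrom-shift (suc m) 0 (blocks κ ς)) ⟩
      map W (map (suc m ℕ.+_) (negFrom 0 (blocks κ ς)))        ≡⟨ sym (LP.map-∘ (negFrom 0 (blocks κ ς))) ⟩
      map (λ i → W (suc m ℕ.+ i)) (negFrom 0 (blocks κ ς))     ≡⟨ LP.map-cong (cycPerm-out (suc m) κ) (negFrom 0 (blocks κ ς)) ⟩
      map (λ i → suc m ℕ.+ cycPerm κ i) (negFrom 0 (blocks κ ς)) ≡⟨ LP.map-∘ (negFrom 0 (blocks κ ς)) ⟩
      map (suc m ℕ.+_) V                                       ∎
    X< : All (_< suc m) (map W X)
    X< with eqℤ x (ℤ.- (ℤ.+ 1))
    ... | false = []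
    ... | true  = AllP.map⁺ (AllP.map⁺ (All.tabulate (λ q → cycPerm-in-< (suc m) κ (∈P.∈-upTo⁻ q))))
    headSign : sgn (inversions (map W X)) ≡ cycleSign (suc m , x)
    headSign with eqℤ x (ℤ.- (ℤ.+ 1))
    ... | false = refl
    ... | true  = cong sgn (trans (cong inversions (trans (cong (map W) (LP.map-id (upTo (suc m)))) (rotation m κ)))
        (trans (inversions-rotation (range 1 m) (range-sorted 1 m) (All.tabulate (λ q → proj₁ (range-∈⁻ 1 m q)))) (length-range 1 m)))

-- Distributing the cycles to the slots

distributions : ℕ → List A → (List (List A) → ℚ) → ℚ
distributions zero    its G = 𝟙 (null its) * G []
distributions (suc m) its G = ∑⊎ (λ a b → distributions m b (λ bs → G (a ∷ bs))) its

distributions-cong : ∀ m (its : List A) {G H} → (∀ bs → G bs ≡ H bs) → distributions m its G ≡ distributions m its H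
distributions-cong zero    its h = cong (𝟙 (null its) *_) (h [])
distributions-cong (suc m) its h = ∑⊎-cong (λ a b → distributions-cong m b (λ bs → h (a ∷ bs))) its

distributions-*ˡ : ∀ c m (its : List A) {G} → distributions m its (λ bs → c * G bs) ≡ c * distributions m its G
distributions-*ˡ c zero    its = x∙yz≈y∙xz (𝟙 (null its)) c _
distributions-*ˡ c (suc m) its = trans (∑⊎-cong (λ a b → distributions-*ˡ c m b) its) (∑⊎-*ˡ c its)

distributions-zero : ∀ m (its : List A) {G} → (∀ bs → G bs ≡ 0ℚ) → distributions m its G ≡ 0ℚ
distributions-zero zero    its h = trans (cong (𝟙 (null its) *_) (h [])) (R.zeroʳ _)
distributions-zero (suc m) its h = ∑⊎-zero (λ a b → distributions-zero m b (λ bs → h (a ∷ bs))) its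

consAt : ℕ → A → List (List A) → List (List A)
consAt j       i []       = []
consAt zero    i (b ∷ bs) = (i ∷ b) ∷ bs
consAt (suc j) i (b ∷ bs) = b ∷ consAt j i bs

distributions-∷ : ∀ m (i : A) its G → distributions m (i ∷ its) G ≡ ∑ (upTo m) (λ j → distributions m its (λ bs → G (consAt j i bs)))
distributions-∷ zero    i its G = R.zeroˡ _
distributions-∷ (suc m) i its G = begin
  ∑⊎ (λ a b → distributions m b (λ bs → G ((i ∷ a) ∷ bs))) its + ∑⊎ (λ a b → distributions m (i ∷ b) (λ bs → G (a ∷ bs))) its
    ≡⟨ cong₂ _+_ refl (trans (∑⊎-cong (λ a b → distributions-∷ m i b (λ bs → G (a ∷ bs))) its) (∑⊎-∑ (upTo m) its)) ⟩
  F 0 + ∑ (upTo m) (λ j → F (suc j))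
    ≡⟨ cong₂ _+_ refl (trans (sym (∑-map suc (upTo m))) (cong (λ L → ∑ L F) (LP.map-upTo suc m))) ⟩
  ∑ (upTo (suc m)) F ∎
  where
  F : ℕ → ℚ
  F j = distributions (suc m) its (λ bs → G (consAt j i bs))

distributions-[] : ∀ m (G : List (List A) → ℚ) → distributions m [] G ≡ G (replicate m [])
distributions-[] zero    G = R.*-identityˡ _
distributions-[] (suc m) G = distributions-[] m (λ bs → G ([] ∷ bs))

slotItems : ℕ → List ℕ → List A → List A
slotItems k c its = map proj₂ (filterᵇ (λ t → proj₁ t ≡ᵇ k) (zip c its))

slotItems-≡ : ∀ k c (i : A) its → slotItems k (k ∷ c) (i ∷ its) ≡ i ∷ slotItems k c its
slotItems-≡ k c i its rewrite ≡ᵇ-refl k = refl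

slotItems-≢ : ∀ {k l} c (i : A) its → l ≢ k → slotItems k (l ∷ c) (i ∷ its) ≡ slotItems k c its
slotItems-≢ {k = k} {l} c i its n rewrite ≡ᵇ-false n = refl

distribute : ℕ → List ℕ → List A → List (List A)
distribute n c its = map (λ k → slotItems k c its) (range 1 n)

map-consAt : ∀ n {j} (i : A) (f g : ℕ → List A) → j < n → g j ≡ i ∷ f j → (∀ m → m ≢ j → g m ≡ f m) → map g (upTo n) ≡ consAt j i (map f (upTo n))
map-consAt (suc n) {zero}  i f g h e ne = trans (map-upTo-suc g n) (trans (cong₂ _∷_ e (LP.map-cong (λ m → ne (suc m) (λ ())) (upTo n))) (cong (consAt 0 i) (sym (map-upTo-suc f n))))
map-consAt (suc n) {suc j} i f g (s≤s h) e ne = trans (map-upTo-suc g n) (trans (cong₂ _∷_ (ne 0 (λ ())) (map-consAt n i (f ∘ suc) (g ∘ suc) h e (λ m q → ne (suc m) (q ∘ ℕP.suc-injective)))) (cong (consAt (suc j) i) (sym (map-upTo-suc f n))))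

distribute-∷ : ∀ n {j} c (i : A) its → j < n → distribute n (suc j ∷ c) (i ∷ its) ≡ consAt j i (distribute n c its)
distribute-∷ n {j} c i its h = trans (sym (LP.map-∘ (upTo n))) (trans
  (map-consAt n i (λ m → slotItems (suc m) c its) (λ m → slotItems (suc m) (suc j ∷ c) (i ∷ its)) h (slotItems-≡ (suc j) c i its) (λ m q → slotItems-≢ c i its (q ∘ sym ∘ ℕP.suc-injective)))
  (cong (consAt j i) (LP.map-∘ (upTo n))))

-- Assigning a value to each cycle is the same as distributing the cycles to the slots, with the
-- order kept inside each slot.
∑-distribute : ∀ n (its : List A) (G : List (List A) → ℚ) → ∑ (tuples (range 1 n) (length its)) (λ c → G (distribute n c its)) ≡ distributions n its G
∑-distribute n []        G = trans (R.+-identityʳ _) (trans (cong G (trans (map-const (range 1 n)) (cong (λ m → replicate m []) (length-range 1 n)))) (sym (distributions-[] n G)))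
  where
  map-const : ∀ (ks : List ℕ) → map (λ k → slotItems k [] []) ks ≡ replicate (length ks) []
  map-const []       = refl
  map-const (k ∷ ks) = cong ([] ∷_) (map-const ks)
∑-distribute n (i ∷ its) G = begin
  ∑ (tuples (range 1 n) (suc (length its))) (λ c → G (distribute n c (i ∷ its)))
    ≡⟨ trans (∑-tuples (range 1 n) (length its)) (∑-map suc (upTo n)) ⟩
  ∑ (upTo n) (λ j → ∑ (tuples (range 1 n) (length its)) (λ c → G (distribute n (suc j ∷ c) (i ∷ its))))
    ≡⟨ ∑-cong-∈ (upTo n) (λ {j} m → ∑-cong (tuples (range 1 n) (length its)) (λ c → cong G (distribute-∷ n c i its (∈P.∈-upTo⁻ m)))) ⟩
  ∑ (upTo n) (λ j → ∑ (tuples (range 1 n) (length its)) (λ c → G (consAt j i (distribute n c its))))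
    ≡⟨ ∑-cong (upTo n) (λ j → ∑-distribute n its (λ bs → G (consAt j i bs))) ⟩
  ∑ (upTo n) (λ j → distributions n its (λ bs → G (consAt j i bs)))
    ≡⟨ distributions-∷ n i its G ⟨
  distributions n (i ∷ its) G ∎

-- Summation over the signs of the cycles

signedSum : (List Item → ℚ) → List ℕ → ℚ
signedSum f []      = f []
signedSum f (k ∷ κ) = ∑ signs (λ x → signedSum (λ a → f ((k , x) ∷ a)) κ)

signedSum-cong : ∀ {f g : List Item → ℚ} κ → (∀ a → map proj₁ a ≡ κ → f a ≡ g a) → signedSum f κ ≡ signedSum g κ
signedSum-cong []      h = h [] refl
signedSum-cong (k ∷ κ) h = ∑-cong signs (λ x → signedSum-cong κ (λ a e → h ((k , x) ∷ a) (cong (k ∷_) e)))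

signedSum-*ˡ : ∀ c {f : List Item → ℚ} κ → signedSum (λ a → c * f a) κ ≡ c * signedSum f κ
signedSum-*ˡ c []      = refl
signedSum-*ˡ c {f} (k ∷ κ) = trans (∑-cong signs (λ x → signedSum-*ˡ c {λ a → f ((k , x) ∷ a)} κ)) (∑-*ˡ c signs {λ x → signedSum (λ a → f ((k , x) ∷ a)) κ})

signedSum-+ : ∀ {f g : List Item → ℚ} κ → signedSum (λ a → f a + g a) κ ≡ signedSum f κ + signedSum g κ
signedSum-+ []      = refl
signedSum-+ {f} {g} (k ∷ κ) = trans (∑-cong signs (λ x → signedSum-+ {λ a → f ((k , x) ∷ a)} {λ a → g ((k , x) ∷ a)} κ))
  (∑-+ signs {λ x → signedSum (λ a → f ((k , x) ∷ a)) κ} {λ x → signedSum (λ a → g ((k , x) ∷ a)) κ})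

signedSum-∑ : ∀ (ys : List B) {f : B → List Item → ℚ} κ → signedSum (λ a → ∑ ys (λ y → f y a)) κ ≡ ∑ ys (λ y → signedSum (f y) κ)
signedSum-∑ ys []      = refl
signedSum-∑ ys {f} (k ∷ κ) = trans (∑-cong signs (λ x → signedSum-∑ ys {λ y a → f y ((k , x) ∷ a)} κ))
  (∑-swap signs ys {λ x y → signedSum (λ a → f y ((k , x) ∷ a)) κ})

signedSum-zero : ∀ {f : List Item → ℚ} κ → (∀ a → f a ≡ 0ℚ) → signedSum f κ ≡ 0ℚ
signedSum-zero []      h = h []
signedSum-zero (k ∷ κ) h = ∑-zero-∈ signs (λ {x} _ → signedSum-zero κ (λ a → h ((k , x) ∷ a)))

signedSum-tuples : ∀ (f : List Item → ℚ) κ → ∑ (tuples signs (length κ)) (λ ς → f (zip κ ς)) ≡ signedSum f κ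
signedSum-tuples f []      = R.+-identityʳ _
signedSum-tuples f (k ∷ κ) = trans (∑-tuples signs (length κ)) (∑-cong signs (λ x → signedSum-tuples (λ a → f ((k , x) ∷ a)) κ))

-- The signs are chosen independently for each part, so they can be chosen after the splitting,
-- separately on both sides.
signedSum-∑⊎ : ∀ {φ : List Item → List Item → ℚ} κ → signedSum (∑⊎ φ) κ ≡ ∑⊎ (λ μ ν → signedSum (λ a → signedSum (φ a) ν) μ) κ
signedSum-∑⊎ []      = refl
signedSum-∑⊎ {φ} (k ∷ κ) = begin
  ∑ signs (λ x → signedSum (λ a → ∑⊎ (λ b c → φ ((k , x) ∷ b) c) a + ∑⊎ (λ b c → φ b ((k , x) ∷ c)) a) κ)
    ≡⟨ ∑-cong signs (λ x → trans (signedSum-+ {λ a → ∑⊎ (λ b c → φ ((k , x) ∷ b) c) a} {λ a → ∑⊎ (λ b c → φ b ((k , x) ∷ c)) a} κ)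
         (cong₂ _+_ (signedSum-∑⊎ {λ b c → φ ((k , x) ∷ b) c} κ) (signedSum-∑⊎ {λ b c → φ b ((k , x) ∷ c)} κ))) ⟩
  ∑ signs (λ x → ∑⊎ (F x) κ + ∑⊎ (G x) κ)
    ≡⟨ trans (∑-+ signs {λ x → ∑⊎ (F x) κ} {λ x → ∑⊎ (G x) κ}) (cong₂ _+_ (sym (∑⊎-∑ signs {F} κ)) (sym (∑⊎-∑ signs {G} κ))) ⟩
  ∑⊎ (λ μ ν → signedSum (λ a → signedSum (φ a) ν) (k ∷ μ)) κ + ∑⊎ (λ μ ν → ∑ signs (λ x → signedSum (λ a → signedSum (λ b → φ a ((k , x) ∷ b)) ν) μ)) κ
    ≡⟨ cong₂ _+_ refl (∑⊎-cong (λ μ ν → sym (signedSum-∑ signs {λ x a → signedSum (λ b → φ a ((k , x) ∷ b)) ν} μ)) κ) ⟩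
  ∑⊎ (λ μ ν → signedSum (λ a → signedSum (φ a) ν) (k ∷ μ)) κ + ∑⊎ (λ μ ν → signedSum (λ a → signedSum (φ a) (k ∷ ν)) μ) κ ∎
  where
  F G : ℤ → List ℕ → List ℕ → ℚ
  F x μ ν = signedSum (λ a → signedSum (φ ((k , x) ∷ a)) ν) μ
  G x μ ν = signedSum (λ a → signedSum (λ b → φ a ((k , x) ∷ b)) ν) μ

size : List Item → ℕ
size b = sum (map proj₁ b)

-- A cycle of length `l` and sign `x` occupies `l` positions of its slot and contributes `x^l` to
-- `σ̄`.
barProd : List Item → ℤ
barProd []            = ℤ.+ 1
barProd ((l , x) ∷ b) = prodℤ (replicate l x) ℤ.* barProd b

bar : List Item → ℤ
bar b = if size b ≡ᵇ 0 then ℤ.+ 0 else barProd b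

signAverage : List ℕ → (ℤ → ℚ) → ℚ
signAverage μ g = signedSum (λ a → ∏ cycleSign a * g (barProd a)) μ

signAverage-cong : ∀ μ {g h} → (∀ y → g y ≡ h y) → signAverage μ g ≡ signAverage μ h
signAverage-cong μ e = signedSum-cong μ (λ a _ → cong (∏ cycleSign a *_) (e (barProd a)))

signAverage-∷ : ∀ k μ g → signAverage (k ∷ μ) g ≡ ∑ signs (λ x → cycleSign (k , x) * signAverage μ (λ y → g (prodℤ (replicate k x) ℤ.* y)))
signAverage-∷ k μ g = ∑-cong signs (λ x → trans (signedSum-cong μ (λ a _ → R.*-assoc (cycleSign (k , x)) (∏ cycleSign a) (g (prodℤ (replicate k x) ℤ.* barProd a)))) (signedSum-*ˡ (cycleSign (k , x)) μ))

prodℤ-ones : ∀ k → prodℤ (replicate k (ℤ.+ 1)) ≡ ℤ.+ 1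
prodℤ-ones zero    = refl
prodℤ-ones (suc k) = trans (ℤP.*-identityˡ _) (prodℤ-ones k)

prodℤ-neg : ∀ k → prodℤ (replicate k (ℤ.- (ℤ.+ 1))) ≡ (if odd k then ℤ.- (ℤ.+ 1) else ℤ.+ 1)
prodℤ-neg zero          = refl
prodℤ-neg (suc zero)    = refl
prodℤ-neg (suc (suc k)) rewrite prodℤ-neg k with odd k
... | true  = refl
... | false = refl

opaque
  unfolding _+_

  -- A cycle of even length contributes the same sign of the slot with opposite weights.
  signAverage-step : ∀ k μ g → signAverage (k ∷ μ) g ≡ 𝟙 (odd k) * (signAverage μ g + signAverage μ (g ∘ ℤ.-_))
  signAverage-step k μ g = trans (signAverage-∷ k μ g) (trans (cong₂ (λ u v → 1ℚ * u + (sgn (suc k) * v + 0ℚ)) plus minus) final)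
    where
    plus : signAverage μ (λ y → g (prodℤ (replicate k (ℤ.+ 1)) ℤ.* y)) ≡ signAverage μ g
    plus = signAverage-cong μ (λ y → cong g (trans (cong (ℤ._* y) (prodℤ-ones k)) (ℤP.*-identityˡ y)))
    minus : signAverage μ (λ y → g (prodℤ (replicate k (ℤ.- (ℤ.+ 1))) ℤ.* y)) ≡ signAverage μ (λ y → g (if odd k then ℤ.- y else y))
    minus = signAverage-cong μ (λ y → cong g (trans (cong (ℤ._* y) (prodℤ-neg k)) (eq y)))
      where
      eq : ∀ y → (if odd k then ℤ.- (ℤ.+ 1) else ℤ.+ 1) ℤ.* y ≡ (if odd k then ℤ.- y else y)
      eq y with odd k
      ... | true  = ℤP.-1*i≡-i y
      ... | false = ℤP.*-identityˡ y
    final : 1ℚ * signAverage μ g + (sgn (suc k) * signAverage μ (λ y → g (if odd k then ℤ.- y else y)) + 0ℚ) ≡ 𝟙 (odd k) * (signAverage μ g + signAverage μ (g ∘ ℤ.-_))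
    final rewrite odd-suc k with odd k
    ... | true  = ring (signAverage μ g) (signAverage μ (g ∘ ℤ.-_))
      where
      ring : ∀ a b → 1ℚ * a + (1ℚ * b + 0ℚ) ≡ 1ℚ * (a + b)
      ring = solve-∀ ℚ-ring
    ... | false = ring (signAverage μ g) (signAverage μ (g ∘ ℤ.-_))
      where
      ring : ∀ a b → 1ℚ * a + (- 1ℚ * a + 0ℚ) ≡ 0ℚ * (a + b)
      ring = solve-∀ ℚ-ring

  -- With the negated argument added, the expression is unchanged under a change of sign, so every
  -- further odd cycle merely doubles it.
  signAverage-both : ∀ μ g → signAverage μ g + signAverage μ (g ∘ ℤ.-_) ≡ Q₂ μ * (g (ℤ.+ 1) + g (ℤ.- (ℤ.+ 1)))
  signAverage-both []      g = ring (g (ℤ.+ 1)) (g (ℤ.- (ℤ.+ 1)))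
    where
    ring : ∀ a b → 1ℚ * a + 1ℚ * b ≡ 1ℚ * (a + b)
    ring = solve-∀ ℚ-ring
  signAverage-both (k ∷ μ) g = begin
    signAverage (k ∷ μ) g + signAverage (k ∷ μ) (g ∘ ℤ.-_)
      ≡⟨ cong₂ _+_ (signAverage-step k μ g) (trans (signAverage-step k μ (g ∘ ℤ.-_)) (cong (λ z → 𝟙 (odd k) * (signAverage μ (g ∘ ℤ.-_) + z)) (signAverage-cong μ (λ y → cong g (ℤP.neg-involutive y))))) ⟩
    𝟙 (odd k) * (signAverage μ g + signAverage μ (g ∘ ℤ.-_)) + 𝟙 (odd k) * (signAverage μ (g ∘ ℤ.-_) + signAverage μ g)
      ≡⟨ ring (𝟙 (odd k)) (signAverage μ g) (signAverage μ (g ∘ ℤ.-_)) ⟩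
    𝟙 (odd k) * (1ℚ + 1ℚ) * (signAverage μ g + signAverage μ (g ∘ ℤ.-_))
      ≡⟨ cong (𝟙 (odd k) * (1ℚ + 1ℚ) *_) (signAverage-both μ g) ⟩
    𝟙 (odd k) * (1ℚ + 1ℚ) * (Q₂ μ * (g (ℤ.+ 1) + g (ℤ.- (ℤ.+ 1))))
      ≡⟨ sym (R.*-assoc (𝟙 (odd k) * (1ℚ + 1ℚ)) (Q₂ μ) _) ⟩
    Q₂ (k ∷ μ) * (g (ℤ.+ 1) + g (ℤ.- (ℤ.+ 1))) ∎
    where
    ring : ∀ o a b → o * (a + b) + o * (b + a) ≡ o * (1ℚ + 1ℚ) * (a + b)
    ring = solve-∀ ℚ-ring

-- The form that an odd shape takes on full contents, where empty slots are still listed.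
oddish : ℕ → Bool
oddish a = (a ≡ᵇ 0) ∨ odd a

-- The first cycle of a nonempty slot makes both slot signs equally likely and gives no factor 2;
-- every further cycle gives one. This matches the factor 2 that `halfWeight` drops at the head.
slotAverage : ∀ {μ} → Positive μ → ∀ (g : ℤ → ℚ) → 𝟙 (oddish (sum μ)) * signedSum (λ a → ∏ cycleSign a * g (bar a)) μ ≡ ∑ trits (λ x → slot x μ * g x)
slotAverage {[]} p g = ring (g (ℤ.+ 0)) (g (ℤ.+ 1)) (g (ℤ.- (ℤ.+ 1)))
  where
  opaque
    unfolding _+_
    ring : ∀ a b c → 1ℚ * (1ℚ * a) ≡ 1ℚ * a + (0ℚ * 1ℚ * b + (0ℚ * 1ℚ * c + 0ℚ))
    ring = solve-∀ ℚ-ring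
slotAverage {zero ∷ μ}  (() ∷ _) g
slotAverage {suc k ∷ μ} p g = begin
  𝟙 (odd S) * signedSum (λ a → ∏ cycleSign a * g (bar a)) (suc k ∷ μ)
    ≡⟨ cong (𝟙 (odd S) *_) (signedSum-cong (suc k ∷ μ) (λ a e → cong (λ z → ∏ cycleSign a * g (if z ≡ᵇ 0 then ℤ.+ 0 else barProd a)) (cong sum e))) ⟩
  𝟙 (odd S) * signAverage (suc k ∷ μ) g
    ≡⟨ cong (𝟙 (odd S) *_) (trans (signAverage-step (suc k) μ g) (cong (𝟙 (odd (suc k)) *_) (signAverage-both μ g))) ⟩
  𝟙 (odd S) * (𝟙 (odd (suc k)) * (Q₂ μ * (g (ℤ.+ 1) + g (ℤ.- (ℤ.+ 1)))))
    ≡⟨ ring (𝟙 (odd S)) (𝟙 (odd (suc k))) (Q₂ μ) (g (ℤ.+ 0)) (g (ℤ.+ 1)) (g (ℤ.- (ℤ.+ 1))) ⟩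
  ∑ trits (λ x → slot x (suc k ∷ μ) * g x) ∎
  where
  S : ℕ
  S = sum (suc k ∷ μ)
  opaque
    unfolding _+_
    ring : ∀ s o q z a b → s * (o * (q * (a + b))) ≡ 0ℚ * z + (s * (o * q) * a + (s * (o * q) * b + 0ℚ))
    ring = solve-∀ ℚ-ring

-- The trace of a permutation

blockSigns : List (List Item) → ℚ
blockSigns = ∏ (∏ cycleSign)

blockWeight : (List ℕ → Bool) → (List ℤ → ℚ) → List (List Item) → ℚ
blockWeight dyck N bs = 𝟙 (dyck (map size bs)) * (𝟙 (all oddish (map size bs)) * (N (map bar bs) * blockSigns bs))

blockWeight-∷ : ∀ j N a bs → blockWeight (isDyck j) N (a ∷ bs) ≡ 𝟙 (oddish (size a)) * ∏ cycleSign a * blockWeight (isDyck↓ (j ℕ.+ size a)) (λ s → N (bar a ∷ s)) bs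
blockWeight-∷ j N a bs = trans
  (cong₂ (λ x y → 𝟙 x * (y * (N (map bar (a ∷ bs)) * blockSigns (a ∷ bs)))) (isDyck-∷ j (size a) (map size bs)) (𝟙-∧ (oddish (size a)) (all oddish (map size bs))))
  (ring (𝟙 (isDyck↓ (j ℕ.+ size a) (map size bs))) (𝟙 (oddish (size a))) (𝟙 (all oddish (map size bs))) (N (map bar (a ∷ bs))) (∏ cycleSign a) (blockSigns bs))
  where
  opaque
    unfolding _+_
    ring : ∀ d o p n c s → d * (o * p * (n * (c * s))) ≡ o * c * (d * (p * (n * s)))
    ring = solve-∀ ℚ-ring

-- Induction on the slots; each slot is summed over the signs of its own cycles by `slotAverage`.
-- `N` has to be arbitrary because the number of matchings depends on all slot signs together.
signedSum-distributions : ∀ m j N {κ} → Positive κ →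
  signedSum (λ its → distributions m its (blockWeight (isDyck j) N)) κ ≡ ∑ (tuples trits m) (λ s → N s * Ω j s κ)
signedSum-distributions zero j N {[]} p = trans (R.*-identityˡ _) (trans (base j) (sym (R.+-identityʳ _)))
  where
  opaque
    unfolding _+_
    ring : ∀ x y → x * (1ℚ * (y * 1ℚ)) ≡ y * x
    ring = solve-∀ ℚ-ring
  base : ∀ j → 𝟙 (isDyck j []) * (1ℚ * (N [] * 1ℚ)) ≡ N [] * dyckEnd j []
  base zero    = ring 1ℚ (N [])
  base (suc j) = ring 0ℚ (N [])
signedSum-distributions zero j N {k ∷ κ} p = trans (∑-zero-∈ signs (λ {x} _ → signedSum-zero κ (λ a → R.zeroˡ (blockWeight (isDyck j) N []))))
  (sym (trans (R.+-identityʳ _) (trans (cong (N [] *_) (end j)) (R.zeroʳ _))))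
  where
  end : ∀ j → dyckEnd j (k ∷ κ) ≡ 0ℚ
  end zero    = refl
  end (suc j) = refl
signedSum-distributions (suc m) j N {κ} p = begin
  signedSum (∑⊎ (λ a b → distributions m b (λ bs → blockWeight (isDyck j) N (a ∷ bs)))) κ
    ≡⟨ signedSum-∑⊎ κ ⟩
  ∑⊎ (λ μ ν → signedSum (λ a → signedSum (λ b → distributions m b (λ bs → blockWeight (isDyck j) N (a ∷ bs))) ν) μ) κ
    ≡⟨ ∑⊎-cong-All (λ {μ} {ν} pμ pν → trans (signedSum-cong μ (λ a e → step a e pν)) (trans (signedSum-*ˡ (𝟙 (oddish (sum μ))) μ) (slotAverage pμ (λ x → g x (j ℕ.+ sum μ) ν)))) p ⟩
  ∑⊎ (λ μ ν → ∑ trits (λ x → slot x μ * g x (j ℕ.+ sum μ) ν)) κ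
    ≡⟨ ∑⊎-∑ trits {λ x μ ν → slot x μ * g x (j ℕ.+ sum μ) ν} κ ⟩
  ∑ trits (λ x → (slot x ⋆ g x) j κ)
    ≡⟨ ∑-cong trits (λ x → sym (∑-⋆ (tuples trits m) (λ s → N (x ∷ s)) (slot x) (λ s m → Ω m s) j κ)) ⟩
  ∑ trits (λ x → ∑ (tuples trits m) (λ s → N (x ∷ s) * Ω j (x ∷ s) κ))
    ≡⟨ ∑-tuples trits m ⟨
  ∑ (tuples trits (suc m)) (λ s → N s * Ω j s κ) ∎
  where
  g : ℤ → ℕ → List ℕ → ℚ
  g x = ↓ (λ m′ ν → ∑ (tuples trits m) (λ s → N (x ∷ s) * Ω m′ s ν))
  rest : ∀ i x {ν} → Positive ν → signedSum (λ b → distributions m b (blockWeight (isDyck↓ i) (λ s → N (x ∷ s)))) ν ≡ g x i ν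
  rest zero    x {ν} pν = signedSum-zero ν (λ b → distributions-zero m b (λ bs → R.zeroˡ _))
  rest (suc i) x pν = signedSum-distributions m i (λ s → N (x ∷ s)) pν
  step : ∀ {μ ν} a → map proj₁ a ≡ μ → Positive ν →
    signedSum (λ b → distributions m b (λ bs → blockWeight (isDyck j) N (a ∷ bs))) ν ≡ 𝟙 (oddish (sum μ)) * (∏ cycleSign a * g (bar a) (j ℕ.+ sum μ) ν)
  step {ν = ν} a refl pν = begin
    signedSum (λ b → distributions m b (λ bs → blockWeight (isDyck j) N (a ∷ bs))) ν
      ≡⟨ signedSum-cong ν (λ b _ → trans (distributions-cong m b (blockWeight-∷ j N a)) (distributions-*ˡ _ m b)) ⟩
    signedSum (λ b → 𝟙 (oddish (size a)) * ∏ cycleSign a * distributions m b (blockWeight (isDyck↓ (j ℕ.+ size a)) (λ s → N (bar a ∷ s)))) ν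
      ≡⟨ trans (signedSum-*ˡ _ ν) (cong (𝟙 (oddish (size a)) * ∏ cycleSign a *_) (rest (j ℕ.+ size a) (bar a) pν)) ⟩
    𝟙 (oddish (size a)) * ∏ cycleSign a * g (bar a) (j ℕ.+ size a) ν
      ≡⟨ R.*-assoc _ _ _ ⟩
    𝟙 (oddish (size a)) * (∏ cycleSign a * g (bar a) (j ℕ.+ size a) ν) ∎

-- Content and slot signs of tuples that are constant on cycles

count-replicate-≢ : ∀ {k c} l → k ≢ c → count k (replicate l c) ≡ 0
count-replicate-≢ {k} {c} l n = count-∉ k (replicate l c) (n ∘ replicate-∈ l)

count-blocks : ∀ k κ c ς → length c ≡ length κ → length ς ≡ length κ → count k (blocks κ c) ≡ size (slotItems k c (zip κ ς))
count-blocks k []      []      []      _ _ = refl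
count-blocks k (l ∷ κ) (y ∷ c) (x ∷ ς) e f = trans (count-++ k (replicate l y) (blocks κ c)) (trans (cong (count k (replicate l y) ℕ.+_) (count-blocks k κ c ς (ℕP.suc-injective e) (ℕP.suc-injective f))) (byCases (y ℕ.≟ k)))
  where
  byCases : Dec (y ≡ k) → count k (replicate l y) ℕ.+ size (slotItems k c (zip κ ς)) ≡ size (slotItems k (y ∷ c) ((l , x) ∷ zip κ ς))
  byCases (yes refl) = trans (cong (ℕ._+ size (slotItems k c (zip κ ς))) (count-replicate l k)) (sym (cong size (slotItems-≡ k c (l , x) (zip κ ς))))
  byCases (no n)     = trans (cong (ℕ._+ size (slotItems k c (zip κ ς))) (count-replicate-≢ l (n ∘ sym))) (sym (cong size (slotItems-≢ c (l , x) (zip κ ς) n)))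

zip-replicate : ∀ l (y : A) (x : B) u v → zip (replicate l y ++ u) (replicate l x ++ v) ≡ replicate l (y , x) ++ zip u v
zip-replicate zero    y x u v = refl
zip-replicate (suc l) y x u v = cong ((y , x) ∷_) (zip-replicate l y x u v)

prodℤ-++ : ∀ xs ys → prodℤ (xs ++ ys) ≡ prodℤ xs ℤ.* prodℤ ys
prodℤ-++ []       ys = sym (ℤP.*-identityˡ (prodℤ ys))
prodℤ-++ (x ∷ xs) ys = trans (cong (x ℤ.*_) (prodℤ-++ xs ys)) (sym (ℤP.*-assoc x (prodℤ xs) (prodℤ ys)))

filter-replicate-≡ : ∀ k l (x : ℤ) R → map proj₂ (filterᵇ (λ t → proj₁ t ≡ᵇ k) (replicate l (k , x) ++ R)) ≡ replicate l x ++ map proj₂ (filterᵇ (λ t → proj₁ t ≡ᵇ k) R)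
filter-replicate-≡ k zero    x R = refl
filter-replicate-≡ k (suc l) x R rewrite ≡ᵇ-refl k = cong (x ∷_) (filter-replicate-≡ k l x R)

filter-replicate-≢ : ∀ {k y} l (x : ℤ) R → y ≢ k → map proj₂ (filterᵇ (λ t → proj₁ t ≡ᵇ k) (replicate l (y , x) ++ R)) ≡ map proj₂ (filterᵇ (λ t → proj₁ t ≡ᵇ k) R)
filter-replicate-≢ zero    x R n = refl
filter-replicate-≢ (suc l) x R n rewrite ≡ᵇ-false n = filter-replicate-≢ l x R n

barProd-blocks : ∀ k κ c ς → length c ≡ length κ → length ς ≡ length κ →
  prodℤ (map proj₂ (filterᵇ (λ t → proj₁ t ≡ᵇ k) (zip (blocks κ c) (blocks κ ς)))) ≡ barProd (slotItems k c (zip κ ς))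
barProd-blocks k []      []      []      _ _ = refl
barProd-blocks k (l ∷ κ) (y ∷ c) (x ∷ ς) e f = trans (cong (λ L → prodℤ (map proj₂ (filterᵇ (λ t → proj₁ t ≡ᵇ k) L))) (zip-replicate l y x (blocks κ c) (blocks κ ς))) (byCases (y ℕ.≟ k))
  where
  ih = barProd-blocks k κ c ς (ℕP.suc-injective e) (ℕP.suc-injective f)
  R′ = zip (blocks κ c) (blocks κ ς)
  byCases : Dec (y ≡ k) → prodℤ (map proj₂ (filterᵇ (λ t → proj₁ t ≡ᵇ k) (replicate l (y , x) ++ R′))) ≡ barProd (slotItems k (y ∷ c) ((l , x) ∷ zip κ ς))
  byCases (yes refl) = trans (cong prodℤ (filter-replicate-≡ k l x R′)) (trans (prodℤ-++ (replicate l x) _) (trans (cong (prodℤ (replicate l x) ℤ.*_) ih) (sym (cong barProd (slotItems-≡ k c (l , x) (zip κ ς))))))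
  byCases (no n)     = trans (cong prodℤ (filter-replicate-≢ l x R′ n)) (trans ih (sym (cong barProd (slotItems-≢ c (l , x) (zip κ ς) n))))

blockSigns-consAt : ∀ {j} i bs → j < length bs → blockSigns (consAt j i bs) ≡ cycleSign i * blockSigns bs
blockSigns-consAt {zero}  i (b ∷ bs) h       = R.*-assoc (cycleSign i) _ _
blockSigns-consAt {suc j} i (b ∷ bs) (s≤s h) = trans (cong (∏ cycleSign b *_) (blockSigns-consAt i bs h)) (x∙yz≈y∙xz (∏ cycleSign b) (cycleSign i) _)

blockSigns-distribute : ∀ n c its → length c ≡ length its → InRange n c → blockSigns (distribute n c its) ≡ ∏ cycleSign its
blockSigns-distribute n []          []        e r = go (range 1 n)
  where
  go : ∀ (ks : List ℕ) → blockSigns (map (λ k → slotItems k [] []) ks) ≡ 1ℚ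
  go []       = refl
  go (k ∷ ks) = trans (R.*-identityˡ _) (go ks)
blockSigns-distribute n (zero ∷ c)  (i ∷ its) e r = ⊥-elim (ℕP.n≮0 (proj₁ (range-∈⁻ 1 n (r (here refl)))))
blockSigns-distribute n (suc j ∷ c) (i ∷ its) e r = trans (cong blockSigns (distribute-∷ n c i its (proj₂ (range-∈⁻ 1 n (r (here refl))))))
  (trans (blockSigns-consAt i (distribute n c its) (subst (j <_) (sym (trans (LP.length-map _ (range 1 n)) (length-range 1 n))) (proj₂ (range-∈⁻ 1 n (r (here refl))))))
    (cong (cycleSign i *_) (blockSigns-distribute n c its (ℕP.suc-injective e) (r ∘ there))))

all-odd-shape : ∀ n p → all odd (shape n p) ≡ all oddish (content n p)
all-odd-shape n p = Bool-ext
  (λ t → all-T oddish (content n p) (λ m → oddish⁺ (∈P.∈-map⁻ (α p) m) t))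
  (λ t → oddContent⁻ n p (λ {k} m ne → oddish⁻ (α p k) (T-all oddish (content n p) t (∈P.∈-map⁺ (α p) m)) ne))
  where
  oddish⁻ : ∀ a → T (oddish a) → a ≢ 0 → T (odd a)
  oddish⁻ zero    t n = ⊥-elim (n refl)
  oddish⁻ (suc a) t n = t
  oddish⁺ : ∀ {a} → ∃ (λ k → k ∈ range 1 n × a ≡ α p k) → T (all odd (shape n p)) → T (oddish a)
  oddish⁺ (k , m , refl) t with α p k in e
  ... | zero  = tt
  ... | suc a = subst (T ∘ odd) e (oddContent n p t m (λ z → ℕP.0≢1+n (trans (sym z) e)))

does-T : ∀ {P : Set} (d : Dec P) → T (does d) → P
does-T (yes p) _ = p

T-does : ∀ {P : Set} (d : Dec P) → P → T (does d)
T-does (yes _) _ = tt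
T-does (no n)  p = n p

≡-decℕ : ∀ (p q : List ℕ) → Dec (p ≡ q)
≡-decℕ = LP.≡-dec ℕ._≟_

≡-decℤ : ∀ (p q : List ℤ) → Dec (p ≡ q)
≡-decℤ = LP.≡-dec ℤ._≟_

≟T-∧ : ∀ p p′ σ σ′ τ → does ((p , σ , τ) ≟T (p′ , σ′ , τ)) ≡ does (≡-decℕ p p′) ∧ does (≡-decℤ σ σ′)
≟T-∧ p p′ σ σ′ τ = Bool-ext to from
  where
  to : T (does ((p , σ , τ) ≟T (p′ , σ′ , τ))) → T (does (≡-decℕ p p′) ∧ does (≡-decℤ σ σ′))
  to t with does-T ((p , σ , τ) ≟T (p′ , σ′ , τ)) t
  ... | refl = ∧-intro (T-does (≡-decℕ p p) refl) (T-does (≡-decℤ σ σ) refl)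
  from : T (does (≡-decℕ p p′) ∧ does (≡-decℤ σ σ′)) → T (does ((p , σ , τ) ≟T (p′ , σ′ , τ)))
  from t with does-T (≡-decℕ p p′) (∧-fst t) | does-T (≡-decℤ σ σ′) (∧-snd {does (≡-decℕ p p′)} t)
  ... | refl | refl = T-does ((p , σ , τ) ≟T (p , σ , τ)) refl

ℤtoℚ-if : ∀ b z → ℤtoℚ (if b then z else ℤ.+ 0) ≡ 𝟙 b * ℤtoℚ z
ℤtoℚ-if true  z = sym (R.*-identityˡ _)
ℤtoℚ-if false z = sym (R.zeroˡ _)

module Character (κ : List ℕ) (pκ : Positive κ) where

  n : ℕ
  n = sum κ
  w : ℕ → ℕ
  w = cycPerm κ
  fixedP : List ℕ → ℚ
  fixedP p = 𝟙 (does (≡-decℕ (actTuple 0 w n p) p))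
  fixedS : List ℤ → ℚ
  fixedS σ = 𝟙 (does (≡-decℤ (actTuple (ℤ.+ 0) w n σ) σ))
  signOf : List ℤ → ℚ
  signOf σ = ℤtoℚ (sortSign (map w (negPositions σ)))
  matchingCount : List ℕ → List ℤ → ℚ
  matchingCount p σ = 𝟙 (all odd (shape n p)) * arcs (ℤ.+ 1) (σbar n p σ) 0
  summand : List ℕ → List ℤ → ℚ
  summand p σ = 𝟙 (isPF n p) * (matchingCount p σ * signOf σ)

  opaque
    unfolding _+_
    ring₁ : ∀ a b c d → a * (b * (c * d)) ≡ b * c * (a * d)
    ring₁ = solve-∀ ℚ-ring
    ring₂ : ∀ a b c d e → a * (b * c * (d * e)) ≡ b * (c * (a * (d * e)))
    ring₂ = solve-∀ ℚ-ring
    ring₃ : ∀ a b c d → a * (b * c * d) ≡ a * (b * (c * d))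
    ring₃ = solve-∀ ℚ-ring

  -- The action leaves `τ` alone, so the matchings enter the trace only through their number, and
  -- fixing a basis element means fixing `p` and `σ` separately.
  χ-fixed : ℤtoℚ (χOSh n w) ≡ ∑ (tuples (range 1 n) n) (λ p → fixedP p * ∑ (tuples signs n) (λ σ → fixedS σ * summand p σ))
  χ-fixed = begin
    ℤtoℚ (χOSh n w)
      ≡⟨ ℤtoℚ-sumℤ (OShPf n) _ ⟩
    ∑ (OShPf n) (λ b → ℤtoℚ (value b))
      ≡⟨ trans (∑-filter (isOShPf n) (triples (Pf n) (tuples signs n) (sublists (allPairs n)))) (∑-triples (Pf n) (tuples signs n) (sublists (allPairs n))) ⟩
    ∑ (Pf n) (λ p → ∑ (tuples signs n) (λ σ → ∑ (sublists (allPairs n)) (λ τ → 𝟙 (isOShPf n (p , σ , τ)) * ℤtoℚ (value (p , σ , τ)))))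
      ≡⟨ ∑-cong-∈ (Pf n) (λ p∈ → ∑-cong-∈ (tuples signs n) (λ σ∈ → overMatchings p∈ σ∈)) ⟩
    ∑ (Pf n) (λ p → ∑ (tuples signs n) (λ σ → fixedP p * fixedS σ * (matchingCount p σ * signOf σ)))
      ≡⟨ ∑-filter (isPF n) (tuples (range 1 n) n) ⟩
    ∑ (tuples (range 1 n) n) (λ p → 𝟙 (isPF n p) * ∑ (tuples signs n) (λ σ → fixedP p * fixedS σ * (matchingCount p σ * signOf σ)))
      ≡⟨ ∑-cong (tuples (range 1 n) n) (λ p → trans (sym (∑-*ˡ (𝟙 (isPF n p)) (tuples signs n))) (trans (∑-cong (tuples signs n) (λ σ → ring₂ (𝟙 (isPF n p)) (fixedP p) (fixedS σ) (matchingCount p σ) (signOf σ))) (∑-*ˡ (fixedP p) (tuples signs n)))) ⟩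
    ∑ (tuples (range 1 n) n) (λ p → fixedP p * ∑ (tuples signs n) (λ σ → fixedS σ * summand p σ)) ∎
    where
    value : Triple → ℤ
    value b = let r = act n w b in if does (proj₂ r ≟T b) then proj₁ r else ℤ.+ 0
    overMatchings : ∀ {p σ} → p ∈ Pf n → σ ∈ tuples signs n →
      ∑ (sublists (allPairs n)) (λ τ → 𝟙 (isOShPf n (p , σ , τ)) * ℤtoℚ (value (p , σ , τ))) ≡ fixedP p * fixedS σ * (matchingCount p σ * signOf σ)
    overMatchings {p} {σ} p∈ σ∈ = begin
      ∑ L (λ τ → 𝟙 (isOShPf n (p , σ , τ)) * ℤtoℚ (value (p , σ , τ)))
        ≡⟨ ∑-cong L (λ τ → cong₂ _*_ (isOSh τ) (trans (ℤtoℚ-if (does (proj₂ (act n w (p , σ , τ)) ≟T (p , σ , τ))) (sortSign (map w (negPositions σ)))) (trans (cong (λ b → 𝟙 b * signOf σ) (≟T-∧ (actTuple 0 w n p) p (actTuple (ℤ.+ 0) w n σ) σ τ)) (cong (_* signOf σ) (𝟙-∧ (does (≡-decℕ (actTuple 0 w n p) p)) _))))) ⟩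
      ∑ L (λ τ → 𝟙 (all odd (shape n p)) * 𝟙 (validτ p σ τ) * (fixedP p * fixedS σ * signOf σ))
        ≡⟨ trans (∑-*ʳ _ L) (cong (_* (fixedP p * fixedS σ * signOf σ)) (trans (∑-*ˡ (𝟙 (all odd (shape n p))) L) (cong (𝟙 (all odd (shape n p)) *_) (∑-validτ n p σs)))) ⟩
      matchingCount p σ * (fixedP p * fixedS σ * signOf σ)
        ≡⟨ trans (ring₃ (matchingCount p σ) (fixedP p) (fixedS σ) (signOf σ)) (ring₁ (matchingCount p σ) (fixedP p) (fixedS σ) (signOf σ)) ⟩
      fixedP p * fixedS σ * (matchingCount p σ * signOf σ) ∎
      where
      L : List (List Pair)
      L = sublists (allPairs n)
      σs : All IsSign σ
      σs = All.tabulate (λ m → signs-IsSign (proj₂ (tuples-∈⁻ signs n σ∈) m))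
      isOSh : ∀ τ → 𝟙 (isOShPf n (p , σ , τ)) ≡ 𝟙 (all odd (shape n p)) * 𝟙 (validτ p σ τ)
      isOSh τ = trans (cong 𝟙 (cong₂ (λ a b → a ∧ all odd (shape n p) ∧ b ∧ validτ p σ τ) (T⇒≡ (proj₂ (filterᵇ-∈⁻ (isPF n) (tuples (range 1 n) n) p∈))) (T⇒≡ (ℕP.≡⇒≡ᵇ _ _ (proj₁ (tuples-∈⁻ signs n σ∈))))))
        (𝟙-∧ (all odd (shape n p)) (validτ p σ τ))

  signs-! : Unique signs
  signs-! = ((λ ()) ∷ []) ∷ [] ∷ []

  summand-blocks : ∀ {c ς} → c ∈ tuples (range 1 n) (length κ) → ς ∈ tuples signs (length κ) →
    summand (blocks κ c) (blocks κ ς) ≡ blockWeight (isDyck 0) (λ s → arcs (ℤ.+ 1) s 0) (distribute n c (zip κ ς))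
  summand-blocks {c} {ς} c∈ ς∈ = trans
    (cong₂ _*_ (cong 𝟙 (trans (isPF-isDyck n (blocks κ c) (rc ∘ blocks-∈ κ c) (length-blocks κ c lc)) (cong (isDyck 0) sizes)))
      (cong₂ _*_ (cong₂ _*_ (cong 𝟙 (trans (all-odd-shape n (blocks κ c)) (cong (all oddish) sizes))) (cong (λ s → arcs (ℤ.+ 1) s 0) bars))
                 (trans (sortSign-blocks κ ς pκ lς) (sym (blockSigns-distribute n c (zip κ ς) lz rc)))))
    (cong (𝟙 (isDyck 0 (map size (distribute n c (zip κ ς)))) *_) (R.*-assoc _ _ _))
    where
    lc = proj₁ (tuples-∈⁻ (range 1 n) (length κ) c∈)
    rc : InRange n c
    rc = proj₂ (tuples-∈⁻ (range 1 n) (length κ) c∈)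
    lς = proj₁ (tuples-∈⁻ signs (length κ) ς∈)
    lz : length c ≡ length (zip κ ς)
    lz = trans lc (sym (trans (LP.length-zipWith _,_ κ ς) (trans (cong (length κ ℕ.⊓_) lς) (ℕP.⊓-idem (length κ)))))
    sizes : content n (blocks κ c) ≡ map size (distribute n c (zip κ ς))
    sizes = trans (LP.map-cong (λ k → count-blocks k κ c ς lc lς) (range 1 n)) (LP.map-∘ (range 1 n))
    bars : σbar n (blocks κ c) (blocks κ ς) ≡ map bar (distribute n c (zip κ ς))
    bars = trans (LP.map-cong (λ k → cong₂ (λ a b → if a ≡ᵇ 0 then ℤ.+ 0 else b) (count-blocks k κ c ς lc lς) (barProd-blocks k κ c ς lc lς)) (range 1 n)) (LP.map-∘ (range 1 n))

  -- The trace becomes the sum over slot signs that also arises from the V-expansion, there with the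
  -- factor `ip κ`; `arcSum-T` evaluates both.
  χ-arcs : ℤtoℚ (χOSh n w) ≡ T[ Q₂ ] n 0 κ
  χ-arcs = begin
    ℤtoℚ (χOSh n w)
      ≡⟨ χ-fixed ⟩
    ∑ (tuples (range 1 n) n) (λ p → fixedP p * ∑ (tuples signs n) (λ σ → fixedS σ * summand p σ))
      ≡⟨ ∑-fixed 0 ≡-decℕ κ pκ (range-! 1 n) ⟩
    ∑ X (λ c → ∑ (tuples signs n) (λ σ → fixedS σ * summand (blocks κ c) σ))
      ≡⟨ ∑-cong X (λ c → ∑-fixed (ℤ.+ 0) ≡-decℤ κ pκ signs-!) ⟩
    ∑ X (λ c → ∑ Y (λ ς → summand (blocks κ c) (blocks κ ς)))
      ≡⟨ ∑-cong-∈ X (λ c∈ → ∑-cong-∈ Y (λ ς∈ → summand-blocks c∈ ς∈)) ⟩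
    ∑ X (λ c → ∑ Y (λ ς → G (distribute n c (zip κ ς))))
      ≡⟨ ∑-swap X Y ⟩
    ∑ Y (λ ς → ∑ X (λ c → G (distribute n c (zip κ ς))))
      ≡⟨ ∑-cong-∈ Y (λ {ς} ς∈ → subst (λ m → ∑ (tuples (range 1 n) m) (λ c → G (distribute n c (zip κ ς))) ≡ distributions n (zip κ ς) G) (lz (proj₁ (tuples-∈⁻ signs (length κ) ς∈))) (∑-distribute n (zip κ ς) G)) ⟩
    ∑ Y (λ ς → distributions n (zip κ ς) G)
      ≡⟨ signedSum-tuples (λ its → distributions n its G) κ ⟩
    signedSum (λ its → distributions n its G) κ
      ≡⟨ signedSum-distributions n 0 (λ s → arcs (ℤ.+ 1) s 0) pκ ⟩
    arcSum (ℤ.+ 1) n 0 0 κ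
      ≡⟨ arcSum-T n pκ ⟩
    T[ Q₂ ] n 0 κ ∎
    where
    X : List (List ℕ)
    X = tuples (range 1 n) (length κ)
    Y : List (List ℤ)
    Y = tuples signs (length κ)
    G : List (List Item) → ℚ
    G = blockWeight (isDyck 0) (λ s → arcs (ℤ.+ 1) s 0)
    lz : ∀ {ς : List ℤ} → length ς ≡ length κ → length (zip κ ς) ≡ length κ
    lz {ς} e = trans (LP.length-zipWith _,_ κ ς) (trans (cong (length κ ℕ.⊓_) e) (ℕP.⊓-idem (length κ)))

-- Partitions

Decreasing : List ℕ → Set
Decreasing = AllPairs (λ x y → y ≤ x)

insertDec-≥ : ∀ x {ys} → All (_≤ x) ys → insertDec x ys ≡ x ∷ ys
insertDec-≥ x []       = refl
insertDec-≥ x (p ∷ ps) rewrite T⇒≡ (ℕP.≤⇒≤ᵇ p) = refl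

sortDec-Decreasing : ∀ {κ} → Decreasing κ → sortDec κ ≡ κ
sortDec-Decreasing []              = refl
sortDec-Decreasing {x ∷ κ} (p ∷ d) = trans (cong (insertDec x) (sortDec-Decreasing d)) (insertDec-≥ x p)

insertDec-All : ∀ {P : ℕ → Set} x {ys} → P x → All P ys → All P (insertDec x ys)
insertDec-All x p []             = p ∷ []
insertDec-All x {y ∷ ys} p (q ∷ qs) with y ≤ᵇ x
... | true  = p ∷ q ∷ qs
... | false = q ∷ insertDec-All x p qs

insertDec-Decreasing : ∀ x {ys} → Decreasing ys → Decreasing (insertDec x ys)
insertDec-Decreasing x []      = [] ∷ []
insertDec-Decreasing x {y ∷ ys} (p ∷ d) with y ≤ᵇ x in e
... | true  = (y≤x ∷ All.map (λ q → ℕP.≤-trans q y≤x) p) ∷ p ∷ d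
  where
  y≤x : y ≤ x
  y≤x = ℕP.≤ᵇ⇒≤ y x (≡⇒T e)
... | false = insertDec-All x (ℕP.<⇒≤ (ℕP.≰⇒> (λ q → subst T e (ℕP.≤⇒≤ᵇ q)))) p ∷ insertDec-Decreasing x d

Decreasing-sortDec : ∀ xs → Decreasing (sortDec xs)
Decreasing-sortDec []       = []
Decreasing-sortDec (x ∷ xs) = insertDec-Decreasing x (Decreasing-sortDec xs)

parts : ℕ → ℕ → List ℕ
parts n m = filterᵇ (λ k → k ≤ᵇ m) (range 1 n)

partsF-∈⁻ : ∀ f n m {κ} → κ ∈ partsF f n m → Decreasing κ × All (_≤ m) κ
partsF-∈⁻ f       zero    m (here refl) = [] , []
partsF-∈⁻ (suc f) (suc n) m κ∈ with concatMap-∈⁻ _ (parts (suc n) m) κ∈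
... | k , k∈ , l with ∈P.∈-map⁻ (k ∷_) l
...   | μ , μ∈ , refl with partsF-∈⁻ f (suc n ∸ k) k μ∈
...     | d , b = b ∷ d , k≤m ∷ All.map (λ q → ℕP.≤-trans q k≤m) b
  where
  k≤m : k ≤ m
  k≤m = ℕP.≤ᵇ⇒≤ k m (proj₂ (filterᵇ-∈⁻ (λ k → k ≤ᵇ m) (range 1 (suc n)) k∈))

-- Every step takes away a part of size at least 1, so fuel `n` is enough to reach 0.
partsF-∈⁺ : ∀ f n m {κ} → n ≤ f → Positive κ → Decreasing κ → All (_≤ m) κ → sum κ ≡ n → κ ∈ partsF f n m
partsF-∈⁺ f       zero    m {[]}        h p d b e = here refl
partsF-∈⁺ f       zero    m {suc k ∷ κ} h p d b ()
partsF-∈⁺ f       zero    m {zero ∷ κ}  h (() ∷ _) d b e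
partsF-∈⁺ (suc f) (suc n) m {zero ∷ κ}  h (() ∷ _) d b e
partsF-∈⁺ (suc f) (suc n) m {suc k ∷ κ} (s≤s h) (_ ∷ p) (c ∷ d) (q ∷ b) e =
  concatMap-∈⁺ _ (filterᵇ-∈⁺ (λ k → k ≤ᵇ m) (range-∈⁺ (s≤s z≤n) (ℕP.≤-trans (ℕP.m≤m+n (suc k) (sum κ)) (ℕP.≤-reflexive e))) (ℕP.≤⇒≤ᵇ q))
    (∈P.∈-map⁺ (suc k ∷_) (partsF-∈⁺ f (n ∸ k) (suc k) (ℕP.≤-trans (ℕP.m∸n≤m n k) h) p d c (sym (trans (cong (_∸ k) (sym (ℕP.suc-injective e))) (ℕP.m+n∸m≡n k (sum κ))))))

partsF-! : ∀ f n m → Unique (partsF f n m)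
partsF-! zero    zero    m = [] ∷ []
partsF-! (suc f) zero    m = [] ∷ []
partsF-! zero    (suc n) m = []
partsF-! (suc f) (suc n) m = concatMap-! _ (filterᵇ-! (λ k → k ≤ᵇ m) (range-! 1 (suc n))) (λ k → UP.map⁺ LP.∷-injectiveʳ (partsF-! f (suc n ∸ k) k)) key
  where
  key : ∀ {k l} {μ : List ℕ} → μ ∈ map (k ∷_) (partsF f (suc n ∸ k) k) → μ ∈ map (l ∷_) (partsF f (suc n ∸ l) l) → k ≡ l
  key a b with ∈P.∈-map⁻ _ a | ∈P.∈-map⁻ _ b
  ... | _ , _ , refl | _ , _ , e = LP.∷-injectiveˡ e

partitions-∈⁺ : ∀ {κ} → Positive κ → Decreasing κ → κ ∈ partitions (sum κ)
partitions-∈⁺ {κ} p d = partsF-∈⁺ (sum κ) (sum κ) (sum κ) ℕP.≤-refl p d (All.tabulate (sum-∈ κ)) refl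

partsF-Positive : ∀ f n m {κ} → κ ∈ partsF f n m → Positive κ × (sum κ ≡ n)
partsF-Positive f       zero    m (here refl) = [] , refl
partsF-Positive (suc f) (suc n) m κ∈ with concatMap-∈⁻ _ (parts (suc n) m) κ∈
... | k , k∈ , l with ∈P.∈-map⁻ (k ∷_) l
...   | μ , μ∈ , refl with partsF-Positive f (suc n ∸ k) k μ∈ | range-∈⁻ 1 (suc n) (proj₁ (filterᵇ-∈⁻ (λ k → k ≤ᵇ m) (range 1 (suc n)) k∈))
...     | p , e | 1≤k , k≤n = 1≤k ∷ p , trans (cong (k ℕ.+_) e) (ℕP.m+[n∸m]≡n k≤n)

-- Orders of centralizers

prodℕ : List ℕ → ℕ
prodℕ = foldr ℕ._*_ 1

prodℕ-update : ∀ {f g : ℕ → ℕ} c {k} ks → Unique ks → k ∈ ks → f k ≡ c ℕ.* g k → (∀ i → i ≢ k → f i ≡ g i) → prodℕ (map f ks) ≡ c ℕ.* prodℕ (map g ks)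
prodℕ-update {f} {g} c {k} (.k ∷ ks) (k∉ ∷ u) (here refl) e ne =
  trans (cong₂ ℕ._*_ e (cong prodℕ (LP.map-cong-local (All.tabulate (λ {i} m → ne i (λ { refl → All.lookup k∉ m refl })))))) (ℕP.*-assoc c (g k) _)
prodℕ-update {f} {g} c {k} (i ∷ ks) (i∉ ∷ u) (there m) e ne =
  trans (cong₂ ℕ._*_ (ne i (All.lookup i∉ m)) (prodℕ-update c ks u m e ne)) (trans (sym (ℕP.*-assoc (g i) c _)) (trans (cong (ℕ._* prodℕ (map g ks)) (ℕP.*-comm (g i) c)) (ℕP.*-assoc c (g i) _)))

zFactor : List ℕ → ℕ → ℕ
zFactor κ i = (i ^ count i κ) ℕ.* (count i κ) !

-- A new part `k` multiplies the factor of `k` by `k` times its new multiplicity and leaves the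
-- other factors unchanged.
zFactors : ∀ N κ → Positive κ → All (_≤ N) κ → prodℕ (map (zFactor κ) (range 1 N)) ≡ fac κ ℕ.* prodℕ κ
zFactors N []      _ _ = go (range 1 N)
  where
  go : ∀ ks → prodℕ (map (zFactor []) ks) ≡ 1
  go []       = refl
  go (k ∷ ks) = trans (ℕP.+-identityʳ _) (go ks)
zFactors N (k ∷ κ) (1≤k ∷ p) (k≤N ∷ b) = begin
  prodℕ (map (zFactor (k ∷ κ)) (range 1 N))         ≡⟨ prodℕ-update (k ℕ.* suc (count k κ)) (range 1 N) (range-! 1 N) (range-∈⁺ 1≤k k≤N) atk other ⟩
  k ℕ.* suc (count k κ) ℕ.* prodℕ (map (zFactor κ) (range 1 N)) ≡⟨ cong (k ℕ.* suc (count k κ) ℕ.*_) (zFactors N κ p b) ⟩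
  k ℕ.* suc (count k κ) ℕ.* (fac κ ℕ.* prodℕ κ)     ≡⟨ regroup k (suc (count k κ)) (fac κ) (prodℕ κ) ⟩
  fac (k ∷ κ) ℕ.* prodℕ (k ∷ κ)                     ∎
  where
  regroup : ∀ a b c d → a ℕ.* b ℕ.* (c ℕ.* d) ≡ b ℕ.* c ℕ.* (a ℕ.* d)
  regroup = solveℕ-∀
  atk : zFactor (k ∷ κ) k ≡ k ℕ.* suc (count k κ) ℕ.* zFactor κ k
  atk rewrite count-self k κ = factor k (suc (count k κ)) (k ^ count k κ) (count k κ !)
    where
    factor : ∀ a b c d → a ℕ.* c ℕ.* (b ℕ.* d) ≡ a ℕ.* b ℕ.* (c ℕ.* d)
    factor = solveℕ-∀
  other : ∀ i → i ≢ k → zFactor (k ∷ κ) i ≡ zFactor κ i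
  other i ne = cong (λ c → (i ^ c) ℕ.* c !) (trans (count-∷ i k κ) (cong (λ b → (if b then 1 else 0) ℕ.+ count i κ) (≡ᵇ-false ne)))

zλ-fac : ∀ κ → Positive κ → zλ κ ≡ fac κ ℕ.* prodℕ κ
zλ-fac κ p = zFactors (sum κ) κ p (All.tabulate (sum-∈ κ))

prodℕ-ip : ∀ κ → Positive κ → ℕtoℚ (prodℕ κ) * ip κ ≡ 1ℚ
prodℕ-ip []          _       = R.*-identityˡ 1ℚ
prodℕ-ip (suc k ∷ κ) (_ ∷ p) = begin
  ℕtoℚ (suc k ℕ.* prodℕ κ) * (inv (suc k) * ip κ)             ≡⟨ cong (_* (inv (suc k) * ip κ)) (ℕtoℚ-* (suc k) (prodℕ κ)) ⟩
  ℕtoℚ (suc k) * ℕtoℚ (prodℕ κ) * (inv (suc k) * ip κ)        ≡⟨ regroup (ℕtoℚ (suc k)) (ℕtoℚ (prodℕ κ)) (inv (suc k)) (ip κ) ⟩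
  inv (suc k) * ℕtoℚ (suc k) * (ℕtoℚ (prodℕ κ) * ip κ)        ≡⟨ cong₂ _*_ (inv-inverseˡ k) (prodℕ-ip κ p) ⟩
  1ℚ * 1ℚ                                                     ≡⟨ R.*-identityˡ 1ℚ ⟩
  1ℚ                                                          ∎
  where
  opaque
    unfolding _+_
    regroup : ∀ a b c d → a * b * (c * d) ≡ c * a * (b * d)
    regroup = solve-∀ ℚ-ring

prodℕ-suc : ∀ κ → Positive κ → ∃ λ m → prodℕ κ ≡ suc m
prodℕ-suc []          _       = 0 , refl
prodℕ-suc (suc k ∷ κ) (_ ∷ p) with prodℕ κ | prodℕ-suc κ p
... | _ | m , refl = _ , refl

-- As `z_κ` is `fac κ` times the product of the parts, the normalisation in the Frobenius character
-- and the factor `fac κ` of the pairing leave exactly `ip κ`.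
zλ-ip : ∀ κ → Positive κ → inv (zλ κ) * ℕtoℚ (fac κ) ≡ ip κ
zλ-ip κ p with fac-suc κ | prodℕ-suc κ p
... | a , ea | b , eb = subst (λ z → inv z * ℕtoℚ (fac κ) ≡ ip κ) (sym ez) (sym (inv-* (b ℕ.+ a ℕ.* suc b) (subst (λ z → ℕtoℚ z * ip κ ≡ ℕtoℚ (fac κ)) ez product)))
  where
  ez : zλ κ ≡ suc (b ℕ.+ a ℕ.* suc b)
  ez = trans (zλ-fac κ p) (cong₂ ℕ._*_ ea eb)
  product : ℕtoℚ (zλ κ) * ip κ ≡ ℕtoℚ (fac κ)
  product = begin
    ℕtoℚ (zλ κ) * ip κ                            ≡⟨ cong (λ z → ℕtoℚ z * ip κ) (zλ-fac κ p) ⟩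
    ℕtoℚ (fac κ ℕ.* prodℕ κ) * ip κ               ≡⟨ cong (_* ip κ) (ℕtoℚ-* (fac κ) (prodℕ κ)) ⟩
    ℕtoℚ (fac κ) * ℕtoℚ (prodℕ κ) * ip κ          ≡⟨ R.*-assoc _ _ _ ⟩
    ℕtoℚ (fac κ) * (ℕtoℚ (prodℕ κ) * ip κ)        ≡⟨ cong (ℕtoℚ (fac κ) *_) (prodℕ-ip κ p) ⟩
    ℕtoℚ (fac κ) * 1ℚ                             ≡⟨ R.*-identityʳ _ ⟩
    ℕtoℚ (fac κ)                                  ∎

-- The Frobenius character

⟨pλ⟩ : ∀ μ κ → ⟨ pλ μ ∣ κ ⟩ ≡ matchings μ κ
⟨pλ⟩ μ κ = trans (R.+-identityʳ _) (R.*-identityˡ _)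

matchings-partition : ∀ {μ κ} → Decreasing μ → Decreasing κ → μ ≢ κ → matchings μ κ ≡ 0ℚ
matchings-partition {μ} {κ} d d′ ne = matchings-¬↭ κ (λ p → ne (trans (sym (sortDec-Decreasing d)) (trans (sortDec-↭⇒≡ p) (sortDec-Decreasing d′))))

-- Partitions are listed decreasingly, so among the `p_μ` only `μ = κ` pairs nontrivially with a
-- decreasing `κ`. In the wrong degree, or if `κ` has a part 0, both sides vanish.
⟨FrobOSh⟩ : ∀ n {κ} → Decreasing κ → ⟨ FrobOSh n ∣ κ ⟩ ≡ ip κ * T[ Q₂ ] n 0 κ
⟨FrobOSh⟩ n {κ} d = trans (⟨sumS⟩ (partitions n) F κ) (trans (∑-cong (partitions n) term) (byCases (All.all? (1 ℕP.≤?_) κ) (sum κ ℕ.≟ n)))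
  where
  F : List ℕ → Sym
  F μ = scaleS (ℤtoℚ (χOSh n (cycPerm μ)) ℚ.* inv (zλ μ)) (pλ μ)
  W : List ℕ → ℚ
  W μ = ℤtoℚ (χOSh n (cycPerm μ)) * inv (zλ μ) * matchings μ κ
  term : ∀ μ → ⟨ F μ ∣ κ ⟩ ≡ W μ
  term μ = trans (⟨scaleS⟩ (ℤtoℚ (χOSh n (cycPerm μ)) ℚ.* inv (zλ μ)) (pλ μ) κ) (cong₂ _*_ (*-ℚ (ℤtoℚ (χOSh n (cycPerm μ))) (inv (zλ μ))) (⟨pλ⟩ μ κ))
  other : ∀ {μ} → μ ∈ partitions n → μ ≢ κ → W μ ≡ 0ℚ
  other m ne = trans (cong (_ *_) (matchings-partition (proj₁ (partsF-∈⁻ n n n m)) d ne)) (R.zeroʳ _)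
  byCases : Dec (Positive κ) → Dec (sum κ ≡ n) → ∑ (partitions n) W ≡ ip κ * T[ Q₂ ] n 0 κ
  byCases (yes p) (yes refl) = begin
    ∑ (partitions n) W                                                                ≡⟨ ∑-singleton (partsF-! n n n) (partitions-∈⁺ p d) other ⟩
    ℤtoℚ (χOSh n (cycPerm κ)) * inv (zλ κ) * matchings κ κ                            ≡⟨ cong (ℤtoℚ (χOSh n (cycPerm κ)) * inv (zλ κ) *_) (matchings-↭ κ ↭-refl) ⟩
    ℤtoℚ (χOSh n (cycPerm κ)) * inv (zλ κ) * ℕtoℚ (fac κ)                             ≡⟨ R.*-assoc _ _ _ ⟩
    ℤtoℚ (χOSh n (cycPerm κ)) * (inv (zλ κ) * ℕtoℚ (fac κ))                           ≡⟨ cong₂ _*_ (Character.χ-arcs κ p) (zλ-ip κ p) ⟩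
    T[ Q₂ ] n 0 κ * ip κ                                                              ≡⟨ R.*-comm _ _ ⟩
    ip κ * T[ Q₂ ] n 0 κ                                                              ∎
  byCases (yes p) (no ne) = trans (∑-zero-∈ (partitions n) (λ m → other m (λ { refl → ne (proj₂ (partsF-Positive n n n m)) })))
    (sym (trans (cong (ip κ *_) (trans (T-homogeneous Q₂ n 0 κ) (trans (cong (λ b → 𝟙 b * T[ Q₂ ] n 0 κ) (≡ᵇ-false ne)) (R.zeroˡ _)))) (R.zeroʳ _)))
  byCases (no np) _ = trans (∑-zero-∈ (partitions n) (λ m → other m (λ { refl → np (proj₁ (partsF-Positive n n n m)) })))
    (sym (trans (ip-*-cong κ {y = 0ℚ} (λ p → ⊥-elim (np p))) (R.zeroʳ _)))

FrobOSh≈SHsym : ∀ n → FrobOSh n ≈S SHsym n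
FrobOSh≈SHsym n = ⟨⟩⇒≈S {FrobOSh n} {SHsym n} (λ κ → trans (⟨FrobOSh⟩ n (Decreasing-sortDec κ)) (sym (⟨SHsym⟩ n (sortDec κ))))

theorem1p2 : (n : ℕ) → 1 ≤ n → (FrobOSh n ≈S SHsym n) × (SHsym n ≈S VSum n)
theorem1p2 n _ = FrobOSh≈SHsym n , SHsym≈VSum n
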